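{- There is a universal constant $\kappa>0$ such that for all finite sets $\mathcal X,\mathcal Y$, every $f:\mathcal X\times\mathcal Y\to\{0,1\}$, every integer $n\ge1$ and every $C>1/\kappa$: if $\mathsf{adv}(C,f)<\kappa$, then $$\mathsf{suc}\Big(\frac{\kappa C\sqrt n}{\log(Cn)},\,f^{n}\Big)<\exp(-\kappa n).$$
   Context: We write $xy$ for $(x,y)$; logs are base 2. $f^n:\mathcal X^n\times\mathcal Y^n\to\{0,1\}^n$ is $f^n(xy)=(f(x_1y_1),\dots,f(x_ny_n))$. A randomized two-party communication protocol $\pi$: Alice receives $x$, Bob receives $y$, they have public and private randomness and exchange bits; the output $\pi(xy)$ is determined by the transcript together with the public randomness. $\|\pi\|$ is the maximum number of bits exchanged (public randomness not counted). For a Boolean function $g$, $$\mathsf{adv}(C,g)=\sup_{\|\pi\|\le C}\inf_{xy}\mathbb E\big[(-1)^{\pi(xy)+g(xy)}\big],$$ and for any function $g$, $$\mathsf{suc}(C,g)=\sup_{\|\pi\|\le C}\inf_{xy}\Pr[\pi(xy)=g(xy)],$$ where the infima are over all inputs and expectation/probability is over the randomness of $\pi$. -}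

module Defs where

open import Data.Bool.Base using (Bool; true; false; if_then_else_)
import Data.Bool.Properties as Bool
open import Data.Fin.Base using (Fin)
open import Data.Integer.Base as ℤ using (+_; +[1+_])
import Data.Integer.Properties as ℤ
open import Data.Nat.Base as ℕ using (ℕ; zero; suc; z≤n; s≤s)
import Data.Nat.Properties as ℕ
import Data.Nat.Coprimality as Coprime
open import Data.Product.Base using (Σ-syntax; ∃; _×_; _,_; proj₁; proj₂)
open import Data.Rational.Base as ℚ using (ℚ; mkℚ; 0ℚ; 1ℚ; ½; ∣_∣)
import Data.Rational.Properties as ℚ
import Data.Rational.Solver as ℚSolver
open import Data.Sum.Base using (_⊎_; inj₁; inj₂)
open import Data.Vec.Base using (Vec; zipWith)
open import Data.Vec.Properties using (≡-dec)
import Data.Vec.Functional as Tuple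
open import Relation.Binary.Definitions using (DecidableEquality)
open import Relation.Binary.PropositionalEquality
  using (_≡_; refl; sym; trans; cong; cong₂; subst)
open import Relation.Nullary.Decidable.Core using (⌊_⌋)
open import Relation.Nullary.Negation.Core using (¬_)

------------------------------------------------------------------------
-- Auxiliary facts about rationals

module Rational where
  open import Data.Rational.Base
  open import Data.Rational.Properties
  open ≤-Reasoning
  open ℚSolver.+-*-Solver

  ι : ℕ → ℚ
  ι n = + n / 1

  ι≡mkℚ : ∀ n → ι n ≡ mkℚ (+ n) 0 (Coprime.sym (Coprime.1-coprimeTo n))
  ι≡mkℚ n = normalize-coprime (Coprime.sym (Coprime.1-coprimeTo n))

  recip : ℕ → ℚ
  recip k = + 1 / suc k

  abstract

    recip≡mkℚ : ∀ k → recip k ≡ mkℚ (+ 1) k (Coprime.1-coprimeTo (suc k))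
    recip≡mkℚ k = normalize-coprime (Coprime.1-coprimeTo (suc k))

    recip*ι : ∀ k → recip k * ι (suc k) ≡ 1ℚ
    recip*ι k rewrite recip≡mkℚ k | ι≡mkℚ (suc k) =
      *-inverseˡ (mkℚ +[1+ k ] 0 (Coprime.sym (Coprime.1-coprimeTo (suc k))))

    ι-suc : ∀ n → ι (suc n) ≡ 1ℚ + ι n
    ι-suc n = sym (trans (cong (λ z → 1ℚ + z) (ι≡mkℚ n))
                         (cong (λ i → i / 1) (cong (λ i → + 1 ℤ.+ i) (ℤ.*-identityʳ (+ n)))))

    0≤recip : ∀ k → 0ℚ ≤ recip k
    0≤recip k = nonNegative⁻¹ (recip k) {{normalize-nonNeg 1 (suc k)}}

    0≤ι : ∀ k → 0ℚ ≤ ι k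
    0≤ι k = nonNegative⁻¹ (ι k) {{normalize-nonNeg k 1}}

    ι-≤-suc : ∀ n → ι n ≤ ι (suc n)
    ι-≤-suc n = begin
      ι n        ≡⟨ +-identityˡ (ι n) ⟨
      0ℚ + ι n   ≤⟨ +-monoˡ-≤ (ι n) (nonNegative⁻¹ 1ℚ) ⟩
      1ℚ + ι n   ≡⟨ ι-suc n ⟨
      ι (suc n)  ∎

    monotone : (u : ℕ → ℚ) → (∀ n → u n ≤ u (suc n)) → ∀ {m n} → m ℕ.≤ n → u m ≤ u n
    monotone u step m≤n = go (ℕ.≤⇒≤′ m≤n)
      where
      go : ∀ {m n} → m ℕ.≤′ n → u m ≤ u n
      go ℕ.≤′-refl = ≤-refl
      go (ℕ.≤′-step p) = ≤-trans (go p) (step _)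

    archimedean : ∀ p → Σ[ n ∈ ℕ ] p ≤ ι n
    archimedean p@(mkℚ i d _) = ℤ.∣ i ∣ , subst (p ≤_) (sym (ι≡mkℚ ℤ.∣ i ∣))
      (*≤* (ℤ.≤-trans (ℤ.≤-reflexive (ℤ.*-identityʳ i))
           (ℤ.≤-trans (i≤∣i∣ i)
           (ℤ.≤-trans (ℤ.+≤+ (ℕ.m≤m*n ℤ.∣ i ∣ (suc d)))
           (ℤ.≤-reflexive (ℤ.pos-* ℤ.∣ i ∣ (suc d)))))))
      where
      i≤∣i∣ : ∀ i → i ℤ.≤ + ℤ.∣ i ∣
      i≤∣i∣ (+ n) = ℤ.≤-refl
      i≤∣i∣ ℤ.-[1+ n ] = ℤ.-≤+

    *-mono : ∀ {a b c d} → 0ℚ ≤ a → 0ℚ ≤ d → a ≤ b → c ≤ d → a * c ≤ b * d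
    *-mono {a} {b} {c} {d} 0≤a 0≤d a≤b c≤d =
      ≤-trans (*-monoˡ-≤-nonNeg a {{nonNegative 0≤a}} c≤d)
              (*-monoʳ-≤-nonNeg d {{nonNegative 0≤d}} a≤b)

    0≤* : ∀ {a b} → 0ℚ ≤ a → 0ℚ ≤ b → 0ℚ ≤ a * b
    0≤* {a} {b} 0≤a 0≤b =
      nonNegative⁻¹ (a * b) {{nonNeg*nonNeg⇒nonNeg a {{nonNegative 0≤a}} b {{nonNegative 0≤b}}}}

    0<* : ∀ {a b} → 0ℚ < a → 0ℚ < b → 0ℚ < a * b
    0<* {a} {b} 0<a 0<b =
      positive⁻¹ (a * b) {{pos*pos⇒pos a {{positive 0<a}} b {{positive 0<b}}}}

    0<½ : 0ℚ < ½
    0<½ = positive⁻¹ ½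

    half : ∀ ε → ½ * ε + ½ * ε ≡ ε
    half ε = trans (sym (*-distribʳ-+ ε ½ ½)) (*-identityˡ ε)

    triangle : ∀ p q r → ∣ p - r ∣ ≤ ∣ p - q ∣ + ∣ q - r ∣
    triangle p q r = subst (λ z → ∣ z ∣ ≤ ∣ p - q ∣ + ∣ q - r ∣)
      (solve 3 (λ p q r → (p :- q) :+ (q :- r) := p :- r) refl p q r)
      (∣p+q∣≤∣p∣+∣q∣ (p - q) (q - r))

    ∣-∣-comm : ∀ p q → ∣ p - q ∣ ≡ ∣ q - p ∣
    ∣-∣-comm p q = trans (sym (∣-p∣≡∣p∣ (p - q)))
      (cong ∣_∣ (solve 2 (λ p q → :- (p :- q) := q :- p) refl p q))

    -- given K ≥ 0 and ε > 0, some δ > 0 satisfies K δ ≤ ε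
    divide : ∀ {K ε} → 0ℚ ≤ K → 0ℚ < ε → Σ[ δ ∈ ℚ ] 0ℚ < δ × K * δ ≤ ε
    divide {K} {ε} 0≤K 0<ε = ε * 1/K⁺ , 0<* 0<ε 0<1/K⁺ , (begin
      K * (ε * 1/K⁺)    ≤⟨ *-monoʳ-≤-nonNeg (ε * 1/K⁺) {{nonNegative (<⇒≤ (0<* 0<ε 0<1/K⁺))}} K≤K⁺ ⟩
      K⁺ * (ε * 1/K⁺)   ≡⟨ solve 3 (λ k e r → k :* (e :* r) := e :* (k :* r)) refl K⁺ ε 1/K⁺ ⟩
      ε * (K⁺ * 1/K⁺)   ≡⟨ cong (ε *_) (*-inverseʳ K⁺) ⟩
      ε * 1ℚ            ≡⟨ *-identityʳ ε ⟩
      ε                 ∎)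
      where
      K⁺ : ℚ
      K⁺ = K + 1ℚ
      instance
        K⁺-pos : Positive K⁺
        K⁺-pos = nonNeg+pos⇒pos K {{nonNegative 0≤K}} 1ℚ
        K⁺-nonZero : NonZero K⁺
        K⁺-nonZero = pos⇒nonZero K⁺
      1/K⁺ : ℚ
      1/K⁺ = 1/ K⁺
      0<1/K⁺ : 0ℚ < 1/K⁺
      0<1/K⁺ = positive⁻¹ 1/K⁺ {{1/pos⇒pos K⁺}}
      K≤K⁺ : K ≤ K⁺
      K≤K⁺ = subst (_≤ K⁺) (+-identityʳ K) (+-monoʳ-≤ K (nonNegative⁻¹ 1ℚ))

open Rational using (ι; recip)

------------------------------------------------------------------------
-- Real numbers: Cauchy sequences of rationals

record ℝ : Set where
  constructor mkℝ
  field
    seq    : ℕ → ℚ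
    cauchy : ∀ ε → 0ℚ ℚ.< ε →
             Σ[ N ∈ ℕ ] ∀ m n → N ℕ.≤ m → N ℕ.≤ n → ∣ seq m ℚ.- seq n ∣ ℚ.≤ ε

open ℝ public

module Bounds where
  open import Data.Rational.Base
  open import Data.Rational.Properties
  open ≤-Reasoning
  open ℚSolver.+-*-Solver
  open Rational

  abstract

    initial-bound : ∀ (u : ℕ → ℚ) N → Σ[ B ∈ ℚ ] (∀ n → n ℕ.≤ N → ∣ u n ∣ ≤ B)
    initial-bound u zero = ∣ u 0 ∣ , λ { zero z≤n → ≤-refl }
    initial-bound u (suc N) with initial-bound u N
    ... | B , b = B ⊔ ∣ u (suc N) ∣ , λ n n≤ → go n (ℕ.m≤n⇒m<n∨m≡n n≤)
      where
      go : ∀ n → n ℕ.< suc N ⊎ n ≡ suc N → ∣ u n ∣ ≤ B ⊔ ∣ u (suc N) ∣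
      go n (inj₁ (s≤s n≤N)) = ≤-trans (b n n≤N) (p≤p⊔q B _)
      go n (inj₂ refl)      = p≤q⊔p B _

    bound : ∀ x → Σ[ B ∈ ℚ ] 0ℚ ≤ B × (∀ n → ∣ seq x n ∣ ≤ B)
    bound x with cauchy x 1ℚ (positive⁻¹ 1ℚ)
    ... | N , c with initial-bound (seq x) N
    ... | B , b = B + 1ℚ , ≤-trans (0≤∣p∣ (seq x 0)) (all 0) , all
      where
      B≤B+1 : B ≤ B + 1ℚ
      B≤B+1 = subst (_≤ B + 1ℚ) (+-identityʳ B) (+-monoʳ-≤ B (nonNegative⁻¹ 1ℚ))
      all : ∀ n → ∣ seq x n ∣ ≤ B + 1ℚ
      all n with ℕ.≤-total n N
      ... | inj₁ n≤N = ≤-trans (b n n≤N) B≤B+1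
      ... | inj₂ N≤n = begin
        ∣ seq x n ∣                              ≡⟨ cong ∣_∣ (solve 2 (λ p q → p := q :+ (p :- q)) refl (seq x n) (seq x N)) ⟩
        ∣ seq x N + (seq x n - seq x N) ∣        ≤⟨ ∣p+q∣≤∣p∣+∣q∣ (seq x N) (seq x n - seq x N) ⟩
        ∣ seq x N ∣ + ∣ seq x n - seq x N ∣      ≤⟨ +-mono-≤ (b N ℕ.≤-refl) (c n N N≤n ℕ.≤-refl) ⟩
        B + 1ℚ                                   ∎

    -- a sequence whose increments are dominated by those of x and y is Cauchy
    dominated : ∀ (x y : ℝ) (u : ℕ → ℚ) K L → 0ℚ ≤ K → 0ℚ ≤ L → (N₀ : ℕ) →
      (∀ m n → N₀ ℕ.≤ m → N₀ ℕ.≤ n →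
         ∣ u m - u n ∣ ≤ K * ∣ seq x m - seq x n ∣ + L * ∣ seq y m - seq y n ∣) →
      ∀ ε → 0ℚ < ε → Σ[ N ∈ ℕ ] ∀ m n → N ℕ.≤ m → N ℕ.≤ n → ∣ u m - u n ∣ ≤ ε
    dominated x y u K L 0≤K 0≤L N₀ h ε 0<ε
      = N₀ ℕ.⊔ (N₁ ℕ.⊔ N₂) , λ m n pm pn → begin
        ∣ u m - u n ∣                                        ≤⟨ h m n (le₀ pm) (le₀ pn) ⟩
        K * ∣ seq x m - seq x n ∣ + L * ∣ seq y m - seq y n ∣
          ≤⟨ +-mono-≤ (*-monoˡ-≤-nonNeg K {{nonNegative 0≤K}} (proj₂ cx m n (le₁ pm) (le₁ pn)))
                      (*-monoˡ-≤-nonNeg L {{nonNegative 0≤L}} (proj₂ cy m n (le₂ pm) (le₂ pn))) ⟩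
        K * proj₁ dx + L * proj₁ dy                          ≤⟨ +-mono-≤ (proj₂ (proj₂ dx)) (proj₂ (proj₂ dy)) ⟩
        ½ * ε + ½ * ε                                        ≡⟨ half ε ⟩
        ε                                                    ∎
      where
      dx : Σ[ δ ∈ ℚ ] 0ℚ < δ × K * δ ≤ ½ * ε
      dx = divide 0≤K (0<* 0<½ 0<ε)
      dy : Σ[ δ ∈ ℚ ] 0ℚ < δ × L * δ ≤ ½ * ε
      dy = divide 0≤L (0<* 0<½ 0<ε)
      cx : Σ[ N ∈ ℕ ] ∀ m n → N ℕ.≤ m → N ℕ.≤ n → ∣ seq x m - seq x n ∣ ≤ proj₁ dx
      cx = cauchy x (proj₁ dx) (proj₁ (proj₂ dx))
      cy : Σ[ N ∈ ℕ ] ∀ m n → N ℕ.≤ m → N ℕ.≤ n → ∣ seq y m - seq y n ∣ ≤ proj₁ dy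
      cy = cauchy y (proj₁ dy) (proj₁ (proj₂ dy))
      N₁ N₂ : ℕ
      N₁ = proj₁ cx
      N₂ = proj₁ cy
      le₀ : ∀ {k} → N₀ ℕ.⊔ (N₁ ℕ.⊔ N₂) ℕ.≤ k → N₀ ℕ.≤ k
      le₀ = ℕ.≤-trans (ℕ.m≤m⊔n N₀ _)
      le₁ : ∀ {k} → N₀ ℕ.⊔ (N₁ ℕ.⊔ N₂) ℕ.≤ k → N₁ ℕ.≤ k
      le₁ p = ℕ.≤-trans (ℕ.m≤m⊔n N₁ N₂) (ℕ.≤-trans (ℕ.m≤n⊔m N₀ _) p)
      le₂ : ∀ {k} → N₀ ℕ.⊔ (N₁ ℕ.⊔ N₂) ℕ.≤ k → N₂ ℕ.≤ k
      le₂ p = ℕ.≤-trans (ℕ.m≤n⊔m N₁ N₂) (ℕ.≤-trans (ℕ.m≤n⊔m N₀ _) p)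

    +-cauchy : ∀ x y m n →
      ∣ (seq x m + seq y m) - (seq x n + seq y n) ∣
        ≤ 1ℚ * ∣ seq x m - seq x n ∣ + 1ℚ * ∣ seq y m - seq y n ∣
    +-cauchy x y m n = begin
      ∣ (a + c) - (b + d) ∣                ≡⟨ cong ∣_∣ (solve 4 (λ a b c d → (a :+ c) :- (b :+ d) := (a :- b) :+ (c :- d)) refl a b c d) ⟩
      ∣ (a - b) + (c - d) ∣                ≤⟨ ∣p+q∣≤∣p∣+∣q∣ (a - b) (c - d) ⟩
      ∣ a - b ∣ + ∣ c - d ∣                ≡⟨ cong₂ _+_ (*-identityˡ ∣ a - b ∣) (*-identityˡ ∣ c - d ∣) ⟨
      1ℚ * ∣ a - b ∣ + 1ℚ * ∣ c - d ∣      ∎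
      where
      a b c d : ℚ
      a = seq x m; b = seq x n; c = seq y m; d = seq y n

    neg-cauchy : ∀ x m n →
      ∣ (- seq x m) - (- seq x n) ∣
        ≤ 1ℚ * ∣ seq x m - seq x n ∣ + 0ℚ * ∣ seq x m - seq x n ∣
    neg-cauchy x m n = ≤-reflexive (trans
      (cong ∣_∣ (solve 2 (λ a b → (:- a) :- (:- b) := b :- a) refl a b))
      (trans (∣-∣-comm b a)
             (sym (trans (cong₂ _+_ (*-identityˡ ∣ a - b ∣) (*-zeroˡ ∣ a - b ∣)) (+-identityʳ ∣ a - b ∣)))))
      where
      a b : ℚ
      a = seq x m; b = seq x n

    *-cauchy : ∀ x y m n → let B = proj₁ (bound x); B′ = proj₁ (bound y) in
      ∣ (seq x m * seq y m) - (seq x n * seq y n) ∣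
        ≤ B′ * ∣ seq x m - seq x n ∣ + B * ∣ seq y m - seq y n ∣
    *-cauchy x y m n = begin
      ∣ a * c - e * d ∣                            ≡⟨ cong ∣_∣ (solve 4 (λ a e c d → a :* c :- e :* d := c :* (a :- e) :+ e :* (c :- d)) refl a e c d) ⟩
      ∣ c * (a - e) + e * (c - d) ∣                ≤⟨ ∣p+q∣≤∣p∣+∣q∣ (c * (a - e)) (e * (c - d)) ⟩
      ∣ c * (a - e) ∣ + ∣ e * (c - d) ∣            ≡⟨ cong₂ _+_ (∣p*q∣≡∣p∣*∣q∣ c (a - e)) (∣p*q∣≡∣p∣*∣q∣ e (c - d)) ⟩
      ∣ c ∣ * ∣ a - e ∣ + ∣ e ∣ * ∣ c - d ∣
        ≤⟨ +-mono-≤ (*-monoʳ-≤-nonNeg ∣ a - e ∣ {{nonNegative (0≤∣p∣ (a - e))}} (b′ m))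
                    (*-monoʳ-≤-nonNeg ∣ c - d ∣ {{nonNegative (0≤∣p∣ (c - d))}} (b n)) ⟩
      B′ * ∣ a - e ∣ + B * ∣ c - d ∣               ∎
      where
      a e c d B B′ : ℚ
      a = seq x m; e = seq x n; c = seq y m; d = seq y n
      B = proj₁ (bound x); B′ = proj₁ (bound y)
      b : ∀ n → ∣ seq x n ∣ ≤ B
      b = proj₂ (proj₂ (bound x))
      b′ : ∀ n → ∣ seq y n ∣ ≤ B′
      b′ = proj₂ (proj₂ (bound y))

  0≤1 : 0ℚ ≤ 1ℚ
  0≤1 = nonNegative⁻¹ 1ℚ

  clamped-pos : ∀ {ε} → 0ℚ < ε → ∀ q → Positive (ε ⊔ q)
  clamped-pos {ε} 0<ε q = positive (<-≤-trans 0<ε (p≤p⊔q ε q))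

  -- q ↦ 1 / max(ε , q)
  clamped-inverse : ∀ {ε} → 0ℚ < ε → ℚ → ℚ
  clamped-inverse {ε} 0<ε q = (1/ (ε ⊔ q)) {{pos⇒nonZero (ε ⊔ q) {{clamped-pos 0<ε q}}}}

  abstract

    clamped-Lipschitz : ∀ {ε} (0<ε : 0ℚ < ε) → Σ[ K ∈ ℚ ] 0ℚ ≤ K ×
      (∀ p q → ε ≤ p → ε ≤ q →
        ∣ clamped-inverse 0<ε p - clamped-inverse 0<ε q ∣ ≤ K * ∣ p - q ∣)
    clamped-Lipschitz {ε} 0<ε = r * r , 0≤* 0≤r 0≤r , λ p q ε≤p ε≤q → begin
        ∣ inv p - inv q ∣
          ≡⟨ cong ∣_∣ (cong₂ _-_ (sym (*-identityʳ (inv p))) (sym (*-identityʳ (inv q)))) ⟩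
        ∣ inv p * 1ℚ - inv q * 1ℚ ∣
          ≡⟨ cong ∣_∣ (cong₂ (λ a b → inv p * a - inv q * b) (sym (inverse q ε≤q)) (sym (inverse p ε≤p))) ⟩
        ∣ inv p * (inv q * q) - inv q * (inv p * p) ∣
          ≡⟨ cong ∣_∣ (solve 4 (λ u v p q → u :* (v :* q) :- v :* (u :* p) := (u :* v) :* (q :- p)) refl (inv p) (inv q) p q) ⟩
        ∣ (inv p * inv q) * (q - p) ∣
          ≡⟨ ∣p*q∣≡∣p∣*∣q∣ (inv p * inv q) (q - p) ⟩
        ∣ inv p * inv q ∣ * ∣ q - p ∣
          ≡⟨ cong₂ _*_ (0≤p⇒∣p∣≡p (0≤* (0≤inv p) (0≤inv q))) (∣-∣-comm q p) ⟩
        (inv p * inv q) * ∣ p - q ∣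
          ≤⟨ *-monoʳ-≤-nonNeg ∣ p - q ∣ {{nonNegative (0≤∣p∣ (p - q))}}
               (*-mono (0≤inv p) 0≤r (inv≤r p ε≤p) (inv≤r q ε≤q)) ⟩
        (r * r) * ∣ p - q ∣  ∎
      where
      inv : ℚ → ℚ
      inv = clamped-inverse 0<ε
      instance
        ε-pos : Positive ε
        ε-pos = positive 0<ε
        ε-nonZero : NonZero ε
        ε-nonZero = pos⇒nonZero ε
      r : ℚ
      r = 1/ ε
      0≤r : 0ℚ ≤ r
      0≤r = <⇒≤ (positive⁻¹ r {{1/pos⇒pos ε}})
      0≤inv : ∀ q → 0ℚ ≤ inv q
      0≤inv q = <⇒≤ (positive⁻¹ (inv q) {{1/pos⇒pos (ε ⊔ q) {{clamped-pos 0<ε q}}}})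
      inverse : ∀ q → ε ≤ q → inv q * q ≡ 1ℚ
      inverse q ε≤q = trans (cong (inv q *_) (sym (p≤q⇒p⊔q≡q ε≤q)))
        (*-inverseˡ (ε ⊔ q) {{pos⇒nonZero (ε ⊔ q) {{clamped-pos 0<ε q}}}})
      inv≤r : ∀ q → ε ≤ q → inv q ≤ r
      inv≤r q ε≤q = begin
        inv q             ≡⟨ *-identityʳ (inv q) ⟨
        inv q * 1ℚ        ≡⟨ cong (inv q *_) (*-inverseʳ ε) ⟨
        inv q * (ε * r)   ≤⟨ *-monoˡ-≤-nonNeg (inv q) {{nonNegative (0≤inv q)}}
                              (*-monoʳ-≤-nonNeg r {{nonNegative 0≤r}} ε≤q) ⟩
        inv q * (q * r)   ≡⟨ *-assoc (inv q) q r ⟨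
        (inv q * q) * r   ≡⟨ cong (_* r) (inverse q ε≤q) ⟩
        1ℚ * r            ≡⟨ *-identityˡ r ⟩
        r                 ∎

-- q ^ k / k!
expTerm : ℚ → ℕ → ℚ
expTerm q zero    = 1ℚ
expTerm q (suc k) = expTerm q k ℚ.* q ℚ.* (+ 1 ℚ./ suc k)

expSum : ℚ → ℕ → ℚ
expSum q zero    = expTerm q 0
expSum q (suc n) = expSum q n ℚ.+ expTerm q (suc n)

module Exp where
  open import Data.Rational.Base
  open import Data.Rational.Properties
  open ≤-Reasoning
  open ℚSolver.+-*-Solver
  open Rational

  module _ (B : ℚ) (0≤B : 0ℚ ≤ B) where

    T S : ℕ → ℚ
    T = expTerm B
    S = expSum B

    0≤T : ∀ k → 0ℚ ≤ T k
    0≤T zero    = nonNegative⁻¹ 1ℚ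
    0≤T (suc k) = 0≤* (0≤* (0≤T k) 0≤B) (0≤recip k)

    S-step : ∀ n → S n ≤ S (suc n)
    S-step n = subst (_≤ S (suc n)) (+-identityʳ (S n)) (+-monoʳ-≤ (S n) (0≤T (suc n)))

    0≤S : ∀ n → 0ℚ ≤ S n
    0≤S n = ≤-trans (0≤T 0) (monotone S S-step (z≤n {n}))

    T≤S : ∀ n → T n ≤ S n
    T≤S zero    = ≤-refl
    T≤S (suc n) = subst (_≤ S (suc n)) (+-identityˡ (T (suc n))) (+-monoˡ-≤ (T (suc n)) (0≤S n))

    T-suc : ∀ k → T k * B ≡ T (suc k) * ι (suc k)
    T-suc k = trans (sym (*-identityʳ _)) (trans (cong ((T k * B) *_) (sym (recip*ι k)))
      (sym (*-assoc (T k * B) (recip k) (ι (suc k)))))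

    ∣term∣≤ : ∀ q → ∣ q ∣ ≤ B → ∀ k → ∣ expTerm q k ∣ ≤ T k
    ∣term∣≤ q h zero    = ≤-refl
    ∣term∣≤ q h (suc k) = begin
      ∣ expTerm q k * q * recip k ∣            ≡⟨ ∣p*q∣≡∣p∣*∣q∣ (expTerm q k * q) (recip k) ⟩
      ∣ expTerm q k * q ∣ * ∣ recip k ∣        ≡⟨ cong₂ _*_ (∣p*q∣≡∣p∣*∣q∣ (expTerm q k) q) (0≤p⇒∣p∣≡p (0≤recip k)) ⟩
      ∣ expTerm q k ∣ * ∣ q ∣ * recip k        ≤⟨ *-monoʳ-≤-nonNeg (recip k) {{nonNegative (0≤recip k)}}
                                                   (*-mono (0≤∣p∣ (expTerm q k)) 0≤B (∣term∣≤ q h k) h) ⟩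
      T k * B * recip k                        ∎

    module _ (p q : ℚ) (hp : ∣ p ∣ ≤ B) (hq : ∣ q ∣ ≤ B) where

      D : ℚ
      D = ∣ p - q ∣

      0≤D : 0ℚ ≤ D
      0≤D = 0≤∣p∣ (p - q)

      term-diff : ∀ k → ∣ expTerm p (suc k) - expTerm q (suc k) ∣ ≤ D * T k
      term-diff zero = ≤-reflexive (trans
        (cong ∣_∣ (solve 2 (λ p q → con 1ℚ :* p :* con 1ℚ :- con 1ℚ :* q :* con 1ℚ := p :- q) refl p q))
        (sym (*-identityʳ D)))
      term-diff (suc k) = begin
        ∣ a * p * r - b * q * r ∣
          ≡⟨ cong ∣_∣ (solve 5 (λ a b p q r → a :* p :* r :- b :* q :* r := ((a :- b) :* p :+ b :* (p :- q)) :* r) refl a b p q r) ⟩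
        ∣ ((a - b) * p + b * (p - q)) * r ∣
          ≡⟨ trans (∣p*q∣≡∣p∣*∣q∣ ((a - b) * p + b * (p - q)) r) (cong (∣ (a - b) * p + b * (p - q) ∣ *_) (0≤p⇒∣p∣≡p 0≤r)) ⟩
        ∣ (a - b) * p + b * (p - q) ∣ * r
          ≤⟨ *-monoʳ-≤-nonNeg r {{nonNegative 0≤r}} (∣p+q∣≤∣p∣+∣q∣ ((a - b) * p) (b * (p - q))) ⟩
        (∣ (a - b) * p ∣ + ∣ b * (p - q) ∣) * r
          ≡⟨ cong (_* r) (cong₂ _+_ (∣p*q∣≡∣p∣*∣q∣ (a - b) p) (∣p*q∣≡∣p∣*∣q∣ b (p - q))) ⟩
        (∣ a - b ∣ * ∣ p ∣ + ∣ b ∣ * D) * r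
          ≤⟨ *-monoʳ-≤-nonNeg r {{nonNegative 0≤r}} (+-mono-≤
               (*-mono (0≤∣p∣ (a - b)) 0≤B (term-diff k) hp)
               (*-monoʳ-≤-nonNeg D {{nonNegative 0≤D}} (∣term∣≤ q hq (suc k)))) ⟩
        (D * T k * B + T (suc k) * D) * r
          ≡⟨ cong (λ z → (z + T (suc k) * D) * r) (trans (*-assoc D (T k) B) (cong (D *_) (T-suc k))) ⟩
        (D * (T (suc k) * ι (suc k)) + T (suc k) * D) * r
          ≡⟨ solve 4 (λ d t i r → (d :* (t :* i) :+ t :* d) :* r := d :* t :* (r :* (con 1ℚ :+ i))) refl D (T (suc k)) (ι (suc k)) r ⟩
        D * T (suc k) * (r * (1ℚ + ι (suc k)))
          ≡⟨ cong (λ z → D * T (suc k) * (r * z)) (sym (ι-suc (suc k))) ⟩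
        D * T (suc k) * (r * ι (suc (suc k)))
          ≡⟨ cong (D * T (suc k) *_) (recip*ι (suc k)) ⟩
        D * T (suc k) * 1ℚ
          ≡⟨ *-identityʳ (D * T (suc k)) ⟩
        D * T (suc k) ∎
        where
        a = expTerm p (suc k)
        b = expTerm q (suc k)
        r = recip (suc k)
        0≤r = 0≤recip (suc k)

      sum-diff : ∀ n → ∣ expSum p n - expSum q n ∣ ≤ D * S n
      sum-diff zero    = 0≤* 0≤D (0≤S 0)
      sum-diff (suc n) = ≤-trans (step n) (*-monoˡ-≤-nonNeg D {{nonNegative 0≤D}} (S-step n))
        where
        step : ∀ n → ∣ expSum p (suc n) - expSum q (suc n) ∣ ≤ D * S n
        step zero = ≤-trans (≤-reflexive (cong ∣_∣
          (solve 2 (λ a b → (con 1ℚ :+ a) :- (con 1ℚ :+ b) := a :- b) refl (expTerm p 1) (expTerm q 1)))) (term-diff 0)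
        step (suc n) = begin
          ∣ (a + c) - (b + d) ∣      ≡⟨ cong ∣_∣ (solve 4 (λ a b c d → (a :+ c) :- (b :+ d) := (a :- b) :+ (c :- d)) refl a b c d) ⟩
          ∣ (a - b) + (c - d) ∣      ≤⟨ ∣p+q∣≤∣p∣+∣q∣ (a - b) (c - d) ⟩
          ∣ a - b ∣ + ∣ c - d ∣      ≤⟨ +-mono-≤ (step n) (term-diff (suc n)) ⟩
          D * S n + D * T (suc n)    ≡⟨ *-distribˡ-+ D (S n) (T (suc n)) ⟨
          D * S (suc n)              ∎
          where
          a = expSum p (suc n)
          b = expSum q (suc n)
          c = expTerm p (suc (suc n))
          d = expTerm q (suc (suc n))

    tail≤ : ∀ q → ∣ q ∣ ≤ B → ∀ {m n} → m ℕ.≤′ n → ∣ expSum q n - expSum q m ∣ ≤ S n - S m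
    tail≤ q h {m} ℕ.≤′-refl = ≤-reflexive (trans (cong ∣_∣ (+-inverseʳ (expSum q m))) (sym (+-inverseʳ (S m))))
    tail≤ q h {m} (ℕ.≤′-step {n} m≤n) = begin
      ∣ (a + c) - b ∣          ≡⟨ cong ∣_∣ (solve 3 (λ a b c → (a :+ c) :- b := (a :- b) :+ c) refl a b c) ⟩
      ∣ (a - b) + c ∣          ≤⟨ ∣p+q∣≤∣p∣+∣q∣ (a - b) c ⟩
      ∣ a - b ∣ + ∣ c ∣        ≤⟨ +-mono-≤ (tail≤ q h m≤n) (∣term∣≤ q h (suc n)) ⟩
      (S n - S m) + T (suc n)  ≡⟨ solve 3 (λ a b c → (a :- b) :+ c := (a :+ c) :- b) refl (S n) (S m) (T (suc n)) ⟩
      S (suc n) - S m          ∎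
      where
      a = expSum q n
      b = expSum q m
      c = expTerm q (suc n)

    N₀ : ℕ
    N₀ = proj₁ (archimedean (B + B))

    -- beyond N₀ consecutive terms at least halve
    T-halves : ∀ k → N₀ ℕ.≤ k → T (suc k) + T (suc k) ≤ T k
    T-halves k N₀≤k = begin
      T k * B * r + T k * B * r   ≡⟨ solve 3 (λ t b r → t :* b :* r :+ t :* b :* r := (t :* r) :* (b :+ b)) refl (T k) B r ⟩
      (T k * r) * (B + B)         ≤⟨ *-monoˡ-≤-nonNeg (T k * r) {{nonNegative (0≤* (0≤T k) (0≤recip k))}}
                                      (≤-trans (proj₂ (archimedean (B + B))) (monotone ι ι-≤-suc (ℕ.m≤n⇒m≤1+n N₀≤k))) ⟩
      (T k * r) * ι (suc k)       ≡⟨ trans (*-assoc (T k) r (ι (suc k))) (cong (T k *_) (recip*ι k)) ⟩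
      T k * 1ℚ                    ≡⟨ *-identityʳ (T k) ⟩
      T k                         ∎
      where r = recip k

    S+T-antitone : ∀ {m n} → N₀ ℕ.≤ m → m ℕ.≤′ n → S n + T n ≤ S m + T m
    S+T-antitone h ℕ.≤′-refl = ≤-refl
    S+T-antitone {m} h (ℕ.≤′-step {n} m≤n) = begin
      (S n + T (suc n)) + T (suc n)  ≡⟨ +-assoc (S n) (T (suc n)) (T (suc n)) ⟩
      S n + (T (suc n) + T (suc n))  ≤⟨ +-monoʳ-≤ (S n) (T-halves n (ℕ.≤-trans h (ℕ.≤′⇒≤ m≤n))) ⟩
      S n + T n                      ≤⟨ S+T-antitone h m≤n ⟩
      S m + T m                      ∎

    S≤S+T : ∀ n → S n ≤ S n + T n
    S≤S+T n = subst (_≤ S n + T n) (+-identityʳ (S n)) (+-monoʳ-≤ (S n) (0≤T n))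

    E : ℚ
    E = S N₀ + T N₀

    S≤E : ∀ n → S n ≤ E
    S≤E n with ℕ.≤-total n N₀
    ... | inj₁ n≤N₀ = ≤-trans (monotone S S-step n≤N₀) (S≤S+T N₀)
    ... | inj₂ N₀≤n = ≤-trans (S≤S+T n) (S+T-antitone ℕ.≤-refl (ℕ.≤⇒≤′ N₀≤n))

    S-tail : ∀ {m n} → N₀ ℕ.≤ m → m ℕ.≤ n → S n - S m ≤ T m
    S-tail {m} {n} h m≤n = begin
      S n - S m          ≤⟨ +-monoˡ-≤ (- S m) (≤-trans (S≤S+T n) (S+T-antitone h (ℕ.≤⇒≤′ m≤n))) ⟩
      (S m + T m) - S m  ≡⟨ solve 2 (λ s t → (s :+ t) :- s := t) refl (S m) (T m) ⟩
      T m                ∎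

    T-small : ∀ ε → 0ℚ < ε → Σ[ N ∈ ℕ ] (∀ m → N ℕ.≤ m → T m ≤ ε)
    T-small ε 0<ε = suc N , go
      where
      instance
        ε-pos : Positive ε
        ε-pos = positive 0<ε
        ε-nonZero : NonZero ε
        ε-nonZero = pos⇒nonZero ε
      0≤ε = <⇒≤ 0<ε
      N : ℕ
      N = proj₁ (archimedean (E * B * 1/ ε))
      EB≤ : ∀ k → N ℕ.≤ k → E * B ≤ ε * ι (suc k)
      EB≤ k N≤k = begin
        E * B                  ≡⟨ *-identityʳ (E * B) ⟨
        E * B * 1ℚ             ≡⟨ cong (E * B *_) (*-inverseˡ ε) ⟨
        E * B * (1/ ε * ε)     ≡⟨ solve 3 (λ a i e → a :* (i :* e) := e :* (a :* i)) refl (E * B) (1/ ε) ε ⟩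
        ε * (E * B * 1/ ε)     ≤⟨ *-monoˡ-≤-nonNeg ε {{nonNegative 0≤ε}}
                                   (≤-trans (proj₂ (archimedean (E * B * 1/ ε))) (monotone ι ι-≤-suc (ℕ.m≤n⇒m≤1+n N≤k))) ⟩
        ε * ι (suc k)          ∎
      go : ∀ m → suc N ℕ.≤ m → T m ≤ ε
      go (suc k) (s≤s N≤k) = begin
        T k * B * recip k              ≤⟨ *-monoʳ-≤-nonNeg (recip k) {{nonNegative (0≤recip k)}} (≤-trans
                                           (*-monoʳ-≤-nonNeg B {{nonNegative 0≤B}} (≤-trans (T≤S k) (S≤E k)))
                                           (EB≤ k N≤k)) ⟩
        ε * ι (suc k) * recip k        ≡⟨ solve 3 (λ e i r → e :* i :* r := e :* (r :* i)) refl ε (ι (suc k)) (recip k) ⟩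
        ε * (recip k * ι (suc k))      ≡⟨ cong (ε *_) (recip*ι k) ⟩
        ε * 1ℚ                         ≡⟨ *-identityʳ ε ⟩
        ε                              ∎

  abstract

    exp-cauchy : ∀ x ε → 0ℚ < ε → Σ[ N ∈ ℕ ] ∀ m n → N ℕ.≤ m → N ℕ.≤ n →
      ∣ expSum (seq x m) m - expSum (seq x n) n ∣ ≤ ε
    exp-cauchy x ε 0<ε with Bounds.bound x
    ... | B , 0≤B , b with T-small B 0≤B (½ * ε) (0<* 0<½ 0<ε)
                         | divide (≤-trans (0≤S B 0≤B 0) (S≤E B 0≤B 0)) (0<* 0<½ 0<ε)
    ... | N₁ , t | δ , 0<δ , Eδ with cauchy x δ 0<δ
    ... | N₂ , c = N , both
      where
      N : ℕ
      N = N₀ B 0≤B ℕ.⊔ (N₁ ℕ.⊔ N₂)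
      le₀ : ∀ {k} → N ℕ.≤ k → N₀ B 0≤B ℕ.≤ k
      le₀ = ℕ.≤-trans (ℕ.m≤m⊔n (N₀ B 0≤B) _)
      le₁ : ∀ {k} → N ℕ.≤ k → N₁ ℕ.≤ k
      le₁ p = ℕ.≤-trans (ℕ.m≤m⊔n N₁ N₂) (ℕ.≤-trans (ℕ.m≤n⊔m (N₀ B 0≤B) _) p)
      le₂ : ∀ {k} → N ℕ.≤ k → N₂ ℕ.≤ k
      le₂ p = ℕ.≤-trans (ℕ.m≤n⊔m N₁ N₂) (ℕ.≤-trans (ℕ.m≤n⊔m (N₀ B 0≤B) _) p)
      ordered : ∀ m n → N ℕ.≤ m → m ℕ.≤ n → ∣ expSum (seq x n) n - expSum (seq x m) m ∣ ≤ ε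
      ordered m n pm m≤n = begin
        ∣ expSum p n - expSum q m ∣
          ≤⟨ triangle (expSum p n) (expSum p m) (expSum q m) ⟩
        ∣ expSum p n - expSum p m ∣ + ∣ expSum p m - expSum q m ∣
          ≤⟨ +-mono-≤
               (≤-trans (tail≤ B 0≤B p (b n) (ℕ.≤⇒≤′ m≤n))
                 (≤-trans (S-tail B 0≤B (le₀ pm) m≤n) (t m (le₁ pm))))
               (≤-trans (sum-diff B 0≤B p q (b n) (b m) m)
                 (≤-trans (*-mono (0≤∣p∣ (p - q)) (≤-trans (0≤S B 0≤B m) (S≤E B 0≤B m))
                             (c n m (le₂ (ℕ.≤-trans pm m≤n)) (le₂ pm)) (S≤E B 0≤B m))
                   (≤-trans (≤-reflexive (*-comm δ (E B 0≤B))) Eδ))) ⟩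
        ½ * ε + ½ * ε  ≡⟨ half ε ⟩
        ε              ∎
        where
        p q : ℚ
        p = seq x n
        q = seq x m
      both : ∀ m n → N ℕ.≤ m → N ℕ.≤ n → ∣ expSum (seq x m) m - expSum (seq x n) n ∣ ≤ ε
      both m n pm pn with ℕ.≤-total m n
      ... | inj₁ m≤n = subst (_≤ ε) (∣-∣-comm (expSum (seq x n) n) (expSum (seq x m) m)) (ordered m n pm m≤n)
      ... | inj₂ n≤m = ordered n m pn n≤m

open Bounds using (clamped-inverse)

------------------------------------------------------------------------
-- Order and arithmetic of reals

infix 4 _<_ _≤_ _≃_

_<_ : ℝ → ℝ → Set
x < y = Σ[ ε ∈ ℚ ] 0ℚ ℚ.< ε × Σ[ N ∈ ℕ ] ∀ n → N ℕ.≤ n → seq x n ℚ.+ ε ℚ.≤ seq y n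

_≤_ : ℝ → ℝ → Set
x ≤ y = ¬ (y < x)

_≃_ : ℝ → ℝ → Set
x ≃ y = x ≤ y × y ≤ x

infix  8 -_
infixl 7 _*_ _/_[_]
infixl 6 _+_
infixr 9 _^_

fromℚ : ℚ → ℝ
fromℚ q = mkℝ (λ _ → q) λ ε 0<ε → 0 , λ _ _ _ _ →
  subst (λ z → ∣ z ∣ ℚ.≤ ε) (sym (ℚ.+-inverseʳ q)) (ℚ.<⇒≤ 0<ε)

fromℕ : ℕ → ℝ
fromℕ n = fromℚ (+ n ℚ./ 1)

0ℝ 1ℝ 2ℝ : ℝ
0ℝ = fromℕ 0
1ℝ = fromℕ 1
2ℝ = fromℕ 2

_+_ : ℝ → ℝ → ℝ
x + y = mkℝ (λ n → seq x n ℚ.+ seq y n)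
  (Bounds.dominated x y (λ n → seq x n ℚ.+ seq y n) 1ℚ 1ℚ Bounds.0≤1 Bounds.0≤1 0 λ m n _ _ → Bounds.+-cauchy x y m n)

-_ : ℝ → ℝ
- x = mkℝ (λ n → ℚ.- seq x n)
  (Bounds.dominated x x (λ n → ℚ.- seq x n) 1ℚ 0ℚ Bounds.0≤1 ℚ.≤-refl 0 λ m n _ _ → Bounds.neg-cauchy x m n)

_*_ : ℝ → ℝ → ℝ
x * y = mkℝ (λ n → seq x n ℚ.* seq y n)
  (Bounds.dominated x y (λ n → seq x n ℚ.* seq y n) (proj₁ (Bounds.bound y)) (proj₁ (Bounds.bound x))
    (proj₁ (proj₂ (Bounds.bound y))) (proj₁ (proj₂ (Bounds.bound x)))
    0 λ m n _ _ → Bounds.*-cauchy x y m n)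

-- The witness of 0 < y provides ε > 0 with yₙ ≥ ε for large n, so taking
-- 1 / max(ε , yₙ) agrees eventually with 1 / yₙ.
inverse : (y : ℝ) → 0ℝ < y → ℝ
inverse y (ε , 0<ε , N , ε≤y) = mkℝ (λ n → clamped-inverse 0<ε (seq y n))
  (Bounds.dominated y y (λ n → clamped-inverse 0<ε (seq y n)) K 0ℚ 0≤K ℚ.≤-refl N λ m n N≤m N≤n →
    ℚ.≤-trans (lip (seq y m) (seq y n) (ε≤ m N≤m) (ε≤ n N≤n))
      (ℚ.≤-reflexive (sym (trans
        (cong (K ℚ.* ∣ seq y m ℚ.- seq y n ∣ ℚ.+_) (ℚ.*-zeroˡ ∣ seq y m ℚ.- seq y n ∣))
        (ℚ.+-identityʳ (K ℚ.* ∣ seq y m ℚ.- seq y n ∣))))))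
  where
  K = proj₁ (Bounds.clamped-Lipschitz 0<ε)
  0≤K = proj₁ (proj₂ (Bounds.clamped-Lipschitz 0<ε))
  lip = proj₂ (proj₂ (Bounds.clamped-Lipschitz 0<ε))
  ε≤ : ∀ n → N ℕ.≤ n → ε ℚ.≤ seq y n
  ε≤ n N≤n = subst (ℚ._≤ seq y n) (ℚ.+-identityˡ ε) (ε≤y n N≤n)

_/_[_] : (x y : ℝ) → 0ℝ < y → ℝ
x / y [ 0<y ] = x * inverse y 0<y

_^_ : ℝ → ℕ → ℝ
x ^ zero  = 1ℝ
x ^ suc n = x * (x ^ n)

∑ : ∀ {n} → (Fin n → ℝ) → ℝ
∑ = Tuple.foldr _+_ 0ℝ

------------------------------------------------------------------------
-- Exponential, square root and binary logarithm

-- ∑ₖ x ^ k / k!, as the diagonal limit of the partial sums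
exp : ℝ → ℝ
exp x = mkℝ (λ n → expSum (seq x n) n) (Exp.exp-cauchy x)

IsSqrt : ℝ → ℝ → Set
IsSqrt x s = 0ℝ ≤ s × s * s ≃ x

-- 2 ^ l = x, where 2 ^ l means exp (l · ln 2)
IsLog₂ : ℝ → ℝ → Set
IsLog₂ x l = Σ[ ln2 ∈ ℝ ] exp ln2 ≃ 2ℝ × exp (l * ln2) ≃ x

------------------------------------------------------------------------
-- Infima and suprema

-- An extended real a is given by its strict upper cut { r | a < r }: a
-- constructive supremum of arbitrarily many reals need not be a Cauchy real.
ℝ̄ : Set₁
ℝ̄ = ℝ → Set

infix 4 _<̄_

_<̄_ : ℝ̄ → ℝ → Set
a <̄ r = a r

inf : {I : Set} → (I → ℝ) → ℝ̄
inf u r = ∃ λ i → u i < r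

-- sup a < r iff some c < r is an upper bound, i.e. a i ≤ c for all i
sup : {I : Set} → (I → ℝ̄) → ℝ̄
sup a r = Σ[ c ∈ ℝ ] c < r × (∀ i d → c < d → a i <̄ d)

------------------------------------------------------------------------
-- Communication protocols

record FiniteProbabilitySpace : Set where
  field
    size     : ℕ
    prob     : Fin size → ℝ
    nonneg   : ∀ ω → 0ℝ ≤ prob ω
    total    : ∑ prob ≃ 1ℝ

  expectation : (Fin size → ℝ) → ℝ
  expectation u = ∑ λ ω → prob ω * u ω

open FiniteProbabilitySpace public

data Tree (A B O : Set) : Set where
  output : O → Tree A B O
  alice  : (A → Bool) → (Bool → Tree A B O) → Tree A B O
  bob    : (B → Bool) → (Bool → Tree A B O) → Tree A B O

run : ∀ {A B O} → Tree A B O → A → B → O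
run (output o)       a b = o
run (alice bit next) a b = run (next (bit a)) a b
run (bob bit next)   a b = run (next (bit b)) a b

depth : ∀ {A B O} → Tree A B O → ℕ
depth (output _)     = 0
depth (alice _ next) = suc (depth (next false) ℕ.⊔ depth (next true))
depth (bob _ next)   = suc (depth (next false) ℕ.⊔ depth (next true))

-- The tree, and with it the output at each leaf, may depend on the public
-- randomness; the three sources of randomness are independent.
record Protocol (X Y O : Set) : Set where
  field
    public-coins  : FiniteProbabilitySpace
    alice-coins   : FiniteProbabilitySpace
    bob-coins     : FiniteProbabilitySpace
    tree          : Fin (size public-coins) →
                    Tree (X × Fin (size alice-coins)) (Y × Fin (size bob-coins)) O

open Protocol public

module _ {X Y O : Set} where

  ‖_‖ : Protocol X Y O → ℕ
  ‖ π ‖ = Tuple.foldr ℕ._⊔_ 0 λ ω → depth (tree π ω)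

  -- expectation of h (π (xy)) over the randomness of π
  𝔼[_] : (O → ℝ) → Protocol X Y O → X × Y → ℝ
  𝔼[ h ] π (x , y) =
    expectation (public-coins π) λ ω →
    expectation (alice-coins π) λ α →
    expectation (bob-coins π) λ β →
    h (run (tree π ω) (x , α) (y , β))

  ProtocolOfLength≤ : ℝ → Set
  ProtocolOfLength≤ C = Σ[ π ∈ Protocol X Y O ] fromℕ ‖ π ‖ ≤ C

bit : Bool → ℕ
bit b = if b then 1 else 0

adv : {X Y : Set} → ℝ → (X × Y → Bool) → ℝ̄
adv {X} {Y} C g = sup {ProtocolOfLength≤ {X} {Y} {Bool} C} λ (π , _) →
  inf λ xy → 𝔼[ (λ o → (- 1ℝ) ^ (bit o ℕ.+ bit (g xy))) ] π xy

suc-prob : {X Y Z : Set} → DecidableEquality Z → ℝ → (X × Y → Z) → ℝ̄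
suc-prob {X} {Y} {Z} _≟_ C g = sup {ProtocolOfLength≤ {X} {Y} {Z} C} λ (π , _) →
  inf λ xy → 𝔼[ (λ o → if ⌊ o ≟ g xy ⌋ then 1ℝ else 0ℝ) ] π xy

_^⊗_ : {X Y : Set} → (X × Y → Bool) → (n : ℕ) → Vec X n × Vec Y n → Vec Bool n
(f ^⊗ n) (xs , ys) = zipWith (λ x y → f (x , y)) xs ys

_≟ⁿ_ : ∀ {n} → DecidableEquality (Vec Bool n)
_≟ⁿ_ = ≡-dec Bool._≟_

{-# OPTIONS --safe #-}
module Submission where

-- Suppose a deterministic protocol of length T computes fⁿ correctly with probability at least ρⁿ on inputs drawn
-- uniformly from Eⁿ. Condition on the set Q of correctly answered inputs. Writing entropies of Q as sums of logarithms
-- of class sizes, the chain rule along the coordinates shows that for some j the players can, given only (xⱼ , yⱼ) and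
-- public randomness, sample (x₍<ⱼ₎ , y₍>ⱼ₎) with little loss by correlated sampling, and that the transcript bits
-- which the two players would predict from their own views disagree only O(T / √n) times on average. A noisy search
-- for the disagreements, with equality tests by hashing, then simulates the transcript with O(T log T / √n) bits and
-- computes f with advantage at least 1/2 on average over E. As E is arbitrary, regret matching turns this into a
-- protocol with advantage 1/8 on every input. If 4 T < n, already the number of transcripts is too small.

open import Data.Bool.Base using (Bool; true; false; if_then_else_; _∧_; not; _xor_; _∨_)
import Data.Bool.Properties as BoolP using (_≟_; xor-comm; ¬-not)
open import Data.Fin.Base using (Fin)
import Data.Fin.Properties as FinP using (_≟_)
open import Data.List.Base using (List; _++_; _∷ʳ_; map; foldr; length; concatMap; filter; allFin; replicate; tabulate; cartesianProduct)
open import Data.List.Membership.Propositional using (_∈_)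
open import Data.List.Membership.Propositional.Properties using (∈-++⁻; ∈-map⁻; ∈-lookup; ∈-filter⁻; ∈-allFin; ∈-++⁺ˡ; ∈-++⁺ʳ; ∈-map⁺; ∈-tabulate⁺; ∈-cartesianProduct⁺)
open import Data.List.Properties using (∷-injective; length-map; length-++; length-tabulate; map-tabulate; tabulate-lookup)
import Data.List.Relation.Unary.All as All using (lookup)
open import Data.List.Relation.Unary.All using (All)
open import Data.List.Relation.Unary.Any using (here; there; Any)
open import Data.Maybe.Base using (Maybe; just; nothing)
open import Data.Nat.Base as ℕ using (ℕ; _<ᵇ_; _≡ᵇ_; z≤n; s≤s)
open import Data.Nat.DivMod using (m≡m%n+[m/n]*n; m%n<n; m/n*n≤m)
import Data.Nat.Properties as ℕP using (*-assoc; *-comm; *-mono-<; *-mono-≤; *-monoʳ-≤; *-suc; *-zeroʳ; +-assoc; +-comm; +-identityʳ; +-mono-≤; +-monoʳ-≤; +-monoˡ-≤; +-suc; +-∸-assoc; <ᵇ⇒<; <⇒<ᵇ; <⇒≢; <⇒≤; <⇒≱; >⇒≢; ^-monoʳ-<; _<?_; _≟_; _≤?_; allUpTo?; m+[n∸m]≡n; m<m+n; m∸n+n≡m; m≤m*n; m≤m+n; m≤m⊔n; m≤n*m; m≤n+m; m≤n⇒m<n∨m≡n; m≤n⇒m∸n≡0; m≤n⇒m≤1+n; m≤n⇒∃[o]m+o≡n; m≤n⊔m; n<1+n; n≤0⇒n≡0; n≤1+n; pred-mono-≤; pred[m∸n]≡m∸[1+n]; suc-injective; ≡ᵇ⇒≡;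 ≤-<-connex; ≤-<-trans; ≤-antisym; ≤-pred; ≤-refl; ≤-reflexive; ≤-total; ≤-trans; ≤⇒≤′; ≮⇒≥; ≰⇒>; ⊔-lub)
open import Data.Product.Base using (_×_; _,_; proj₁; proj₂; Σ-syntax; ∃)
import Data.Product.Properties as ×P using (≡-dec)
import Data.Rational.Base as Q
import Data.Rational.Properties as QP using (*-assoc; *-cancelʳ-<-nonNeg; *-cancelʳ-≤-pos; *-comm; *-distribˡ-+; *-identityʳ; *-identityˡ; *-inverseˡ; *-monoʳ-<-pos; *-monoʳ-≤-nonNeg; *-monoˡ-≤-nonNeg; *-zeroʳ; *-zeroˡ; +-assoc; +-comm; +-identityʳ; +-identityˡ; +-inverseʳ; +-mono-≤; +-monoʳ-<; +-monoʳ-≤; +-monoˡ-<; +-monoˡ-≤; 0≤p⇒∣p∣≡p; 0≤∣p∣; 1/pos⇒pos; <-irrefl; <-≤-trans; <⇒≤; _<?_; _≤?_; neg-antimono-≤; neg-distrib-+; nonNegative⁻¹; positive⁻¹; pos⇒nonZero; p≤p⊔q; p≤q⇒p⊔q≡q; p≤q⊔p; p⊓q≤p; p⊓q≤q; ∣-p∣≡∣p∣; ≤-<-trans; ≤-antisym; ≤-refl; ≤-reflexive; ≤-total; ≤-trans; ≮⇒≥; ≰⇒>; ⊓-glb; ⊔-lub)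
import Data.Rational.Solver
open import Data.Sum.Base using (_⊎_; inj₁; inj₂)
open import Data.Unit.Base using (tt; ⊤)
open import Data.Vec.Base as Vec using (Vec)
import Data.Vec.Functional as Tuple
import Data.Vec.Properties as VecP using (≡-dec)
import Defs
import Defs as D
open import Function.Base using (_∘_; id)
open import Function.Bundles using (_↔_; Inverse)
open import Relation.Binary.Definitions using (DecidableEquality)
open import Relation.Binary.PropositionalEquality using (_≡_; refl; sym; trans; cong; cong₂; subst; subst₂; _≢_)
open import Relation.Nullary using (Dec; yes; no; ¬_; does; contradiction)
open import Relation.Nullary.Decidable using (_×-dec_; _→-dec_; map′; ¬?; toWitness)
open import Relation.Nullary.Decidable.Core using (⌊_⌋)

-- The exponent `1/2` comes from Pinsker's inequality. Summed over the coordinates, the single views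
-- lack `O(T)` bits of information about the transcript, so some coordinate lacks `O(T / n)`, spread
-- over `T` predictions. A prediction errs like the square root of what it lacks. Here the square
-- root is replaced by a tangent, which turns total information `I` into `I / θ + T θ`; `θ` near
-- `1 / √n` balances both terms at `T / √n`. Conditioning on success with `ρ = 1 / (1 + θ₁²)` costs
-- about `θ₁²` per coordinate, and a second tangent with the constant `θ₁ = 1/256` keeps the
-- resulting loss small. This cost must not exceed the information in the transcript, hence the
-- separate case of very short protocols. All of this is rational: distributions are lists with
-- repetitions, logarithms are floors to the base `1 + 1/N`, and `N` is chosen last, so large that
-- the lost units do not matter. Random integers below powers of a factorial make every sampling
-- step exact. Real numbers enter only at the end; as their order is undecidable, inequalities
-- between them are refuted or decided up to a tolerance.

private

 -- Rational arithmetic behind opaque operations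

 module Field where

  open import Data.Nat.Base as ℕ using (zero; suc)

  open Q using (ℚ; 0ℚ; 1ℚ) public

  infix 4 _≤_ _<_ _≤?_
  infixl 6 _+_ _-_
  infixl 7 _*_ _⊓_
  infix 8 -_

  _≤_ _<_ : ℚ → ℚ → Set
  _≤_ = Q._≤_
  _<_ = Q._<_

  open QP public using (≤-refl; ≤-reflexive; ≤-trans; ≤-antisym; ≤-total; <-irrefl; <-≤-trans; ≤-<-trans; <⇒≤; ≰⇒>; ≮⇒≥)

  -- Opaque copies of the operations of ℚ, which unification can then take apart.
  opaque
    _+_ _*_ _⊓_ : ℚ → ℚ → ℚ
    _+_ = Q._+_
    _*_ = Q._*_
    _⊓_ = Q._⊓_

    -_ plus : ℚ → ℚ
    -_ = Q.-_
    plus = 0ℚ Q.⊔_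

    ι inv : ℕ → ℚ
    ι = Defs.Rational.ι
    inv zero    = 0ℚ
    inv (suc k) = Defs.Rational.recip k

    _≤?_ : (a b : ℚ) → Dec (a ≤ b)
    _≤?_ = QP._≤?_

  ≡≤ : ∀ {a b c} → a ≡ b → b ≤ c → a ≤ c
  ≡≤ refl q = q

  ≤≡ : ∀ {a b c} → a ≤ b → b ≡ c → a ≤ c
  ≤≡ p refl = p

  _-_ : ℚ → ℚ → ℚ
  a - b = a + (- b)

  opaque
    unfolding _+_

    +-assoc : ∀ a b c → (a + b) + c ≡ a + (b + c)
    +-assoc = QP.+-assoc

    +-comm : ∀ a b → a + b ≡ b + a
    +-comm = QP.+-comm

    +-identityˡ : ∀ a → 0ℚ + a ≡ a
    +-identityˡ = QP.+-identityˡ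

    +-identityʳ : ∀ a → a + 0ℚ ≡ a
    +-identityʳ = QP.+-identityʳ

    +-inverseʳ : ∀ a → a - a ≡ 0ℚ
    +-inverseʳ = QP.+-inverseʳ

    *-assoc : ∀ a b c → (a * b) * c ≡ a * (b * c)
    *-assoc = QP.*-assoc

    *-comm : ∀ a b → a * b ≡ b * a
    *-comm = QP.*-comm

    *-identityˡ : ∀ a → 1ℚ * a ≡ a
    *-identityˡ = QP.*-identityˡ

    *-identityʳ : ∀ a → a * 1ℚ ≡ a
    *-identityʳ = QP.*-identityʳ

    *-zeroˡ : ∀ a → 0ℚ * a ≡ 0ℚ
    *-zeroˡ = QP.*-zeroˡ

    *-zeroʳ : ∀ a → a * 0ℚ ≡ 0ℚ
    *-zeroʳ = QP.*-zeroʳ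

    *-distribˡ-+ : ∀ a b c → a * (b + c) ≡ a * b + a * c
    *-distribˡ-+ = QP.*-distribˡ-+

    neg-distrib-+ : ∀ a b → - (a + b) ≡ - a + (- b)
    neg-distrib-+ = QP.neg-distrib-+

    neg-0 : - 0ℚ ≡ 0ℚ
    neg-0 = refl

    +-mono-≤ : ∀ {a b c d} → a ≤ b → c ≤ d → a + c ≤ b + d
    +-mono-≤ = QP.+-mono-≤

    +-monoˡ-≤ : ∀ c {a b} → a ≤ b → a + c ≤ b + c
    +-monoˡ-≤ = QP.+-monoˡ-≤

    +-monoʳ-≤ : ∀ c {a b} → a ≤ b → c + a ≤ c + b
    +-monoʳ-≤ = QP.+-monoʳ-≤

    +-monoʳ-< : ∀ c {a b} → a < b → c + a < c + b
    +-monoʳ-< = QP.+-monoʳ-<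

    +-monoˡ-< : ∀ c {a b} → a < b → a + c < b + c
    +-monoˡ-< = QP.+-monoˡ-<

    neg-≤ : ∀ {a b} → a ≤ b → - b ≤ - a
    neg-≤ = QP.neg-antimono-≤

    *ˡ : ∀ {a b} c → 0ℚ ≤ c → a ≤ b → c * a ≤ c * b
    *ˡ c h = QP.*-monoˡ-≤-nonNeg c {{Q.nonNegative h}}

    *ʳ : ∀ {a b} c → 0ℚ ≤ c → a ≤ b → a * c ≤ b * c
    *ʳ c h = QP.*-monoʳ-≤-nonNeg c {{Q.nonNegative h}}

    *ˡ-< : ∀ {a b} c → 0ℚ < c → a < b → c * a < c * b
    *ˡ-< c h = QP.*-monoʳ-<-pos c {{Q.positive h}}

    *-cancelʳ-≤ : ∀ {a b} c → 0ℚ < c → a * c ≤ b * c → a ≤ b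
    *-cancelʳ-≤ c h = QP.*-cancelʳ-≤-pos c {{Q.positive h}}

    *-cancelʳ-< : ∀ {a b} c → 0ℚ ≤ c → a * c < b * c → a < b
    *-cancelʳ-< c h = QP.*-cancelʳ-<-nonNeg c {{Q.nonNegative h}}

    0≤* : ∀ {a b} → 0ℚ ≤ a → 0ℚ ≤ b → 0ℚ ≤ a * b
    0≤* = Defs.Rational.0≤*

    0<* : ∀ {a b} → 0ℚ < a → 0ℚ < b → 0ℚ < a * b
    0<* = Defs.Rational.0<*

    0≤1 : 0ℚ ≤ 1ℚ
    0≤1 = QP.nonNegative⁻¹ 1ℚ

    0<1 : 0ℚ < 1ℚ
    0<1 = QP.positive⁻¹ 1ℚ

    ι0 : ι 0 ≡ 0ℚ
    ι0 = refl

    ι1 : ι 1 ≡ 1ℚ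
    ι1 = refl

    inv0 : inv 0 ≡ 0ℚ
    inv0 = refl

    0≤ι : ∀ n → 0ℚ ≤ ι n
    0≤ι = Defs.Rational.0≤ι

    ι-suc : ∀ n → ι (suc n) ≡ 1ℚ + ι n
    ι-suc = Defs.Rational.ι-suc

    0≤inv : ∀ c → 0ℚ ≤ inv c
    0≤inv zero    = QP.≤-refl
    0≤inv (suc k) = Defs.Rational.0≤recip k

    inv*ι : ∀ {c} → 1 ℕ.≤ c → inv c * ι c ≡ 1ℚ
    inv*ι {suc k} _ = Defs.Rational.recip*ι k

    0≤plus : ∀ a → 0ℚ ≤ plus a
    0≤plus a = QP.p≤p⊔q 0ℚ a

    ≤plus : ∀ a → a ≤ plus a
    ≤plus a = QP.p≤q⊔p 0ℚ a

    plus-lub : ∀ {a b} → 0ℚ ≤ b → a ≤ b → plus a ≤ b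
    plus-lub p q = QP.⊔-lub p q

    ⊓-≤ˡ : ∀ a b → a ⊓ b ≤ a
    ⊓-≤ˡ = QP.p⊓q≤p

    ⊓-≤ʳ : ∀ a b → a ⊓ b ≤ b
    ⊓-≤ʳ = QP.p⊓q≤q

    ⊓-glb : ∀ {a b c} → c ≤ a → c ≤ b → c ≤ a ⊓ b
    ⊓-glb = QP.⊓-glb

 -- A reflective solver for polynomial identities over the rationals

 module PolynomialSolver where

  open import Data.Bool.Base using (T)
  open import Data.List.Base using ([]; _∷_)
  open import Data.Nat.Base as ℕ using (zero; suc)
  open Field

  private
    module R = Data.Rational.Solver.+-*-Solver

  opaque
    unfolding _+_

    sum-of-differences : ∀ p n q m → (p - n) + (q - m) ≡ (p + q) - (n + m)
    sum-of-differences = R.solve 4 (λ p n q m → (p R.:- n) R.:+ (q R.:- m) R.:= (p R.:+ q) R.:- (n R.:+ m)) refl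

    negated-difference : ∀ p n → - (p - n) ≡ n - p
    negated-difference = R.solve 2 (λ p n → R.:- (p R.:- n) R.:= n R.:- p) refl

    product-of-differences : ∀ p n q m → (p - n) * (q - m) ≡ (p * q + n * m) - (p * m + n * q)
    product-of-differences = R.solve 4 (λ p n q m → (p R.:- n) R.:* (q R.:- m) R.:= (p R.:* q R.:+ n R.:* m) R.:- (p R.:* m R.:+ n R.:* q)) refl

    cancel-both : ∀ p n m → p + m - (n + m) ≡ p - n
    cancel-both = R.solve 3 (λ p n m → p R.:+ m R.:- (n R.:+ m) R.:= p R.:- n) refl

  as-difference : ∀ p → p ≡ p - 0ℚ
  as-difference p = sym (trans (cong (p +_) neg-0) (+-identityʳ p))

  infix  4 _:=_
  infixl 6 _:+_ _:-_
  infixl 7 _:*_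
  infix  8 neg_

  data Expr : Set where
    var       : ℕ → Expr
    0# 1#     : Expr
    _:+_ _:*_ : Expr → Expr → Expr
    neg_      : Expr → Expr

  _:-_ : Expr → Expr → Expr
  e :- f = e :+ neg f

  Equation : Set
  Equation = Expr × Expr

  _:=_ : Expr → Expr → Equation
  _:=_ = _,_

  -- A polynomial is a difference of two lists of monomials, and a monomial is a list of variables.
  Monomial Polynomial : Set
  Monomial = List ℕ
  Polynomial = List Monomial

  times : Polynomial → Polynomial → Polynomial
  times []      Q = []
  times (m ∷ P) Q = map (m ++_) Q ++ times P Q

  expand : Expr → Polynomial × Polynomial
  expand (var i)  = (i ∷ []) ∷ [] , []
  expand 0#       = [] , []
  expand 1#       = [] ∷ [] , []
  expand (e :+ f) = proj₁ (expand e) ++ proj₁ (expand f) , proj₂ (expand e) ++ proj₂ (expand f)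
  expand (e :* f) = times (proj₁ (expand e)) (proj₁ (expand f)) ++ times (proj₂ (expand e)) (proj₂ (expand f)) ,
    times (proj₁ (expand e)) (proj₂ (expand f)) ++ times (proj₂ (expand e)) (proj₁ (expand f))
  expand (neg e)  = proj₂ (expand e) , proj₁ (expand e)

  module Sorting {A : Set} (_<_ : A → A → Bool) where

    insert : A → List A → List A
    insert a []       = a ∷ []
    insert a (b ∷ bs) = if a < b then a ∷ b ∷ bs else b ∷ insert a bs

    sort : List A → List A
    sort = foldr insert []

  before : Monomial → Monomial → Bool
  before []      _       = true
  before (_ ∷ _) []      = false
  before (i ∷ m) (j ∷ n) = if i <ᵇ j then true else if j <ᵇ i then false else before m n

  module Variables = Sorting _<ᵇ_
  module Monomials = Sorting before

  canonical : Polynomial → Polynomial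
  canonical P = Monomials.sort (map Variables.sort P)

  same-monomial : Monomial → Monomial → Bool
  same-monomial []      []      = true
  same-monomial (i ∷ m) (j ∷ n) = (i ≡ᵇ j) ∧ same-monomial m n
  same-monomial _       _       = false

  same : Polynomial → Polynomial → Bool
  same []      []      = true
  same (m ∷ P) (n ∷ Q) = same-monomial m n ∧ same P Q
  same _       _       = false

  -- Adding the negative part of each side to the positive part of the other leaves an equation
  -- between two sums of monomials. Nothing has to be cancelled any more: such sums agree as
  -- polynomials exactly when they agree as multisets, which sorting decides. Coefficients are
  -- repetitions.
  holds : Equation → Bool
  holds (e , f) = same (canonical (proj₁ (expand e) ++ proj₂ (expand f))) (canonical (proj₁ (expand f) ++ proj₂ (expand e)))

  lookup : List ℚ → ℕ → ℚ
  lookup []      i       = 0ℚ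
  lookup (q ∷ ρ) zero    = q
  lookup (q ∷ ρ) (suc i) = lookup ρ i

  ⟦_⟧ : Expr → List ℚ → ℚ
  ⟦ var i ⟧  ρ = lookup ρ i
  ⟦ 0# ⟧     ρ = 0ℚ
  ⟦ 1# ⟧     ρ = 1ℚ
  ⟦ e :+ f ⟧ ρ = ⟦ e ⟧ ρ + ⟦ f ⟧ ρ
  ⟦ e :* f ⟧ ρ = ⟦ e ⟧ ρ * ⟦ f ⟧ ρ
  ⟦ neg e ⟧  ρ = - ⟦ e ⟧ ρ

  module Soundness (ρ : List ℚ) where

    monomial : Monomial → ℚ
    monomial []      = 1ℚ
    monomial (i ∷ m) = lookup ρ i * monomial m

    polynomial : Polynomial → ℚ
    polynomial []      = 0ℚ
    polynomial (m ∷ P) = monomial m + polynomial P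

    monomial-++ : ∀ m n → monomial (m ++ n) ≡ monomial m * monomial n
    monomial-++ []      n = sym (*-identityˡ _)
    monomial-++ (i ∷ m) n = trans (cong (lookup ρ i *_) (monomial-++ m n)) (sym (*-assoc (lookup ρ i) _ _))

    polynomial-++ : ∀ P Q → polynomial (P ++ Q) ≡ polynomial P + polynomial Q
    polynomial-++ []      Q = sym (+-identityˡ _)
    polynomial-++ (m ∷ P) Q = trans (cong (monomial m +_) (polynomial-++ P Q)) (sym (+-assoc (monomial m) _ _))

    polynomial-map : ∀ m Q → polynomial (map (m ++_) Q) ≡ monomial m * polynomial Q
    polynomial-map m []      = sym (*-zeroʳ _)
    polynomial-map m (n ∷ Q) = trans (cong₂ _+_ (monomial-++ m n) (polynomial-map m Q)) (sym (*-distribˡ-+ (monomial m) _ _))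

    polynomial-times : ∀ P Q → polynomial (times P Q) ≡ polynomial P * polynomial Q
    polynomial-times []      Q = sym (*-zeroˡ _)
    polynomial-times (m ∷ P) Q = trans (polynomial-++ (map (m ++_) Q) (times P Q)) (trans (cong₂ _+_ (polynomial-map m Q) (polynomial-times P Q))
      (trans (cong₂ _+_ (*-comm (monomial m) _) (*-comm (polynomial P) _)) (trans (sym (*-distribˡ-+ (polynomial Q) _ _)) (*-comm (polynomial Q) _))))

    value : Polynomial × Polynomial → ℚ
    value (P , N) = polynomial P - polynomial N

    expand-sound : ∀ e → ⟦ e ⟧ ρ ≡ value (expand e)
    expand-sound (var i)  = sym (trans (cong (_- 0ℚ) (trans (+-identityʳ _) (*-identityʳ _))) (sym (as-difference _)))
    expand-sound 0#       = as-difference 0ℚ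
    expand-sound 1#       = sym (trans (cong (_- 0ℚ) (+-identityʳ 1ℚ)) (sym (as-difference 1ℚ)))
    expand-sound (e :+ f) = trans (cong₂ _+_ (expand-sound e) (expand-sound f)) (trans (sum-of-differences _ _ _ _)
      (sym (cong₂ _-_ (polynomial-++ (proj₁ (expand e)) _) (polynomial-++ (proj₂ (expand e)) _))))
    expand-sound (e :* f) = trans (cong₂ _*_ (expand-sound e) (expand-sound f)) (trans (product-of-differences _ _ _ _)
      (sym (cong₂ _-_ (trans (polynomial-++ (times P P′) _) (cong₂ _+_ (polynomial-times P P′) (polynomial-times N N′)))
        (trans (polynomial-++ (times P N′) _) (cong₂ _+_ (polynomial-times P N′) (polynomial-times N P′))))))
      where
      P N P′ N′ : Polynomial
      P = proj₁ (expand e)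
      N = proj₂ (expand e)
      P′ = proj₁ (expand f)
      N′ = proj₂ (expand f)
    expand-sound (neg e)  = trans (cong -_ (expand-sound e)) (negated-difference _ _)

    insert-variable : ∀ i m → monomial (Variables.insert i m) ≡ lookup ρ i * monomial m
    insert-variable i []      = refl
    insert-variable i (j ∷ m) with i <ᵇ j
    ... | true  = refl
    ... | false = trans (cong (lookup ρ j *_) (insert-variable i m)) (trans (sym (*-assoc (lookup ρ j) _ _)) (trans (cong (_* monomial m) (*-comm (lookup ρ j) _)) (*-assoc (lookup ρ i) _ _)))

    sort-variables : ∀ m → monomial (Variables.sort m) ≡ monomial m
    sort-variables []      = refl
    sort-variables (i ∷ m) = trans (insert-variable i (Variables.sort m)) (cong (lookup ρ i *_) (sort-variables m))

    insert-monomial : ∀ m P → polynomial (Monomials.insert m P) ≡ monomial m + polynomial P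
    insert-monomial m []      = refl
    insert-monomial m (n ∷ P) with before m n
    ... | true  = refl
    ... | false = trans (cong (monomial n +_) (insert-monomial m P)) (trans (sym (+-assoc (monomial n) _ _)) (trans (cong (_+ polynomial P) (+-comm (monomial n) _)) (+-assoc (monomial m) _ _)))

    canonical-sound : ∀ P → polynomial (canonical P) ≡ polynomial P
    canonical-sound []      = refl
    canonical-sound (m ∷ P) = trans (insert-monomial (Variables.sort m) (canonical P)) (cong₂ _+_ (sort-variables m) (canonical-sound P))

    same-monomial-sound : ∀ m n → same-monomial m n ≡ true → m ≡ n
    same-monomial-sound []      []      h = refl
    same-monomial-sound (i ∷ m) (j ∷ n) h with i ≡ᵇ j in e
    ... | true = cong₂ _∷_ (ℕP.≡ᵇ⇒≡ i j (subst T (sym e) tt)) (same-monomial-sound m n h)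

    same-sound : ∀ P Q → same P Q ≡ true → P ≡ Q
    same-sound []      []      h = refl
    same-sound (m ∷ P) (n ∷ Q) h with same-monomial m n in e
    ... | true = cong₂ _∷_ (same-monomial-sound m n e) (same-sound P Q h)

    holds-sound : ∀ e f → holds (e , f) ≡ true → ⟦ e ⟧ ρ ≡ ⟦ f ⟧ ρ
    holds-sound e f h = trans (expand-sound e) (trans (sym (cancelled P N N′)) (trans (cong (_- (polynomial N + polynomial N′)) crossed) (trans (cong (λ u → polynomial P′ + polynomial N - u) (+-comm (polynomial N) _)) (trans (cancelled P′ N′ N) (sym (expand-sound f))))))
      where
      P N P′ N′ : Polynomial
      P = proj₁ (expand e)
      N = proj₂ (expand e)
      P′ = proj₁ (expand f)
      N′ = proj₂ (expand f)
      cancelled : ∀ P N M → polynomial P + polynomial M - (polynomial N + polynomial M) ≡ polynomial P - polynomial N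
      cancelled P N M = cancel-both (polynomial P) (polynomial N) (polynomial M)
      crossed : polynomial P + polynomial N′ ≡ polynomial P′ + polynomial N
      crossed = trans (sym (polynomial-++ P N′)) (trans (sym (canonical-sound (P ++ N′))) (trans (cong polynomial (same-sound (canonical (P ++ N′)) (canonical (P′ ++ N)) h)) (trans (canonical-sound (P′ ++ N)) (polynomial-++ P′ N))))

  Nary : ℕ → Set
  Nary zero    = Equation
  Nary (suc n) = Expr → Nary n

  close : ∀ n → ℕ → Nary n → Equation
  close zero    i f = f
  close (suc n) i f = close n (suc i) (f (var i))

  Statement : ℕ → List ℚ → Equation → Set
  Statement zero    ρ (e , f) = ⟦ e ⟧ ρ ≡ ⟦ f ⟧ ρ
  Statement (suc n) ρ ef      = ∀ q → Statement n (ρ ∷ʳ q) ef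

  -- The hypothesis is a closed Boolean computation on syntax, so `refl` proves it without
  -- evaluating rational arithmetic.
  solve : ∀ n (f : Nary n) → holds (close n 0 f) ≡ true → Statement n [] (close n 0 f)
  solve n f h = go n []
    where
    go : ∀ k ρ → Statement k ρ (close n 0 f)
    go zero    ρ = Soundness.holds-sound ρ (proj₁ (close n 0 f)) (proj₂ (close n 0 f)) h
    go (suc k) ρ = λ q → go k (ρ ∷ʳ q)

 -- Polynomial identities used in the estimates

 module Identities where

  open PolynomialSolver

  identity-1 = solve 2 (λ a b → b := a :+ (b :- a)) refl
  identity-2 = solve 2 (λ a b → a :+ b :* a := (1# :+ b) :* a) refl
  identity-3 = solve 4 (λ a b c d → a :+ b :+ (c :+ d) := (a :+ c) :+ (b :+ d)) refl
  identity-4 = solve 4 (λ a b c d → (b :+ d :- (a :+ c)) :+ (a :- b) := d :- c) refl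
  identity-5 = solve 4 (λ a b c d → (a :+ b :- c) :* d := a :* d :+ (b :- c) :* d) refl
  identity-6 = solve 3 (λ a b c → (a :+ b :- a) :* c := 1# :+ b :* c :- 1#) refl
  identity-7 = solve 3 (λ a b c → (a :- (a :+ b)) :* c := 1# :- b :* c :- 1#) refl
  identity-8 = solve 5 (λ a b c d e → (a :* b) :* (a :* b) :* (c :* d :* e) := a :* a :* c :* (b :* b :* d :* e)) refl
  identity-9 = solve 2 (λ a b → a :* a :* b :* 1# := a :* (a :* (1# :+ b)) :- a :* a) refl
  identity-10 = solve 1 (λ a → 1# :- (a :- a :* a) := 1# :- a :+ a :* a) refl
  identity-11 = solve 3 (λ a b c → (1# :+ a) :* b :- 1# :- (a :- a :* a :+ c) := b :- 1# :- c :+ a :* a :- a :* (1# :- b)) refl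
  identity-12 = solve 1 (λ a → (1# :- 0# :* a) :* 1# := 1#) refl
  identity-13 = solve 3 (λ a b c → (1# :- a :* b) :* c := (1# :- (1# :+ a) :* b) :* ((1# :+ b) :* c) :+ (1# :+ a) :* b :* b :* c) refl
  identity-14 = solve 4 (λ a b c d → a :* b :* (c :* d) := a :* c :* (b :* d)) refl
  identity-15 = solve 1 (λ a → (1# :+ a) :* (1# :- a :+ a :* a) := 1# :+ a :* a :* a) refl
  identity-16 = solve 1 (λ a → 1# :+ 0# :* a := 1#) refl
  identity-17 = solve 2 (λ a b → (1# :+ a) :* (1# :+ b :* a) := 1# :+ (1# :+ b) :* a :+ a :* (b :* a)) refl
  identity-18 = solve 3 (λ a b c → (1# :* 1#) :* (a :* (b :* c)) := (a :* (1# :* b)) :* (1# :* c)) refl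
  identity-19 = solve 2 (λ a b → neg (a :- b) := b :- a) refl
  identity-20 = solve 2 (λ a b → (a :- b) :- (b :+ (neg b)) := a :- b) refl
  identity-21 = solve 4 (λ a b c d → 0# :+ (neg ((a :- b) :* c)) :+ d := (b :- a) :* c :+ d) refl
  identity-22 = solve 3 (λ a b c → a :* (b :* c) := b :* (a :* c)) refl
  identity-23 = solve 5 (λ a b c d e → b :* (a :* (c :* (d :* e))) := c :* ((a :* d) :* (b :* e))) refl
  identity-24 = solve 2 (λ a b → 1# :* (1# :* (a :* b)) := (1# :* a) :* (1# :* b)) refl
  identity-25 = solve 4 (λ a b c d → a :* (b :* (c :* d)) := b :* (a :* c :* d)) refl
  identity-26 = solve 6 (λ a b c d e f → (a :* (d :* e :* f)) :* (b :* c) := (a :* b) :* (d :* e) :* (c :* f)) refl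
  identity-27 = solve 4 (λ a b c d → ((a :+ b) :+ (a :+ c)) :- d := (1# :+ 1# :+ 0#) :* a :+ (b :+ c) :- d :- 0#) refl
  identity-28 = solve 5 (λ a b c d e → (a :+ (c :+ e)) :- (b :+ d) := a :- b :+ (c :- (d :- e))) refl
  identity-29 = solve 7 (λ a b c d e f g → (a :+ b) :* c :+ d :- e :- f :+ (c :- g) := (a :+ (1# :+ b)) :* c :+ d :- e :- (f :+ g)) refl
  identity-30 = solve 5 (λ a b c d e → (a :+ (c :+ d)) :- (b :+ e) := a :- b :+ (c :+ d :- e)) refl
  identity-31 = solve 8 (λ a b c d e f g h → (a :+ b) :* c :+ d :- e :- f :+ (c :+ g :- h) := (1# :+ a :+ b) :* c :+ d :- e :- f :+ g :- h) refl
  identity-32 = solve 6 (λ a b c d e f → (a :* b :* (c :* d)) :* (e :* f) := a :* (c :* e) :* (b :* (f :* d))) refl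
  identity-33 = solve 3 (λ a b c → a :* (b :* c) := (a :* b) :* c) refl
  identity-34 = solve 3 (λ a b c → a :* (b :+ b) :+ a :* c :+ a :* (1# :+ 1#) := a :* (b :+ b :+ (c :+ (1# :+ 1#)))) refl
  identity-35 = solve 6 (λ a b c d e f → a :* (b :* (c :+ c :+ (d :+ d)) :+ (b :* e :+ b :* e)) :* f := b :* (a :* (((c :+ d) :* f :+ (c :+ d) :* f) :+ (e :* f :+ e :* f)))) refl
  identity-36 = solve 7 (λ a b c d e f g → a :* (b :+ (c :* d :+ c :* d) :+ (e :+ e) :* (1# :+ 1# :+ f)) :* g := a :* ((b :+ (e :+ e) :* (1# :+ 1#)) :* g :+ (c :+ c) :* (d :* g) :+ (e :+ e) :* (f :* g))) refl
  identity-37 = solve 4 (λ a b c d → (a :* b) :* (a :* b) :* (c :* d) := a :* a :* (b :* b :* c :* d)) refl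
  identity-38 = solve 6 (λ a b c d e f → 0# := a :* (0# :* b :+ 0# :* e) :+ c :* (d :* ((0# :+ 0#) :* b :+ 0# :* f))) refl
  identity-39 = solve 13 (λ a b c d e f g h i j k l m → a :* (h :* b :+ g :* e) :+ c :* (d :* ((i :+ j) :* b :+ g :* f)) :+ (a :* (k :* b :+ e) :+ c :* (d :* ((l :+ m) :* b :+ f))) := a :* ((h :+ k) :* b :+ (1# :+ g) :* e) :+ c :* (d :* (((i :+ l) :+ (j :+ m)) :* b :+ (1# :+ g) :* f))) refl
  identity-40 = solve 4 (λ a b c d → a :* (c :* (d :* (b :* b :+ b :* b :+ (b :* b :+ b :* b))) :+ c :* (d :* (b :* b) :+ d :* (b :* b))) := (a :* b) :* (c :* (d :* ((1# :+ (1# :+ 1#) :+ (1# :+ (1# :+ 1#))) :* b)))) refl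
  identity-41 = solve 5 (λ a b c d e → a :* (b :* (c :+ c :+ (c :+ c)) :+ d :* (c :* (b :* (e :* e) :+ b :* (e :* e)))) := a :* (b :* (c :+ c :+ (c :+ c))) :+ (a :* e) :* (d :* (c :* (b :* e :+ b :* e)))) refl
  identity-42 = solve 4 (λ a b c d → (c :* d) :* (a :* (b :+ b :+ (b :+ b))) :+ 1# :* (c :* (b :* (a :* d :+ a :* d))) := c :* (a :* (b :* (1# :+ (1# :+ 1#) :+ (1# :+ (1# :+ 1#))) :* d))) refl
  identity-43 = solve 5 (λ a b c d e → a :* (b :* (c :* (d :* e))) := b :* (c :* (d :* (e :* a)))) refl
  identity-44 = solve 16 (λ a b c d e f g h i j k l m n o p → a :* (b :* (c :+ c) :+ b :* (((1# :+ (1# :+ 1#)) :+ (1# :+ (1# :+ 1#)) :+ (1# :+ 1#)) :+ ((1# :+ (1# :+ 1#)) :+ (1# :+ (1# :+ 1#)) :+ (1# :+ 1#))) :+ (1# :+ 1#) :+ (d :+ d)) :- ((b :* (((1# :+ (1# :+ 1#)) :+ c) :* a :+ e :- f) :+ b :* (((1# :+ (1# :+ 1#)) :+ c) :* a :+ e :- f) :+ (g :+ h) :- (i :+ i)) :- (j :- l :+ n :+ j) :- (((k :- j) :- (m :- l)) :+ ((k :- j) :- (m :- l))) :+ (p :+ p)) := ((((((k :+ o :+ b :* (a :+ a) :- (p :+ m)) :+ (k :+ o :+ b :* (a :+ a) :- (p :+ m))) :+ (i :+ b :* a :- o)) :+ (i :+ b :* a :- o)) :+ (n :+ b :* f :+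 b :* (a :+ a) :- (g :+ f))) :+ (l :+ b :* f :+ b :* (a :+ a) :- (h :+ f))) :+ ((f :+ a :+ a :* d :- b :* e) :+ (f :+ a :+ a :* d :- b :* e))) refl
  identity-45 = solve 1 (λ a → 0# := 0# :* a :+ ((0# :- 0#) :+ (0# :- 0#)) :- (0# :- 0#) :- (0# :- 0#)) refl
  identity-46 = solve 14 (λ a b c d e f g h i j k l m n → a :* b :+ ((c :- d) :+ (c :- d)) :- (e :- f) :- (g :- h) :+ (b :+ ((i :- j) :+ (i :- j)) :- (k :- l) :- (m :- n)) := (1# :+ a) :* b :+ (((c :+ i) :- (d :+ j)) :+ ((c :+ i) :- (d :+ j))) :- ((e :+ k) :- (f :+ l)) :- ((g :+ m) :- (h :+ n))) refl
  identity-47 = solve 19 (λ a b c d e f g h i j k l m n o p q r s → a :* (b :* (c :+ c :+ (c :+ c)) :+ b :* (((1# :+ (1# :+ 1#)) :+ (1# :+ (1# :+ 1#)) :+ (1# :+ 1#)) :+ ((1# :+ (1# :+ 1#)) :+ (1# :+ (1# :+ 1#)) :+ (1# :+ 1#))) :+ (1# :+ 1#) :+ (d :+ d) :+ (c :+ c) :* (1# :+ 1# :+ e)) :- (((b :* (c :* (a :+ a :+ (a :+ a))) :+ ((r :- s) :+ (r :- s)) :- (l :- k)) :- ((l :- n :+ p) :- (k :- m :+ o))) :+ ((b :* ((1# :+ (1# :+ 1#)) :* a :+ f :- g) :+ b :* ((1# :+ (1# :+ 1#)) :* a :+ f :- g) :+ (h :+ i) :- (j :+ j)) :- (k :- m :+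 o :+ k) :- (((k :- k) :- (m :- m)) :+ ((k :- k) :- (m :- m))) :+ (s :+ s))) := ((((((l :+ q :+ b :* (a :+ a) :- (r :+ n)) :+ (l :+ q :+ b :* (a :+ a) :- (r :+ n))) :+ (j :+ b :* a :- q)) :+ (j :+ b :* a :- q)) :+ (o :+ b :* g :+ b :* (a :+ a) :- (h :+ g))) :+ (m :+ b :* g :+ b :* (a :+ a) :- (i :+ g))) :+ ((g :+ a :+ a :* d :- b :* f) :+ (g :+ a :+ a :* d :- b :* f)) :+ ((n :+ c :* (a :+ a :* (1# :+ e)) :- m) :+ (p :+ c :* (a :+ a :* (1# :+ e)) :- o))) refl
  identity-48 = solve 6 (λ a b c d e f → 0# := (0# :* a :+ ((b :- b) :+ (b :- b)) :- (c :- c) :- (d :- d)) :* e :+ 0# :* f) refl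
  identity-49 = solve 13 (λ a b c d e f g h i j k l m → (a :* (b :+ b :+ (b :+ b)) :+ ((c :- d) :+ (c :- d)) :- (e :- f) :- (g :- h)) :* l :+ a :* (m :+ m) :+ ((((b :+ e) :+ (b :+ i) :- (j :+ c)) :* l :+ m) :+ (((b :+ g) :+ (b :+ i) :- (k :+ c)) :* l :+ m)) := ((1# :+ a) :* (b :+ b :+ (b :+ b)) :+ ((i :- d) :+ (i :- d)) :- (j :- f) :- (k :- h)) :* l :+ (1# :+ a) :* (m :+ m)) refl
  identity-50 = solve 4 (λ a b c d → (a :* c :+ d) :+ (b :* c :+ d) := (a :+ b) :* c :+ (d :+ d)) refl
  identity-51 = solve 4 (λ a b c d → a :* (b :* c) :+ a :* (b :* d) := a :* (b :* (c :+ d))) refl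
  identity-52 = solve 2 (λ a b → 0# :+ a := 0# :+ a :+ 0# :* b) refl
  identity-53 = solve 9 (λ a b c d e f g h i → (c :+ d :+ e :* (f :+ f) :- (a :+ b)) :+ (((f :+ g) :+ (f :+ h)) :- (i :+ d)) := (c :+ g) :+ h :+ (1# :+ e) :* (f :+ f) :- ((a :+ i) :+ b)) refl
  identity-54 = solve 2 (λ a b → 0# :+ a := a :+ 0# :* a :+ 0# :* b) refl
  identity-55 = solve 7 (λ a b c d e f g → (c :+ d :* b :+ d :* (e :+ e) :- (a :+ b)) :+ (((e :+ b) :+ (e :+ g)) :- (f :+ c)) := g :+ (1# :+ d) :* b :+ (1# :+ d) :* (e :+ e) :- ((a :+ f) :+ b)) refl
  identity-56 = solve 3 (λ a b c → a :+ b :+ (1# :+ c) := a :+ c :+ (1# :+ b)) refl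
  identity-57 = solve 1 (λ a → 0# := (0# :- 0#) :+ a :- a) refl
  identity-58 = solve 3 (λ a b c → a :+ b := a :+ (c :+ b) :- c) refl
  identity-59 = solve 7 (λ a b c d e f g → (a :- b) :+ c :- d :+ (e :+ (f :- g) :- c) := ((a :+ f) :- (b :+ g)) :+ e :- d) refl
  identity-60 = solve 1 (λ a → 0# := 0# :- a :+ a) refl
  identity-61 = solve 4 (λ a b c d → a :- b :+ c :+ d := (a :+ c) :- b :+ d) refl
  identity-62 = solve 1 (λ a → 0# := 0# :* a :+ 0# :* a :+ (0# :+ 0#) :- (0# :+ 0#) :- (0# :+ 0#) :- (0# :+ 0#) :+ (0# :+ 0#)) refl
  identity-63 = solve 18 (λ a b c d e f g h i j k l m n o p q r → (a :* (b :+ c :- d) :+ a :* (b :+ c :- d) :+ (e :+ f) :- (g :+ g) :- (h :+ i) :- (j :+ j) :+ (k :+ k)) :+ ((b :+ (c :+ l) :- (n :+ o) :- q :+ r :- d) :+ (b :+ (c :+ m) :- (n :+ p) :- q :+ r :- d)) := (1# :+ a) :* (b :+ c :- d) :+ (1# :+ a) :* (b :+ c :- d) :+ ((e :+ l) :+ (f :+ m)) :- ((g :+ n) :+ (g :+ n)) :- ((h :+ o) :+ (i :+ p)) :- ((j :+ q) :+ (j :+ q)) :+ ((k :+ r) :+ (k :+ r))) refl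
  identity-64 = solve 3 (λ a b c → a :* (b :+ 1# :+ c) := a :* b :+ a :+ a :* c) refl
  identity-65 = solve 2 (λ a b → a := a :+ 0# :* b) refl
  identity-66 = solve 4 (λ a b c d → (a :+ b) :+ c :+ d :* (a :+ c) := b :+ (1# :+ d) :* (a :+ c)) refl
  identity-67 = solve 4 (λ a b c d → (a :+ b) :+ (c :+ d) := (a :+ c) :+ (b :+ d)) refl
  identity-68 = solve 4 (λ a b c d → (a :+ c) :+ (b :+ d) := (a :+ b) :+ (c :+ d)) refl
  identity-69 = solve 3 (λ a b c → (a :- b) :+ (c :- a) := c :- b) refl
  identity-70 = solve 2 (λ a b → a :+ 0# :- b := a :- b) refl
  identity-71 = solve 4 (λ a b c d → (1# :+ a) :* b :- (c :+ d) :+ (d :- b) := a :* b :- c) refl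
  identity-72 = solve 4 (λ a b c d → ((1# :+ 1#) :* ((1# :+ 1#) :* (1# :+ 1#))) :* (a :* (a :* (c :* d)) :+ b :* ((1# :+ 1#) :* ((1# :+ 1#) :* c) :* d)) := ((1# :+ 1#) :* ((1# :+ 1#) :* (1# :+ 1#))) :* (a :* (a :* (c :* d))) :+ ((1# :+ 1#) :* (c :* d)) :* (((1# :+ 1#) :* ((1# :+ 1#) :* ((1# :+ 1#) :* ((1# :+ 1#) :* 1#)))) :* b)) refl
  identity-73 = solve 3 (λ a b c → ((1# :+ 1#) :* ((1# :+ 1#) :* (1# :+ 1#))) :* (a :* (a :* (b :* c))) :+ ((1# :+ 1#) :* (b :* c)) :* (a :* a) := (1# :+ (1# :+ 1#) :* (1# :+ 1#)) :* ((1# :+ 1#) :* b :* (a :* a :* c))) refl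
  identity-74 = solve 6 (λ a b c d e f → (b :* (c :* a)) :* ((1# :+ 1#) :* d :* (e :* e :* f)) := a :* ((1# :+ 1#) :* d :* ((b :* c) :* (e :* e) :* f))) refl
  identity-75 = solve 4 (λ a b c d → (a :* a) :* (d :* ((c :* b) :* (c :* b))) := (b :* a) :* (b :* a) :* (d :* (c :* c))) refl
  identity-76 = solve 4 (λ a b c d → a :* (b :* (c :* d)) := (a :* c) :* (b :* d)) refl
  identity-77 = solve 2 (λ a b → (a :+ (b :- a)) :+ (a :+ (b :- a)) := b :+ b) refl
  identity-78 = solve 4 (λ a b c d → a :* (b :* (c :* d)) := (a :* (b :* c)) :* d) refl
  identity-79 = solve 3 (λ a b c → ((1# :+ 1#) :* a) :* (b :* c) := (b :+ b) :* (a :* c)) refl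
  identity-80 = solve 3 (λ a b c → (0# :* a) :* b :+ 0# :* c := 0#) refl
  identity-81 = solve 3 (λ a b c → (0# :* a) :* b :+ 1# :* c := c) refl
  identity-82 = solve 1 (λ a → a :* (1# :- 1#) :* 1# := 0#) refl
  identity-83 = solve 7 (λ a b c d e f g → (d :- a :* (b :- c)) :* g :+ a :* (f :* g) :* (e :* b :- c) := d :* g :+ c :* (a :* (1# :- f) :* g) :- a :* (1# :- e :* f) :* (b :* g)) refl
  identity-84 = solve 4 (λ a b c d → (a :* b) :* (c :* d) := (a :* c) :* (b :* d)) refl
  identity-85 = solve 6 (λ a b c d e f → (a :* (b :* c)) :* (d :* e) :+ (a :* b) :* (d :* e :* f) := (a :* d) :* (b :* e) :* (c :+ f)) refl
  identity-86 = solve 2 (λ a b → (1# :* a) :* 1# :+ 1# :* b := a :+ b) refl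
  identity-87 = solve 3 (λ a b c → 0# :* a :* b :+ 0# :* c := 0#) refl
  identity-88 = solve 1 (λ a → 0# :- a :* 0# := 0#) refl
  identity-89 = solve 2 (λ a b → b := a :+ b :- a) refl
  identity-90 = solve 4 (λ a b c d → a :* ((b :+ c) :* d) :- a :* (b :* d) := a :* (c :* d)) refl
  identity-91 = solve 3 (λ a b c → a :* b :- a :* c := a :* (b :- c)) refl
  identity-92 = solve 5 (λ a b c d e → c :* (a :* b :* d :- e) := (a :* b :- c :* e) :- a :* (b :* (1# :- c :* d))) refl
  identity-93 = solve 3 (λ a b c → a :* c :* (a :- b) := a :* ((1# :- b :* c) :+ (a :* c :- 1#))) refl
  identity-94 = solve 3 (λ a b c → a :- (a :* c :* b) := a :* (1# :- b :* c)) refl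
  identity-95 = solve 5 (λ a b c d e → a :* (b :* (e :* (d :* c))) := (a :* (b :* c) :* (e :+ e :- 1#)) :* (d :* (1# :+ 1# :- e)) :+ (a :* (b :* (c :* d))) :* ((1# :- e) :* (1# :- e) :+ (1# :- e) :* (1# :- e))) refl
  identity-96 = solve 6 (λ a b c d e f → a :* (1# :+ 1# :- b) :- (c :* a :- (c :* a :- a :* d :- a :* e :+ f)) := a :* (1# :- d) :+ a :* (1# :- e) :+ (f :- a :* b)) refl
  identity-97 = solve 1 (λ a → (neg a) :* (neg a) := a :* a) refl
  identity-98 = solve 4 (λ a b c d → a :* (b :* c :* d) := (a :* b) :* (c :* d)) refl
  identity-99 = solve 5 (λ a b c d e → b :* d :- e := (a :* b :- b :* c) :- (a :* b :- b :* c :- b :* d :+ e)) refl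
  identity-100 = solve 3 (λ a b c → a :* b :- b :* (c :* a) := (1# :- c) :* (a :* b)) refl
  identity-101 = solve 3 (λ a b c → a :- (1# :+ c) :* (a :- b) := (1# :+ c) :* b :- (c :* a) :* 1#) refl
  identity-102 = solve 6 (λ a b c d e f → (a :* (b :* c)) :* d :* e :* f := 1# :* ((a :* (b :* c) :* f) :* d :* e)) refl
  identity-103 = solve 5 (λ a b c d e → (a :* b) :* (c :* d :* e) := a :* (b :* c :* d :* e)) refl
  identity-104 = solve 2 (λ a b → a :* b := (1# :+ a) :* b :- b) refl
  identity-105 = solve 3 (λ a b c → a :* (b :* c :+ b :* c) := (a :+ a) :* c :* b) refl
  identity-106 = solve 2 (λ a b → a :+ b :- b := a) refl
  identity-107 = solve 1 (λ a → 0# := a :- a :- a :+ a) refl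
  identity-108 = solve 1 (λ a → 0# := a :- a :- 0# :+ 0#) refl
  identity-109 = solve 1 (λ a → 0# := a :- 0# :- a :+ 0#) refl
  identity-110 = solve 1 (λ a → a := a :- 0# :- 0# :+ 0#) refl
  identity-111 = solve 3 (λ a b c → a :* b :* c := b :* (a :* c)) refl
  identity-112 = solve 3 (λ a b c → a :* (b :* c) := b :* (c :* a)) refl
  identity-113 = solve 4 (λ a b c d → (a :* b) :* (c :* d) := a :* (c :* (d :* b))) refl
  identity-114 = solve 4 (λ a b c d → (1# :* a) :* ((b :* c) :* d) := (b :* (a :* c)) :* d) refl
  identity-115 = solve 6 (λ a b c d e f → a :* ((b :* c) :* d :* e :* f) := (a :* c) :* (d :* (b :* e :* f))) refl
  identity-116 = solve 8 (λ a b c d e f g h → a :* (b :* ((c :* d) :* (e :* (f :* (g :* h))))) := (c :* f) :* ((d :* (b :* g :* (a :* e))) :* h)) refl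
  identity-117 = solve 3 (λ a b c → 1# :- a :- c := (1# :- (a :+ b) :- c) :+ b) refl
  identity-118 = solve 4 (λ a b c d → (a :* b) :* (c :* d) := b :* ((a :* c) :* d)) refl
  identity-119 = solve 4 (λ a b c d → a :- b :- c :- a :* (1# :- d) := a :* d :- (b :+ c)) refl
  identity-120 = solve 2 (λ a b → 1# :- (1# :+ a) :* b := (1# :+ a) :* (1# :- b) :- a) refl
  identity-121 = solve 4 (λ a b c d → (a :* b) :* c :* d := (b :* d) :* (a :* c)) refl
  identity-122 = solve 3 (λ a b c → (c :* (b :+ b) :- c) :* a := c :* (a :* b :+ a :* b :- a)) refl
  identity-123 = solve 4 (λ a b c d → (a :* b) :* (c :* d) := c :* (a :* (b :* d))) refl
  identity-124 = solve 1 (λ a → 1# := (1# :+ a) :* (1# :- a) :+ a :* a) refl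
  identity-125 = solve 1 (λ a → 1# :- (1# :- a) := a) refl
  identity-126 = solve 2 (λ a b → (1# :- a) :* (1# :- b) := (1# :- a :- b) :+ a :* b) refl
  identity-127 = solve 3 (λ a b c → a :* (b :* c) := c :* b :* a) refl
  identity-128 = solve 5 (λ a b c d e → a :* b :* (c :* d :* e) := (a :* (c :* d)) :* b :* e) refl
  identity-129 = solve 5 (λ a b c d e → a :* ((b :* c) :* (d :* e)) := a :* (b :* c :* (d :* e))) refl
  identity-130 = solve 6 (λ a b c d e f → a :* b :* (c :* d :* (e :* f)) := (a :* (c :* b :* f)) :* (d :* e)) refl
  identity-131 = solve 4 (λ a b c d → a :* (b :* (c :* d)) := (a :* c) :* (d :* b)) refl
  identity-132 = solve 4 (λ a b c d → (a :* b) :* (a :* c :* d) := (a :* a) :* (b :* (c :* d))) refl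
  identity-133 = solve 1 (λ a → neg (a :- 1#) := 1# :- a) refl
  identity-134 = solve 4 (λ a b c d → a :* (b :* c) :* d := c :* (a :* b :* d)) refl
  identity-135 = solve 3 (λ a b c → a :* b :* c := a :* c :* b) refl
  identity-136 = solve 2 (λ a b → a :* b :+ a :* b := (1# :+ 1#) :* a :* b) refl
  identity-137 = solve 3 (λ a b c → a :* a :* (b :* b :* c) := (a :* b) :* (a :* b) :* c) refl
  identity-138 = solve 3 (λ a b c → a :* (b :* c) := (a :* c) :* b) refl
  identity-139 = solve 3 (λ a b c → (a :* b) :* (c :+ c) := a :* ((b :+ b) :* c)) refl
  identity-140 = solve 2 (λ a b → (a :+ a) :* b := a :* b :+ a :* b) refl
  identity-141 = solve 2 (λ a b → (1# :+ a) :* b :- b := a :* b) refl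
  identity-142 = solve 3 (λ a b c → a :* b :* (b :* c) := (a :* c) :* (b :* b)) refl
  identity-143 = solve 2 (λ a b → a :* b :* (b :* a) := a :* b :* (a :* b)) refl
  identity-144 = solve 5 (λ a b c d e → (a :- (b :* c :- d :* e)) :+ (a :- (b :* c :- d :* e)) := (d :+ d) :* e :- ((b :+ b) :* c :- (a :+ a))) refl
  identity-145 = solve 2 (λ a b → a :* b :+ b := (1# :+ a) :* b) refl
  identity-146 = solve 2 (λ a b → a :* 0# :- b :* 0# := 0#) refl
  identity-147 = solve 5 (λ a b c d e → a :* (1# :+ c) :- b :* (d :+ e) := (a :* c :- b :* e) :+ (a :- b :* d)) refl
  identity-148 = solve 2 (λ a b → a := a :+ b :- b) refl
  identity-149 = solve 2 (λ a b → (a :+ b) :* (a :+ b) := a :* a :+ (1# :+ 1#) :* (a :* b) :+ b :* b) refl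
  identity-150 = solve 1 (λ a → (1# :- a) :* 1# :+ a :* 1# := 1#) refl
  identity-151 = solve 3 (λ a b c → (1# :- a) :* (b :+ c) :+ a :* c := (1# :- a) :* b :+ c) refl
  identity-152 = solve 3 (λ a b c → a :- b :+ c := a :+ c :- b) refl
  identity-153 = solve 4 (λ a b c d → (a :+ b) :* (c :* d) := (a :* c) :* d :+ c :* (b :* d)) refl
  identity-154 = solve 6 (λ a b c d e f → (a :* b) :* c :+ e :* (d :* f) := a :* (b :* c) :+ d :* (e :* f)) refl
  identity-155 = solve 2 (λ a b → a :* (1# :* b) := a :* b) refl
  identity-156 = solve 2 (λ a b → a :* b := a :* (1# :* b)) refl
  identity-157 = solve 4 (λ a b c d → a :* b :+ (c :+ a :* d) := c :+ a :* (b :+ d)) refl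
  identity-158 = solve 6 (λ a b c d e f → (a :* b :+ d :* e) :+ (a :* c :+ d :* f) := a :* (b :+ c) :+ d :* (e :+ f)) refl
  identity-159 = solve 2 (λ a b → a :* (b :* 1#) := a :* b) refl
  identity-160 = solve 2 (λ a b → b :* (1# :* 1#) :+ a :* 1# := (a :+ b) :* (1# :* 1#)) refl
  identity-161 = solve 4 (λ a b c d → (a :* c :+ b :* (c :+ d :* 1#)) :+ a :* d := (a :+ b) :* (c :+ d :* 1#)) refl
  identity-162 = solve 5 (λ a b c d e → a :+ b :+ c :* (d :+ e) := (a :+ c :* d) :+ (b :+ c :* e)) refl
  identity-163 = solve 3 (λ a b c → a :* (b :- c) := a :* b :- a :* c) refl
  identity-164 = solve 5 (λ a b c d e → (a :* b :- c) :+ d :* (b :- e) := (a :+ d) :* b :- (c :+ d :* e)) refl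
  identity-165 = solve 4 (λ a b c d → a :* (b :* c :* d) := (d :* a) :* (c :* b)) refl
  identity-166 = solve 4 (λ a b c d → (b :- a) :* (d :- (neg c)) :+ (b :- (neg a)) :* (d :- c) := (b :* d :- a :* c) :+ (b :* d :- a :* c)) refl
  identity-167 = solve 4 (λ a b c d → (b :- a) :* (d :- c) :+ (b :- (neg a)) :* (d :- (neg c)) := (b :* d :- (neg (a :* c))) :+ (b :* d :- (neg (a :* c)))) refl
  identity-168 = solve 3 (λ a b c → (a :+ b) :* c := a :* c :+ b :* c) refl
  identity-169 = solve 2 (λ a b → (1# :+ b) :* a := a :+ b :* a) refl
  identity-170 = solve 1 (λ a → neg (neg a) := a) refl
  identity-171 = solve 5 (λ a b c d e → (a :+ b) :* (c :+ b :- d) :+ b :* (e :+ d) := (c :+ b) :* a :+ b :* (c :+ e :+ b) :- a :* d) refl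
  identity-172 = solve 1 (λ a → a :+ a :+ (a :+ a) := a :* (1# :+ (1# :+ (1# :+ 1#)))) refl
  identity-173 = solve 5 (λ a b c d e → (a :+ (b :+ b) :- c) :+ ((c :+ b :- d) :+ (e :- (a :+ (b :+ b :+ (b :+ b))))) := e :- (d :+ b)) refl
  identity-174 = solve 4 (λ a b c d → (c :- (a :+ (b :+ b))) :+ (d :+ b :- c) := d :- (a :+ b)) refl
  identity-175 = solve 3 (λ a b c → (a :+ b) :* (1# :+ b) :+ b :* c := a :+ b :* (a :+ (1# :+ b) :+ c)) refl
  identity-176 = solve 1 (λ a → (a :+ a :+ a) :+ a :+ a := a :* (1# :+ (1# :+ (1# :+ (1# :+ 1#))))) refl
  identity-177 = solve 2 (λ a b → a :+ b :+ (b :+ b :+ b) :+ b := a :+ ((b :+ b :+ b) :+ b :+ b)) refl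
  identity-178 = solve 5 (λ a b c d e → (c :- (d :+ (e :+ e :+ e))) :+ ((a :+ e :- c) :+ (d :+ e :- b)) := a :- (b :+ e)) refl
  identity-179 = solve 3 (λ a b c → c :- (a :- b) := b :+ c :- a) refl
  identity-180 = solve 2 (λ a b → a :* b :+ a :* b := a :* ((1# :+ 1#) :* b)) refl
  identity-181 = solve 4 (λ a b c d → (1# :+ a) :* b :+ (c :+ d) := (b :+ d) :+ (a :* b :+ c)) refl
  identity-182 = solve 2 (λ a b → a :+ a :* b := a :* (1# :+ b)) refl
  identity-183 = solve 4 (λ a b c d → a :* (b :* (c :* d)) := (a :* d) :* (b :* c)) refl
  identity-184 = solve 2 (λ a b → a :- (neg (b :- 1#)) := b :- (1# :- a)) refl
  identity-185 = solve 2 (λ a b → a :- (b :- 1#) := 1# :+ a :- b) refl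
  identity-186 = solve 3 (λ a b c → (b :* (1# :- c) :+ a) :- b := a :- b :* c) refl
  identity-187 = solve 2 (λ a b → a :* (b :+ b) := (1# :+ 1#) :* (b :* a)) refl
  identity-188 = solve 2 (λ a b → (1# :+ 1#) :* (a :* b) := a :* (1# :+ 1#) :* b) refl
  identity-189 = solve 5 (λ a b c d e → a :* (b :* c :* d :* e) := b :* (c :* d :* (e :* a))) refl
  identity-190 = solve 4 (λ a b c d → a :* (b :* c :* d) := (a :* (b :* d)) :* c) refl
  identity-191 = solve 3 (λ a b c → b :* a :+ a :* c := a :* (b :+ c)) refl
  identity-192 = solve 4 (λ a b c d → (a :* b :* (c :+ c) :+ d) :+ (a :* b :* (c :+ c) :+ d) := (a :+ a :+ (a :+ a)) :* (b :* c) :+ (d :+ d)) refl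
  identity-193 = solve 2 (λ a b → a :* b :+ a :* b := (a :+ a) :* b) refl
  identity-194 = solve 4 (λ a b c d → (c :* d) :* (a :* (b :+ b)) := (c :+ c) :* (a :* (b :* d))) refl
  identity-195 = solve 2 (λ a b → a :+ b := a :- (neg b)) refl
  identity-196 = solve 5 (λ a b c d e → a :* ((b :+ ((d :+ d :* e) :+ (d :+ d :* e))) :* c :+ 1#) := (b :* c :+ 1#) :* a :+ (c :+ c) :* (d :* a) :+ (c :+ c) :* (d :* (a :* e))) refl
  identity-197 = solve 6 (λ a b c d e f → a :* (e :* (b :* f)) :+ c :* (e :* (b :* f)) :+ c :* (e :* (b :* f :+ d :* f)) := (a :* b :+ (c :* b :+ c :* (b :+ d))) :* (e :* f)) refl
  identity-198 = solve 3 (λ a b c → (a :* b :+ a :* b) :* c := (b :+ b) :* (a :* c)) refl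
  identity-199 = solve 4 (λ a b c d → a :* b :* c :- (1# :+ a) :* d := a :* (b :* c :- d) :- d) refl

 -- Finite sums, indicators and counting over lists

 module Sums where

  open import Data.List.Base using ([]; _∷_)
  open import Data.Nat.Base as ℕ using (zero; suc)
  open Field public
  open Identities public

  private variable
    A B : Set

  module _ where

    gap : ∀ {a b} d → 0ℚ ≤ d → b ≡ a + d → a ≤ b
    gap {a} d 0≤d refl = subst (_≤ a + d) (+-identityʳ a) (+-monoʳ-≤ a 0≤d)

    0≤+ : ∀ {a b} → 0ℚ ≤ a → 0ℚ ≤ b → 0ℚ ≤ a + b
    0≤+ {a} {b} p q = subst (_≤ a + b) (+-identityˡ 0ℚ) (+-mono-≤ p q)

    *-mono : ∀ {a b c d} → 0ℚ ≤ a → 0ℚ ≤ d → a ≤ b → c ≤ d → a * c ≤ b * d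
    *-mono {a} {b} {c} {d} 0≤a 0≤d p q = ≤-trans (*ˡ a 0≤a q) (*ʳ d 0≤d p)

    0≤- : ∀ {a b} → a ≤ b → 0ℚ ≤ b - a
    0≤- {a} {b} p = subst (_≤ b - a) (+-inverseʳ a) (+-monoˡ-≤ (- a) p)

    -≤0⇒≤ : ∀ {a b} → 0ℚ ≤ b - a → a ≤ b
    -≤0⇒≤ {a} {b} p = gap (b - a) p (identity-1 a b)

    ≤-half : ∀ {a} → 0ℚ ≤ a + a → 0ℚ ≤ a
    ≤-half {a} h with ≤-total 0ℚ a
    ... | inj₁ p = p
    ... | inj₂ q = ≤-trans h (subst (a + a ≤_) (+-identityʳ a) (+-monoʳ-≤ a q))

    ι-+ : ∀ m n → ι (m ℕ.+ n) ≡ ι m + ι n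
    ι-+ zero n = sym (trans (cong (_+ ι n) ι0) (+-identityˡ (ι n)))
    ι-+ (suc m) n = trans (ι-suc (m ℕ.+ n)) (trans (cong (1ℚ +_) (ι-+ m n))
      (trans (sym (+-assoc 1ℚ (ι m) (ι n))) (cong (_+ ι n) (sym (ι-suc m)))))

    ι-* : ∀ m n → ι (m ℕ.* n) ≡ ι m * ι n
    ι-* zero n = trans ι0 (sym (trans (cong (_* ι n) ι0) (*-zeroˡ (ι n))))
    ι-* (suc m) n = trans (ι-+ n (m ℕ.* n)) (trans (cong (ι n +_) (ι-* m n))
      (trans (identity-2 (ι n) (ι m)) (cong (_* ι n) (sym (ι-suc m)))))

    ι-mono : ∀ {m n} → m ℕ.≤ n → ι m ≤ ι n
    ι-mono {m} h with ℕP.m≤n⇒∃[o]m+o≡n h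
    ... | o , refl = gap (ι o) (0≤ι o) (ι-+ m o)

    ι-cancel : ∀ {m n} → ι m ≤ ι n → m ℕ.≤ n
    ι-cancel {m} {n} h with ℕP.≤-<-connex m n
    ... | inj₁ p = p
    ... | inj₂ q = contradiction (≤-trans (ι-mono q) h) λ r →
      <⇒≱ (subst₂ _<_ (+-identityˡ (ι n)) (sym (ι-suc n)) (+-monoˡ-< (ι n) 0<1)) r
      where
      <⇒≱ : ∀ {a b} → a < b → ¬ (b ≤ a)
      <⇒≱ p q = <-irrefl refl (<-≤-trans p q)

  module _ where

    ι*inv : ∀ {c} → 1 ℕ.≤ c → ι c * inv c ≡ 1ℚ
    ι*inv {c} h = trans (*-comm (ι c) (inv c)) (inv*ι h)

    1≤ι : ∀ {c} → 1 ℕ.≤ c → 1ℚ ≤ ι c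
    1≤ι {c} h = subst (_≤ ι c) ι1 (ι-mono h)

    ι-cancelˡ : ∀ {c a b} → 1 ℕ.≤ c → ι c * a ≤ ι c * b → a ≤ b
    ι-cancelˡ {c} {a} {b} h p = subst₂ _≤_ (lem a) (lem b) (*ˡ (inv c) (0≤inv c) p)
      where
      lem : ∀ a → inv c * (ι c * a) ≡ a
      lem a = trans (sym (*-assoc (inv c) (ι c) a)) (trans (cong (_* a) (inv*ι h)) (*-identityˡ a))

  ∑ : List A → (A → ℚ) → ℚ
  ∑ []       f = 0ℚ
  ∑ (x ∷ xs) f = f x + ∑ xs f

  module _ where

    ∑-cong : ∀ (xs : List A) {f g : A → ℚ} → (∀ x → f x ≡ g x) → ∑ xs f ≡ ∑ xs g
    ∑-cong []       h = refl
    ∑-cong (x ∷ xs) h = cong₂ _+_ (h x) (∑-cong xs h)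

    ∑-mono∈ : ∀ (xs : List A) {f g : A → ℚ} → (∀ {x} → x ∈ xs → f x ≤ g x) → ∑ xs f ≤ ∑ xs g
    ∑-mono∈ []       h = ≤-refl
    ∑-mono∈ (x ∷ xs) h = +-mono-≤ (h (here refl)) (∑-mono∈ xs (h ∘ there))

    ∑-mono : ∀ (xs : List A) {f g : A → ℚ} → (∀ x → f x ≤ g x) → ∑ xs f ≤ ∑ xs g
    ∑-mono xs h = ∑-mono∈ xs λ {x} _ → h x

    ∑-0 : ∀ (xs : List A) → ∑ xs (λ _ → 0ℚ) ≡ 0ℚ
    ∑-0 []       = refl
    ∑-0 (x ∷ xs) = trans (+-identityˡ _) (∑-0 xs)

    ∑-0≤ : ∀ (xs : List A) {f : A → ℚ} → (∀ x → 0ℚ ≤ f x) → 0ℚ ≤ ∑ xs f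
    ∑-0≤ xs h = subst (_≤ ∑ xs _) (∑-0 xs) (∑-mono xs h)

    ∑-+ : ∀ (xs : List A) (f g : A → ℚ) → ∑ xs (λ x → f x + g x) ≡ ∑ xs f + ∑ xs g
    ∑-+ []       f g = sym (+-identityˡ 0ℚ)
    ∑-+ (x ∷ xs) f g = trans (cong (f x + g x +_) (∑-+ xs f g)) (identity-3 (f x) (g x) (∑ xs f) (∑ xs g))

    ∑-*ˡ : ∀ (xs : List A) c (f : A → ℚ) → ∑ xs (λ x → c * f x) ≡ c * ∑ xs f
    ∑-*ˡ []       c f = sym (*-zeroʳ c)
    ∑-*ˡ (x ∷ xs) c f = trans (cong (c * f x +_) (∑-*ˡ xs c f)) (sym (*-distribˡ-+ c (f x) (∑ xs f)))

    ∑-*ʳ : ∀ (xs : List A) c (f : A → ℚ) → ∑ xs (λ x → f x * c) ≡ ∑ xs f * c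
    ∑-*ʳ xs c f = trans (∑-cong xs λ x → *-comm (f x) c) (trans (∑-*ˡ xs c f) (*-comm c (∑ xs f)))

    ∑-neg : ∀ (xs : List A) (f : A → ℚ) → ∑ xs (λ x → - f x) ≡ - ∑ xs f
    ∑-neg []       f = sym neg-0
    ∑-neg (x ∷ xs) f = trans (cong (- f x +_) (∑-neg xs f)) (sym (neg-distrib-+ (f x) (∑ xs f)))

    ∑-- : ∀ (xs : List A) (f g : A → ℚ) → ∑ xs (λ x → f x - g x) ≡ ∑ xs f - ∑ xs g
    ∑-- xs f g = trans (∑-+ xs f (λ x → - g x)) (cong (∑ xs f +_) (∑-neg xs g))

    ∑-const : ∀ (xs : List A) c → ∑ xs (λ _ → c) ≡ ι (length xs) * c
    ∑-const []       c = sym (trans (cong (_* c) ι0) (*-zeroˡ c))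
    ∑-const (x ∷ xs) c = trans (cong (c +_) (∑-const xs c)) (trans (identity-2 c (ι (length xs))) (cong (_* c) (sym (ι-suc (length xs)))))

    ∑-swap : ∀ (xs : List A) (ys : List B) (f : A → B → ℚ) →
      ∑ xs (λ x → ∑ ys (f x)) ≡ ∑ ys (λ y → ∑ xs (λ x → f x y))
    ∑-swap []       ys f = sym (∑-0 ys)
    ∑-swap (x ∷ xs) ys f = trans (cong (∑ ys (f x) +_) (∑-swap xs ys f)) (sym (∑-+ ys (f x) (λ y → ∑ xs (λ x → f x y))))

    ∑-++ : ∀ (xs ys : List A) (f : A → ℚ) → ∑ (xs ++ ys) f ≡ ∑ xs f + ∑ ys f
    ∑-++ []       ys f = sym (+-identityˡ _)
    ∑-++ (x ∷ xs) ys f = trans (cong (f x +_) (∑-++ xs ys f)) (sym (+-assoc (f x) _ _))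

    ∑-map : ∀ (g : A → B) (xs : List A) (f : B → ℚ) → ∑ (map g xs) f ≡ ∑ xs (f ∘ g)
    ∑-map g []       f = refl
    ∑-map g (x ∷ xs) f = cong (f (g x) +_) (∑-map g xs f)

    ∑-concatMap : ∀ (g : A → List B) (xs : List A) (f : B → ℚ) → ∑ (concatMap g xs) f ≡ ∑ xs (λ x → ∑ (g x) f)
    ∑-concatMap g []       f = refl
    ∑-concatMap g (x ∷ xs) f = trans (∑-++ (g x) (concatMap g xs) f) (cong (∑ (g x) f +_) (∑-concatMap g xs f))

    ∑-≤∈ : ∀ {xs : List A} {f : A → ℚ} → (∀ x → 0ℚ ≤ f x) → ∀ {x} → x ∈ xs → f x ≤ ∑ xs f
    ∑-≤∈ {xs = y ∷ xs} {f} h (here refl) = gap (∑ xs f) (∑-0≤ xs h) refl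
    ∑-≤∈ {xs = y ∷ xs} {f} h {x} (there p) = ≤-trans (∑-≤∈ h p) (gap (f y) (h y) (+-comm (f y) _))

    cancel-≤ : ∀ a b c d → a + c ≤ b + d → b ≤ a → c ≤ d
    cancel-≤ a b c d p q = -≤0⇒≤ (subst (0ℚ ≤_) (identity-4 a b c d) (0≤+ (0≤- p) (0≤- q)))

    ∑-exists : ∀ (xs : List A) (f g : A → ℚ) → 1 ℕ.≤ length xs → ∑ xs f ≤ ∑ xs g → Σ[ x ∈ A ] x ∈ xs × f x ≤ g x
    ∑-exists (x ∷ []) f g h p = x , here refl , subst₂ _≤_ (+-identityʳ (f x)) (+-identityʳ (g x)) p
    ∑-exists (x ∷ xs@(_ ∷ _)) f g h p = go (≤-total (f x) (g x)) (λ q → ∑-exists xs f g (s≤s z≤n) (cancel-≤ (f x) (g x) (∑ xs f) (∑ xs g) p q))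
      where
      go : f x ≤ g x ⊎ g x ≤ f x → (g x ≤ f x → Σ[ y ∈ _ ] y ∈ xs × f y ≤ g y) → Σ[ y ∈ _ ] y ∈ (x ∷ xs) × f y ≤ g y
      go (inj₁ q) k = x , here refl , q
      go (inj₂ q) k with k q
      ... | z , z∈ , r = z , there z∈ , r

  ind : {P : Set} → Dec P → ℚ
  ind d = if does d then 1ℚ else 0ℚ

  module _ where

    ind-yes : ∀ {P : Set} (d : Dec P) → P → ind d ≡ 1ℚ
    ind-yes (yes _) p = refl
    ind-yes (no ¬p) p = contradiction p ¬p

    ind-no : ∀ {P : Set} (d : Dec P) → ¬ P → ind d ≡ 0ℚ
    ind-no (yes p) ¬p = contradiction p ¬p
    ind-no (no _)  ¬p = refl

    0≤ind : ∀ {P : Set} (d : Dec P) → 0ℚ ≤ ind d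
    0≤ind (yes _) = 0≤1
    0≤ind (no _)  = ≤-refl

    ind≤1 : ∀ {P : Set} (d : Dec P) → ind d ≤ 1ℚ
    ind≤1 (yes _) = ≤-refl
    ind≤1 (no _)  = 0≤1

    ind-mono : ∀ {P R : Set} (d : Dec P) (e : Dec R) → (P → R) → ind d ≤ ind e
    ind-mono (yes p) e h = ≤-reflexive (sym (ind-yes e (h p)))
    ind-mono (no _)  e h = 0≤ind e

    ind-cong : ∀ {P R : Set} (d : Dec P) (e : Dec R) → (P → R) → (R → P) → ind d ≡ ind e
    ind-cong d e h k = ≤-antisym (ind-mono d e h) (ind-mono e d k)

    ind-*-cong : ∀ {P : Set} (d : Dec P) {a b} → (P → a ≡ b) → ind d * a ≡ ind d * b
    ind-*-cong (yes p) h = cong (1ℚ *_) (h p)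
    ind-*-cong (no _)  {a} {b} h = trans (*-zeroˡ a) (sym (*-zeroˡ b))

  count : {P : A → Set} → (∀ x → Dec (P x)) → List A → ℕ
  count P? []       = 0
  count P? (x ∷ xs) = (if does (P? x) then 1 else 0) ℕ.+ count P? xs

  module _ where

    ι-count : ∀ {P : A → Set} (P? : ∀ x → Dec (P x)) xs → ι (count P? xs) ≡ ∑ xs (ind ∘ P?)
    ι-count P? []       = ι0
    ι-count P? (x ∷ xs) = trans (ι-+ (if does (P? x) then 1 else 0) _) (cong₂ _+_ (lem (P? x)) (ι-count P? xs))
      where
      lem : ∀ {P : Set} (d : Dec P) → ι (if does d then 1 else 0) ≡ ind d
      lem (yes _) = ι1
      lem (no _)  = ι0

    count-mono : ∀ {P R : A → Set} (P? : ∀ x → Dec (P x)) (R? : ∀ x → Dec (R x)) xs →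
      (∀ x → P x → R x) → count P? xs ℕ.≤ count R? xs
    count-mono P? R? xs h = ι-cancel (subst₂ _≤_ (sym (ι-count P? xs)) (sym (ι-count R? xs))
      (∑-mono xs λ x → ind-mono (P? x) (R? x) (h x)))

    count-cong : ∀ {P R : A → Set} (P? : ∀ x → Dec (P x)) (R? : ∀ x → Dec (R x)) xs →
      (∀ x → P x → R x) → (∀ x → R x → P x) → count P? xs ≡ count R? xs
    count-cong P? R? xs h k = ℕP.≤-antisym (count-mono P? R? xs h) (count-mono R? P? xs k)

    count-pos : ∀ {P : A → Set} (P? : ∀ x → Dec (P x)) {xs x} → x ∈ xs → P x → 1 ℕ.≤ count P? xs
    count-pos P? {x = x} (here refl) p with P? x
    ... | yes _ = s≤s z≤n
    ... | no ¬p = contradiction p ¬p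
    count-pos P? {y ∷ ys} (there i) p = ℕP.≤-trans (count-pos P? i p) (ℕP.m≤n+m _ _)

    count≤length : ∀ {P : A → Set} (P? : ∀ x → Dec (P x)) xs → count P? xs ℕ.≤ length xs
    count≤length P? []       = z≤n
    count≤length P? (x ∷ xs) with P? x
    ... | yes _ = s≤s (count≤length P? xs)
    ... | no _  = ℕP.m≤n⇒m≤1+n (count≤length P? xs)

 -- Powers, Bernoulli's inequality and rational logarithms

 module Logarithms where

  open import Data.Nat.Base as ℕ using (zero; suc)
  open Sums

  pw : ℚ → ℕ → ℚ
  pw b zero    = 1ℚ
  pw b (suc k) = b * pw b k

  module _ where

    plus-0 : ∀ {a} → a ≤ 0ℚ → plus a ≡ 0ℚ
    plus-0 {a} h = ≤-antisym (plus-lub ≤-refl h) (0≤plus a)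

    plus≡ : ∀ {a} → 0ℚ ≤ a → plus a ≡ a
    plus≡ {a} h = ≤-antisym (plus-lub h ≤-refl) (≤plus a)

    plus-split : ∀ a → plus a ≡ a + plus (- a)
    plus-split a with ≤-total 0ℚ a
    ... | inj₁ p = trans (plus≡ p) (sym (trans (cong (a +_) (plus-0 (subst (- a ≤_) neg-0 (neg-≤ p)))) (+-identityʳ a)))
    ... | inj₂ q = trans (plus-0 q) (sym (trans (cong (a +_) (plus≡ (subst (_≤ - a) neg-0 (neg-≤ q)))) (+-inverseʳ a)))

    pw-+ : ∀ b m n → pw b (m ℕ.+ n) ≡ pw b m * pw b n
    pw-+ b zero n = sym (*-identityˡ _)
    pw-+ b (suc m) n = trans (cong (b *_) (pw-+ b m n)) (sym (*-assoc b _ _))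

    pw-0≤ : ∀ {b} → 0ℚ ≤ b → ∀ n → 0ℚ ≤ pw b n
    pw-0≤ h zero = 0≤1
    pw-0≤ h (suc n) = 0≤* h (pw-0≤ h n)

    pw-mono : ∀ {a b} → 0ℚ ≤ a → a ≤ b → ∀ n → pw a n ≤ pw b n
    pw-mono p q zero = ≤-refl
    pw-mono p q (suc n) = *-mono p (pw-0≤ (≤-trans p q) n) q (pw-mono p q n)

    pw-1≤ : ∀ {b} → 1ℚ ≤ b → ∀ n → 1ℚ ≤ pw b n
    pw-1≤ {b} h zero = ≤-refl
    pw-1≤ {b} h (suc n) = subst (_≤ b * pw b n) (*-identityʳ 1ℚ) (*-mono 0≤1 (pw-0≤ (≤-trans 0≤1 h) n) h (pw-1≤ h n))

    pw-* : ∀ a b n → pw (a * b) n ≡ pw a n * pw b n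
    pw-* a b zero = sym (*-identityˡ 1ℚ)
    pw-* a b (suc n) = trans (cong (a * b *_) (pw-* a b n)) (identity-14 a b (pw a n) (pw b n))

    pw-∸ : ∀ b m n → pw b (m ℕ.* n) ≡ pw (pw b n) m
    pw-∸ b zero n = refl
    pw-∸ b (suc m) n = trans (pw-+ b n (m ℕ.* n)) (cong (pw b n *_) (pw-∸ b m n))

    pw-ι : ∀ m n → pw (ι m) n ≡ ι (m ℕ.^ n)
    pw-ι m zero = sym ι1
    pw-ι m (suc n) = trans (cong (ι m *_) (pw-ι m n)) (sym (ι-* m (m ℕ.^ n)))

    bernoulli : ∀ {x} → 0ℚ ≤ x → ∀ n → 1ℚ + ι n * x ≤ pw (1ℚ + x) n
    bernoulli {x} h zero = ≤-reflexive (trans (cong (λ z → 1ℚ + z * x) ι0) (identity-16 x))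
    bernoulli {x} h (suc n) = ≤-trans
      (gap (x * (ι n * x)) (0≤* h (0≤* (0≤ι n) h)) (trans (identity-17 x (ι n)) (cong (λ z → 1ℚ + z * x + x * (ι n * x)) (sym (ι-suc n)))))
      (*ˡ (1ℚ + x) (0≤+ 0≤1 h) (bernoulli h n))

    *-cancel-pos : ∀ {a b} c → 1ℚ ≤ c → a * c ≤ b * c → a ≤ b
    *-cancel-pos c h = *-cancelʳ-≤ c (<-≤-trans 0<1 h)

  square-0≤ : ∀ u → 0ℚ ≤ u * u
  square-0≤ u with ≤-total 0ℚ u
  ... | inj₁ p = 0≤* p p
  ... | inj₂ p = ≤≡ (0≤* 0≤-u 0≤-u) (identity-97 u)
    where
    0≤-u : 0ℚ ≤ - u
    0≤-u = subst (_≤ - u) neg-0 (neg-≤ p)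

  -- A conditional meant for `pick-elim`, whose explicit motive splits the decision without
  -- abstracting it from a large goal.
  pick : {P C : Set} → Dec P → C → C → C
  pick (yes _) a b = a
  pick (no _)  a b = b

  pick-elim : ∀ {P C : Set} (T : C → Set) (d : Dec P) {a b} → (P → T a) → (¬ P → T b) → T (pick d a b)
  pick-elim T (yes p) f g = f p
  pick-elim T (no ¬p) f g = g ¬p

  -- Floors of logarithms to the base 1 + 1/N.
  module Log (N : ℕ) (1≤N : 1 ℕ.≤ N) where

    β : ℚ
    β = 1ℚ + inv N

    module _ where

      1≤β : 1ℚ ≤ β
      1≤β = gap (inv N) (0≤inv N) refl

      0≤β : 0ℚ ≤ β
      0≤β = ≤-trans 0≤1 1≤β

      β^≥ : ∀ n → 1ℚ + ι n * inv N ≤ pw β n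
      β^≥ = bernoulli (0≤inv N)

      -- Multiplying `1 - (m + 1) x` by `1 + x` gives `1 - m x - (m + 1) x²`, so the product can
      -- only decrease with `m`. Together with `β^≥` this encloses the powers of `β` from both
      -- sides.
      β^≤ : ∀ m → (1ℚ - ι m * inv N) * pw β m ≤ 1ℚ
      β^≤ zero = ≤-reflexive (trans (cong (λ z → (1ℚ - z * inv N) * 1ℚ) ι0) (identity-12 (inv N)))
      β^≤ (suc m) = ≤-trans (gap (ι (suc m) * x * x * pw β m)
          (0≤* (0≤* (0≤* (0≤ι (suc m)) (0≤inv N)) (0≤inv N)) (pw-0≤ 0≤β m))
          (trans (identity-13 (ι m) x (pw β m)) (cong (λ z → (1ℚ - z * x) * ((1ℚ + x) * pw β m) + z * x * x * pw β m) (sym (ι-suc m)))))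
        (β^≤ m)
        where
        x : ℚ
        x = inv N

      β^-cancel : ∀ {a b} → pw β a ≤ pw β b → a ℕ.≤ b
      β^-cancel {a} {b} h with ℕP.≤-<-connex a b
      ... | inj₁ p = p
      ... | inj₂ q with ℕP.m≤n⇒∃[o]m+o≡n q
      ... | o , refl = contradiction (*-cancel-pos (pw β b) (pw-1≤ 1≤β b)
          (subst₂ _≤_ (trans (cong (pw β) (ℕP.+-comm (suc b) o)) (trans (cong (pw β) (ℕP.+-suc o b)) (pw-+ β (suc o) b))) (sym (*-identityˡ _)) h))
          λ k → <-irrefl refl (<-≤-trans (<-≤-trans 1<β (subst (_≤ β * pw β o) (*-identityʳ β) (*ˡ β 0≤β (pw-1≤ 1≤β o)))) k)
        where
        0<inv : 0ℚ < inv N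
        0<inv = *-cancelʳ-< (ι N) (0≤ι N)
          (subst₂ _<_ (sym (*-zeroˡ (ι N))) (sym (inv*ι 1≤N)) 0<1)
        1<β : 1ℚ < β
        1<β = subst (_< β) (+-identityʳ 1ℚ) (+-monoʳ-< 1ℚ 0<inv)

    search : ℚ → ℕ → ℕ
    search q zero = 0
    search q (suc k) = pick (pw β (suc k) ≤? q) (suc k) (search q k)

    opaque
      -- The search may start at the exponent `N * c`, since `β ^ (N * c) ≥ 1 + c` by Bernoulli's
      -- inequality. Opacity keeps the search from being unfolded in types.
      lg : ℕ → ℕ
      lg c = search (ι c) (N ℕ.* c)

    module _ where

      search-≤ : ∀ {q} → 1ℚ ≤ q → ∀ k → pw β (search q k) ≤ q
      search-≤ h zero = h
      search-≤ {q} h (suc k) = pick-elim (λ r → pw β r ≤ q) (pw β (suc k) ≤? q) id (λ _ → search-≤ h k)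

      search-> : ∀ q k → q ≤ pw β (suc k) → q ≤ pw β (suc (search q k))
      search-> q zero h = h
      search-> q (suc k) h = pick-elim (λ r → q ≤ pw β (suc r)) (pw β (suc k) ≤? q) (λ _ → h) (λ ¬p → search-> q k (<⇒≤ (≰⇒> ¬p)))

      opaque
        unfolding lg

        lg-≤ : ∀ {c} → 1 ℕ.≤ c → pw β (lg c) ≤ ι c
        lg-≤ {c} h = search-≤ (1≤ι h) (N ℕ.* c)

        lg-≥ : ∀ c → ι c ≤ pw β (suc (lg c))
        lg-≥ c = search-> (ι c) (N ℕ.* c) (≤-trans (≤-trans
          (gap 1ℚ 0≤1 (trans (+-comm 1ℚ _) (cong (_+ 1ℚ) (trans (cong (_* inv N) (trans (ι-* N c) (*-comm (ι N) (ι c))))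
            (trans (*-assoc (ι c) (ι N) (inv N)) (trans (cong (ι c *_) (ι*inv 1≤N)) (*-identityʳ _)))))))
          (β^≥ (N ℕ.* c)))
          (subst (_≤ pw β (suc (N ℕ.* c))) (*-identityˡ _) (*ʳ (pw β (N ℕ.* c)) (pw-0≤ 0≤β (N ℕ.* c)) 1≤β)))

    -- (p - m) / N is a lower bound for the logarithm of w
    record Low (w : ℚ) (p m : ℕ) : Set where
      constructor low
      field bound : pw β p ≤ w * pw β m

    val : ℕ → ℕ → ℚ
    val p m = (ι p - ι m) * inv N

    module _ where

      Low-ι : ∀ {c} → 1 ℕ.≤ c → Low (ι c) (lg c) 0
      Low-ι {c} h = low (subst (pw β (lg c) ≤_) (sym (*-identityʳ _)) (lg-≤ h))

      Low-inv : ∀ {c} → 1 ℕ.≤ c → Low (inv c) 0 (suc (lg c))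
      Low-inv {c} h = low (subst (_≤ inv c * pw β (suc (lg c))) (inv*ι h) (*ˡ (inv c) (0≤inv c) (lg-≥ c)))

      Low-* : ∀ {w w′ p p′ m m′} → Low w p m → Low w′ p′ m′ → Low (w * w′) (p ℕ.+ p′) (m ℕ.+ m′)
      Low-* {w} {w′} {p} {p′} {m} {m′} (low a) (low b) = low (subst₂ _≤_ (sym (pw-+ β p p′))
        (trans (identity-14 w (pw β m) w′ (pw β m′)) (cong (w * w′ *_) (sym (pw-+ β m m′))))
        (*-mono (pw-0≤ 0≤β p) (≤-trans (pw-0≤ 0≤β p′) b) a b))

      -- The discrete form of `ln w ≤ w - 1`: a nonnegative difference of exponents uses
      -- `1 + o / N ≤ β ^ o`, a negative one `(1 - o / N) β ^ o ≤ 1`.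
      log≤ : ∀ {w p m} → Low w p m → val p m ≤ w - 1ℚ
      log≤ {w} {p} {m} (low a) = go (ℕP.≤-total m p)
        where
        go : m ℕ.≤ p ⊎ p ℕ.≤ m → val p m ≤ w - 1ℚ
        go (inj₁ m≤p) with ℕP.m≤n⇒∃[o]m+o≡n m≤p
        ... | o , refl = ≡≤ (trans (cong (λ z → (z - ι m) * inv N) (ι-+ m o)) (identity-6 (ι m) (ι o) (inv N)))
            (+-monoˡ-≤ (- 1ℚ) (≤-trans (β^≥ o) (*-cancel-pos (pw β m) (pw-1≤ 1≤β m)
              (subst (_≤ w * pw β m) (trans (pw-+ β m o) (*-comm (pw β m) (pw β o))) a))))
        go (inj₂ p≤m) with ℕP.m≤n⇒∃[o]m+o≡n p≤m
        ... | o , refl = ≡≤ (trans (cong (λ z → (ι p - z) * inv N) (ι-+ p o)) (identity-7 (ι p) (ι o) (inv N)))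
            (+-monoˡ-≤ (- 1ℚ) (*-cancel-pos (pw β o) (pw-1≤ 1≤β o) (≤-trans (β^≤ o)
              (*-cancel-pos (pw β p) (pw-1≤ 1≤β p) (subst₂ _≤_ (sym (*-identityˡ _))
                (trans (cong (w *_) (trans (pw-+ β p o) (*-comm (pw β p) (pw β o)))) (sym (*-assoc w (pw β o) (pw β p)))) a)))))

      -- `N` is a multiple of `(h + 1)²` so that `θ - θ²`, which equals `h / (h + 1)²`, is a whole
      -- number of units `1 / N`.
      θ-gap : ∀ h N′ → N ≡ suc h ℕ.* suc h ℕ.* N′ → ι (h ℕ.* N′) * inv N ≡ inv (suc h) - inv (suc h) * inv (suc h)
      θ-gap h N′ eq = body
        where
        g = h ℕ.* N′
        θ = inv (suc h)
        NθθN′ : ι N ≡ ι (suc h) * ι (suc h) * ι N′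
        NθθN′ = trans (cong ι eq) (trans (ι-* (suc h ℕ.* suc h) N′) (cong (_* ι N′) (ι-* (suc h) (suc h))))
        body : ι g * inv N ≡ θ - θ * θ
        body = trans (sym (trans (cong (_* (ι g * inv N)) (trans (cong₂ _*_ one one) (*-identityʳ 1ℚ))) (*-identityˡ _)))
          (trans (cong (λ z → (θ * ι (suc h)) * (θ * ι (suc h)) * (z * inv N)) (ι-* h N′))
          (trans (identity-8 θ (ι (suc h)) (ι h) (ι N′) (inv N))
          (trans (cong (λ z → θ * θ * ι h * (z * inv N)) (sym NθθN′))
          (trans (cong (θ * θ * ι h *_) (ι*inv 1≤N))
          (trans (identity-9 θ (ι h)) (trans (cong (λ z → θ * (θ * z) - θ * θ) (sym (ι-suc h)))
            (cong (λ z → z - θ * θ) (trans (cong (θ *_) one) (*-identityʳ θ)))))))))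
          where
          one : θ * ι (suc h) ≡ 1ℚ
          one = inv*ι (s≤s z≤n)

      -- The logarithm of `1 + θ` is at least `θ - θ²`: by `β^≤`, the corresponding power of `β` is
      -- at most `1 / (1 - θ + θ²)`, and `(1 + θ) (1 - θ + θ²) = 1 + θ³` is at least one.
      Low-1+θ : ∀ h N′ → N ≡ suc h ℕ.* suc h ℕ.* N′ → Low (1ℚ + inv (suc h)) (h ℕ.* N′) 0
      Low-1+θ h N′ eq = low (subst (pw β g ≤_) (sym (*-identityʳ _))
        (*-cancelʳ-≤ ψ 0<ψ (≤-trans (subst (_≤ 1ℚ) (trans (*-comm (1ℚ - ι g * inv N) (pw β g))
          (cong (λ z → pw β g * z) ψ≡)) (β^≤ g)) (gap (θ * θ * θ) (0≤* (0≤* 0≤θ 0≤θ) 0≤θ) (identity-15 θ)))))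
        where
        g : ℕ
        g = h ℕ.* N′
        θ ψ : ℚ
        θ = inv (suc h)
        ψ = 1ℚ - θ + θ * θ
        0≤θ : 0ℚ ≤ θ
        0≤θ = 0≤inv (suc h)
        gN : ι g * inv N ≡ θ - θ * θ
        gN = θ-gap h N′ eq
        ψ≡ : 1ℚ - ι g * inv N ≡ ψ
        ψ≡ = trans (cong (λ z → 1ℚ - z) gN) (identity-10 θ)
        0<ψ : 0ℚ < ψ
        0<ψ = *-cancelʳ-< (1ℚ + θ) (0≤+ 0≤1 0≤θ) (subst₂ _<_ (sym (*-zeroˡ (1ℚ + θ))) (sym (trans (*-comm ψ (1ℚ + θ)) (identity-15 θ)))
          (<-≤-trans 0<1 (gap (θ * θ * θ) (0≤* (0≤* 0≤θ 0≤θ) 0≤θ) refl)))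

      -- Pinsker's inequality in tangent form
      tangent : ∀ h N′ → N ≡ suc h ℕ.* suc h ℕ.* N′ → let θ = inv (suc h) in ∀ {w p m} → Low w p m →
        θ * plus (1ℚ - w) ≤ (w - 1ℚ) - val p m + θ * θ
      tangent h N′ eq {w} {p} {m} a = go (≤-total 0ℚ (1ℚ - w))
        where
        θ : ℚ
        θ = inv (suc h)
        0≤θ : 0ℚ ≤ θ
        0≤θ = 0≤inv (suc h)
        g : ℕ
        g = h ℕ.* N′
        -- The inequality `log≤` is applied to `(1 + θ) w` instead of `w`. This is where the tangent
        -- comes from: the best `θ` would give back the square root of Pinsker's inequality.
        shifted : val (g ℕ.+ p) m ≤ (1ℚ + θ) * w - 1ℚ
        shifted = log≤ {p = g ℕ.+ p} {m = m} (Low-* {p = g} {p′ = p} {m = 0} {m′ = m} (Low-1+θ h N′ eq) a)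
        go : 0ℚ ≤ 1ℚ - w ⊎ 1ℚ - w ≤ 0ℚ → θ * plus (1ℚ - w) ≤ (w - 1ℚ) - val p m + θ * θ
        go (inj₁ q) = ≡≤ (cong (θ *_) (plus≡ q))
          (-≤0⇒≤ (≤≡ (0≤- shifted) (trans (cong (λ z → (1ℚ + θ) * w - 1ℚ - z) val-g) (identity-11 θ w (val p m)))))
          where
          val-g : val (g ℕ.+ p) m ≡ θ - θ * θ + val p m
          val-g = trans (cong (λ z → (z - ι m) * inv N) (ι-+ g p)) (trans (identity-5 (ι g) (ι p) (ι m) (inv N))
            (cong (_+ val p m) gN))
            where
            gN : ι g * inv N ≡ θ - θ * θ
            gN = θ-gap h N′ eq
        go (inj₂ q) = ≡≤ (trans (cong (θ *_) (plus-0 q)) (*-zeroʳ θ))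
          (0≤+ (0≤- (log≤ {w} {p} {m} a)) (0≤* 0≤θ 0≤θ))

 -- Equivalence classes and the calculus of entropies

 module Classes where

  open import Data.List.Relation.Unary.Any using (any?)
  open import Data.Nat.Base as ℕ using (suc)
  open Sums
  open Logarithms

  -- A random variable on the uniform list `Q` is encoded by the relation of having the same value.
  -- Conditioning on its value at `ω` means passing to the class of `ω`, and probabilities become
  -- quotients of class sizes.
  record Eqv (Ω : Set) : Set₁ where
    field
      _≈_     : Ω → Ω → Set
      _≈?_    : ∀ ω ω′ → Dec (ω ≈ ω′)
      ≈-refl  : ∀ ω → ω ≈ ω
      ≈-sym   : ∀ {ω ω′} → ω ≈ ω′ → ω′ ≈ ω
      ≈-trans : ∀ {ω ω′ ω″} → ω ≈ ω′ → ω′ ≈ ω″ → ω ≈ ω″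

  open Eqv public using () renaming (_≈_ to _∋_≈_; _≈?_ to _∋_≈?_; ≈-refl to reflexive; ≈-sym to symmetric; ≈-trans to transitive)

  _⊆_ : ∀ {Ω} → Eqv Ω → Eqv Ω → Set
  R ⊆ S = ∀ {ω ω′} → R ∋ ω ≈ ω′ → S ∋ ω ≈ ω′

  module Counting {Ω : Set} (Q : List Ω) (full : ∀ ω → ω ∈ Q) where

    cnt : Eqv Ω → Ω → ℕ
    cnt R ω = count (R ∋ ω ≈?_) Q

    c i : Eqv Ω → Ω → ℚ
    c R ω = ι (cnt R ω)
    i R ω = inv (cnt R ω)

    cnt-pos : ∀ R ω → 1 ℕ.≤ cnt R ω
    cnt-pos R ω = count-pos (R ∋ ω ≈?_) (full ω) (reflexive R ω)

    c-∑ : ∀ R ω → c R ω ≡ ∑ Q (λ ω′ → ind (R ∋ ω ≈? ω′))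
    c-∑ R ω = ι-count (R ∋ ω ≈?_) Q

    cnt-≈ : ∀ R {ω ω′} → R ∋ ω ≈ ω′ → cnt R ω ≡ cnt R ω′
    cnt-≈ R {ω} {ω′} p = count-cong (R ∋ ω ≈?_) (R ∋ ω′ ≈?_) Q (λ _ → transitive R (symmetric R p)) (λ _ → transitive R p)

    cnt-⊆ : ∀ {R S : Eqv Ω} → R ⊆ S → ∀ ω → cnt R ω ℕ.≤ cnt S ω
    cnt-⊆ {R} {S} h ω = count-mono (R ∋ ω ≈?_) (S ∋ ω ≈?_) Q (λ _ → h)

    cnt≤ : ∀ R ω → cnt R ω ℕ.≤ length Q
    cnt≤ R ω = count≤length (R ∋ ω ≈?_) Q

    0≤c : ∀ R ω → 0ℚ ≤ c R ω
    0≤c R ω = 0≤ι (cnt R ω)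

    0≤i : ∀ R ω → 0ℚ ≤ i R ω
    0≤i R ω = 0≤inv (cnt R ω)

    i*c : ∀ R ω → i R ω * c R ω ≡ 1ℚ
    i*c R ω = inv*ι (cnt-pos R ω)

    unit= : ∀ R ω → ∑ Q (λ ω′ → ind (R ∋ ω ≈? ω′) * i R ω′) ≡ 1ℚ
    unit= R ω = trans (∑-cong Q λ ω′ → ind-*-cong (R ∋ ω ≈? ω′) (λ p → cong inv (sym (cnt-≈ R p))))
      (trans (∑-*ʳ Q (i R ω) (λ ω′ → ind (R ∋ ω ≈? ω′))) (trans (cong (_* i R ω) (sym (c-∑ R ω))) (trans (*-comm (c R ω) (i R ω)) (i*c R ω))))

    -- a set lying inside a class of R has total weight at most one if every point is weighted by the inverse size of its class
    unit : ∀ R {M : Ω → Set} (M? : ∀ ω → Dec (M ω)) → (∀ {ω ω′} → M ω → M ω′ → R ∋ ω ≈ ω′) →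
      ∑ Q (λ ω → ind (M? ω) * i R ω) ≤ 1ℚ
    unit R {M} M? h with any? M? Q
    ... | no ¬m = ≤-trans (∑-mono∈ Q λ {ω} ω∈ → ≤-reflexive (trans (cong (_* i R ω) (ind-no (M? ω) (λ m → ¬m (lose ω∈ m)))) (*-zeroˡ _)))
        (≡≤ (∑-0 Q) 0≤1)
      where
      lose : ∀ {ω xs} → ω ∈ xs → M ω → Any M xs
      lose (here refl) m = here m
      lose (there p)   m = there (lose p m)
    ... | yes m with satisfy m
      where
      satisfy : ∀ {xs} → Any M xs → Σ[ ω ∈ Ω ] M ω
      satisfy (here m)  = _ , m
      satisfy (there p) = satisfy p
    ... | ω₀ , m₀ = ≤≡ (∑-mono Q λ ω → *ʳ (i R ω) (0≤i R ω) (ind-mono (M? ω) (R ∋ ω₀ ≈? ω) (h m₀))) (unit= R ω₀)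

    ∣Q∣ : ℚ
    ∣Q∣ = ι (length Q)

    ∑1 : ∑ Q (λ _ → 1ℚ) ≡ ∣Q∣
    ∑1 = trans (∑-const Q 1ℚ) (*-identityʳ _)

    -- With the names read as variables `A`, `B`, `C`, this is `P(a | c) / P(a | b , c)` at the
    -- sample `ω`. Its logarithm, averaged, is minus the conditional mutual information of `A` and
    -- `B`.
    ratio : (AC BC ABC C : Eqv Ω) → Ω → ℚ
    ratio AC BC ABC C ω = (c AC ω * i C ω) * (c BC ω * i ABC ω)

    -- Expand the sizes of the `AC` and `BC` classes into sums over `ω₁` and `ω₂`, and sum over `ω`
    -- first. The samples related to both lie in one class of `ABC`, so `unit` bounds their weight
    -- by one; the remaining sum over `ω₁` is a total probability within a class of `C`. The weight
    -- `g` passes through because it is constant on classes of `BC`.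
    ∑-ratio-weighted : ∀ AC BC ABC C → AC ⊆ C → BC ⊆ C →
      (∀ {ω ω′} → AC ∋ ω ≈ ω′ → BC ∋ ω ≈ ω′ → ABC ∋ ω ≈ ω′) →
      (g : Ω → ℚ) → (∀ ω → 0ℚ ≤ g ω) → (∀ {ω ω′} → BC ∋ ω ≈ ω′ → g ω ≡ g ω′) →
      ∑ Q (λ ω → g ω * ratio AC BC ABC C ω) ≤ ∑ Q g
    ∑-ratio-weighted AC BC ABC C ac⊆c bc⊆c both g 0≤g g-BC = ≡≤ (∑-cong Q expand) (≡≤ swap
      (≤≡ (∑-mono Q λ ω₂ → ∑-mono Q λ ω₁ → inner ω₁ ω₂) (∑-cong Q total)))
      where
      term : Ω → Ω → Ω → ℚ
      term ω ω₂ ω₁ = (ind (AC ∋ ω ≈? ω₁) * ind (BC ∋ ω ≈? ω₂)) * (g ω * (i C ω * i ABC ω))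
      expand : ∀ ω → g ω * ratio AC BC ABC C ω ≡ ∑ Q (λ ω₂ → ∑ Q (term ω ω₂))
      expand ω = sym (trans (∑-cong Q (λ ω₂ → trans (∑-cong Q (λ ω₁ → *-assoc (ind (AC ∋ ω ≈? ω₁)) (ind (BC ∋ ω ≈? ω₂)) W))
          (trans (∑-*ʳ Q (ind (BC ∋ ω ≈? ω₂) * W) (λ ω₁ → ind (AC ∋ ω ≈? ω₁)))
            (trans (cong (_* (ind (BC ∋ ω ≈? ω₂) * W)) (sym (c-∑ AC ω))) (identity-22 (c AC ω) (ind (BC ∋ ω ≈? ω₂)) W)))))
        (trans (∑-*ʳ Q (c AC ω * W) (λ ω₂ → ind (BC ∋ ω ≈? ω₂))) (trans (cong (_* (c AC ω * W)) (sym (c-∑ BC ω)))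
          (identity-23 (c AC ω) (c BC ω) (g ω) (i C ω) (i ABC ω)))))
        where
        W : ℚ
        W = g ω * (i C ω * i ABC ω)
      swap : ∑ Q (λ ω → ∑ Q (λ ω₂ → ∑ Q (term ω ω₂))) ≡ ∑ Q (λ ω₂ → ∑ Q (λ ω₁ → ∑ Q (λ ω → term ω ω₂ ω₁)))
      swap = trans (∑-swap Q Q (λ ω ω₂ → ∑ Q (term ω ω₂))) (∑-cong Q λ ω₂ → ∑-swap Q Q (λ ω ω₁ → term ω ω₂ ω₁))
      inner : ∀ ω₁ ω₂ → ∑ Q (λ ω → term ω ω₂ ω₁) ≤ g ω₂ * (ind (C ∋ ω₂ ≈? ω₁) * i C ω₁)
      inner ω₁ ω₂ = ≤-trans (∑-mono Q pointwise) (≡≤ (∑-*ˡ Q K (λ ω → ind (M? ω) * i ABC ω))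
        (subst (K * ∑ Q (λ ω → ind (M? ω) * i ABC ω) ≤_) (*-identityʳ K) (*ˡ K 0≤K
          (unit ABC M? (λ { (a , b) (a′ , b′) → both (transitive AC a (symmetric AC a′)) (transitive BC b (symmetric BC b′)) })))))
        where
        K : ℚ
        K = g ω₂ * (ind (C ∋ ω₂ ≈? ω₁) * i C ω₁)
        0≤K : 0ℚ ≤ K
        0≤K = 0≤* (0≤g ω₂) (0≤* (0≤ind (C ∋ ω₂ ≈? ω₁)) (0≤i C ω₁))
        M? : ∀ ω → Dec (AC ∋ ω ≈ ω₁ × BC ∋ ω ≈ ω₂)
        M? ω = (AC ∋ ω ≈? ω₁) ×-dec (BC ∋ ω ≈? ω₂)
        pointwise : ∀ ω → term ω ω₂ ω₁ ≤ K * (ind (M? ω) * i ABC ω)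
        pointwise ω = go (AC ∋ ω ≈? ω₁) (BC ∋ ω ≈? ω₂)
          where
          W : ℚ
          W = g ω * (i C ω * i ABC ω)
          nonneg : ∀ (d : Dec (AC ∋ ω ≈ ω₁ × BC ∋ ω ≈ ω₂)) → 0ℚ ≤ K * (ind d * i ABC ω)
          nonneg d = 0≤* 0≤K (0≤* (0≤ind d) (0≤i ABC ω))
          go : (d : Dec (AC ∋ ω ≈ ω₁)) (e : Dec (BC ∋ ω ≈ ω₂)) →
            (ind d * ind e) * W ≤ K * (ind (d ×-dec e) * i ABC ω)
          go (no a) e = ≡≤ (trans (cong (_* W) (*-zeroˡ (ind e))) (*-zeroˡ _)) (nonneg (no a ×-dec e))
          go (yes a) (no b) = ≡≤ (trans (cong (_* W) (*-zeroʳ 1ℚ)) (*-zeroˡ _)) (nonneg (yes a ×-dec no b))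
          go (yes a) (yes b) = ≤-reflexive (trans (identity-18 (g ω) (i C ω) (i ABC ω)) (cong₂ (λ u v → (u * v) * (1ℚ * i ABC ω)) (g-BC b)
            (cong₂ _*_ (sym (ind-yes (C ∋ ω₂ ≈? ω₁) (transitive C (symmetric C (bc⊆c b)) (ac⊆c a)))) (cong inv (cnt-≈ C (ac⊆c a))))))
      total : ∀ ω₂ → ∑ Q (λ ω₁ → g ω₂ * (ind (C ∋ ω₂ ≈? ω₁) * i C ω₁)) ≡ g ω₂
      total ω₂ = trans (∑-*ˡ Q (g ω₂) _) (trans (cong (g ω₂ *_) (unit= C ω₂)) (*-identityʳ _))

    ∑-ratio : ∀ AC BC ABC C → AC ⊆ C → BC ⊆ C →
      (∀ {ω ω′} → AC ∋ ω ≈ ω′ → BC ∋ ω ≈ ω′ → ABC ∋ ω ≈ ω′) →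
      ∑ Q (ratio AC BC ABC C) ≤ ∣Q∣
    ∑-ratio AC BC ABC C a b ab = subst₂ _≤_ (∑-cong Q λ ω → *-identityˡ _) ∑1
      (∑-ratio-weighted AC BC ABC C a b ab (λ _ → 1ℚ) (λ _ → 0≤1) (λ _ → refl))

    -- refining by one bit at most doubles the number of classes
    ∑-bit : ∀ C AC (b : Ω → Bool) → (∀ {ω ω′} → C ∋ ω ≈ ω′ → b ω ≡ b ω′ → AC ∋ ω ≈ ω′) →
      ∑ Q (λ ω → c C ω * i AC ω) ≤ ι 2 * ∣Q∣
    ∑-bit C AC b h = ≡≤ (trans (∑-cong Q λ ω → trans (cong (_* i AC ω) (c-∑ C ω)) (sym (∑-*ʳ Q (i AC ω) (λ ω′ → ind (C ∋ ω ≈? ω′)))))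
        (∑-swap Q Q (λ ω ω′ → ind (C ∋ ω ≈? ω′) * i AC ω)))
      (≤≡ (∑-mono Q λ ω′ → ≤-trans (∑-mono Q (split ω′)) (≡≤ (∑-+ Q (part ω′ true) (part ω′ false))
        (+-mono-≤ (half ω′ true) (half ω′ false)))) (trans (∑-const Q (1ℚ + 1ℚ)) (trans (*-comm ∣Q∣ _) (cong (_* ∣Q∣)
          (sym (trans (ι-suc 1) (cong (1ℚ +_) ι1)))))))
      where
      M? : ∀ ω′ v ω → Dec (C ∋ ω ≈ ω′ × b ω ≡ v)
      M? ω′ v ω = (C ∋ ω ≈? ω′) ×-dec (b ω BoolP.≟ v)
      part : Ω → Bool → Ω → ℚ
      part ω′ v ω = ind (M? ω′ v ω) * i AC ω
      half : ∀ ω′ v → ∑ Q (part ω′ v) ≤ 1ℚ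
      half ω′ v = unit AC (M? ω′ v) λ { (p , q) (p′ , q′) → h (transitive C p (symmetric C p′)) (trans q (sym q′)) }
      split : ∀ ω′ ω → ind (C ∋ ω ≈? ω′) * i AC ω ≤ part ω′ true ω + part ω′ false ω
      split ω′ ω = go (b ω) refl
        where
        go : ∀ v → b ω ≡ v → ind (C ∋ ω ≈? ω′) * i AC ω ≤ part ω′ true ω + part ω′ false ω
        go true  e = ≤-trans (*ʳ (i AC ω) (0≤i AC ω) (ind-mono (C ∋ ω ≈? ω′) (M? ω′ true ω) (_, e)))
          (gap (part ω′ false ω) (0≤* (0≤ind (M? ω′ false ω)) (0≤i AC ω)) refl)
        go false e = ≤-trans (*ʳ (i AC ω) (0≤i AC ω) (ind-mono (C ∋ ω ≈? ω′) (M? ω′ false ω) (_, e)))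
          (gap (part ω′ true ω) (0≤* (0≤ind (M? ω′ true ω)) (0≤i AC ω)) (+-comm (part ω′ true ω) _))

    module Logs (N : ℕ) (1≤N : 1 ℕ.≤ N) where
      open Log N 1≤N public

      -- Entropy up to sign and a constant: the entropy of the class of a uniform sample is
      -- `log ∣Q∣` minus the mean logarithm of its size. `G` grows as the relation becomes coarser.
      G : Eqv Ω → ℚ
      G R = ∑ Q (λ ω → ι (lg (cnt R ω)))

      module _ (w : Ω → ℚ) (p m : Ω → ℕ) (lw : ∀ ω → Low (w ω) (p ω) (m ω)) where

        private
          ∑val : ∑ Q (λ ω → val (p ω) (m ω)) ≡ (∑ Q (ι ∘ p) - ∑ Q (ι ∘ m)) * inv N
          ∑val = trans (∑-*ʳ Q (inv N) (λ ω → ι (p ω) - ι (m ω))) (cong (_* inv N) (∑-- Q (ι ∘ p) (ι ∘ m)))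

          ∑w-1 : ∑ Q (λ ω → w ω - 1ℚ) ≡ ∑ Q w - ∣Q∣
          ∑w-1 = trans (∑-- Q w (λ _ → 1ℚ)) (cong (λ z → ∑ Q w - z) ∑1)

        -- Gibbs' inequality: `Σ log w ≤ Σ (w - 1) ≤ 0`.
        ∑-log≤ : ∑ Q w ≤ ∣Q∣ → ∑ Q (ι ∘ p) ≤ ∑ Q (ι ∘ m)
        ∑-log≤ h = -≤0⇒≤ (subst (0ℚ ≤_) (identity-19 (∑ Q (ι ∘ p)) (∑ Q (ι ∘ m)))
            (subst (_≤ - (∑ Q (ι ∘ p) - ∑ Q (ι ∘ m))) neg-0 (neg-≤ scaled)))
          where
          nonpos : (∑ Q (ι ∘ p) - ∑ Q (ι ∘ m)) * inv N ≤ 0ℚ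
          nonpos = ≡≤ (sym ∑val) (≤-trans (∑-mono Q λ ω → log≤ {w ω} {p ω} {m ω} (lw ω))
            (≡≤ ∑w-1 (subst (∑ Q w - ∣Q∣ ≤_) (+-inverseʳ ∣Q∣) (+-monoˡ-≤ (- ∣Q∣) h))))
          scaled : ∑ Q (ι ∘ p) - ∑ Q (ι ∘ m) ≤ 0ℚ
          scaled = subst₂ _≤_ (trans (*-assoc _ (inv N) (ι N)) (trans (cong (_ *_) (inv*ι 1≤N)) (*-identityʳ _))) (*-zeroˡ (ι N))
            (*ʳ (ι N) (0≤ι N) nonpos)

        ∑-tangent : ∀ h N′ → N ≡ suc h ℕ.* suc h ℕ.* N′ → ∑ Q w ≤ ∣Q∣ → let θ = inv (suc h) in
          θ * ∑ Q (λ ω → plus (1ℚ - w ω)) ≤ (∑ Q (ι ∘ m) - ∑ Q (ι ∘ p)) * inv N + ∣Q∣ * (θ * θ)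
        ∑-tangent h N′ eq hw = ≡≤ (sym (∑-*ˡ Q θ _))
          (≤-trans (∑-mono Q λ ω → tangent h N′ eq {w ω} {p ω} {m ω} (lw ω))
          (≡≤ (trans (∑-+ Q _ _) (cong₂ _+_ (∑-- Q _ _) (∑-const Q (θ * θ))))
          (≤≡ (+-monoˡ-≤ (∣Q∣ * (θ * θ)) (+-mono-≤ (≡≤ ∑w-1
            (subst (∑ Q w - ∣Q∣ ≤_) (+-inverseʳ ∣Q∣) (+-monoˡ-≤ (- ∣Q∣) hw))) (≤-reflexive (cong -_ ∑val))))
          (identity-21 (∑ Q (ι ∘ p)) (∑ Q (ι ∘ m)) (inv N) (∣Q∣ * (θ * θ))))))
          where
          θ = inv (suc h)

      -- Inverse sizes contribute logarithms rounded up. The two extra units per sample are the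
      -- summands `∣Q∣` that accompany every inequality between values of `G`.
      low-ratio : ∀ AC BC ABC C ω → Low (ratio AC BC ABC C ω)
        (lg (cnt AC ω) ℕ.+ lg (cnt BC ω)) (suc (lg (cnt C ω)) ℕ.+ suc (lg (cnt ABC ω)))
      low-ratio AC BC ABC C ω = subst₂ (Low (ratio AC BC ABC C ω)) (cong₂ ℕ._+_ (ℕP.+-identityʳ (lg (cnt AC ω))) (ℕP.+-identityʳ (lg (cnt BC ω)))) refl
        (Low-* {p = lg (cnt AC ω) ℕ.+ 0} {p′ = lg (cnt BC ω) ℕ.+ 0} {m = suc (lg (cnt C ω))} {m′ = suc (lg (cnt ABC ω))}
          (Low-* {p = lg (cnt AC ω)} {p′ = 0} {m = 0} {m′ = suc (lg (cnt C ω))} (Low-ι (cnt-pos AC ω)) (Low-inv (cnt-pos C ω)))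
          (Low-* {p = lg (cnt BC ω)} {p′ = 0} {m = 0} {m′ = suc (lg (cnt ABC ω))} (Low-ι (cnt-pos BC ω)) (Low-inv (cnt-pos ABC ω))))

      ∑-num : ∀ R S → ∑ Q (λ ω → ι (lg (cnt R ω) ℕ.+ lg (cnt S ω))) ≡ G R + G S
      ∑-num R S = trans (∑-cong Q λ ω → ι-+ (lg (cnt R ω)) (lg (cnt S ω))) (∑-+ Q _ _)

      ∑-suc : ∀ (f : Ω → ℕ) → ∑ Q (λ ω → ι (suc (f ω))) ≡ ∣Q∣ + ∑ Q (ι ∘ f)
      ∑-suc f = trans (∑-cong Q λ ω → ι-suc (f ω)) (trans (∑-+ Q _ _) (cong (_+ ∑ Q (ι ∘ f)) ∑1))

      ∑-den : ∀ R S → ∑ Q (λ ω → ι (suc (lg (cnt R ω)) ℕ.+ suc (lg (cnt S ω)))) ≡ (∣Q∣ + G R) + (∣Q∣ + G S)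
      ∑-den R S = trans (∑-cong Q λ ω → ι-+ (suc (lg (cnt R ω))) (suc (lg (cnt S ω))))
        (trans (∑-+ Q _ _) (cong₂ _+_ (∑-suc (λ ω → lg (cnt R ω))) (∑-suc (λ ω → lg (cnt S ω)))))

      -- strong subadditivity of entropy
      submodular : ∀ AC BC ABC C → AC ⊆ C → BC ⊆ C →
        (∀ {ω ω′} → AC ∋ ω ≈ ω′ → BC ∋ ω ≈ ω′ → ABC ∋ ω ≈ ω′) →
        G AC + G BC ≤ (∣Q∣ + G C) + (∣Q∣ + G ABC)
      submodular AC BC ABC C a b ab = subst₂ _≤_ (∑-num AC BC) (∑-den C ABC)
        (∑-log≤ (ratio AC BC ABC C) _ _ (low-ratio AC BC ABC C) (∑-ratio AC BC ABC C a b ab))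

      ratio-tangent : ∀ h N′ → N ≡ suc h ℕ.* suc h ℕ.* N′ → ∀ AC BC ABC C → AC ⊆ C → BC ⊆ C →
        (∀ {ω ω′} → AC ∋ ω ≈ ω′ → BC ∋ ω ≈ ω′ → ABC ∋ ω ≈ ω′) → let θ = inv (suc h) in
        θ * ∑ Q (λ ω → plus (1ℚ - ratio AC BC ABC C ω)) ≤
          (((∣Q∣ + G C) + (∣Q∣ + G ABC)) - (G AC + G BC)) * inv N + ∣Q∣ * (θ * θ)
      ratio-tangent h N′ eq AC BC ABC C a b ab = subst₂ (λ u v → inv (suc h) * ∑ Q (λ ω → plus (1ℚ - ratio AC BC ABC C ω)) ≤ (u - v) * inv N + ∣Q∣ * (inv (suc h) * inv (suc h)))
        (∑-den C ABC) (∑-num AC BC) (∑-tangent (ratio AC BC ABC C) _ _ (low-ratio AC BC ABC C) h N′ eq (∑-ratio AC BC ABC C a b ab))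

      lg2≤N : lg 2 ℕ.≤ N
      lg2≤N = β^-cancel (≤-trans (lg-≤ (s≤s z≤n)) (≡≤ (trans (ι-suc 1) (trans (cong (1ℚ +_) (trans ι1 (sym (ι*inv 1≤N)))) refl)) (β^≥ N)))

      -- By `∑-bit` the refinement costs a factor of two on average, and a factor of two is worth at
      -- most `N` units because `(1 + 1 / N) ^ N ≥ 2`.
      bit-log : ∀ C AC (b : Ω → Bool) → (∀ {ω ω′} → C ∋ ω ≈ ω′ → b ω ≡ b ω′ → AC ∋ ω ≈ ω′) →
        G C ≤ (∣Q∣ + G AC) + ∣Q∣ * (1ℚ + ι N)
      bit-log C AC b h = ≤≡ (≡≤ (∑-cong Q λ ω → cong ι (sym (ℕP.+-identityʳ (lg (cnt C ω)))))
        (∑-log≤ w _ _ lw ∑w)) den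
        where
        w : Ω → ℚ
        w ω = (c C ω * i AC ω) * inv 2
        lw : ∀ ω → Low (w ω) (lg (cnt C ω) ℕ.+ 0) (suc (lg (cnt AC ω)) ℕ.+ suc N)
        lw ω = subst₂ (Low (w ω)) (cong (ℕ._+ 0) (ℕP.+-identityʳ _)) refl
          (Low-* {p = lg (cnt C ω) ℕ.+ 0} {p′ = 0} {m = suc (lg (cnt AC ω))} {m′ = suc N}
            (Low-* {p = lg (cnt C ω)} {p′ = 0} {m = 0} {m′ = suc (lg (cnt AC ω))} (Low-ι (cnt-pos C ω)) (Low-inv (cnt-pos AC ω))) inv2)
          where
          inv2 : Low (inv 2) 0 (suc N)
          inv2 = low (≤-trans (Low.bound (Low-inv {2} (s≤s z≤n))) (*ˡ (inv 2) (0≤inv 2) β-mono))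
            where
            β-mono : pw β (suc (lg 2)) ≤ pw β (suc N)
            β-mono with ℕP.m≤n⇒∃[o]m+o≡n (s≤s lg2≤N)
            ... | o , e = subst (λ z → pw β (suc (lg 2)) ≤ pw β z) e (subst₂ _≤_ (*-identityʳ _) (sym (pw-+ β (suc (lg 2)) o))
              (*ˡ (pw β (suc (lg 2))) (pw-0≤ 0≤β (suc (lg 2))) (pw-1≤ 1≤β o)))
        ∑w : ∑ Q w ≤ ∣Q∣
        ∑w = ≡≤ (∑-*ʳ Q (inv 2) _) (≤≡ (*ʳ (inv 2) (0≤inv 2) (∑-bit C AC b h))
          (trans (cong (_* inv 2) (*-comm (ι 2) ∣Q∣)) (trans (*-assoc ∣Q∣ (ι 2) (inv 2)) (trans (cong (∣Q∣ *_) (ι*inv (s≤s z≤n))) (*-identityʳ _)))))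
        den : ∑ Q (λ ω → ι (suc (lg (cnt AC ω)) ℕ.+ suc N)) ≡ (∣Q∣ + G AC) + ∣Q∣ * (1ℚ + ι N)
        den = trans (∑-cong Q λ ω → ι-+ (suc (lg (cnt AC ω))) (suc N)) (trans (∑-+ Q _ _) (cong₂ _+_ (∑-suc (λ ω → lg (cnt AC ω)))
          (trans (∑-const Q (ι (suc N))) (cong (∣Q∣ *_) (ι-suc N)))))

 -- The likelihood ratio of the simulated protocol

 module Likelihoods where

  open import Data.Nat.Base as ℕ using (zero; suc)
  open Sums
  open Logarithms
  open Classes

  -- The law of the simulated protocol relative to the uniform distribution on Q: the input pt is uniform on E,
  -- then the public part is drawn given z (XR against CZ), then K bits of the transcript (AC k against C k).
  module Likelihood {Ω Pt Z : Set} (Q : List Ω) (full : ∀ ω → ω ∈ Q)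
    (E : List Pt) (_≟_ : DecidableEquality Pt) (pt : Ω → Pt) (pt∈E : ∀ ω → pt ω ∈ E)
    (z : Pt → Z) (_≟Z_ : DecidableEquality Z) (CZ XR : Eqv Ω) (XYR C AC : ℕ → Eqv Ω)
    (z-CZ : ∀ {ω ω′} → z (pt ω) ≡ z (pt ω′) → CZ ∋ ω ≈ ω′)
    (XR-z : ∀ {ω ω′} → XR ∋ ω ≈ ω′ → z (pt ω) ≡ z (pt ω′))
    (XR-XYR : ∀ {ω ω′} → pt ω ≡ pt ω′ → XR ∋ ω ≈ ω′ → XYR 0 ∋ ω ≈ ω′)
    (XYR-pt : ∀ {ω ω′} → XYR 0 ∋ ω ≈ ω′ → pt ω ≡ pt ω′)
    (XYR-XR : XYR 0 ⊆ XR)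
    (XYR-anti : ∀ k → XYR (suc k) ⊆ XYR k)
    (XYR-AC : ∀ k → XYR (suc k) ⊆ AC k)
    (XYR-C : ∀ k → XYR k ⊆ C k)
    (AC-C : ∀ k → AC k ⊆ C k)
    (AC-XYR : ∀ k {ω ω′} → AC k ∋ ω ≈ ω′ → XYR k ∋ ω ≈ ω′ → XYR (suc k) ∋ ω ≈ ω′)
    (N : ℕ) (1≤N : 1 ℕ.≤ N) where

    open Counting Q full
    open Logs N 1≤N

    #E : ℕ
    #E = length E

    μ : Ω → ℕ
    μ ω = count (pt ω ≟_) E

    μ-pos : ∀ ω → 1 ℕ.≤ μ ω
    μ-pos ω = count-pos (pt ω ≟_) (pt∈E ω) refl

    module _ (1≤#E : 1 ℕ.≤ #E) (1≤#Q : 1 ℕ.≤ length Q) where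

      step : ℕ → Ω → ℚ
      step k ω = c (AC k) ω * i (C k) ω

      -- The simulated probability of the class of `ω`: the input has probability `μ / #E`, the
      -- public part `c XR / c CZ`, and each bit the quotient `step`. In `w` it is divided by the
      -- probability of this class under the uniform law on `Q`.
      v : ℕ → Ω → ℚ
      v zero    ω = (ι (μ ω) * inv #E) * (c XR ω * i CZ ω)
      v (suc K) ω = v K ω * step K ω

      w : ℕ → Ω → ℚ
      w K ω = v K ω * (∣Q∣ * i (XYR K) ω)

      0≤v : ∀ K ω → 0ℚ ≤ v K ω
      0≤v zero    ω = 0≤* (0≤* (0≤ι (μ ω)) (0≤inv #E)) (0≤* (0≤c XR ω) (0≤i CZ ω))
      0≤v (suc K) ω = 0≤* (0≤v K ω) (0≤* (0≤c (AC K) ω) (0≤i (C K) ω))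

      0≤w : ∀ K ω → 0ℚ ≤ w K ω
      0≤w K ω = 0≤* (0≤v K ω) (0≤* (0≤ι (length Q)) (0≤i (XYR K) ω))

      v-≈ : ∀ K {ω ω′} → XYR K ∋ ω ≈ ω′ → v K ω ≡ v K ω′
      v-≈ zero p = cong₂ _*_ (cong (λ e → ι (count (e ≟_) E) * inv #E) (XYR-pt p))
        (cong₂ _*_ (cong ι (cnt-≈ XR (XYR-XR p))) (cong inv (cnt-≈ CZ (z-CZ (XR-z (XYR-XR p))))))
      v-≈ (suc K) p = cong₂ _*_ (v-≈ K (XYR-anti K p))
        (cong₂ _*_ (cong ι (cnt-≈ (AC K) (XYR-AC K p))) (cong inv (cnt-≈ (C K) (XYR-C K (XYR-anti K p)))))

      w-≈ : ∀ K {ω ω′} → XYR K ∋ ω ≈ ω′ → w K ω ≡ w K ω′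
      w-≈ K p = cong₂ _*_ (v-≈ K p) (cong (λ n → ∣Q∣ * inv n) (cnt-≈ (XYR K) p))

      w-suc : ∀ K ω → w (suc K) ω ≡ w K ω * ratio (AC K) (XYR K) (XYR (suc K)) (C K) ω
      w-suc K ω = trans (sym (trans (cong (λ u → (v K ω * step K ω * (∣Q∣ * i (XYR (suc K)) ω)) * u) (i*c (XYR K) ω)) (*-identityʳ _)))
        (identity-32 (v K ω) (step K ω) ∣Q∣ (i (XYR (suc K)) ω) (i (XYR K) ω) (c (XYR K) ω))

      -- Distinct classes have simulated probabilities that add up to at most one. For each `e`, the
      -- factor `c XR` is spread over the members `ω′` of the class. Given `e` and `ω′`, the samples
      -- lie in one class of `XYR 0`; given `e`, the possible `ω′` lie in one class of `CZ`. `unit`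
      -- applies to both.
      ∑w₀ : ∑ Q (w 0) ≤ ∣Q∣
      ∑w₀ = ≡≤ (∑-cong Q expand) (≡≤ (∑-*ʳ Q K body)
        (≤≡ (*ʳ K 0≤K (≡≤ (∑-swap Q E term) (≤≡ (∑-mono E per-e) (trans (∑-const E 1ℚ) (*-identityʳ _)))))
        (trans (identity-33 (ι #E) (inv #E) ∣Q∣) (trans (cong (_* ∣Q∣) (ι*inv 1≤#E)) (*-identityˡ _)))))
        where
        K : ℚ
        K = inv #E * ∣Q∣
        0≤K : 0ℚ ≤ K
        0≤K = 0≤* (0≤inv #E) (0≤ι (length Q))
        term : Ω → Pt → ℚ
        term ω e = ind (pt ω ≟ e) * (c XR ω * i CZ ω * i (XYR 0) ω)
        body : Ω → ℚ
        body ω = ∑ E (term ω)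
        expand : ∀ ω → w 0 ω ≡ body ω * K
        expand ω = sym (trans (cong (_* K) (trans (∑-*ʳ E (c XR ω * i CZ ω * i (XYR 0) ω) (λ e → ind (pt ω ≟ e)))
          (cong (_* (c XR ω * i CZ ω * i (XYR 0) ω)) (sym (ι-count (pt ω ≟_) E))))) (identity-26 (ι (μ ω)) (inv #E) ∣Q∣ (c XR ω) (i CZ ω) (i (XYR 0) ω)))
        per-e : ∀ e → ∑ Q (λ ω → term ω e) ≤ 1ℚ
        per-e e = ≤-trans (∑-mono Q λ ω → ≡≤ (spread ω) (∑-mono Q (bound ω))) (≡≤ (∑-swap Q Q _)
          (≤-trans (∑-mono Q λ ω′ → ≡≤ (∑-*ˡ Q (ind (Mz? ω′) * i CZ ω′) (λ ω → ind (Me? ω′ ω) * i (XYR 0) ω))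
            (≤≡ (*ˡ _ (0≤* (0≤ind (Mz? ω′)) (0≤i CZ ω′)) (unit (XYR 0) (Me? ω′) same)) (*-identityʳ _)))
          (unit CZ Mz? λ p q → z-CZ (trans p (sym q)))))
          where
          Mz? : ∀ ω′ → Dec (z (pt ω′) ≡ z e)
          Mz? ω′ = z (pt ω′) ≟Z z e
          Me? : ∀ ω′ ω → Dec (pt ω ≡ e × XR ∋ ω ≈ ω′)
          Me? ω′ ω = (pt ω ≟ e) ×-dec (XR ∋ ω ≈? ω′)
          same : ∀ {ω′ ω₁ ω₂} → pt ω₁ ≡ e × XR ∋ ω₁ ≈ ω′ → pt ω₂ ≡ e × XR ∋ ω₂ ≈ ω′ → XYR 0 ∋ ω₁ ≈ ω₂
          same (p , q) (p′ , q′) = XR-XYR (trans p (sym p′)) (transitive XR q (symmetric XR q′))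
          spread : ∀ ω → term ω e ≡ ∑ Q (λ ω′ → ind (XR ∋ ω ≈? ω′) * (ind (pt ω ≟ e) * (i CZ ω * i (XYR 0) ω)))
          spread ω = sym (trans (∑-*ʳ Q _ _) (trans (cong (_* (ind (pt ω ≟ e) * (i CZ ω * i (XYR 0) ω))) (sym (c-∑ XR ω)))
            (identity-25 (c XR ω) (ind (pt ω ≟ e)) (i CZ ω) (i (XYR 0) ω))))
          bound : ∀ ω ω′ → ind (XR ∋ ω ≈? ω′) * (ind (pt ω ≟ e) * (i CZ ω * i (XYR 0) ω)) ≤
            (ind (Mz? ω′) * i CZ ω′) * (ind (Me? ω′ ω) * i (XYR 0) ω)
          bound ω ω′ = go (XR ∋ ω ≈? ω′) (pt ω ≟ e)
            where
            W : ℚ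
            W = i CZ ω * i (XYR 0) ω
            nonneg : (d : Dec (pt ω ≡ e × XR ∋ ω ≈ ω′)) → 0ℚ ≤ (ind (Mz? ω′) * i CZ ω′) * (ind d * i (XYR 0) ω)
            nonneg d = 0≤* (0≤* (0≤ind (Mz? ω′)) (0≤i CZ ω′)) (0≤* (0≤ind d) (0≤i (XYR 0) ω))
            go : (a : Dec (XR ∋ ω ≈ ω′)) (b : Dec (pt ω ≡ e)) → ind a * (ind b * W) ≤ (ind (Mz? ω′) * i CZ ω′) * (ind (b ×-dec a) * i (XYR 0) ω)
            go (no a) b = ≡≤ (*-zeroˡ _) (nonneg (b ×-dec no a))
            go (yes a) (no b) = ≡≤ (trans (cong (1ℚ *_) (*-zeroˡ W)) (*-zeroʳ 1ℚ)) (nonneg (no b ×-dec yes a))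
            go (yes a) (yes b) = ≤-reflexive (trans (identity-24 (i CZ ω) (i (XYR 0) ω)) (cong₂ (λ p q → (p * q) * (1ℚ * i (XYR 0) ω))
              (sym (ind-yes (Mz? ω′) (trans (sym (XR-z a)) (cong z b)))) (cong inv (cnt-≈ CZ (z-CZ (XR-z a))))))

      ∑w : ∀ K → ∑ Q (w K) ≤ ∣Q∣
      ∑w zero    = ∑w₀
      ∑w (suc K) = ≡≤ (∑-cong Q (w-suc K))
        (≤-trans (∑-ratio-weighted (AC K) (XYR K) (XYR (suc K)) (C K) (AC-C K) (XYR-C K) (AC-XYR K) (w K) (0≤w K) (w-≈ K)) (∑w K))

      pe me : ℕ → Ω → ℕ
      pe zero    ω = lg (μ ω) ℕ.+ lg (cnt XR ω)
      pe (suc K) ω = pe K ω ℕ.+ lg (cnt (AC K) ω)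
      me zero    ω = suc (lg #E) ℕ.+ suc (lg (cnt CZ ω))
      me (suc K) ω = me K ω ℕ.+ suc (lg (cnt (C K) ω))

      quot : ∀ {a b} → 1 ℕ.≤ a → 1 ℕ.≤ b → Low (ι a * inv b) (lg a) (suc (lg b))
      quot {a} {b} ha hb = subst (λ p → Low (ι a * inv b) p (suc (lg b))) (ℕP.+-identityʳ (lg a))
        (Low-* {p = lg a} {p′ = 0} {m = 0} {m′ = suc (lg b)} (Low-ι ha) (Low-inv hb))

      low-v : ∀ K ω → Low (v K ω) (pe K ω) (me K ω)
      low-v zero    ω = Low-* (quot (μ-pos ω) 1≤#E) (quot (cnt-pos XR ω) (cnt-pos CZ ω))
      low-v (suc K) ω = Low-* (low-v K ω) (quot (cnt-pos (AC K) ω) (cnt-pos (C K) ω))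

      low-w : ∀ K ω → Low (w K ω) (pe K ω ℕ.+ lg (length Q)) (me K ω ℕ.+ suc (lg (cnt (XYR K) ω)))
      low-w K ω = Low-* (low-v K ω) (quot 1≤#Q (cnt-pos (XYR K) ω))

      Gμ : ℚ
      Gμ = ∑ Q (λ ω → ι (lg (μ ω)))

      -- the information Σ log (own probability of the k-th bit)
      U : ℕ → ℚ
      U zero    = 0ℚ
      U (suc K) = U K + (G (AC K) - G (C K))

      private
        add : ∀ (f g : Ω → ℕ) → ∑ Q (λ ω → ι (f ω ℕ.+ g ω)) ≡ ∑ Q (ι ∘ f) + ∑ Q (ι ∘ g)
        add f g = trans (∑-cong Q λ ω → ι-+ (f ω) (g ω)) (∑-+ Q _ _)

        ∑pm : ∀ K → ∑ Q (ι ∘ me K) - ∑ Q (ι ∘ pe K) ≡ (ι 2 + ι K) * ∣Q∣ + (∣Q∣ * ι (lg #E) + G CZ) - (Gμ + G XR) - U K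
        ∑pm zero = trans (cong₂ _-_ (trans (add _ _) (cong₂ _+_ (trans (∑-suc _) (cong (∣Q∣ +_) (∑-const Q _))) (∑-suc _))) (add _ _))
          (trans (identity-27 ∣Q∣ (∣Q∣ * ι (lg #E)) (G CZ) (Gμ + G XR)) (cong₂ (λ a b → (a + b) * ∣Q∣ + (∣Q∣ * ι (lg #E) + G CZ) - (Gμ + G XR) - 0ℚ)
            (sym (trans (ι-suc 1) (cong (1ℚ +_) ι1))) (sym ι0)))
        ∑pm (suc K) = trans (cong₂ _-_ (trans (add _ _) (cong (∑ Q (ι ∘ me K) +_) (∑-suc _))) (add _ _))
          (trans (identity-28 (∑ Q (ι ∘ me K)) (∑ Q (ι ∘ pe K)) ∣Q∣ (G (AC K)) (G (C K))) (trans (cong (λ u → u + (∣Q∣ - (G (AC K) - G (C K)))) (∑pm K))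
            (trans (identity-29 (ι 2) (ι K) ∣Q∣ (∣Q∣ * ι (lg #E) + G CZ) (Gμ + G XR) (U K) (G (AC K) - G (C K)))
              (cong (λ u → (ι 2 + u) * ∣Q∣ + (∣Q∣ * ι (lg #E) + G CZ) - (Gμ + G XR) - U (suc K)) (sym (ι-suc K))))))

      -- Minus the sum of the lower bounds for `log w`, in units of `1 / N`: up to the rounding
      -- terms in `∣Q∣`, this is `∣Q∣` times the divergence of the uniform law on `Q` from the
      -- simulated law.
      Div : ℕ → ℚ
      Div K = (ι 3 + ι K) * ∣Q∣ + (∣Q∣ * ι (lg #E) + G CZ) - (Gμ + G XR) - U K + G (XYR K) - ∣Q∣ * ι (lg (length Q))

      private
        ∑Div : ∀ K → ∑ Q (λ ω → ι (me K ω ℕ.+ suc (lg (cnt (XYR K) ω)))) - ∑ Q (λ ω → ι (pe K ω ℕ.+ lg (length Q))) ≡ Div K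
        ∑Div K = trans (cong₂ _-_ (trans (add _ _) (cong (∑ Q (ι ∘ me K) +_) (∑-suc _))) (trans (add _ _) (cong (∑ Q (ι ∘ pe K) +_) (∑-const Q _))))
          (trans (identity-30 (∑ Q (ι ∘ me K)) (∑ Q (ι ∘ pe K)) ∣Q∣ (G (XYR K)) (∣Q∣ * ι (lg (length Q))))
          (trans (cong (λ u → u + (∣Q∣ + G (XYR K) - ∣Q∣ * ι (lg (length Q)))) (∑pm K))
          (trans (identity-31 (ι 2) (ι K) ∣Q∣ (∣Q∣ * ι (lg #E) + G CZ) (Gμ + G XR) (U K) (G (XYR K)) (∣Q∣ * ι (lg (length Q))))
          (cong (λ u → (u + ι K) * ∣Q∣ + (∣Q∣ * ι (lg #E) + G CZ) - (Gμ + G XR) - U K + G (XYR K) - ∣Q∣ * ι (lg (length Q))) (sym (ι-suc 2))))))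

      0≤Div : ∀ K → 0ℚ ≤ Div K
      0≤Div K = subst (0ℚ ≤_) (∑Div K) (0≤- (∑-log≤ (w K) _ _ (low-w K) (∑w K)))

      w-tangent : ∀ h N′ → N ≡ suc h ℕ.* suc h ℕ.* N′ → ∀ K → let θ = inv (suc h) in
        θ * ∑ Q (λ ω → plus (1ℚ - w K ω)) ≤ Div K * inv N + ∣Q∣ * (θ * θ)
      w-tangent h N′ eq K = subst (λ u → inv (suc h) * ∑ Q (λ ω → plus (1ℚ - w K ω)) ≤ u * inv N + ∣Q∣ * (inv (suc h) * inv (suc h)))
        (∑Div K) (∑-tangent (w K) _ _ (low-w K) h N′ eq (∑w K))

 -- The chain rule along the coordinates and the choice of a coordinate

 module CoordinateChoice where

  open import Data.List.Base using ([]; _∷_)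
  open import Data.Nat.Base as ℕ using (zero; suc)
  open import Data.Product.Properties using (≡-dec)
  open Sums
  open Logarithms
  open Classes
  open Likelihoods

  kernel : ∀ {Ω A : Set} → DecidableEquality A → (Ω → A) → Eqv Ω
  kernel _≟_ f = record
    { _≈_ = λ ω ω′ → f ω ≡ f ω′ ; _≈?_ = λ ω ω′ → f ω ≟ f ω′
    ; ≈-refl = λ _ → refl ; ≈-sym = sym ; ≈-trans = trans }

  infixr 6 _∩_
  _∩_ : ∀ {Ω} → Eqv Ω → Eqv Ω → Eqv Ω
  R ∩ S = record
    { _≈_ = λ ω ω′ → R ∋ ω ≈ ω′ × S ∋ ω ≈ ω′ ; _≈?_ = λ ω ω′ → (R ∋ ω ≈? ω′) ×-dec (S ∋ ω ≈? ω′)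
    ; ≈-refl = λ ω → reflexive R ω , reflexive S ω
    ; ≈-sym = λ (p , q) → symmetric R p , symmetric S q
    ; ≈-trans = λ (p , q) (p′ , q′) → transitive R p p′ , transitive S q q′ }

  ⋂ : ∀ {Ω} → ℕ → (ℕ → Eqv Ω) → Eqv Ω
  ⋂ b R = record
    { _≈_ = λ ω ω′ → ∀ i → i ℕ.< b → R i ∋ ω ≈ ω′
    ; _≈?_ = λ ω ω′ → map′ (λ f i h → f {i} h) (λ f {i} → f i) (ℕP.allUpTo? (λ i → R i ∋ ω ≈? ω′) b)
    ; ≈-refl = λ ω i _ → reflexive (R i) ω
    ; ≈-sym = λ p i h → symmetric (R i) (p i h)
    ; ≈-trans = λ p q i h → transitive (R i) (p i h) (q i h) }

  guard : ∀ {Ω} {P : Set} → Dec P → Eqv Ω → Eqv Ω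
  guard {P = P} d R = record
    { _≈_ = λ ω ω′ → P → R ∋ ω ≈ ω′ ; _≈?_ = λ ω ω′ → d →-dec (R ∋ ω ≈? ω′)
    ; ≈-refl = λ ω _ → reflexive R ω
    ; ≈-sym = λ p h → symmetric R (p h)
    ; ≈-trans = λ p q h → transitive R (p h) (q h) }

  sumTo prodTo : (ℕ → ℚ) → ℕ → ℚ
  sumTo f zero    = 0ℚ
  sumTo f (suc n) = sumTo f n + f n
  prodTo f zero    = 1ℚ
  prodTo f (suc n) = prodTo f n * f n

  sumTo-mono : ∀ {f g : ℕ → ℚ} n → (∀ i → i ℕ.< n → f i ≤ g i) → sumTo f n ≤ sumTo g n
  sumTo-mono zero    h = ≤-refl
  sumTo-mono (suc n) h = +-mono-≤ (sumTo-mono n λ i p → h i (ℕP.m≤n⇒m≤1+n p)) (h n ℕP.≤-refl)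

  sumTo-*ˡ : ∀ a (f : ℕ → ℚ) n → sumTo (λ i → a * f i) n ≡ a * sumTo f n
  sumTo-*ˡ a f zero    = sym (*-zeroʳ a)
  sumTo-*ˡ a f (suc n) = trans (cong (_+ a * f n) (sumTo-*ˡ a f n)) (sym (*-distribˡ-+ a (sumTo f n) (f n)))

  ∑-sumTo : ∀ {A : Set} (xs : List A) (f : ℕ → A → ℚ) n → ∑ xs (λ a → sumTo (λ i → f i a) n) ≡ sumTo (λ i → ∑ xs (f i)) n
  ∑-sumTo xs f zero    = ∑-0 xs
  ∑-sumTo xs f (suc n) = trans (∑-+ xs (λ a → sumTo (λ i → f i a) n) (f n)) (cong (_+ ∑ xs (f n)) (∑-sumTo xs f n))

  sum-pick : ∀ {B : ℚ} (F : ℕ → ℚ) k → 1 ℕ.≤ k → sumTo F k ≤ ι k * B → Σ[ j ∈ ℕ ] j ℕ.< k × F j ≤ B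
  sum-pick {B} F (suc zero) _ h = 0 , s≤s z≤n , subst₂ _≤_ (+-identityˡ (F 0)) (trans (cong (_* B) ι1) (*-identityˡ B)) h
  sum-pick {B} F (suc (suc k)) _ h = go (≤-total (F (suc k)) B) (λ p → sum-pick F (suc k) (s≤s z≤n) (-≤0⇒≤ (subst (0ℚ ≤_)
      (trans (cong (λ u → u * B - (sumTo F (suc k) + F (suc k)) + (F (suc k) - B)) (ι-suc (suc k)))
      (identity-71 (ι (suc k)) B (sumTo F (suc k)) (F (suc k)))) (0≤+ (0≤- h) (0≤- p)))))
    where
    go : F (suc k) ≤ B ⊎ B ≤ F (suc k) → (B ≤ F (suc k) → Σ[ j ∈ ℕ ] j ℕ.< suc k × F j ≤ B) → Σ[ j ∈ ℕ ] j ℕ.< suc (suc k) × F j ≤ B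
    go (inj₁ p) _ = suc k , ℕP.≤-refl , p
    go (inj₂ p) f with f p
    ... | j , j< , r = j , ℕP.m≤n⇒m≤1+n j< , r

  ι3 : ι 3 ≡ 1ℚ + (1ℚ + 1ℚ)
  ι3 = trans (ι-suc 2) (cong (1ℚ +_) (trans (ι-suc 1) (cong (1ℚ +_) ι1)))

  ι8 : ι 8 ≡ (1ℚ + (1ℚ + 1ℚ)) + (1ℚ + (1ℚ + 1ℚ)) + (1ℚ + 1ℚ)
  ι8 = trans (ι-+ 6 2) (cong₂ _+_ (trans (ι-+ 3 3) (cong₂ _+_ ι3 ι3)) (trans (ι-suc 1) (cong (1ℚ +_) ι1)))

  module Coordinates {Ω X Y : Set} (Q : List Ω) (full : ∀ ω → ω ∈ Q) (1≤#Q : 1 ℕ.≤ length Q)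
    (E : List (X × Y)) (_≟X_ : DecidableEquality X) (_≟Y_ : DecidableEquality Y)
    (n : ℕ) (x : ℕ → Ω → X) (y : ℕ → Ω → Y) (bits : ℕ → Ω → Bool) (own : ℕ → Bool)
    (pt∈E : ∀ {j} → j ℕ.< n → ∀ ω → (x j ω , y j ω) ∈ E) (1≤#E : 1 ℕ.≤ length E) where

    xk yk mk : ℕ → Eqv Ω
    xk i = kernel _≟X_ (x i)
    yk i = kernel _≟Y_ (y i)
    mk i = kernel BoolP._≟_ (bits i)

    -- Rel s t k: equal x before s, equal y from t on, equal transcript before k
    Rel : ℕ → ℕ → ℕ → Eqv Ω
    Rel s t k = ⋂ s xk ∩ ⋂ n (λ i → guard (t ℕP.≤? i) (yk i)) ∩ ⋂ k mk

    Rel-mono : ∀ {s s′ t t′ k k′} → s′ ℕ.≤ s → t ℕ.≤ t′ → k′ ℕ.≤ k → Rel s t k ⊆ Rel s′ t′ k′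
    Rel-mono hs ht hk (p , q , r) = (λ i h → p i (ℕP.≤-trans h hs)) , (λ i h h′ → q i h (ℕP.≤-trans ht h′)) , (λ i h → r i (ℕP.≤-trans h hk))

    splitLast : ∀ {i s} → i ℕ.< suc s → i ℕ.< s ⊎ i ≡ s
    splitLast h = ℕP.m≤n⇒m<n∨m≡n (ℕP.≤-pred h)

    add-x : ∀ {s t k ω ω′} → x s ω ≡ x s ω′ → Rel s t k ∋ ω ≈ ω′ → Rel (suc s) t k ∋ ω ≈ ω′
    add-x e (p , q , r) = (λ i h → go i (splitLast h)) , q , r
      where
      go : ∀ i → i ℕ.< _ ⊎ i ≡ _ → x i _ ≡ x i _
      go i (inj₁ h)    = p i h
      go i (inj₂ refl) = e

    add-y : ∀ {s t k ω ω′} → y t ω ≡ y t ω′ → Rel s (suc t) k ∋ ω ≈ ω′ → Rel s t k ∋ ω ≈ ω′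
    add-y e (p , q , r) = p , (λ i h h′ → go i h (ℕP.m≤n⇒m<n∨m≡n h′)) , r
      where
      go : ∀ i → i ℕ.< n → _ ℕ.< i ⊎ _ ≡ i → y i _ ≡ y i _
      go i h (inj₁ h′)   = q i h h′
      go i h (inj₂ refl) = e

    add-m : ∀ {s t k ω ω′} → bits k ω ≡ bits k ω′ → Rel s t k ∋ ω ≈ ω′ → Rel s t (suc k) ∋ ω ≈ ω′
    add-m e (p , q , r) = p , q , (λ i h → go i (splitLast h))
      where
      go : ∀ i → i ℕ.< _ ⊎ i ≡ _ → bits i _ ≡ bits i _
      go i (inj₁ h)    = r i h
      go i (inj₂ refl) = e

    last-m : ∀ {s t k} {ω ω′} → Rel s t (suc k) ∋ ω ≈ ω′ → bits k ω ≡ bits k ω′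
    last-m (_ , _ , r) = r _ ℕP.≤-refl

    pt : ℕ → Ω → X × Y
    pt j ω = x j ω , y j ω

    -- the relation between what the owner of level k sees of the k-th level, and the transcript before level k + d
    Own : ℕ → ℕ → ℕ → Eqv Ω
    Own d j k = if own k then Rel (suc j) (suc j) (d ℕ.+ k) else Rel j j (d ℕ.+ k)

    rel⊆own : ∀ d j k → Rel (suc j) j (d ℕ.+ k) ⊆ Own d j k
    rel⊆own d j k with own k
    ... | true  = Rel-mono ℕP.≤-refl (ℕP.n≤1+n j) ℕP.≤-refl
    ... | false = Rel-mono (ℕP.n≤1+n j) ℕP.≤-refl ℕP.≤-refl

    own⊆own : ∀ j k → Own 1 j k ⊆ Own 0 j k
    own⊆own j k with own k
    ... | true  = Rel-mono ℕP.≤-refl ℕP.≤-refl (ℕP.n≤1+n k)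
    ... | false = Rel-mono ℕP.≤-refl ℕP.≤-refl (ℕP.n≤1+n k)

    own-m : ∀ j k {ω ω′} → Own 1 j k ∋ ω ≈ ω′ → bits k ω ≡ bits k ω′
    own-m j k with own k
    ... | true  = last-m {suc j} {suc j}
    ... | false = last-m {j} {j}

    open Counting Q full public

    μ : ℕ → Ω → ℕ
    μ j ω = count (≡-dec _≟X_ _≟Y_ (pt j ω)) E

  module Totals {Ω X Y : Set} (Q : List Ω) (full : ∀ ω → ω ∈ Q) (1≤#Q : 1 ℕ.≤ length Q)
    (E : List (X × Y)) (_≟X_ : DecidableEquality X) (_≟Y_ : DecidableEquality Y)
    (n : ℕ) (x : ℕ → Ω → X) (y : ℕ → Ω → Y) (bits : ℕ → Ω → Bool) (own : ℕ → Bool)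
    (pt∈E : ∀ {j} → j ℕ.< n → ∀ ω → (x j ω , y j ω) ∈ E) (1≤#E : 1 ℕ.≤ length E)
    (N : ℕ) (1≤N : 1 ℕ.≤ N) (T N₁ : ℕ) where

    open Coordinates Q full 1≤#Q E _≟X_ _≟Y_ n x y bits own pt∈E 1≤#E public

    -- The public part consists of `x` before `j` and `y` after `j`. In `LX` it is drawn given
    -- Alice's `x j`, in `LY` given Bob's `y j`; the bits are drawn by their owners in both.
    -- Correlated sampling works if both laws are close to the uniform law on `Q`.
    module LX {j : ℕ} (j<n : j ℕ.< n) = Likelihood Q full E (≡-dec _≟X_ _≟Y_) (pt j) (pt∈E j<n) proj₁ _≟X_
      (xk j) (Rel (suc j) (suc j) 0) (Rel (suc j) j) (Own 0 j) (Own 1 j) id (λ (p , _) → p j ℕP.≤-refl)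
      (λ e → add-y {suc j} (cong proj₂ e)) (λ (p , q , _) → cong₂ _,_ (p j ℕP.≤-refl) (q j j<n ℕP.≤-refl))
      (Rel-mono ℕP.≤-refl (ℕP.n≤1+n j) ℕP.≤-refl) (λ k → Rel-mono ℕP.≤-refl ℕP.≤-refl (ℕP.n≤1+n k))
      (rel⊆own 1 j) (rel⊆own 0 j) (own⊆own j) (λ k a → add-m (own-m j k a))

    module LY {j : ℕ} (j<n : j ℕ.< n) = Likelihood Q full E (≡-dec _≟X_ _≟Y_) (pt j) (pt∈E j<n) proj₂ _≟Y_
      (yk j) (Rel j j 0) (Rel (suc j) j) (Own 0 j) (Own 1 j) id (λ (_ , q , _) → q j j<n ℕP.≤-refl)
      (λ e → add-x {j} (cong proj₁ e)) (λ (p , q , _) → cong₂ _,_ (p j ℕP.≤-refl) (q j j<n ℕP.≤-refl))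
      (Rel-mono (ℕP.n≤1+n j) ℕP.≤-refl ℕP.≤-refl) (λ k → Rel-mono ℕP.≤-refl ℕP.≤-refl (ℕP.n≤1+n k))
      (rel⊆own 1 j) (rel⊆own 0 j) (own⊆own j) (λ k a → add-m (own-m j k a))

    module Determined
      (detA : ∀ k {ω ω′} → own k ≡ true → Rel n n k ∋ ω ≈ ω′ → bits k ω ≡ bits k ω′)
      (detB : ∀ k {ω ω′} → own k ≡ false → Rel 0 0 k ∋ ω ≈ ω′ → bits k ω ≡ bits k ω′)
      (hprod : ∀ ω → c (Rel n 0 0) ω ≤ prodTo (λ j → ι (μ j ω)) n) where

      open Logs N 1≤N public

      q : ℚ
      q = ∣Q∣ * ι (lg (length Q))

      ℓE : ℚ
      ℓE = ∣Q∣ * ι (lg (length E))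

      g : ℕ → ℕ → ℕ → ℚ
      g s t k = G (Rel s t k)

      Gμ : ℕ → ℚ
      Gμ j = ∑ Q (λ ω → ι (lg (μ j ω)))

      G-⊆ : ∀ {R S : Eqv Ω} → R ⊆ S → S ⊆ R → G R ≡ G S
      G-⊆ {R} {S} a b = ∑-cong Q λ ω → cong (ι ∘ lg) (ℕP.≤-antisym (cnt-⊆ {R} {S} a ω) (cnt-⊆ {S} {R} b ω))

      diag : (k : ℕ) → ℚ
      diag k = sumTo (λ j → g j j k) n

      -- Submodularity trades `g (i + 1) i` and `g i 0` for `g i i` and `g (i + 1) 0`, at a price of
      -- `2 ∣Q∣`. The terms with second index `0` telescope.
      staircase : ∀ k → sumTo (λ j → g (suc j) j k) n + g 0 0 k ≤ diag k + g n 0 k + ι n * (∣Q∣ + ∣Q∣)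
      staircase k = go n
        where
        go : ∀ i → sumTo (λ j → g (suc j) j k) i + g 0 0 k ≤ sumTo (λ j → g j j k) i + g i 0 k + ι i * (∣Q∣ + ∣Q∣)
        go zero = ≤-reflexive (trans (identity-52 (g 0 0 k) (∣Q∣ + ∣Q∣)) (cong (λ u → 0ℚ + g 0 0 k + u * (∣Q∣ + ∣Q∣)) (sym ι0)))
        go (suc i) = -≤0⇒≤ (subst (0ℚ ≤_) (trans (identity-53 (sumTo (λ j → g (suc j) j k) i) (g 0 0 k) (sumTo (λ j → g j j k) i) (g i 0 k) (ι i) ∣Q∣ (g i i k) (g (suc i) 0 k) (g (suc i) i k))
            (cong (λ u → sumTo (λ j → g j j k) (suc i) + g (suc i) 0 k + u * (∣Q∣ + ∣Q∣) - (sumTo (λ j → g (suc j) j k) (suc i) + g 0 0 k)) (sym (ι-suc i))))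
          (0≤+ (0≤- (go i)) (0≤- sub)))
          where
          sub : g (suc i) i k + g i 0 k ≤ (∣Q∣ + g i i k) + (∣Q∣ + g (suc i) 0 k)
          sub = submodular (Rel (suc i) i k) (Rel i 0 k) (Rel (suc i) 0 k) (Rel i i k)
            (Rel-mono (ℕP.n≤1+n i) ℕP.≤-refl ℕP.≤-refl) (Rel-mono ℕP.≤-refl z≤n ℕP.≤-refl)
            (λ { (a , _ , _) (_ , b , r) → a , b , r })

      -- superadditivity of the sums of logarithms of class sizes over independent-looking coordinates
      chain : (A P : ℕ → Eqv Ω) → (∀ {ω ω′} → P 0 ∋ ω ≈ ω′) →
        (∀ i {ω ω′} → A i ∋ ω ≈ ω′ → P i ∋ ω ≈ ω′ → P (suc i) ∋ ω ≈ ω′) →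
        sumTo (G ∘ A) n + q ≤ G (P n) + ι n * q + ι n * (∣Q∣ + ∣Q∣)
      chain A P triv ext = go n
        where
        cnt0 : ∀ ω → cnt (P 0) ω ≡ length Q
        cnt0 ω = all Q
          where
          all : ∀ xs → count (P 0 ∋ ω ≈?_) xs ≡ length xs
          all [] = refl
          all (a ∷ xs) with P 0 ∋ ω ≈? a
          ... | yes _ = cong suc (all xs)
          ... | no ¬p = contradiction triv ¬p
        GP0 : G (P 0) ≡ q
        GP0 = trans (∑-cong Q λ ω → cong (ι ∘ lg) (cnt0 ω)) (∑-const Q _)
        go : ∀ i → sumTo (G ∘ A) i + q ≤ G (P i) + ι i * q + ι i * (∣Q∣ + ∣Q∣)
        go zero = ≤-reflexive (trans (identity-54 q (∣Q∣ + ∣Q∣)) (cong₂ (λ u v → u + v * q + v * (∣Q∣ + ∣Q∣)) (sym GP0) (sym ι0)))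
        go (suc i) = -≤0⇒≤ (subst (0ℚ ≤_) (trans (identity-55 (sumTo (G ∘ A) i) q (G (P i)) (ι i) ∣Q∣ (G (A i)) (G (P (suc i))))
            (cong (λ u → G (P (suc i)) + u * q + u * (∣Q∣ + ∣Q∣) - (sumTo (G ∘ A) (suc i) + q)) (sym (ι-suc i))))
          (0≤+ (0≤- (go i)) (0≤- sub)))
          where
          sub : G (A i) + G (P i) ≤ (∣Q∣ + q) + (∣Q∣ + G (P (suc i)))
          sub = subst (λ u → G (A i) + G (P i) ≤ (∣Q∣ + u) + (∣Q∣ + G (P (suc i)))) GP0
            (submodular (A i) (P i) (P (suc i)) (P 0) (λ _ → triv) (λ _ → triv) (ext i))

      GX GY : ℚ
      GX = sumTo (λ j → G (xk j)) n
      GY = sumTo (λ j → G (yk j)) n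

      GX≤ : GX + q ≤ g n n 0 + ι n * q + ι n * (∣Q∣ + ∣Q∣)
      GX≤ = chain xk (λ i → Rel i n 0) ((λ _ ()) , (λ i h h′ → contradiction h′ (ℕP.<⇒≱ h)) , (λ _ ())) (λ i → add-x {i})

      GY≤ : GY + q ≤ g 0 0 0 + ι n * q + ι n * (∣Q∣ + ∣Q∣)
      GY≤ = subst (λ u → GY + q ≤ u + ι n * q + ι n * (∣Q∣ + ∣Q∣)) (G-⊆ {⋂ n yk} {Rel 0 0 0} (λ p → (λ _ ()) , (λ i h _ → p i h) , (λ _ ())) (λ (_ , q , _) i h → q i h z≤n))
        (chain yk (λ i → ⋂ i yk) (λ _ ()) ext)
        where
        ext : ∀ i {ω ω′} → y i ω ≡ y i ω′ → ⋂ i yk ∋ ω ≈ ω′ → ⋂ (suc i) yk ∋ ω ≈ ω′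
        ext i e p k h with splitLast h
        ... | inj₁ h′   = p k h′
        ... | inj₂ refl = e

      gμ : ℚ
      gμ = sumTo Gμ n

      -- Once all inputs are fixed, only repetitions in `E` remain, and `hprod` bounds their number
      -- by a product over the coordinates. Rounding up each factor costs one unit.
      top≤ : g n 0 T ≤ gμ + ι n * ∣Q∣
      top≤ = ≤≡ (∑-mono Q pointwise) (trans (∑-+ Q _ _) (cong₂ _+_ (∑-sumTo Q (λ j ω → ι (lg (μ j ω))) n) (trans (∑-const Q (ι n)) (*-comm ∣Q∣ (ι n)))))
        where
        floors : Ω → ℕ → ℕ
        floors ω zero    = 0
        floors ω (suc i) = floors ω i ℕ.+ suc (lg (μ i ω))
        prod≤ : ∀ ω i → prodTo (λ j → ι (μ j ω)) i ≤ pw β (floors ω i)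
        prod≤ ω zero    = ≤-refl
        prod≤ ω (suc i) = ≤≡ (*-mono (0≤prod i) (pw-0≤ 0≤β (suc (lg (μ i ω)))) (prod≤ ω i) (lg-≥ (μ i ω))) (sym (pw-+ β (floors ω i) (suc (lg (μ i ω)))))
          where
          0≤prod : ∀ i → 0ℚ ≤ prodTo (λ j → ι (μ j ω)) i
          0≤prod zero    = 0≤1
          0≤prod (suc i) = 0≤* (0≤prod i) (0≤ι (μ i ω))
        floors≡ : ∀ ω i → ι (floors ω i) ≡ sumTo (λ j → ι (lg (μ j ω))) i + ι i
        floors≡ ω zero    = trans ι0 (sym (trans (+-identityˡ _) ι0))
        floors≡ ω (suc i) = trans (ι-+ (floors ω i) (suc (lg (μ i ω)))) (trans (cong₂ _+_ (floors≡ ω i) (ι-suc (lg (μ i ω))))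
          (trans (identity-56 (sumTo (λ j → ι (lg (μ j ω))) i) (ι i) (ι (lg (μ i ω)))) (cong (λ u → sumTo (λ j → ι (lg (μ j ω))) (suc i) + u) (sym (ι-suc i)))))
        pointwise : ∀ ω → ι (lg (cnt (Rel n 0 T) ω)) ≤ sumTo (λ j → ι (lg (μ j ω))) n + ι n
        pointwise ω = ≤≡ (ι-mono (β^-cancel (≤-trans (lg-≤ (cnt-pos (Rel n 0 T) ω))
          (≤-trans (ι-mono (cnt-⊆ {Rel n 0 T} {Rel n 0 0} (Rel-mono ℕP.≤-refl ℕP.≤-refl z≤n) ω)) (≤-trans (hprod ω) (prod≤ ω n)))))) (floors≡ ω n)

      -- the information carried by the own bits, seen from the staircase
      UU : ℕ → ℕ → ℚ
      UU j zero    = 0ℚ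
      UU j (suc K) = UU j K + (G (Own 1 j K) - G (Own 0 j K))

      inc : Bool → ℕ → ℕ → ℚ
      inc true  s k = g s s (suc k) - g s s k
      inc false s k = 0ℚ

      UA UB : ℕ → ℕ → ℚ
      UA s zero    = 0ℚ
      UA s (suc K) = UA s K + inc (own K) s K
      UB s zero    = 0ℚ
      UB s (suc K) = UB s K + inc (not (own K)) s K

      -- Alice's view at the coordinate `j` contains `x j` and Bob's contains `y j`. Hence her bits
      -- are measured at the diagonal point `j + 1` and his at the diagonal point `j`.
      UU≡ : ∀ j K → UU j K ≡ UA (suc j) K + UB j K
      UU≡ j zero    = sym (+-identityˡ 0ℚ)
      UU≡ j (suc K) = trans (cong₂ _+_ (UU≡ j K) (split (own K) refl)) (identity-67 (UA (suc j) K) (UB j K) (inc (own K) (suc j) K) (inc (not (own K)) j K))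
        where
        split : ∀ o → own K ≡ o → G (Own 1 j K) - G (Own 0 j K) ≡ inc o (suc j) K + inc (not o) j K
        split true  e rewrite e = sym (+-identityʳ _)
        split false e rewrite e = sym (+-identityˡ _)

      UA+UB : ∀ s K → UA s K + UB s K ≡ g s s K - g s s 0
      UA+UB s zero    = trans (+-identityˡ 0ℚ) (sym (+-inverseʳ (g s s 0)))
      UA+UB s (suc K) = trans (identity-68 (UA s K) (UB s K) (inc (own K) s K) (inc (not (own K)) s K))
        (trans (cong₂ _+_ (UA+UB s K) (both (own K))) (identity-69 (g s s K) (g s s 0) (g s s (suc K))))
        where
        both : ∀ o → inc o s K + inc (not o) s K ≡ g s s (suc K) - g s s K
        both true  = +-identityʳ _
        both false = +-identityˡ _

      UA-n : ∀ K → UA n K ≡ 0ℚ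
      UA-n zero    = refl
      UA-n (suc K) = trans (cong₂ _+_ (UA-n K) (go (own K) refl)) (+-identityˡ 0ℚ)
        where
        go : ∀ o → own K ≡ o → inc o n K ≡ 0ℚ
        go false e = refl
        go true  e = trans (cong (_- g n n K) (G-⊆ {Rel n n (suc K)} {Rel n n K} (Rel-mono ℕP.≤-refl ℕP.≤-refl (ℕP.n≤1+n K)) (λ p → add-m (detA K e p) p))) (+-inverseʳ (g n n K))

      UB-0 : ∀ K → UB 0 K ≡ 0ℚ
      UB-0 zero    = refl
      UB-0 (suc K) = trans (cong₂ _+_ (UB-0 K) (go (own K) refl)) (+-identityˡ 0ℚ)
        where
        go : ∀ o → own K ≡ o → inc (not o) 0 K ≡ 0ℚ
        go true  e = refl
        go false e = trans (cong (_- g 0 0 K) (G-⊆ {Rel 0 0 (suc K)} {Rel 0 0 K} (Rel-mono ℕP.≤-refl ℕP.≤-refl (ℕP.n≤1+n K)) (λ p → add-m (detB K e p) p))) (+-inverseʳ (g 0 0 K))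

      -- `UA + UB` at a diagonal point is the full increment there, so replacing `UB i` by that
      -- increment minus `UA i` makes the shift by one telescope to `UA n - UA 0`. The boundary is
      -- known because a player with its whole input determines its own bits: `UA n = 0`, and
      -- `UB 0 = 0` gives `UA 0`.
      ∑UU : ∀ K → sumTo (λ j → UU j K) n ≡ (diag K - diag 0) - (g 0 0 K - g 0 0 0)
      ∑UU K = trans (go n) (trans (cong₂ (λ u v → (diag K - diag 0) + u - v) (UA-n K) UA-0) (identity-70 (diag K - diag 0) (g 0 0 K - g 0 0 0)))
        where
        UA-0 : UA 0 K ≡ g 0 0 K - g 0 0 0
        UA-0 = trans (sym (+-identityʳ _)) (trans (cong (UA 0 K +_) (sym (UB-0 K))) (UA+UB 0 K))
        go : ∀ i → sumTo (λ j → UU j K) i ≡ (sumTo (λ j → g j j K) i - sumTo (λ j → g j j 0) i) + UA i K - UA 0 K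
        go zero = identity-57 (UA 0 K)
        go (suc i) = trans (cong₂ _+_ (go i) (trans (UU≡ i K) (identity-58 (UA (suc i) K) (UB i K) (UA i K))))
          (trans (cong (λ u → (sumTo (λ j → g j j K) i - sumTo (λ j → g j j 0) i) + UA i K - UA 0 K + (UA (suc i) K + u - UA i K)) (UA+UB i K))
          (identity-59 (sumTo (λ j → g j j K) i) (sumTo (λ j → g j j 0) i) (UA i K) (UA 0 K) (UA (suc i) K) (g i i K) (g i i 0)))

      shifted : ∀ k → sumTo (λ j → g (suc j) (suc j) k) n ≡ diag k - g 0 0 k + g n n k
      shifted k = go n
        where
        go : ∀ i → sumTo (λ j → g (suc j) (suc j) k) i ≡ sumTo (λ j → g j j k) i - g 0 0 k + g i i k
        go zero = identity-60 (g 0 0 k)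
        go (suc i) = trans (cong (_+ g (suc i) (suc i) k) (go i)) (identity-61 (sumTo (λ j → g j j k) i) (g 0 0 k) (g i i k) (g (suc i) (suc i) k))

      DX DY D : ℕ → ℕ → ℚ
      DX j K = (ι 3 + ι K) * ∣Q∣ + (ℓE + G (xk j)) - (Gμ j + g (suc j) (suc j) 0) - UU j K + g (suc j) j K - q
      DY j K = (ι 3 + ι K) * ∣Q∣ + (ℓE + G (yk j)) - (Gμ j + g j j 0) - UU j K + g (suc j) j K - q
      D j K = DX j K + DY j K

      ∑D : ∀ K → sumTo (λ j → D j K) n ≡ ι n * ((ι 3 + ι K) * ∣Q∣ + ℓE - q) + ι n * ((ι 3 + ι K) * ∣Q∣ + ℓE - q) + (GX + GY)
        - (gμ + gμ) - (sumTo (λ j → g (suc j) (suc j) 0) n + diag 0)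
        - (sumTo (λ j → UU j K) n + sumTo (λ j → UU j K) n) + (sumTo (λ j → g (suc j) j K) n + sumTo (λ j → g (suc j) j K) n)
      ∑D K = go n
        where
        C₀ : ℚ
        C₀ = (ι 3 + ι K) * ∣Q∣
        go : ∀ i → sumTo (λ j → D j K) i ≡ ι i * (C₀ + ℓE - q) + ι i * (C₀ + ℓE - q) + (sumTo (λ j → G (xk j)) i + sumTo (λ j → G (yk j)) i)
          - (sumTo Gμ i + sumTo Gμ i) - (sumTo (λ j → g (suc j) (suc j) 0) i + sumTo (λ j → g j j 0) i)
          - (sumTo (λ j → UU j K) i + sumTo (λ j → UU j K) i) + (sumTo (λ j → g (suc j) j K) i + sumTo (λ j → g (suc j) j K) i)
        go zero = trans (identity-62 (C₀ + ℓE - q)) (cong (λ u → u * (C₀ + ℓE - q) + u * (C₀ + ℓE - q) + (0ℚ + 0ℚ) - (0ℚ + 0ℚ) - (0ℚ + 0ℚ) - (0ℚ + 0ℚ) + (0ℚ + 0ℚ)) (sym ι0))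
        go (suc i) = trans (cong (_+ D i K) (go i)) (trans
          (identity-63 (ι i) C₀ ℓE q (sumTo (λ j → G (xk j)) i) (sumTo (λ j → G (yk j)) i) (sumTo Gμ i) (sumTo (λ j → g (suc j) (suc j) 0) i) (sumTo (λ j → g j j 0) i)
            (sumTo (λ j → UU j K) i) (sumTo (λ j → g (suc j) j K) i) (G (xk i)) (G (yk i)) (Gμ i) (g (suc i) (suc i) 0) (g i i 0) (UU i K) (g (suc i) i K))
          (cong (λ u → u * (C₀ + ℓE - q) + u * (C₀ + ℓE - q) + (sumTo (λ j → G (xk j)) (suc i) + sumTo (λ j → G (yk j)) (suc i))
            - (sumTo Gμ (suc i) + sumTo Gμ (suc i)) - (sumTo (λ j → g (suc j) (suc j) 0) (suc i) + sumTo (λ j → g j j 0) (suc i))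
            - (sumTo (λ j → UU j K) (suc i) + sumTo (λ j → UU j K) (suc i)) + (sumTo (λ j → g (suc j) j K) (suc i) + sumTo (λ j → g (suc j) j K) (suc i))) (sym (ι-suc i))))

      module Sizes (hsize : ι n * ι (lg (length E)) ≤ ι (lg (length Q)) + 1ℚ + ι n * ι N₁) where

        hsizeQ : ι n * ℓE ≤ q + ∣Q∣ + ∣Q∣ * (ι n * ι N₁)
        hsizeQ = subst₂ _≤_ (identity-22 ∣Q∣ (ι n) (ι (lg (length E)))) (identity-64 ∣Q∣ (ι (lg (length Q))) (ι n * ι N₁)) (*ˡ ∣Q∣ (0≤ι (length Q)) hsize)

        -- The difference of the two sides is a sum of slacks of `staircase`, `top≤`, `GX≤`, `GY≤`
        -- and `hsizeQ`, in which all entropies cancel. What remains are rounding units and the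
        -- price `n N₁` of conditioning on success, once for each player.
        total₁ : sumTo (λ j → D j T) n ≤ ∣Q∣ * (ι n * (ι T + ι T) + ι n * ι 16 + (1ℚ + 1ℚ) + (ι n * ι N₁ + ι n * ι N₁))
        total₁ = -≤0⇒≤ (subst (0ℚ ≤_) (sym (trans (cong (λ u → B - u) (trans (∑D T) (cong₂ (λ u v → A₁ - (u + diag 0) - (v + v) + (H + H)) (shifted 0) (∑UU T)))) final))
          (0≤+ (0≤+ (0≤+ (0≤+ (0≤+ (0≤+ (0≤- (staircase T)) (0≤- (staircase T))) (0≤- top≤)) (0≤- top≤)) (0≤- GX≤)) (0≤- GY≤)) (0≤+ (0≤- hsizeQ) (0≤- hsizeQ))))
          where
          B A₁ H : ℚ
          B = ∣Q∣ * (ι n * (ι T + ι T) + ι n * ι 16 + (1ℚ + 1ℚ) + (ι n * ι N₁ + ι n * ι N₁))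
          H = sumTo (λ j → g (suc j) j T) n
          A₁ = ι n * ((ι 3 + ι T) * ∣Q∣ + ℓE - q) + ι n * ((ι 3 + ι T) * ∣Q∣ + ℓE - q) + (GX + GY) - (gμ + gμ)
          final : B - (A₁ - (diag 0 - g 0 0 0 + g n n 0 + diag 0) - (((diag T - diag 0) - (g 0 0 T - g 0 0 0)) + ((diag T - diag 0) - (g 0 0 T - g 0 0 0))) + (H + H)) ≡
            ((((((diag T + g n 0 T + ι n * (∣Q∣ + ∣Q∣) - (H + g 0 0 T)) + (diag T + g n 0 T + ι n * (∣Q∣ + ∣Q∣) - (H + g 0 0 T)))
            + (gμ + ι n * ∣Q∣ - g n 0 T)) + (gμ + ι n * ∣Q∣ - g n 0 T)) + (g n n 0 + ι n * q + ι n * (∣Q∣ + ∣Q∣) - (GX + q))) + (g 0 0 0 + ι n * q + ι n * (∣Q∣ + ∣Q∣) - (GY + q)))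
            + ((q + ∣Q∣ + ∣Q∣ * (ι n * ι N₁) - ι n * ℓE) + (q + ∣Q∣ + ∣Q∣ * (ι n * ι N₁) - ι n * ℓE))
          final = trans (cong₂ (λ u v → ∣Q∣ * (ι n * (ι T + ι T) + ι n * u + (1ℚ + 1ℚ) + (ι n * ι N₁ + ι n * ι N₁)) -
              ((ι n * ((v + ι T) * ∣Q∣ + ℓE - q) + ι n * ((v + ι T) * ∣Q∣ + ℓE - q) + (GX + GY) - (gμ + gμ)) - (diag 0 - g 0 0 0 + g n n 0 + diag 0) - (((diag T - diag 0) - (g 0 0 T - g 0 0 0)) + ((diag T - diag 0) - (g 0 0 T - g 0 0 0))) + (H + H)))
              (trans (ι-+ 8 8) (cong₂ _+_ ι8 ι8)) ι3)
            (identity-44 ∣Q∣ (ι n) (ι T) (ι n * ι N₁) ℓE q GX GY gμ (diag 0) (diag T) (g 0 0 0) (g 0 0 T) (g n n 0) (g n 0 T) H)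

        bits≤ : ∀ s t K → g s t 0 ≤ g s t K + ι K * (∣Q∣ + ∣Q∣ * (1ℚ + ι N))
        bits≤ s t zero    = ≤-reflexive (trans (identity-65 (g s t 0) (∣Q∣ + ∣Q∣ * (1ℚ + ι N))) (cong (λ u → g s t 0 + u * (∣Q∣ + ∣Q∣ * (1ℚ + ι N))) (sym ι0)))
        bits≤ s t (suc K) = ≤-trans (bits≤ s t K) (≤≡ (+-monoˡ-≤ (ι K * (∣Q∣ + ∣Q∣ * (1ℚ + ι N)))
            (bit-log (Rel s t K) (Rel s t (suc K)) (bits K) (λ p e → add-m e p)))
          (trans (identity-66 ∣Q∣ (g s t (suc K)) (∣Q∣ * (1ℚ + ι N)) (ι K)) (cong (λ u → g s t (suc K) + u * (∣Q∣ + ∣Q∣ * (1ℚ + ι N))) (sym (ι-suc K)))))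

        -- For each level and each player, the information about the next bit that the other's input
        -- adds to this player's view. The sum over the levels telescopes, which leaves only the
        -- values at `0` and `T`.
        M : ℕ → ℚ
        M j = ι T * (∣Q∣ + ∣Q∣ + (∣Q∣ + ∣Q∣)) + ((g (suc j) j T - g (suc j) j 0) + (g (suc j) j T - g (suc j) j 0)) - (g j j T - g j j 0) - (g (suc j) (suc j) T - g (suc j) (suc j) 0)

        ∑M : sumTo M n ≡ ι n * (ι T * (∣Q∣ + ∣Q∣ + (∣Q∣ + ∣Q∣))) + ((sumTo (λ j → g (suc j) j T) n - sumTo (λ j → g (suc j) j 0) n) + (sumTo (λ j → g (suc j) j T) n - sumTo (λ j → g (suc j) j 0) n))
          - (diag T - diag 0) - (sumTo (λ j → g (suc j) (suc j) T) n - sumTo (λ j → g (suc j) (suc j) 0) n)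
        ∑M = go n
          where
          t : ℚ
          t = ι T * (∣Q∣ + ∣Q∣ + (∣Q∣ + ∣Q∣))
          go : ∀ i → sumTo M i ≡ ι i * t + ((sumTo (λ j → g (suc j) j T) i - sumTo (λ j → g (suc j) j 0) i) + (sumTo (λ j → g (suc j) j T) i - sumTo (λ j → g (suc j) j 0) i))
            - (sumTo (λ j → g j j T) i - sumTo (λ j → g j j 0) i) - (sumTo (λ j → g (suc j) (suc j) T) i - sumTo (λ j → g (suc j) (suc j) 0) i)
          go zero = trans (identity-45 t) (cong (λ u → u * t + ((0ℚ - 0ℚ) + (0ℚ - 0ℚ)) - (0ℚ - 0ℚ) - (0ℚ - 0ℚ)) (sym ι0))
          go (suc i) = trans (cong (_+ M i) (go i)) (trans
            (identity-46 (ι i) t (sumTo (λ j → g (suc j) j T) i) (sumTo (λ j → g (suc j) j 0) i) (sumTo (λ j → g j j T) i) (sumTo (λ j → g j j 0) i) (sumTo (λ j → g (suc j) (suc j) T) i) (sumTo (λ j → g (suc j) (suc j) 0) i)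
              (g (suc i) i T) (g (suc i) i 0) (g i i T) (g i i 0) (g (suc i) (suc i) T) (g (suc i) (suc i) 0))
            (cong (λ u → u * t + ((sumTo (λ j → g (suc j) j T) (suc i) - sumTo (λ j → g (suc j) j 0) (suc i)) + (sumTo (λ j → g (suc j) j T) (suc i) - sumTo (λ j → g (suc j) j 0) (suc i)))
            - (sumTo (λ j → g j j T) (suc i) - sumTo (λ j → g j j 0) (suc i)) - (sumTo (λ j → g (suc j) (suc j) T) (suc i) - sumTo (λ j → g (suc j) (suc j) 0) (suc i))) (sym (ι-suc i))))

        -- The nonnegative `D j 0` are added because each contains `2 g (j + 1) j 0`, which removes
        -- these terms from `M`. The transcript then enters through `bits≤` at the two ends of the
        -- diagonal, worth `T` bits at each.
        total₂ : sumTo M n + sumTo (λ j → D j 0) n ≤ ∣Q∣ * (ι n * (ι T + ι T + (ι T + ι T)) + ι n * ι 16 + (1ℚ + 1ℚ) + (ι n * ι N₁ + ι n * ι N₁) + (ι T + ι T) * (1ℚ + 1ℚ + ι N))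
        total₂ = -≤0⇒≤ (subst (0ℚ ≤_) (sym (trans (cong₂ (λ u v → B - (u + v)) (trans ∑M (cong₂ (λ u v → X₁ - (u - v)) (shifted T) (shifted 0)))
              (trans (∑D 0) (cong₂ (λ u v → A₁ - (u + diag 0) - (v + v) + (H₀ + H₀)) (shifted 0) (∑UU 0)))) final))
          (0≤+ (0≤+ (0≤+ (0≤+ (0≤+ (0≤+ (0≤+ (0≤- (staircase T)) (0≤- (staircase T))) (0≤- top≤)) (0≤- top≤)) (0≤- GX≤)) (0≤- GY≤)) (0≤+ (0≤- hsizeQ) (0≤- hsizeQ)))
            (0≤+ (0≤- (bits≤ 0 0 T)) (0≤- (bits≤ n n T)))))
          where
          B A₁ H H₀ X₁ : ℚ
          B = ∣Q∣ * (ι n * (ι T + ι T + (ι T + ι T)) + ι n * ι 16 + (1ℚ + 1ℚ) + (ι n * ι N₁ + ι n * ι N₁) + (ι T + ι T) * (1ℚ + 1ℚ + ι N))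
          H = sumTo (λ j → g (suc j) j T) n
          H₀ = sumTo (λ j → g (suc j) j 0) n
          X₁ = ι n * (ι T * (∣Q∣ + ∣Q∣ + (∣Q∣ + ∣Q∣))) + ((H - H₀) + (H - H₀)) - (diag T - diag 0)
          A₁ = ι n * ((ι 3 + ι 0) * ∣Q∣ + ℓE - q) + ι n * ((ι 3 + ι 0) * ∣Q∣ + ℓE - q) + (GX + GY) - (gμ + gμ)
          final : B - ((X₁ - ((diag T - g 0 0 T + g n n T) - (diag 0 - g 0 0 0 + g n n 0))) +
              (A₁ - (diag 0 - g 0 0 0 + g n n 0 + diag 0) - (((diag 0 - diag 0) - (g 0 0 0 - g 0 0 0)) + ((diag 0 - diag 0) - (g 0 0 0 - g 0 0 0))) + (H₀ + H₀))) ≡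
            ((((((diag T + g n 0 T + ι n * (∣Q∣ + ∣Q∣) - (H + g 0 0 T)) + (diag T + g n 0 T + ι n * (∣Q∣ + ∣Q∣) - (H + g 0 0 T)))
            + (gμ + ι n * ∣Q∣ - g n 0 T)) + (gμ + ι n * ∣Q∣ - g n 0 T)) + (g n n 0 + ι n * q + ι n * (∣Q∣ + ∣Q∣) - (GX + q))) + (g 0 0 0 + ι n * q + ι n * (∣Q∣ + ∣Q∣) - (GY + q)))
            + ((q + ∣Q∣ + ∣Q∣ * (ι n * ι N₁) - ι n * ℓE) + (q + ∣Q∣ + ∣Q∣ * (ι n * ι N₁) - ι n * ℓE))
            + ((g 0 0 T + ι T * (∣Q∣ + ∣Q∣ * (1ℚ + ι N)) - g 0 0 0) + (g n n T + ι T * (∣Q∣ + ∣Q∣ * (1ℚ + ι N)) - g n n 0))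
          final = trans (cong₂ (λ u v → ∣Q∣ * (ι n * (ι T + ι T + (ι T + ι T)) + ι n * u + (1ℚ + 1ℚ) + (ι n * ι N₁ + ι n * ι N₁) + (ι T + ι T) * (1ℚ + 1ℚ + ι N)) -
              ((X₁ - ((diag T - g 0 0 T + g n n T) - (diag 0 - g 0 0 0 + g n n 0))) + ((ι n * (v * ∣Q∣ + ℓE - q) + ι n * (v * ∣Q∣ + ℓE - q) + (GX + GY) - (gμ + gμ)) - (diag 0 - g 0 0 0 + g n n 0 + diag 0) - (((diag 0 - diag 0) - (g 0 0 0 - g 0 0 0)) + ((diag 0 - diag 0) - (g 0 0 0 - g 0 0 0))) + (H₀ + H₀))))
              (trans (ι-+ 8 8) (cong₂ _+_ ι8 ι8)) (trans (cong₂ _+_ ι3 ι0) (+-identityʳ _)))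
            (identity-47 ∣Q∣ (ι n) (ι T) (ι n * ι N₁) (ι N) ℓE q GX GY gμ (diag 0) (diag T) (g 0 0 0) (g 0 0 T) (g n n 0) (g n n T) (g n 0 T) H H₀)

        -- The probability of the next bit given one view, divided by its probability given both:
        -- `w₁` for Bob's view and `w₂` for Alice's.
        w₁ w₂ : ℕ → ℕ → Ω → ℚ
        w₁ j k = ratio (Rel j j (suc k)) (Rel (suc j) j k) (Rel (suc j) j (suc k)) (Rel j j k)
        w₂ j k = ratio (Rel (suc j) (suc j) (suc k)) (Rel (suc j) j k) (Rel (suc j) j (suc k)) (Rel (suc j) (suc j) k)

        mistakes : ℕ → Ω → ℕ → ℚ
        mistakes j ω k = plus (1ℚ - w₁ j k ω) + plus (1ℚ - w₂ j k ω)

        mistakes-tangent : ∀ h N′ → N ≡ suc h ℕ.* suc h ℕ.* N′ → ∀ j → let θ = inv (suc h) in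
          θ * ∑ Q (λ ω → sumTo (mistakes j ω) T) ≤ M j * inv N + ι T * (∣Q∣ * (θ * θ) + ∣Q∣ * (θ * θ))
        mistakes-tangent h N′ eq j = ≡≤ (trans (cong (θ *_) (∑-sumTo Q (λ k ω → mistakes j ω k) T)) (sym (sumTo-*ˡ θ (λ k → ∑ Q (λ ω → mistakes j ω k)) T))) (go T)
          where
          θ t : ℚ
          θ = inv (suc h)
          t = ∣Q∣ * (θ * θ)
          br : (AC BC ABC C : Eqv Ω) → ℚ
          br AC BC ABC C = (∣Q∣ + G C) + (∣Q∣ + G ABC) - (G AC + G BC)
          M′ : ℕ → ℚ
          M′ K = ι K * (∣Q∣ + ∣Q∣ + (∣Q∣ + ∣Q∣)) + ((g (suc j) j K - g (suc j) j 0) + (g (suc j) j K - g (suc j) j 0)) - (g j j K - g j j 0) - (g (suc j) (suc j) K - g (suc j) (suc j) 0)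
          go : ∀ K → sumTo (λ k → θ * ∑ Q (λ ω → mistakes j ω k)) K ≤ M′ K * inv N + ι K * (t + t)
          go zero = ≤-reflexive (trans (identity-48 (∣Q∣ + ∣Q∣ + (∣Q∣ + ∣Q∣)) (g (suc j) j 0) (g j j 0) (g (suc j) (suc j) 0) (inv N) (t + t))
              (cong (λ u → (u * (∣Q∣ + ∣Q∣ + (∣Q∣ + ∣Q∣)) + ((g (suc j) j 0 - g (suc j) j 0) + (g (suc j) j 0 - g (suc j) j 0)) - (g j j 0 - g j j 0) - (g (suc j) (suc j) 0 - g (suc j) (suc j) 0)) * inv N + u * (t + t)) (sym ι0)))
          go (suc K) = ≤≡ (+-mono-≤ (go K) level) (trans
              (identity-49 (ι K) ∣Q∣ (g (suc j) j K) (g (suc j) j 0) (g j j K) (g j j 0) (g (suc j) (suc j) K) (g (suc j) (suc j) 0) (g (suc j) j (suc K)) (g j j (suc K)) (g (suc j) (suc j) (suc K)) (inv N) t)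
              (cong (λ u → (u * (∣Q∣ + ∣Q∣ + (∣Q∣ + ∣Q∣)) + ((g (suc j) j (suc K) - g (suc j) j 0) + (g (suc j) j (suc K) - g (suc j) j 0)) - (g j j (suc K) - g j j 0) - (g (suc j) (suc j) (suc K) - g (suc j) (suc j) 0)) * inv N + u * (t + t)) (sym (ι-suc K))))
            where
            level : θ * ∑ Q (λ ω → mistakes j ω K) ≤
              (br (Rel j j (suc K)) (Rel (suc j) j K) (Rel (suc j) j (suc K)) (Rel j j K) * inv N + t) +
              (br (Rel (suc j) (suc j) (suc K)) (Rel (suc j) j K) (Rel (suc j) j (suc K)) (Rel (suc j) (suc j) K) * inv N + t)
            level = ≡≤ (trans (cong (θ *_) (∑-+ Q _ _)) (*-distribˡ-+ θ _ _))
              (+-mono-≤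
                (ratio-tangent h N′ eq (Rel j j (suc K)) (Rel (suc j) j K) (Rel (suc j) j (suc K)) (Rel j j K)
                  (Rel-mono ℕP.≤-refl ℕP.≤-refl (ℕP.n≤1+n K)) (Rel-mono (ℕP.n≤1+n j) ℕP.≤-refl ℕP.≤-refl) (λ p → add-m (last-m {j} {j} p)))
                (ratio-tangent h N′ eq (Rel (suc j) (suc j) (suc K)) (Rel (suc j) j K) (Rel (suc j) j (suc K)) (Rel (suc j) (suc j) K)
                  (Rel-mono ℕP.≤-refl ℕP.≤-refl (ℕP.n≤1+n K)) (Rel-mono ℕP.≤-refl (ℕP.n≤1+n j) ℕP.≤-refl) (λ p → add-m (last-m {suc j} {suc j} p))))

        module _ {j : ℕ} (j<n : j ℕ.< n) where

          private
            module PX = LX j<n N 1≤N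
            module PY = LY j<n N 1≤N

          wX wY : ℕ → Ω → ℚ
          wX = PX.w 1≤#E 1≤#Q
          wY = PY.w 1≤#E 1≤#Q

          private
            UX : ∀ K → PX.U 1≤#E 1≤#Q K ≡ UU j K
            UX zero    = refl
            UX (suc K) = cong (_+ (G (Own 1 j K) - G (Own 0 j K))) (UX K)

            UY : ∀ K → PY.U 1≤#E 1≤#Q K ≡ UU j K
            UY zero    = refl
            UY (suc K) = cong (_+ (G (Own 1 j K) - G (Own 0 j K))) (UY K)

            DX≡ : ∀ K → PX.Div 1≤#E 1≤#Q K ≡ DX j K
            DX≡ K = cong (λ u → (ι 3 + ι K) * ∣Q∣ + (ℓE + G (xk j)) - (Gμ j + g (suc j) (suc j) 0) - u + g (suc j) j K - q) (UX K)

            DY≡ : ∀ K → PY.Div 1≤#E 1≤#Q K ≡ DY j K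
            DY≡ K = cong (λ u → (ι 3 + ι K) * ∣Q∣ + (ℓE + G (yk j)) - (Gμ j + g j j 0) - u + g (suc j) j K - q) (UY K)

          0≤D : ∀ K → 0ℚ ≤ D j K
          0≤D K = 0≤+ (subst (0ℚ ≤_) (DX≡ K) (PX.0≤Div 1≤#E 1≤#Q K)) (subst (0ℚ ≤_) (DY≡ K) (PY.0≤Div 1≤#E 1≤#Q K))

          loss : Ω → ℚ
          loss ω = plus (1ℚ - wX T ω) + plus (1ℚ - wY T ω)

          loss-tangent : ∀ h N′ → N ≡ suc h ℕ.* suc h ℕ.* N′ → let θ = inv (suc h) in
            θ * ∑ Q loss ≤ D j T * inv N + (∣Q∣ * (θ * θ) + ∣Q∣ * (θ * θ))
          loss-tangent h N′ eq = ≡≤ (trans (cong (θ *_) (∑-+ Q _ _)) (*-distribˡ-+ θ _ _))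
            (≤≡ (+-mono-≤ (PX.w-tangent 1≤#E 1≤#Q h N′ eq T) (PY.w-tangent 1≤#E 1≤#Q h N′ eq T))
            (trans (cong₂ (λ u v → (u * inv N + t) + (v * inv N + t)) (DX≡ T) (DY≡ T)) (identity-50 (DX j T) (DY j T) (inv N) t)))
            where
            θ t : ℚ
            θ = inv (suc h)
            t = ∣Q∣ * (θ * θ)

        -- `h` fixes the slope for the two sampling losses and `s`, of order `√n`, the slope for the
        -- mistakes. Up to `d` mistakes will be tolerated, so the weight `inv d` prepares Markov's
        -- inequality. `hA` and `hB` say that rounding units are negligible, `hC` that conditioning
        -- costs no more than the transcript is worth.
        module Pick (1≤n : 1 ℕ.≤ n) (h s N₂ : ℕ) (d : ℕ) (eq₁ : N ≡ suc h ℕ.* suc h ℕ.* N₁) (eq₂ : N ≡ suc s ℕ.* suc s ℕ.* N₂)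
          (hA : (ι T + ι 9) * inv N ≤ inv (suc h) * inv (suc h))
          (hB : (ι n * (ι T + ι T + (ι T + ι T)) + ι n * ι 16 + (1ℚ + 1ℚ) + (ι T + ι T) * (1ℚ + 1ℚ)) * inv N ≤ ι T)
          (hC : (ι n + ι n) * (inv (suc h) * inv (suc h)) ≤ ι T)
          (hs : ι (suc s) ≤ ι n * inv (suc s))
          (hd : (ι T * ι 6) * (inv (suc s) * inv d) ≤ inv 32) where

          θ₁ θ₂ : ℚ
          θ₁ = inv (suc h)
          θ₂ = inv (suc s)

          private
            N₁N : ι N₁ * inv N ≡ θ₁ * θ₁
            N₁N = trans (cong (ι N₁ *_) refl) (trans (sym (trans (cong (λ u → (u * u) * (ι N₁ * inv N)) (inv*ι {suc h} (s≤s z≤n))) (trans (cong (_* (ι N₁ * inv N)) (*-identityʳ 1ℚ)) (*-identityˡ _))))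
              (trans (identity-37 θ₁ (ι (suc h)) (ι N₁) (inv N)) (trans (cong (λ u → θ₁ * θ₁ * (u * inv N)) (sym (trans (cong ι eq₁) (trans (ι-* (suc h ℕ.* suc h) N₁) (cong (_* ι N₁) (ι-* (suc h) (suc h)))))))
                (trans (cong (θ₁ * θ₁ *_) (ι*inv 1≤N)) (*-identityʳ _)))))

          F : ℕ → ℚ
          F j = ι (suc h) * (D j T * inv N + (∣Q∣ * (θ₁ * θ₁) + ∣Q∣ * (θ₁ * θ₁)))
            + inv d * (ι (suc s) * ((M j + D j 0) * inv N + ι T * (∣Q∣ * (θ₂ * θ₂) + ∣Q∣ * (θ₂ * θ₂))))

          bound-F : ∀ {j} (j<n : j ℕ.< n) → ∑ Q (loss j<n) + inv d * ∑ Q (λ ω → sumTo (mistakes j ω) T) ≤ F j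
          bound-F {j} j<n = +-mono-≤ (scale h (loss-tangent j<n h N₁ eq₁))
            (*ˡ (inv d) (0≤inv d) (≤-trans (scale s (mistakes-tangent s N₂ eq₂ j)) (*ˡ (ι (suc s)) (0≤ι (suc s)) (+-monoˡ-≤ _ (*ʳ (inv N) (0≤inv N) (gap (D j 0) (0≤D j<n 0) refl))))))
            where
            scale : ∀ h {a b} → inv (suc h) * a ≤ b → a ≤ ι (suc h) * b
            scale h {a} {b} p = subst (_≤ ι (suc h) * b) (trans (sym (*-assoc _ _ a)) (trans (cong (_* a) (ι*inv {suc h} (s≤s z≤n))) (*-identityˡ a))) (*ˡ (ι (suc h)) (0≤ι (suc h)) p)

          ∑F : sumTo F n ≡ ι (suc h) * (sumTo (λ j → D j T) n * inv N + ι n * (∣Q∣ * (θ₁ * θ₁) + ∣Q∣ * (θ₁ * θ₁)))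
            + inv d * (ι (suc s) * ((sumTo M n + sumTo (λ j → D j 0) n) * inv N + ι n * (ι T * (∣Q∣ * (θ₂ * θ₂) + ∣Q∣ * (θ₂ * θ₂)))))
          ∑F = go n
            where
            a b : ℚ
            a = ∣Q∣ * (θ₁ * θ₁) + ∣Q∣ * (θ₁ * θ₁)
            b = ι T * (∣Q∣ * (θ₂ * θ₂) + ∣Q∣ * (θ₂ * θ₂))
            go : ∀ i → sumTo F i ≡ ι (suc h) * (sumTo (λ j → D j T) i * inv N + ι i * a) + inv d * (ι (suc s) * ((sumTo M i + sumTo (λ j → D j 0) i) * inv N + ι i * b))
            go zero = trans (identity-38 (ι (suc h)) (inv N) (inv d) (ι (suc s)) a b) (cong (λ u → ι (suc h) * (0ℚ * inv N + u * a) + inv d * (ι (suc s) * ((0ℚ + 0ℚ) * inv N + u * b))) (sym ι0))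
            go (suc i) = trans (cong (_+ F i) (go i)) (trans
              (identity-39 (ι (suc h)) (inv N) (inv d) (ι (suc s)) a b (ι i) (sumTo (λ j → D j T) i) (sumTo M i) (sumTo (λ j → D j 0) i) (D i T) (M i) (D i 0))
              (cong (λ u → ι (suc h) * (sumTo (λ j → D j T) (suc i) * inv N + u * a) + inv d * (ι (suc s) * ((sumTo M (suc i) + sumTo (λ j → D j 0) (suc i)) * inv N + u * b))) (sym (ι-suc i))))

          private
            one-h : ι (suc h) * θ₁ ≡ 1ℚ
            one-h = ι*inv {suc h} (s≤s z≤n)

            one-s : ι (suc s) * θ₂ ≡ 1ℚ
            one-s = ι*inv {suc s} (s≤s z≤n)

            ι16 : ι 16 + (1ℚ + 1ℚ) ≡ ι 9 + ι 9
            ι16 = trans (trans (cong (ι 16 +_) (sym (trans (ι-suc 1) (cong (1ℚ +_) ι1)))) (sym (ι-+ 16 2))) (ι-+ 9 9)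

            -- The six multiples of `θ₁²` per coordinate are two from rounding (`hA`), two from
            -- conditioning (`N₁ / N = θ₁²`) and two from the tangents of the two players. One
            -- factor `θ₁` cancels against `h + 1`.
            part₁ : ι (suc h) * (sumTo (λ j → D j T) n * inv N + ι n * (∣Q∣ * (θ₁ * θ₁) + ∣Q∣ * (θ₁ * θ₁))) ≤ ι n * (∣Q∣ * (ι 6 * θ₁))
            part₁ = ≤≡ (*ˡ (ι (suc h)) (0≤ι (suc h)) (+-monoˡ-≤ _ (≤-trans (*ʳ (inv N) (0≤inv N) total₁) inner)))
              (trans (identity-40 (ι (suc h)) θ₁ (ι n) ∣Q∣) (trans (cong (λ u → u * (ι n * (∣Q∣ * ((1ℚ + (1ℚ + 1ℚ) + (1ℚ + (1ℚ + 1ℚ))) * θ₁)))) one-h)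
                (trans (*-identityˡ _) (cong (λ u → ι n * (∣Q∣ * (u * θ₁))) (sym (trans (ι-+ 3 3) (cong₂ _+_ ι3 ι3)))))))
              where
              inner : ∣Q∣ * (ι n * (ι T + ι T) + ι n * ι 16 + (1ℚ + 1ℚ) + (ι n * ι N₁ + ι n * ι N₁)) * inv N ≤ ι n * (∣Q∣ * (θ₁ * θ₁ + θ₁ * θ₁ + (θ₁ * θ₁ + θ₁ * θ₁)))
              inner = ≤-trans (*ʳ (inv N) (0≤inv N) (*ˡ ∣Q∣ (0≤ι (length Q)) (+-monoˡ-≤ _ (≤≡ (+-monoʳ-≤ _ (≡≤ (sym (*-identityˡ _)) (*ʳ (1ℚ + 1ℚ) (0≤+ 0≤1 0≤1) (1≤ι 1≤n))))
                  (trans (identity-34 (ι n) (ι T) (ι 16)) (cong (λ u → ι n * (ι T + ι T + u)) ι16))))))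
                (≡≤ (identity-35 ∣Q∣ (ι n) (ι T) (ι 9) (ι N₁) (inv N))
                (≤-trans (*ˡ (ι n) (0≤ι n) (*ˡ ∣Q∣ (0≤ι (length Q)) (+-mono-≤ (+-mono-≤ hA hA) (≤-reflexive (cong₂ _+_ N₁N N₁N))))) ≤-refl))

            -- Four multiples of `T` come from `total₂`: one from rounding (`hB`), one from
            -- conditioning (`hC`), two from the bits of the transcript. The tangents add two more,
            -- and `hd` is the condition that results.
            part₂ : inv d * (ι (suc s) * ((sumTo M n + sumTo (λ j → D j 0) n) * inv N + ι n * (ι T * (∣Q∣ * (θ₂ * θ₂) + ∣Q∣ * (θ₂ * θ₂))))) ≤ ι n * (∣Q∣ * inv 32)
            part₂ = ≤-trans (*ˡ (inv d) (0≤inv d) (≤-trans (*ˡ (ι (suc s)) (0≤ι (suc s)) (+-monoˡ-≤ _ (≤-trans (*ʳ (inv N) (0≤inv N) total₂) inner)))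
                (≡≤ (identity-41 (ι (suc s)) ∣Q∣ (ι T) (ι n) θ₂)
                (≤≡ (+-mono-≤ (*ʳ (∣Q∣ * (ι T + ι T + (ι T + ι T))) (0≤* (0≤ι (length Q)) (0≤+ (0≤+ (0≤ι T) (0≤ι T)) (0≤+ (0≤ι T) (0≤ι T)))) hs) (≤-reflexive (cong (λ u → u * (ι n * (ι T * (∣Q∣ * θ₂ + ∣Q∣ * θ₂)))) one-s)))
                (trans (identity-42 ∣Q∣ (ι T) (ι n) θ₂) (cong (λ u → ι n * (∣Q∣ * (ι T * u * θ₂))) (sym (trans (ι-+ 3 3) (cong₂ _+_ ι3 ι3))))))))) 
              (≡≤ (identity-43 (inv d) (ι n) ∣Q∣ (ι T * ι 6) θ₂) (*ˡ (ι n) (0≤ι n) (*ˡ ∣Q∣ (0≤ι (length Q)) hd)))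
              where
              inner : ∣Q∣ * (ι n * (ι T + ι T + (ι T + ι T)) + ι n * ι 16 + (1ℚ + 1ℚ) + (ι n * ι N₁ + ι n * ι N₁) + (ι T + ι T) * (1ℚ + 1ℚ + ι N)) * inv N ≤ ∣Q∣ * (ι T + ι T + (ι T + ι T))
              inner = ≡≤ (identity-36 ∣Q∣ (ι n * (ι T + ι T + (ι T + ι T)) + ι n * ι 16 + (1ℚ + 1ℚ)) (ι n) (ι N₁) (ι T) (ι N) (inv N))
                (*ˡ ∣Q∣ (0≤ι (length Q)) (≤-trans (+-mono-≤ (+-mono-≤ hB (≡≤ (cong ((ι n + ι n) *_) N₁N) hC)) (≤-reflexive (trans (cong ((ι T + ι T) *_) (ι*inv 1≤N)) (*-identityʳ _)))) ≤-refl))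

          pick-coordinate : Σ[ j ∈ ℕ ] Σ[ j<n ∈ j ℕ.< n ] ∑ Q (loss j<n) + inv d * ∑ Q (λ ω → sumTo (mistakes j ω) T) ≤ ∣Q∣ * (ι 6 * θ₁ + inv 32)
          pick-coordinate = finish (sum-pick F n 1≤n (≡≤ ∑F (≤≡ (+-mono-≤ part₁ part₂) (identity-51 (ι n) ∣Q∣ (ι 6 * θ₁) (inv 32)))))
            where
            finish : Σ[ j ∈ ℕ ] j ℕ.< n × F j ≤ ∣Q∣ * (ι 6 * θ₁ + inv 32) →
              Σ[ j ∈ ℕ ] Σ[ j<n ∈ j ℕ.< n ] ∑ Q (loss j<n) + inv d * ∑ Q (λ ω → sumTo (mistakes j ω) T) ≤ ∣Q∣ * (ι 6 * θ₁ + inv 32)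
            finish (j , j<n , p) = j , j<n , ≤-trans (bound-F j<n) p

 -- Noisy binary search for disagreements, with equality by hashing

 module NoisySearch where

  open import Data.List.Base using ([]; _∷_)
  open import Data.List.Properties using (≡-dec)
  open import Data.Nat.Base as ℕ using (zero; suc)
  open import Defs using (Tree; output; alice; bob; run; depth)
  open Sums
  open Logarithms

  -- One-sided hashing by inner products modulo 2.
  ip : List Bool → List Bool → Bool
  ip (r ∷ rs) (u ∷ us) = (r ∧ u) xor ip rs us
  ip _        _        = false

  bools : ℕ → List (List Bool)
  bools zero    = [] ∷ []
  bools (suc k) = map (false ∷_) (bools k) ++ map (true ∷_) (bools k)

  tuples : {A : Set} → List A → ℕ → List (List A)
  tuples xs zero    = [] ∷ []
  tuples xs (suc k) = concatMap (λ x → map (x ∷_) (tuples xs k)) xs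

  ∑-tuples : ∀ {A : Set} (xs : List A) k (f : List A → ℚ) →
    ∑ (tuples xs (suc k)) f ≡ ∑ xs (λ x → ∑ (tuples xs k) (λ t → f (x ∷ t)))
  ∑-tuples xs k f = trans (∑-concatMap (λ x → map (x ∷_) (tuples xs k)) xs f) (∑-cong xs λ x → ∑-map (x ∷_) (tuples xs k) f)

  length-tuples : ∀ {A : Set} (xs : List A) k → ι (length (tuples xs k)) ≡ pw (ι (length xs)) k
  length-tuples xs zero    = ι1
  length-tuples xs (suc k) = trans (sym (trans (∑-const (tuples xs (suc k)) 1ℚ) (*-identityʳ _)))
    (trans (∑-tuples xs k (λ _ → 1ℚ)) (trans (∑-const xs _) (cong (ι (length xs) *_) (trans (trans (∑-const (tuples xs k) 1ℚ) (*-identityʳ _)) (length-tuples xs k)))))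

  ∑-bools : ∀ k (f : List Bool → ℚ) → ∑ (bools (suc k)) f ≡ ∑ (bools k) (λ r → f (false ∷ r)) + ∑ (bools k) (λ r → f (true ∷ r))
  ∑-bools k f = trans (∑-++ (map (false ∷_) (bools k)) _ f) (cong₂ _+_ (∑-map (false ∷_) (bools k) f) (∑-map (true ∷_) (bools k) f))

  collide : ∀ u v r → Dec (ip r u ≡ ip r v)
  collide u v r = ip r u BoolP.≟ ip r v

  -- The first bit of `r` either leaves the comparison of the tails alone or negates it. Where the
  -- heads differ, it negates for exactly one of its two values, which gives one half at once; where
  -- they agree, the tails differ and induction applies.
  half-collide : ∀ k u v → length u ≡ length v → length u ℕ.≤ k → u ≢ v →
    ∑ (bools k) (λ r → ind (collide u v r)) + ∑ (bools k) (λ r → ind (collide u v r)) ≡ ∑ (bools k) (λ _ → 1ℚ)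
  half-collide zero    []       []       e h ne = contradiction refl ne
  half-collide (suc k) []       []       e h ne = contradiction refl ne
  half-collide (suc k) (a ∷ us) (b ∷ vs) e (s≤s h) ne = trans (cong₂ _+_ (∑-bools k _) (∑-bools k _)) (trans (go (≡-dec BoolP._≟_ us vs)) (sym (∑-bools k (λ _ → 1ℚ))))
    where
    e′ : length us ≡ length vs
    e′ = ℕP.suc-injective e
    I : ℚ
    I = ∑ (bools k) (λ r → ind (collide us vs r))
    O : ℚ
    O = ∑ (bools k) (λ _ → 1ℚ)
    f : Bool → List Bool → ℚ
    f c r = ind (collide (a ∷ us) (b ∷ vs) (c ∷ r))
    F : Bool → ℚ
    F c = ∑ (bools k) (f c)
    flip : ∀ c d s t → c ≢ d → ind ((c xor s) BoolP.≟ (d xor t)) ≡ 1ℚ - ind (s BoolP.≟ t)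
    flip false false s t ne = contradiction refl ne
    flip true  true  s t ne = contradiction refl ne
    flip false true  false false ne = sym (+-inverseʳ 1ℚ)
    flip false true  false true  ne = sym (trans (cong (1ℚ +_) neg-0) (+-identityʳ 1ℚ))
    flip false true  true  false ne = sym (trans (cong (1ℚ +_) neg-0) (+-identityʳ 1ℚ))
    flip false true  true  true  ne = sym (+-inverseʳ 1ℚ)
    flip true  false false false ne = sym (+-inverseʳ 1ℚ)
    flip true  false false true  ne = sym (trans (cong (1ℚ +_) neg-0) (+-identityʳ 1ℚ))
    flip true  false true  false ne = sym (trans (cong (1ℚ +_) neg-0) (+-identityʳ 1ℚ))
    flip true  false true  true  ne = sym (+-inverseʳ 1ℚ)
    same : ∀ c s t → ind ((c xor s) BoolP.≟ (c xor t)) ≡ ind (s BoolP.≟ t)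
    same false s t = refl
    same true false false = refl
    same true false true  = refl
    same true true  false = refl
    same true true  true  = refl
    F-flip : a ≢ b → F true ≡ O - I
    F-flip ne′ = trans (∑-cong (bools k) λ r → flip a b (ip r us) (ip r vs) ne′) (∑-- (bools k) _ _)
    F-same : a ≡ b → F true ≡ I
    F-same refl = ∑-cong (bools k) λ r → same a (ip r us) (ip r vs)
    go : Dec (us ≡ vs) → (F false + F true) + (F false + F true) ≡ O + O
    go (yes refl) = trans (cong (λ u → (I + u) + (I + u)) (F-flip λ { refl → ne refl })) (identity-77 I O)
    go (no ne′) with a BoolP.≟ b
    ... | yes p = trans (cong (λ u → (I + u) + (I + u)) (F-same p)) (cong₂ _+_ IH IH)
      where
      IH : I + I ≡ O
      IH = half-collide k us vs e′ h ne′
    ... | no p = trans (cong (λ u → (I + u) + (I + u)) (F-flip p)) (identity-77 I O)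

  verdict : List (List Bool) → List Bool → List Bool → Bool
  verdict []       u v = true
  verdict (r ∷ rs) u v = does (collide u v r) ∧ verdict rs u v

  verdict-refl : ∀ rs u → verdict rs u u ≡ true
  verdict-refl []       u = refl
  verdict-refl (r ∷ rs) u with collide u u r
  ... | yes _ = verdict-refl rs u
  ... | no ne = contradiction refl ne

  false-equal : ∀ k u v → length u ≡ length v → length u ℕ.≤ k → u ≢ v → ∀ m →
    pw (1ℚ + 1ℚ) m * ∑ (tuples (bools k) m) (λ rs → ind (verdict rs u v BoolP.≟ true)) ≡ ∑ (tuples (bools k) m) (λ _ → 1ℚ)
  false-equal k u v e h ne zero    = *-identityˡ _
  false-equal k u v e h ne (suc m) = trans (cong (pw (1ℚ + 1ℚ) (suc m) *_) (trans (∑-tuples (bools k) m _) (trans (∑-cong (bools k) factor) (∑-*ʳ (bools k) V _))))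
      (trans (identity-79 (pw (1ℚ + 1ℚ) m) (∑ (bools k) (λ r → ind (collide u v r))) V)
      (trans (cong₂ _*_ (half-collide k u v e h ne) (false-equal k u v e h ne m))
      (sym (trans (∑-tuples (bools k) m (λ _ → 1ℚ)) (trans (∑-cong (bools k) λ _ → sym (*-identityˡ _)) (∑-*ʳ (bools k) _ (λ _ → 1ℚ)))))))
    where
    V : ℚ
    V = ∑ (tuples (bools k) m) (λ rs → ind (verdict rs u v BoolP.≟ true))
    factor : ∀ r → ∑ (tuples (bools k) m) (λ rs → ind (verdict (r ∷ rs) u v BoolP.≟ true)) ≡ ind (collide u v r) * V
    factor r with collide u v r
    ... | yes _ = sym (*-identityˡ V)
    ... | no _  = trans (∑-0 (tuples (bools k) m)) (sym (*-zeroˡ V))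

  -- Two players hold predictors fa, fb for the bits of a string whose k-th bit follows the predictor of the owner of k.
  -- They find the string by searching the (few) positions at which their predictions differ.
  module Walk {A B : Set} (own : ℕ → Bool) (fa : A → List Bool → Bool) (fb : B → List Bool → Bool)
    (T J : ℕ) (z : List Bool → Bool) where

    -- Alice's guess at the first `k` bits, latest first: her own predictions, with Bob's bits
    -- flipped where `K` records a disagreement. `pb` flips Alice's bits instead. `K` depends only
    -- on answers known to both players.
    pa : (ℕ → Bool) → A → ℕ → List Bool
    pa K a zero    = []
    pa K a (suc k) = (fa a (pa K a k) xor (K k ∧ not (own k))) ∷ pa K a k

    pb : (ℕ → Bool) → B → ℕ → List Bool
    pb K b zero    = []
    pb K b (suc k) = (fb b (pb K b k) xor (K k ∧ own k)) ∷ pb K b k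

    tp : A → B → ℕ → List Bool
    tp a b zero    = []
    tp a b (suc k) = (if own k then fa a (tp a b k) else fb b (tp a b k)) ∷ tp a b k

    mist : A → B → ℕ → Bool
    mist a b k = fa a (tp a b k) xor fb b (tp a b k)

    ones : (ℕ → Bool) → ℕ → ℕ → ℕ
    ones D zero    k = 0
    ones D (suc m) k = (if D k then 1 else 0) ℕ.+ ones D m (suc k)

    -- the next disagreement lies at lo + r for some r < 2 ^ j, the flips K being correct below lo
    record State : Set where
      constructor st
      field
        K  : ℕ → Bool
        lo : ℕ
        j  : ℕ

    set : (ℕ → Bool) → ℕ → ℕ → Bool
    set K l i = pick (i ℕP.≟ l) true (K i)

    -- An interval of length one has located a disagreement, so the flip is recorded and the search
    -- starts afresh to its right with length `2 ^ J`. At `lo = T` the search is over and the state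
    -- stays.
    norm : (ℕ → Bool) → ℕ → ℕ → State
    norm K lo (suc j) = st K lo (suc j)
    norm K lo zero    = pick (lo ℕP.<? T) (st (set K lo) (suc lo) J) (st K lo 0)

    Coin : Set
    Coin = List (List Bool)

    query : Coin → (ℕ → Bool) → ℕ → (Bool → Tree A B Bool) → Tree A B Bool
    query []       K k next = next true
    query (r ∷ rs) K k next = alice (λ a → ip r (pa K a k)) λ α → bob (λ b → does (α BoolP.≟ ip r (pb K b k))) λ ok →
      if ok then query rs K k next else next false

    -- Positions beyond `T` are answered negatively without communication, so intervals may extend
    -- past the end of the transcript.
    bounded : Coin → (ℕ → Bool) → ℕ → (Bool → Tree A B Bool) → Tree A B Bool
    bounded h K k next = pick (k ℕP.≤? T) (query h K k next) (next false)

    -- Each round uses `h` to recheck the left end of the interval and `h′` to test the midpoint. A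
    -- failed recheck exposes an earlier false acceptance, and the search returns to the parent
    -- interval on the stack `ss`.
    walk : List (Coin × Coin) → State → List State → Tree A B Bool
    afterMid : List (Coin × Coin) → (ℕ → Bool) → ℕ → ℕ → List State → Bool → Tree A B Bool
    afterLo : List (Coin × Coin) → Coin → State → List State → Bool → Tree A B Bool
    popped : List (Coin × Coin) → State → List State → Tree A B Bool

    walk []             (st K lo j) ss = alice (λ a → z (pa K a T)) output
    walk ((h , h′) ∷ c) s ss = bounded h (State.K s) (State.lo s) (afterLo c h′ s ss)

    afterLo c h s          ss false = popped c s ss
    afterLo c h (st K lo zero)    ss true = walk c (st K lo zero) ss
    afterLo c h (st K lo (suc j)) ss true = bounded h K (lo ℕ.+ 2 ℕ.^ j) (afterMid c K lo j ss)

    afterMid c K lo j ss true  = walk c (norm K (lo ℕ.+ 2 ℕ.^ j) j) (st K lo (suc j) ∷ ss)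
    afterMid c K lo j ss false = walk c (norm K lo j) (st K lo (suc j) ∷ ss)

    popped c s []       = walk c s []
    popped c s (s′ ∷ ss) = walk c s′ ss

    query-run : ∀ h K k next a b → run (query h K k next) a b ≡ run (next (verdict h (pa K a k) (pb K b k))) a b
    query-run []       K k next a b = refl
    query-run (r ∷ rs) K k next a b with ip r (pa K a k) BoolP.≟ ip r (pb K b k)
    ... | yes _ = query-run rs K k next a b
    ... | no _  = refl

    query-depth : ∀ h K k next m → (∀ v → depth (next v) ℕ.≤ m) → depth (query h K k next) ℕ.≤ 2 ℕ.* length h ℕ.+ m
    query-depth []       K k next m hm = hm true
    query-depth (r ∷ rs) K k next m hm = ℕP.≤-trans (s≤s (ℕP.⊔-lub inner inner))
        (ℕP.≤-reflexive (cong (ℕ._+ m) (sym (ℕP.*-suc 2 (length rs)))))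
      where
      inner : suc (depth (next false) ℕ.⊔ depth (query rs K k next)) ℕ.≤ suc (2 ℕ.* length rs ℕ.+ m)
      inner = s≤s (ℕP.⊔-lub (ℕP.≤-trans (hm false) (ℕP.m≤n+m m _)) (query-depth rs K k next m hm))

    bounded-depth : ∀ h K k next m → (∀ v → depth (next v) ℕ.≤ m) → depth (bounded h K k next) ℕ.≤ 2 ℕ.* length h ℕ.+ m
    bounded-depth h K k next m hm = pick-elim (λ t → depth t ℕ.≤ 2 ℕ.* length h ℕ.+ m) (k ℕP.≤? T)
      (λ _ → query-depth h K k next m hm) (λ _ → ℕP.≤-trans (hm false) (ℕP.m≤n+m m _))

    Short : ℕ → List (Coin × Coin) → Set
    Short w []            = ⊤
    Short w ((h , h′) ∷ c) = length h ≡ w × length h′ ≡ w × Short w c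

    walk-depth : ∀ w c → Short w c → ∀ s ss → depth (walk c s ss) ℕ.≤ length c ℕ.* (2 ℕ.* w ℕ.+ 2 ℕ.* w) ℕ.+ 1
    walk-depth w [] _ s ss = s≤s z≤n
    walk-depth w ((h , h′) ∷ c) (eh , eh′ , sh) s ss = ℕP.≤-trans
        (bounded-depth h (State.K s) (State.lo s) (afterLo c h′ s ss) (2 ℕ.* w ℕ.+ R) (λ { false → ℕP.≤-trans (pop ss) (ℕP.m≤n+m R (2 ℕ.* w)) ; true → lo s }))
        (ℕP.≤-reflexive (trans (cong (λ l → 2 ℕ.* l ℕ.+ (2 ℕ.* w ℕ.+ R)) eh) (trans (sym (ℕP.+-assoc (2 ℕ.* w) (2 ℕ.* w) R)) (sym (ℕP.+-assoc (2 ℕ.* w ℕ.+ 2 ℕ.* w) _ 1)))))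
      where
      R : ℕ
      R = length c ℕ.* (2 ℕ.* w ℕ.+ 2 ℕ.* w) ℕ.+ 1
      rest : ∀ s ss → depth (walk c s ss) ℕ.≤ R
      rest = walk-depth w c sh
      pop : ∀ ss → depth (popped c s ss) ℕ.≤ R
      pop []       = rest s []
      pop (s′ ∷ ss) = rest s′ ss
      lo : ∀ s → depth (afterLo c h′ s ss true) ℕ.≤ 2 ℕ.* w ℕ.+ R
      lo (st K l zero)    = ℕP.≤-trans (rest _ ss) (ℕP.m≤n+m R (2 ℕ.* w))
      lo (st K l (suc j)) = ℕP.≤-trans (bounded-depth h′ K (l ℕ.+ 2 ℕ.^ j) (afterMid c K l j ss) R (λ { false → rest _ _ ; true → rest _ _ }))
        (ℕP.≤-reflexive (cong (λ w′ → 2 ℕ.* w′ ℕ.+ R) eh′))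

  pairs : {A B : Set} → List A → List B → List (A × B)
  pairs xs ys = concatMap (λ x → map (x ,_) ys) xs

  ∑-pairs : ∀ {A B : Set} (xs : List A) (ys : List B) (f : A × B → ℚ) → ∑ (pairs xs ys) f ≡ ∑ xs (λ x → ∑ ys (λ y → f (x , y)))
  ∑-pairs xs ys f = trans (∑-concatMap (λ x → map (x ,_) ys) xs f) (∑-cong xs λ x → ∑-map (x ,_) ys f)

  module WalkCorrect {A B : Set} (own : ℕ → Bool) (fa : A → List Bool → Bool) (fb : B → List Bool → Bool)
    (T J : ℕ) (z : List Bool → Bool) (1≤J : 1 ℕ.≤ J) (T<2^J : T ℕ.< 2 ℕ.^ J) (a : A) (b : B) where

    open Walk own fa fb T J z

    D : ℕ → Bool
    D = mist a b

    target : Bool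
    target = z (tp a b T)

    Agree : (ℕ → Bool) → ℕ → Set
    Agree K k = ∀ i → i ℕ.< k → K i ≡ D i

    cancel : ∀ o p q f → p xor (f ∧ not o) ≡ q xor (f ∧ o) → f ≡ p xor q
    cancel true  p q f e = lem p q f e
      where
      lem : ∀ p q f → p xor (f ∧ false) ≡ q xor (f ∧ true) → f ≡ p xor q
      lem true  true  true  ()
      lem true  true  false e = refl
      lem true  false true  e = refl
      lem true  false false ()
      lem false true  true  e = refl
      lem false true  false ()
      lem false false true  ()
      lem false false false e = refl
    cancel false p q f e = lem p q f e
      where
      lem : ∀ p q f → p xor (f ∧ true) ≡ q xor (f ∧ false) → f ≡ p xor q
      lem true  true  true  ()
      lem true  true  false e = refl
      lem true  false true  e = refl
      lem true  false false ()
      lem false true  true  e = refl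
      lem false true  false ()
      lem false false true  ()
      lem false false false e = refl

    correct : ∀ o p q → p xor ((p xor q) ∧ not o) ≡ (if o then p else q) × q xor ((p xor q) ∧ o) ≡ (if o then p else q)
    correct true  true  true  = refl , refl
    correct true  true  false = refl , refl
    correct true  false true  = refl , refl
    correct true  false false = refl , refl
    correct false true  true  = refl , refl
    correct false true  false = refl , refl
    correct false false true  = refl , refl
    correct false false false = refl , refl

    agree-tp : ∀ K k → Agree K k → pa K a k ≡ tp a b k × pb K b k ≡ tp a b k
    agree-tp K zero    h = refl , refl
    agree-tp K (suc k) h with pa K a k | pb K b k | agree-tp K k (λ i p → h i (ℕP.m≤n⇒m≤1+n p))
    ... | _ | _ | refl , refl rewrite h k ℕP.≤-refl =
      cong (_∷ tp a b k) (proj₁ (correct (own k) (fa a (tp a b k)) (fb b (tp a b k)))) , cong (_∷ tp a b k) (proj₂ (correct (own k) (fa a (tp a b k)) (fb b (tp a b k))))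

    -- This is why equality tests suffice: with the earlier bits right, the corrected predictions of
    -- bit `k` coincide only if `K k` is the exclusive or of the uncorrected ones.
    equal-agree : ∀ K k → pa K a k ≡ pb K b k → Agree K k
    equal-agree K (suc k) e i i<k with ∷-injective e
    ... | e₁ , e₂ with ℕP.m≤n⇒m<n∨m≡n (ℕP.≤-pred i<k)
    ... | inj₁ p = equal-agree K k e₂ i p
    ... | inj₂ refl with pa K a k | pb K b k | agree-tp K k (equal-agree K k e₂)
    ... | _ | _ | refl , refl = cancel (own k) (fa a (tp a b k)) (fb b (tp a b k)) (K k) e₁

    length-pa : ∀ K k → length (pa K a k) ≡ k
    length-pa K zero    = refl
    length-pa K (suc k) = cong suc (length-pa K k)

    length-pb : ∀ K k → length (pb K b k) ≡ k
    length-pb K zero    = refl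
    length-pb K (suc k) = cong suc (length-pb K k)

    GoodAt : (ℕ → Bool) → ℕ → Set
    GoodAt K k = k ℕ.≤ T × Agree K k

    GoodAt? : ∀ K k → Dec (GoodAt K k)
    GoodAt? K k with k ℕP.≤? T | ≡-dec BoolP._≟_ (pa K a k) (pb K b k)
    ... | no ¬p | _     = no (¬p ∘ proj₁)
    ... | yes p | yes e = yes (p , equal-agree K k e)
    ... | yes p | no ne = no λ { (_ , h) → ne (trans (proj₁ (agree-tp K k h)) (sym (proj₂ (agree-tp K k h)))) }

    GoodAt-mono : ∀ {K k l} → k ℕ.≤ l → GoodAt K l → GoodAt K k
    GoodAt-mono h (p , q) = ℕP.≤-trans h p , λ i i< → q i (ℕP.≤-trans i< h)

    vb : Coin → (ℕ → Bool) → ℕ → Bool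
    vb h K k = pick (k ℕP.≤? T) (verdict h (pa K a k) (pb K b k)) false

    bounded-run : ∀ h K k next → run (bounded h K k next) a b ≡ run (next (vb h K k)) a b
    bounded-run h K k next = go (k ℕP.≤? T)
      where
      go : (d : Dec (k ℕ.≤ T)) → run (pick d (query h K k next) (next false)) a b ≡ run (next (pick d (verdict h (pa K a k) (pb K b k)) false)) a b
      go (yes _) = query-run h K k next a b
      go (no _)  = refl

    vb-good : ∀ h K k → GoodAt K k → vb h K k ≡ true
    vb-good h K k (p , q) = pick-elim (_≡ true) (k ℕP.≤? T) (λ _ → equal) (λ ¬p → contradiction p ¬p)
      where
      equal : verdict h (pa K a k) (pb K b k) ≡ true
      equal = trans (cong₂ (verdict h) (proj₁ (agree-tp K k q)) (proj₂ (agree-tp K k q))) (verdict-refl h (tp a b k))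

    H : List Coin
    H = tuples (bools T) 4

    h : ℚ
    h = ∑ H (λ _ → 1ℚ)

    16* : ℚ
    16* = pw (1ℚ + 1ℚ) 4

    -- A test errs only by accepting, and four independent hash bits let this happen for at most one
    -- coin in sixteen.
    vb-bad : ∀ K k → ¬ GoodAt K k → 16* * ∑ H (λ c → ind (vb c K k BoolP.≟ true)) ≤ h
    vb-bad K k bad = go (k ℕP.≤? T)
      where
      go : (d : Dec (k ℕ.≤ T)) → 16* * ∑ H (λ c → ind (pick d (verdict c (pa K a k) (pb K b k)) false BoolP.≟ true)) ≤ h
      go (no _)  = subst (_≤ h) (sym (trans (cong (16* *_) (∑-0 H)) (*-zeroʳ 16*))) (∑-0≤ H λ _ → 0≤1)
      go (yes p) = ≤-reflexive (false-equal T (pa K a k) (pb K b k) (trans (length-pa K k) (sym (length-pb K k)))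
        (subst (ℕ._≤ T) (sym (length-pa K k)) p) (λ e → bad (p , equal-agree K k e)) 4)

    left : ℕ → ℕ
    left k = ones D (T ℕ.∸ k) k

    -- The rounds still to go if no test errs: `j` halvings of the current interval, and a fresh
    -- search of `J` halvings after each remaining disagreement. The last search ends at `T`.
    rem : State → ℕ
    rem (st K lo j) = j ℕ.+ J ℕ.* left lo

    -- The field `final` says that a unit interval survives only at the end of the transcript, all
    -- others being resolved at once by `norm`.
    record Good (s : State) : Set where
      constructor mkGood
      open State s
      field
        agree : GoodAt K lo
        above : ∀ i → lo ℕ.≤ i → K i ≡ false
        end   : ¬ GoodAt K (lo ℕ.+ 2 ℕ.^ j)
        final : j ≡ 0 → lo ≡ T

    left-step : ∀ {lo} → lo ℕ.< T → left lo ≡ (if D lo then 1 else 0) ℕ.+ left (suc lo)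
    left-step {lo} p rewrite ℕP.+-∸-assoc 1 {T} {suc lo} p = refl

    left-≡ : ∀ K lo d → (∀ i → lo ℕ.≤ i → K i ≡ false) → GoodAt K (lo ℕ.+ d) → left (lo ℕ.+ d) ≡ left lo
    left-≡ K lo zero    h g = cong left (ℕP.+-identityʳ lo)
    left-≡ K lo (suc d) h g = trans (cong left (ℕP.+-suc lo d)) (trans (left-≡ K (suc lo) d (λ i p → h i (ℕP.≤-trans (ℕP.n≤1+n lo) p)) (subst (GoodAt K) (ℕP.+-suc lo d) g))
        (sym (trans (left-step (ℕP.≤-trans lo< (proj₁ g))) (cong (λ v → (if v then 1 else 0) ℕ.+ left (suc lo)) (trans (sym (proj₂ g lo lo<)) (h lo ℕP.≤-refl))))))
      where
      lo< : lo ℕ.< lo ℕ.+ suc d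
      lo< = ℕP.m<m+n lo (s≤s z≤n)

    set-other : ∀ K l i → i ≢ l → set K l i ≡ K i
    set-other K l i ne = pick-elim (_≡ K i) (i ℕP.≟ l) (λ e → contradiction e ne) (λ _ → refl)

    set-same : ∀ K l → set K l l ≡ true
    set-same K l = pick-elim (_≡ true) (l ℕP.≟ l) (λ _ → refl) (λ ne → contradiction refl ne)

    norm-good : ∀ K lo j → GoodAt K lo → (∀ i → lo ℕ.≤ i → K i ≡ false) → ¬ GoodAt K (lo ℕ.+ 2 ℕ.^ j) →
      Good (norm K lo j) × rem (norm K lo j) ≡ j ℕ.+ J ℕ.* left lo
    norm-good K lo (suc j) g z e = mkGood g z e (λ ()) , refl
    norm-good K lo zero g z e = pick-elim (λ s → Good s × rem s ≡ 0 ℕ.+ J ℕ.* left lo) (lo ℕP.<? T) toggled done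
      where
      done : ¬ lo ℕ.< T → Good (st K lo 0) × rem (st K lo 0) ≡ 0 ℕ.+ J ℕ.* left lo
      done ¬p = mkGood g z e (λ _ → ℕP.≤-antisym (proj₁ g) (ℕP.≮⇒≥ ¬p)) , refl
      toggled : lo ℕ.< T → Good (st (set K lo) (suc lo) J) × rem (st (set K lo) (suc lo) J) ≡ 0 ℕ.+ J ℕ.* left lo
      toggled p = mkGood (p , agree) above (λ g′ → ℕP.<⇒≱ T<2^J (ℕP.≤-trans (ℕP.m≤n+m _ (suc lo)) (proj₁ g′))) (λ J≡0 → contradiction 1≤J (subst (λ u → ¬ 1 ℕ.≤ u) (sym J≡0) λ ()))
        , trans (sym (ℕP.*-suc J (left (suc lo)))) (cong (J ℕ.*_) (sym (trans (left-step p) (cong (λ v → (if v then 1 else 0) ℕ.+ left (suc lo)) Dlo))))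
        where
        Dlo : D lo ≡ true
        Dlo = BoolP.¬-not λ Df → e (subst (GoodAt K) (ℕP.+-comm 1 lo) (p , λ i i< → go i (ℕP.m≤n⇒m<n∨m≡n (ℕP.≤-pred i<)) Df))
          where
          go : ∀ i → i ℕ.< lo ⊎ i ≡ lo → D lo ≡ false → K i ≡ D i
          go i (inj₁ q)    Df = proj₂ g i q
          go i (inj₂ refl) Df = trans (z lo ℕP.≤-refl) (sym Df)
        agree : Agree (set K lo) (suc lo)
        agree i i< with ℕP.m≤n⇒m<n∨m≡n (ℕP.≤-pred i<)
        ... | inj₁ q    = trans (set-other K lo i (ℕP.<⇒≢ q)) (proj₂ g i q)
        ... | inj₂ refl = trans (set-same K lo) (sym Dlo)
        above : ∀ i → suc lo ℕ.≤ i → set K lo i ≡ false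
        above i q = trans (set-other K lo i (ℕP.>⇒≢ q)) (z i (ℕP.≤-trans (ℕP.n≤1+n lo) q))

    Bad : State → Set
    Bad s = ¬ GoodAt (State.K s) (State.lo s)

    norm-bad : ∀ K lo j → ¬ GoodAt K lo → Bad (norm K lo j)
    norm-bad K lo (suc j) n = n
    norm-bad K lo zero    n = pick-elim Bad (lo ℕP.<? T) (λ p (_ , ag) → n (ℕP.<⇒≤ p , λ i q → trans (sym (set-other K lo i (ℕP.<⇒≢ q))) (ag i (ℕP.m≤n⇒m≤1+n q)))) (λ _ → n)

    -- A bound for the distance from completion: in a good state the rounds to go, in a bad state
    -- one more than at the parent. A round without harmful error lowers it by one, and a false
    -- acceptance raises it by at most one.
    data Pot : ℕ → State → List State → Set where
      good : ∀ {p s ss} → Good s → rem s ℕ.≤ p → Pot p s ss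
      bad  : ∀ {p s s′ ss} → Bad s → Pot p s′ ss → Pot (suc p) s (s′ ∷ ss)

    weaken : ∀ {p s ss} → Pot p s ss → Pot (suc p) s ss
    weaken (good g r) = good g (ℕP.m≤n⇒m≤1+n r)
    weaken (bad n q)  = bad n (weaken q)

    wrong : List (Coin × Coin) → State → List State → ℚ
    wrong c s ss = ind (¬? (run (walk c s ss) a b BoolP.≟ target))

    HH : List (Coin × Coin)
    HH = pairs H H

    W : ℕ → State → List State → ℚ
    W N s ss = ∑ (tuples HH N) (λ c → wrong c s ss)

    settled : ∀ K lo ss c → Good (st K lo 0) → wrong c (st K lo 0) ss ≡ 0ℚ
    settled K lo ss [] (mkGood g _ _ f) = ind-no (¬? (z (pa K a T) BoolP.≟ target)) λ n →
      n (cong z (proj₁ (agree-tp K T (subst (Agree K) (f refl) (proj₂ g)))))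
    settled K lo ss ((c , c′) ∷ cs) g = trans (cong (λ r → ind (¬? (r BoolP.≟ target)))
        (trans (bounded-run c K lo (afterLo cs c′ (st K lo 0) ss)) (cong (λ v → run (afterLo cs c′ (st K lo 0) ss v) a b) (vb-good c K lo (Good.agree g)))))
      (settled K lo ss cs g)

    -- The weight `2 ^ p` is halved in a correct round and doubled by an error, which has
    -- probability at most `1/16`: `1/2 + 2/16 = 5/8` per round.
    5/8 : ℚ
    5/8 = ι 5 * inv 8

    Bound : ℕ → ℕ → ℚ
    Bound p N = pw (1ℚ + 1ℚ) p * pw (5/8 * (h * h)) N

    0≤h : 0ℚ ≤ h
    0≤h = ∑-0≤ H λ _ → 0≤1

    0≤Bound : ∀ p N → 0ℚ ≤ Bound p N
    0≤Bound p N = 0≤* (pw-0≤ (0≤+ 0≤1 0≤1) p) (pw-0≤ (0≤* (0≤* (0≤ι 5) (0≤inv 8)) (0≤* 0≤h 0≤h)) N)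

    W-suc : ∀ N s ss → W (suc N) s ss ≡ ∑ H (λ c → ∑ H (λ c′ → ∑ (tuples HH N) (λ cs → wrong ((c , c′) ∷ cs) s ss)))
    W-suc N s ss = trans (∑-tuples HH N _) (∑-pairs H H _)

    W-cong : ∀ N {s ss s′ ss′ x} → (∀ cs → run (walk (x ∷ cs) s ss) a b ≡ run (walk cs s′ ss′) a b) →
      ∑ (tuples HH N) (λ cs → wrong (x ∷ cs) s ss) ≡ W N s′ ss′
    W-cong N e = ∑-cong (tuples HH N) λ cs → cong (λ r → ind (¬? (r BoolP.≟ target))) (e cs)

    W≤ : ∀ N p s ss → Pot p s ss → W N s ss ≤ Bound p N

    -- In each state the false acceptance of a single test is charged, and `e` indicates it: the
    -- midpoint in a good state, the left end in a bad one. After a bad left end is accepted, every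
    -- outcome at the midpoint is covered by the same increase of the potential.
    step : ∀ N p s ss → (∀ {q s′ ss′} → Pot q s′ ss′ → W N s′ ss′ ≤ Bound q N) → Pot (suc p) s ss → Σ[ e ∈ (Coin → Coin → ℚ) ]
      (16* * ∑ H (λ c → ∑ H (e c)) ≤ h * h) × (∀ c c′ → ∑ (tuples HH N) (λ cs → wrong ((c , c′) ∷ cs) s ss) ≤ Bound p N + e c c′ * Bound (2 ℕ.+ p) N)
    step N p (st K lo zero) ss IH (good g r) = (λ _ _ → 0ℚ) ,
      subst (_≤ h * h) (sym (trans (cong (16* *_) (trans (∑-cong H λ _ → ∑-0 H) (∑-0 H))) (*-zeroʳ 16*))) (0≤* 0≤h 0≤h) ,
      λ c c′ → ≡≤ (trans (∑-cong (tuples HH N) λ cs → settled K lo ss ((c , c′) ∷ cs) g) (∑-0 (tuples HH N)))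
        (0≤+ (0≤Bound p N) (0≤* ≤-refl (0≤Bound (2 ℕ.+ p) N)))
    step N p s@(st K lo (suc j)) ss IH (good g r) with GoodAt? K (lo ℕ.+ 2 ℕ.^ j)
    ... | yes gm = (λ _ _ → 0ℚ) ,
      subst (_≤ h * h) (sym (trans (cong (16* *_) (trans (∑-cong H λ _ → ∑-0 H) (∑-0 H))) (*-zeroʳ 16*))) (0≤* 0≤h 0≤h) ,
      λ c c′ → ≡≤ (W-cong N {s} {ss} {x = c , c′} λ cs → trans (bounded-run c K lo (afterLo cs c′ s ss))
          (trans (cong (λ v → run (afterLo cs c′ s ss v) a b) (vb-good c K lo (Good.agree g)))
          (trans (bounded-run c′ K (lo ℕ.+ 2 ℕ.^ j) (afterMid cs K lo j ss)) (cong (λ v → run (afterMid cs K lo j ss v) a b) (vb-good c′ K (lo ℕ.+ 2 ℕ.^ j) gm)))))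
        (≤-trans (IH (good (proj₁ ng) (ℕP.≤-trans (ℕP.≤-reflexive (trans (proj₂ ng) (cong (λ u → j ℕ.+ J ℕ.* u) (left-≡ K lo (2 ℕ.^ j) (Good.above g) gm)))) (ℕP.≤-pred r))))
          (gap _ (0≤* ≤-refl (0≤Bound (2 ℕ.+ p) N)) refl))
      where
      ng : Good (norm K (lo ℕ.+ 2 ℕ.^ j) j) × rem (norm K (lo ℕ.+ 2 ℕ.^ j) j) ≡ j ℕ.+ J ℕ.* left (lo ℕ.+ 2 ℕ.^ j)
      ng = norm-good K (lo ℕ.+ 2 ℕ.^ j) j gm (λ i q → Good.above g i (ℕP.≤-trans (ℕP.m≤m+n lo _) q))
        (λ g′ → Good.end g (subst (GoodAt K) (trans (ℕP.+-assoc lo (2 ℕ.^ j) (2 ℕ.^ j)) (cong (λ u → lo ℕ.+ (2 ℕ.^ j ℕ.+ u)) (sym (ℕP.+-identityʳ (2 ℕ.^ j))))) g′))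
    ... | no bm = (λ _ c′ → ind (vb c′ K (lo ℕ.+ 2 ℕ.^ j) BoolP.≟ true)) ,
      ≡≤ (trans (cong (16* *_) (trans (∑-cong H λ _ → sym (*-identityˡ _)) (∑-*ʳ H _ (λ _ → 1ℚ)))) (identity-22 16* h _)) (*ˡ h 0≤h (vb-bad K (lo ℕ.+ 2 ℕ.^ j) bm)) ,
      λ c c′ → ≡≤ (∑-cong (tuples HH N) λ cs → cong (λ r → ind (¬? (r BoolP.≟ target))) (first c c′ cs)) (branch (vb c′ K (lo ℕ.+ 2 ℕ.^ j)))
      where
      first : ∀ c c′ cs → run (walk ((c , c′) ∷ cs) s ss) a b ≡ run (afterMid cs K lo j ss (vb c′ K (lo ℕ.+ 2 ℕ.^ j))) a b
      first c c′ cs = trans (bounded-run c K lo (afterLo cs c′ s ss)) (trans (cong (λ v → run (afterLo cs c′ s ss v) a b) (vb-good c K lo (Good.agree g)))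
        (bounded-run c′ K (lo ℕ.+ 2 ℕ.^ j) (afterMid cs K lo j ss)))
      branch : ∀ v → ∑ (tuples HH N) (λ cs → ind (¬? (run (afterMid cs K lo j ss v) a b BoolP.≟ target))) ≤ Bound p N + ind (v BoolP.≟ true) * Bound (2 ℕ.+ p) N
      branch false = ≤-trans (IH (good (proj₁ ng) (ℕP.≤-trans (ℕP.≤-reflexive (proj₂ ng)) (ℕP.≤-pred r)))) (gap _ (0≤* ≤-refl (0≤Bound (2 ℕ.+ p) N)) refl)
        where
        ng : Good (norm K lo j) × rem (norm K lo j) ≡ j ℕ.+ J ℕ.* left lo
        ng = norm-good K lo j (Good.agree g) (Good.above g) bm
      branch true = ≤-trans (IH (bad (norm-bad K (lo ℕ.+ 2 ℕ.^ j) j bm) (good g r)))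
        (gap (Bound p N) (0≤Bound p N) (trans (+-comm _ _) (cong (_+ Bound p N) (*-identityˡ _))))
    step N p s@(st K lo j) (s′ ∷ ss) IH (bad n q) = (λ c _ → ind (vb c K lo BoolP.≟ true)) ,
      ≡≤ (trans (cong (16* *_) (trans (∑-cong H λ c → trans (∑-cong H λ _ → sym (*-identityʳ _)) (∑-*ˡ H (ind (vb c K lo BoolP.≟ true)) (λ _ → 1ℚ))) (∑-*ʳ H h _))) (sym (*-assoc 16* _ h))) (*ʳ h 0≤h (vb-bad K lo n)) ,
      λ c c′ → ≡≤ (∑-cong (tuples HH N) λ cs → cong (λ r → ind (¬? (r BoolP.≟ target))) (bounded-run c K lo (afterLo cs c′ s (s′ ∷ ss)))) (branch c′ (vb c K lo))
      where
      error : ∀ {s″ ss″} → Pot (2 ℕ.+ p) s″ ss″ → W N s″ ss″ ≤ Bound p N + 1ℚ * Bound (2 ℕ.+ p) N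
      error q = ≤-trans (IH q) (gap (Bound p N) (0≤Bound p N) (trans (+-comm _ _) (cong (_+ Bound p N) (*-identityˡ _))))
      branch : ∀ c′ v → ∑ (tuples HH N) (λ cs → ind (¬? (run (afterLo cs c′ s (s′ ∷ ss) v) a b BoolP.≟ target))) ≤ Bound p N + ind (v BoolP.≟ true) * Bound (2 ℕ.+ p) N
      branch c′ false = ≤-trans (IH q) (gap _ (0≤* ≤-refl (0≤Bound (2 ℕ.+ p) N)) refl)
      branch c′ true  = deeper j refl
        where
        deeper : ∀ j′ → j ≡ j′ → ∑ (tuples HH N) (λ cs → ind (¬? (run (afterLo cs c′ (st K lo j′) (s′ ∷ ss) true) a b BoolP.≟ target))) ≤ Bound p N + 1ℚ * Bound (2 ℕ.+ p) N
        deeper zero     refl = error (weaken (bad n q))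
        deeper (suc j′) refl = ≡≤ (∑-cong (tuples HH N) λ cs → cong (λ r → ind (¬? (r BoolP.≟ target))) (bounded-run c′ K (lo ℕ.+ 2 ℕ.^ j′) (afterMid cs K lo j′ (s′ ∷ ss))))
            (mid (vb c′ K (lo ℕ.+ 2 ℕ.^ j′)))
          where
          mid : ∀ v → ∑ (tuples HH N) (λ cs → ind (¬? (run (afterMid cs K lo j′ (s′ ∷ ss) v) a b BoolP.≟ target))) ≤ Bound p N + 1ℚ * Bound (2 ℕ.+ p) N
          mid true  = error (bad (norm-bad K (lo ℕ.+ 2 ℕ.^ j′) j′ (λ g → n (GoodAt-mono (ℕP.m≤m+n lo _) g))) (bad n q))
          mid false = error (bad (norm-bad K lo j′ n) (bad n q))

    wrong≤1 : ∀ c s ss → wrong c s ss ≤ 1ℚ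
    wrong≤1 c s ss = ind≤1 (¬? (run (walk c s ss) a b BoolP.≟ target))

    W≤ N zero (st K lo zero) ss (good g r) = ≡≤ (trans (∑-cong (tuples HH N) λ c → settled K lo ss c g) (∑-0 (tuples HH N))) (0≤Bound 0 N)
    W≤ N zero (st K lo (suc j)) ss (good g ())
    W≤ zero (suc p) s ss q = ≤-trans (+-monoˡ-≤ 0ℚ (wrong≤1 [] s ss)) (≡≤ (+-identityʳ 1ℚ)
      (≤≡ (pw-1≤ (gap 1ℚ 0≤1 refl) (suc p)) (sym (*-identityʳ _))))
    W≤ (suc N) (suc p) s ss q with step N p s ss (λ {q} {s′} {ss′} → W≤ N q s′ ss′) q
    ... | e , he , hW = ≡≤ (W-suc N s ss) (≤-trans (∑-mono H λ c → ≤≡ (∑-mono H (hW c))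
          (trans (∑-+ H _ _) (cong₂ _+_ (trans (∑-cong H λ _ → sym (*-identityˡ _)) (∑-*ʳ H (Bound p N) (λ _ → 1ℚ))) (∑-*ʳ H (Bound (2 ℕ.+ p) N) (e c)))))
        (≡≤ (trans (∑-+ H _ _) (cong₂ _+_ (trans (∑-cong H λ _ → sym (*-identityˡ _)) (∑-*ʳ H (h * Bound p N) (λ _ → 1ℚ))) (∑-*ʳ H (Bound (2 ℕ.+ p) N) (λ c → ∑ H (e c)))))
        (total (∑ H (λ c → ∑ H (e c))) he)))
      where
      P X : ℚ
      P = pw (1ℚ + 1ℚ) p
      X = pw (5/8 * (h * h)) N
      total : ∀ S → 16* * S ≤ h * h → h * (h * Bound p N) + S * Bound (2 ℕ.+ p) N ≤ Bound (suc p) (suc N)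
      total S hS = ι-cancelˡ {8} (s≤s z≤n) (≡≤ (trans (cong (_* (h * (h * (P * X)) + S * ((1ℚ + 1ℚ) * ((1ℚ + 1ℚ) * P) * X))) ι8′) (identity-72 h S P X))
        (≤≡ (+-monoʳ-≤ _ (*ˡ ((1ℚ + 1ℚ) * (P * X)) (0≤* (0≤+ 0≤1 0≤1) (0≤* (pw-0≤ (0≤+ 0≤1 0≤1) p) (pw-0≤ (0≤* (0≤* (0≤ι 5) (0≤inv 8)) (0≤* 0≤h 0≤h)) N))) hS))
        (trans (identity-73 h P X) (trans (cong (λ u → u * ((1ℚ + 1ℚ) * P * (h * h * X))) (trans (sym ι5′) (trans (sym (*-identityʳ (ι 5))) (cong (ι 5 *_) (sym (inv*ι {8} (s≤s z≤n)))))))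
          (identity-74 (ι 8) (ι 5) (inv 8) P h X)))))
        where
        two : ℚ
        two = 1ℚ + 1ℚ
        ι2 : ι 2 ≡ 1ℚ + 1ℚ
        ι2 = trans (ι-suc 1) (cong (1ℚ +_) ι1)
        ι5′ : ι 5 ≡ 1ℚ + (1ℚ + 1ℚ) * (1ℚ + 1ℚ)
        ι5′ = trans (ι-suc 4) (cong (1ℚ +_) (trans (ι-* 2 2) (cong₂ _*_ ι2 ι2)))
        ι8′ : ι 8 ≡ (1ℚ + 1ℚ) * ((1ℚ + 1ℚ) * (1ℚ + 1ℚ))
        ι8′ = trans (ι-* 2 4) (cong₂ _*_ ι2 (trans (ι-* 2 2) (cong₂ _*_ ι2 ι2)))

    start : State
    start = st (λ _ → false) 0 J

    -- Since `2 (5/8)² = 50/64 ≤ 1`, the first `2 p` rounds outweigh the factor `2 ^ p`, and the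
    -- eight further ones give `(5/8) ^ 8 ≤ 1/16`.
    walk-correct : ∀ p → J ℕ.+ J ℕ.* left 0 ℕ.≤ p → ι 16 * W (8 ℕ.+ (p ℕ.+ p)) start [] ≤ ι (length (tuples HH (8 ℕ.+ (p ℕ.+ p))))
    walk-correct p hp = ≤-trans (*ˡ (ι 16) (0≤ι 16) (W≤ N p start [] (good (mkGood (z≤n , λ _ ()) (λ _ _ → refl)
        (λ g → ℕP.<⇒≱ T<2^J (proj₁ g)) (λ J≡0 → contradiction 1≤J (subst (λ u → ¬ 1 ℕ.≤ u) (sym J≡0) λ ()))) hp)))
      (subst (ι 16 * Bound p N ≤_) (sym (trans (length-tuples HH N) (cong (λ u → pw u N) hh)))
        (≡≤ (trans (cong (λ u → ι 16 * (pw (1ℚ + 1ℚ) p * u)) (pw-* 5/8 (h * h) N)) (identity-78 (ι 16) (pw (1ℚ + 1ℚ) p) (pw 5/8 N) (pw (h * h) N)))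
          (≤≡ (*ʳ (pw (h * h) N) (pw-0≤ (0≤* 0≤h 0≤h) N) small) (*-identityˡ _))))
      where
      N : ℕ
      N = 8 ℕ.+ (p ℕ.+ p)
      hh : ι (length HH) ≡ h * h
      hh = trans (sym (trans (∑-const HH 1ℚ) (*-identityʳ _))) (trans (∑-pairs H H (λ _ → 1ℚ)) (trans (∑-cong H λ _ → sym (*-identityˡ h)) (∑-*ʳ H h (λ _ → 1ℚ))))
      0≤5/8 : 0ℚ ≤ 5/8
      0≤5/8 = 0≤* (0≤ι 5) (0≤inv 8)
      sq : ι 2 * (5/8 * 5/8) ≤ 1ℚ
      sq = ι-cancelˡ {64} (s≤s z≤n) (≡≤ (trans (cong (_* (ι 2 * (5/8 * 5/8))) (ι-* 8 8)) (trans (identity-75 (ι 8) (inv 8) (ι 5) (ι 2))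
          (trans (cong (λ u → u * u * (ι 2 * (ι 5 * ι 5))) (inv*ι {8} (s≤s z≤n))) (trans (cong (_* (ι 2 * (ι 5 * ι 5))) (*-identityʳ 1ℚ)) (trans (*-identityˡ _) (trans (cong (ι 2 *_) (sym (ι-* 5 5))) (sym (ι-* 2 25))))))))
        (≤≡ (ι-mono {50} {64} (ℕP.m≤m+n 50 14)) (sym (*-identityʳ _))))
      half : ∀ p → pw (1ℚ + 1ℚ) p * pw 5/8 (p ℕ.+ p) ≤ 1ℚ
      half p = ≡≤ (trans (cong (pw (1ℚ + 1ℚ) p *_) (trans (pw-+ 5/8 p p) (sym (pw-* 5/8 5/8 p)))) (sym (pw-* (1ℚ + 1ℚ) (5/8 * 5/8) p)))
        (≤≡ (pw-mono (0≤* (0≤+ 0≤1 0≤1) (0≤* 0≤5/8 0≤5/8)) (subst (λ u → u * (5/8 * 5/8) ≤ 1ℚ) (trans (ι-suc 1) (cong (1ℚ +_) ι1)) sq) p) (one p))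
        where
        one : ∀ p → pw 1ℚ p ≡ 1ℚ
        one zero    = refl
        one (suc p) = trans (*-identityˡ _) (one p)
      small : ι 16 * (pw (1ℚ + 1ℚ) p * pw 5/8 N) ≤ 1ℚ
      small = ≡≤ (trans (cong (λ u → ι 16 * (pw (1ℚ + 1ℚ) p * u)) (pw-+ 5/8 8 (p ℕ.+ p))) (trans (identity-76 (ι 16) (pw (1ℚ + 1ℚ) p) (pw 5/8 8) (pw 5/8 (p ℕ.+ p)))
          (cong (_* (pw (1ℚ + 1ℚ) p * pw 5/8 (p ℕ.+ p))) (cong (_* pw 5/8 8) (trans (pw-ι′) refl)))))
        (≤≡ (*-mono (0≤* (pw-0≤ (0≤+ 0≤1 0≤1) 4) (pw-0≤ 0≤5/8 8)) 0≤1 (half 4) (half p)) (*-identityʳ 1ℚ))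
        where
        pw-ι′ : ι 16 ≡ pw (1ℚ + 1ℚ) 4
        pw-ι′ = trans (sym (pw-ι 2 4)) (cong (λ u → pw u 4) (trans (ι-suc 1) (cong (1ℚ +_) ι1)))

 -- Random thresholds and correlated sampling

 module Dithering where

  open import Data.List.Base using ([]; _∷_)
  open import Data.Nat.Base as ℕ using (zero; suc)
  open Sums
  open Logarithms
  open NoisySearch using (tuples; ∑-tuples; length-tuples; pairs; ∑-pairs)

  range : ℕ → List ℕ
  range zero    = []
  range (suc D) = D ∷ range D

  length-range : ∀ D → length (range D) ≡ D
  length-range zero    = refl
  length-range (suc D) = cong suc (length-range D)

  ∑-range : ∀ D → ∑ (range D) (λ _ → 1ℚ) ≡ ι D
  ∑-range D = trans (∑-const (range D) 1ℚ) (trans (*-identityʳ _) (cong ι (length-range D)))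

  below : ℕ → ℕ → Bool
  below τ u = u ℕ.<ᵇ τ

  below-yes : ∀ {τ u} → u ℕ.< τ → below τ u ≡ true
  below-yes {τ} {u} h = go (u ℕ.<ᵇ τ) (ℕP.<⇒<ᵇ h)
    where
    open import Data.Bool.Base using (T)
    go : ∀ b → T b → b ≡ true
    go true _ = refl

  below-no : ∀ {τ u} → τ ℕ.≤ u → below τ u ≡ false
  below-no {τ} {u} h = BoolP.¬-not λ e → ℕP.<⇒≱ (ℕP.<ᵇ⇒< u τ (subst T (sym e) _)) h
    where
    open import Data.Bool.Base using (T)

  hits : ℕ → Bool → ℕ → ℚ
  hits D b τ = ∑ (range D) (λ u → ind (below τ u BoolP.≟ b))

  hits-true : ∀ D τ → τ ℕ.≤ D → hits D true τ ≡ ι τ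
  hits-true zero    zero    h = sym ι0
  hits-true (suc D) τ h with ℕP.m≤n⇒m<n∨m≡n h
  ... | inj₁ (s≤s p) = trans (cong₂ _+_ (cong (λ b → ind (b BoolP.≟ true)) (below-no p)) (hits-true D τ p)) (+-identityˡ _)
  ... | inj₂ refl = trans (cong₂ _+_ (cong (λ b → ind (b BoolP.≟ true)) (below-yes {suc D} ℕP.≤-refl)) (all D ℕP.≤-refl)) (sym (ι-suc D))
    where
    all : ∀ k → k ℕ.≤ D → ∑ (range k) (λ u → ind (below (suc D) u BoolP.≟ true)) ≡ ι k
    all zero    _ = sym ι0
    all (suc k) q = trans (cong₂ _+_ (cong (λ b → ind (b BoolP.≟ true)) (below-yes {suc D} (ℕP.≤-trans q (ℕP.n≤1+n D)))) (all k (ℕP.≤-trans (ℕP.n≤1+n k) q))) (sym (ι-suc k))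

  hits-both : ∀ D τ → hits D true τ + hits D false τ ≡ ι D
  hits-both D τ = trans (sym (∑-+ (range D) _ _)) (trans (∑-cong (range D) λ u → one (below τ u)) (∑-range D))
    where
    one : ∀ b → ind (b BoolP.≟ true) + ind (b BoolP.≟ false) ≡ 1ℚ
    one true  = +-identityʳ 1ℚ
    one false = +-identityˡ 1ℚ

  -- thresholded with the same random number, the second prediction fails on the first one's value with the least possible probability
  misses : ∀ D b τ τ′ → ∑ (range D) (λ u → ind (below τ u BoolP.≟ b) * (1ℚ - ind (below τ′ u BoolP.≟ b))) ≤ plus (hits D b τ - hits D b τ′)
  misses D b τ τ′ = go (nested b (ℕP.≤-total τ τ′))
    where
    Sub : ℕ → ℕ → Set
    Sub τ τ′ = ∀ u → below τ u ≡ b → below τ′ u ≡ b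
    nested : ∀ b → τ ℕ.≤ τ′ ⊎ τ′ ℕ.≤ τ → (∀ u → below τ u ≡ b → below τ′ u ≡ b) ⊎ (∀ u → below τ′ u ≡ b → below τ u ≡ b)
    nested true  (inj₁ h) = inj₁ (up h)
      where
      up : ∀ {τ τ′} → τ ℕ.≤ τ′ → ∀ u → below τ u ≡ true → below τ′ u ≡ true
      up {τ} h u e = below-yes (ℕP.≤-trans (ℕP.≰⇒> λ q → contradiction (trans (sym e) (below-no q)) λ ()) h)
    nested true  (inj₂ h) = inj₂ (up h)
      where
      up : ∀ {τ τ′} → τ ℕ.≤ τ′ → ∀ u → below τ u ≡ true → below τ′ u ≡ true
      up {τ} h u e = below-yes (ℕP.≤-trans (ℕP.≰⇒> λ q → contradiction (trans (sym e) (below-no q)) λ ()) h)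
    nested false (inj₁ h) = inj₂ (down h)
      where
      down : ∀ {τ τ′} → τ ℕ.≤ τ′ → ∀ u → below τ′ u ≡ false → below τ u ≡ false
      down {τ} {τ′} h u e = below-no (ℕP.≤-trans h (ℕP.≮⇒≥ λ q → contradiction (trans (sym e) (below-yes q)) λ ()))
    nested false (inj₂ h) = inj₁ (down h)
      where
      down : ∀ {τ τ′} → τ ℕ.≤ τ′ → ∀ u → below τ′ u ≡ false → below τ u ≡ false
      down {τ} {τ′} h u e = below-no (ℕP.≤-trans h (ℕP.≮⇒≥ λ q → contradiction (trans (sym e) (below-yes q)) λ ()))
    go : Sub τ τ′ ⊎ Sub τ′ τ → _
    go (inj₁ sub) = ≡≤ (trans (∑-cong (range D) λ u → zero′ u (below τ u BoolP.≟ b)) (∑-0 (range D))) (0≤plus _)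
      where
      zero′ : ∀ u (d : Dec (below τ u ≡ b)) → ind d * (1ℚ - ind (below τ′ u BoolP.≟ b)) ≡ 0ℚ
      zero′ u (yes e) = trans (*-identityˡ _) (trans (cong (λ v → 1ℚ - v) (ind-yes (below τ′ u BoolP.≟ b) (sub u e))) (+-inverseʳ 1ℚ))
      zero′ u (no _)  = *-zeroˡ _
    go (inj₂ sub) = ≡≤ (trans (∑-cong (range D) λ u → diff u (below τ′ u BoolP.≟ b)) (∑-- (range D) _ _)) (≤plus _)
      where
      diff : ∀ u (d : Dec (below τ′ u ≡ b)) → ind (below τ u BoolP.≟ b) * (1ℚ - ind d) ≡ ind (below τ u BoolP.≟ b) - ind d
      diff u (yes e) = trans (cong (λ v → v * (1ℚ - 1ℚ)) (ind-yes (below τ u BoolP.≟ b) (sub u e))) (trans (*-identityˡ _) (cong (_- 1ℚ) (sym (ind-yes (below τ u BoolP.≟ b) (sub u e)))))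
      diff u (no _)  = trans (cong (ind (below τ u BoolP.≟ b) *_) (trans (cong (1ℚ +_) neg-0) (+-identityʳ 1ℚ))) (trans (*-identityʳ _) (sym (trans (cong (ind (below τ u BoolP.≟ b) +_) neg-0) (+-identityʳ _))))

  -- Class sizes are at most `length Q`, so the factorial of `length Q` is a common multiple of them
  -- and a uniform integer below it realizes their quotients exactly.
  fact : ℕ → ℕ
  fact zero    = 1
  fact (suc n) = suc n ℕ.* fact n

  -- n! / c for 1 ≤ c ≤ n, and 0 for c = 0
  share : ℕ → ℕ → ℕ
  share n       zero    = 0
  share zero    (suc c) = 0
  share (suc n) (suc c) = if c ℕ.≡ᵇ n then fact n else suc n ℕ.* share n (suc c)

  share-* : ∀ n c → 1 ℕ.≤ c → c ℕ.≤ n → share n c ℕ.* c ≡ fact n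
  share-* (suc n) (suc c) _ (s≤s h) with ℕP.m≤n⇒m<n∨m≡n h
  ... | inj₂ refl = trans (cong (λ b → (if b then fact c else suc c ℕ.* share c (suc c)) ℕ.* suc c) (eq c)) (ℕP.*-comm (fact c) (suc c))
    where
    eq : ∀ c → (c ℕ.≡ᵇ c) ≡ true
    eq zero = refl
    eq (suc c) = eq c
  ... | inj₁ p = trans (cong (λ b → (if b then fact n else suc n ℕ.* share n (suc c)) ℕ.* suc c) (ne c n p))
      (trans (ℕP.*-assoc (suc n) (share n (suc c)) (suc c)) (cong (suc n ℕ.*_) (share-* n (suc c) (s≤s z≤n) p)))
    where
    ne : ∀ c n → c ℕ.< n → (c ℕ.≡ᵇ n) ≡ false
    ne zero    (suc n) _ = refl
    ne (suc c) (suc n) (s≤s p) = ne c n p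

  fact-pos : ∀ n → 1 ℕ.≤ fact n
  fact-pos zero    = s≤s z≤n
  fact-pos (suc n) = ℕP.≤-trans (fact-pos n) (ℕP.m≤m+n (fact n) _)

  ι-share : ∀ n c → c ℕ.≤ n → ι (share n c) ≡ ι (fact n) * inv c
  ι-share n zero    h = trans (cong ι (share-0 n)) (trans ι0 (sym (trans (cong (ι (fact n) *_) inv0) (*-zeroʳ _))))
    where
    share-0 : ∀ n → share n 0 ≡ 0
    share-0 zero    = refl
    share-0 (suc n) = refl
  ι-share n (suc c) h = trans (sym (*-identityʳ _)) (trans (cong (ι (share n (suc c)) *_) (sym (ι*inv {suc c} (s≤s z≤n))))
    (trans (sym (*-assoc _ _ _)) (cong (_* inv (suc c)) (trans (sym (ι-* (share n (suc c)) (suc c))) (cong ι (share-* n (suc c) (s≤s z≤n) h))))))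

  prodFrom sumFrom : (ℕ → ℚ) → ℕ → ℕ → ℚ
  prodFrom p k zero    = 1ℚ
  prodFrom p k (suc m) = p k * prodFrom p (suc k) m
  sumFrom e k zero    = 0ℚ
  sumFrom e k (suc m) = e k + sumFrom e (suc k) m

  -- Level `k` consumes its own random number. `S` is to indicate that the owner predicts the right
  -- bit, and `X` that the other player then errs; `E` bounds the conditional rate of the latter.
  -- `someX` counts errors along paths that are right throughout.
  module Levels (D : ℕ) (S X : ℕ → ℕ → ℚ) (p E : ℕ → ℚ)
    (0≤S : ∀ k u → 0ℚ ≤ S k u) (0≤X : ∀ k u → 0ℚ ≤ X k u) (0≤p : ∀ k → 0ℚ ≤ p k) (0≤E : ∀ k → 0ℚ ≤ E k)
    (∑S : ∀ k → ∑ (range D) (S k) ≡ ι D * p k) (∑X : ∀ k → ∑ (range D) (X k) ≤ ι D * (p k * E k)) where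

    seqs : ℕ → List (List ℕ)
    seqs = tuples (range D)

    allS someX : ℕ → List ℕ → ℚ
    allS k []       = 1ℚ
    allS k (u ∷ us) = S k u * allS (suc k) us
    someX k []       = 0ℚ
    someX k (u ∷ us) = X k u * allS (suc k) us + S k u * someX (suc k) us

    prod from : ℕ → ℕ → ℚ
    prod = prodFrom p
    from = sumFrom E

    0≤prod : ∀ k m → 0ℚ ≤ prod k m
    0≤prod k zero    = 0≤1
    0≤prod k (suc m) = 0≤* (0≤p k) (0≤prod (suc k) m)

    ∑-seqs : ∀ m (f : List ℕ → ℚ) → ∑ (seqs (suc m)) f ≡ ∑ (range D) (λ u → ∑ (seqs m) (λ us → f (u ∷ us)))
    ∑-seqs = ∑-tuples (range D)

    ∑-allS : ∀ k m → ∑ (seqs m) (allS k) ≡ pw (ι D) m * prod k m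
    ∑-allS k zero    = trans (+-identityʳ 1ℚ) (sym (*-identityˡ 1ℚ))
    ∑-allS k (suc m) = trans (∑-seqs m (allS k)) (trans (∑-cong (range D) λ u → trans (∑-*ˡ (seqs m) (S k u) (allS (suc k))) (cong (S k u *_) (∑-allS (suc k) m)))
      (trans (∑-*ʳ (range D) _ (S k)) (trans (cong (_* (pw (ι D) m * prod (suc k) m)) (∑S k)) (identity-84 (ι D) (p k) (pw (ι D) m) (prod (suc k) m)))))

    ∑-someX : ∀ k m → ∑ (seqs m) (someX k) ≤ pw (ι D) m * prod k m * from k m
    ∑-someX k zero    = ≤-reflexive (trans (+-identityʳ 0ℚ) (sym (*-zeroʳ _)))
    ∑-someX k (suc m) = ≡≤ (trans (∑-seqs m (someX k)) (trans (∑-cong (range D) λ u → trans (∑-+ (seqs m) _ _) (cong₂ _+_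
        (trans (∑-*ˡ (seqs m) (X k u) (allS (suc k))) (cong (X k u *_) (∑-allS (suc k) m))) (∑-*ˡ (seqs m) (S k u) (someX (suc k)))))
        (trans (∑-+ (range D) _ _) (cong₂ _+_ (∑-*ʳ (range D) A (X k)) (trans (∑-*ʳ (range D) _ (S k)) (cong (_* ∑ (seqs m) (someX (suc k))) (∑S k)))))))
      (≤≡ (+-mono-≤ (*ʳ A (0≤* (pw-0≤ (0≤ι D) m) (0≤prod (suc k) m)) (∑X k)) (*ˡ (ι D * p k) (0≤* (0≤ι D) (0≤p k)) (∑-someX (suc k) m)))
      (identity-85 (ι D) (p k) (E k) (pw (ι D) m) (prod (suc k) m) (from (suc k) m)))
      where
      A : ℚ
      A = pw (ι D) m * prod (suc k) m

  firstAccepted : {C R : Set} → (C → R) → (C → Bool) → List C → Maybe R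
  firstAccepted value acc []       = nothing
  firstAccepted value acc (c ∷ cs) = if acc c then just (value c) else firstAccepted value acc cs

  -- Correlated sampling: from a common sequence of trials each player takes the first one it accepts.
  module Correlated {C R : Set} (trials : List C) (accA accB : C → Bool) (value : C → R) where

    first : (C → Bool) → List C → Maybe R
    first = firstAccepted value

    open import Data.Bool.Base using (_∨_)

    both none : C → ℚ
    both c = ind ((accA c ∧ accB c) BoolP.≟ true)
    none c = ind ((accA c ∨ accB c) BoolP.≟ false)

    module _ (succ : Maybe R → Maybe R → ℚ) (0≤succ : ∀ r r′ → 0ℚ ≤ succ r r′) where

      gain : C → ℚ
      gain c = both c * succ (just (value c)) (just (value c))

      total : ℕ → ℚ
      total N = ∑ (tuples trials N) (λ cs → succ (first accA cs) (first accB cs))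

      -- A trial accepted by both players decides, a trial rejected by both passes to the remaining
      -- ones, and a trial accepted by only one is counted as lost.
      total-suc : ∀ N → ∑ trials gain * pw (ι (length trials)) N + ∑ trials none * total N ≤ total (suc N)
      total-suc N = ≡≤ (sym (trans (∑-+ trials _ _) (cong₂ _+_ (∑-*ʳ trials _ gain) (∑-*ʳ trials (total N) none))))
        (≤≡ (∑-mono trials step) (sym (∑-tuples trials N _)))
        where
        L : ℚ
        L = pw (ι (length trials)) N
        const : ∀ v → ∑ (tuples trials N) (λ _ → v) ≡ v * L
        const v = trans (∑-const (tuples trials N) v) (trans (*-comm _ v) (cong (v *_) (length-tuples trials N)))
        step : ∀ c → gain c * L + none c * total N ≤ ∑ (tuples trials N) (λ cs → succ (first accA (c ∷ cs)) (first accB (c ∷ cs)))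
        step c with accA c | accB c
        ... | true  | true  = ≤-reflexive (trans (cong₂ (λ u v → u * L + v) (*-identityˡ _) (*-zeroˡ _)) (trans (+-identityʳ _) (sym (const _))))
        ... | true  | false = ≡≤ (identity-80 _ L (total N)) (∑-0≤ (tuples trials N) λ _ → 0≤succ _ _)
        ... | false | true  = ≡≤ (identity-80 _ L (total N)) (∑-0≤ (tuples trials N) λ _ → 0≤succ _ _)
        ... | false | false = ≤-reflexive (identity-81 _ L (total N))

      0≤total : ∀ N → 0ℚ ≤ total N
      0≤total N = ∑-0≤ (tuples trials N) λ _ → 0≤succ _ _

      -- κ is a lower bound for the success probability conditional on acceptance, ζ for that of acceptance
      total-≥ : ∀ κ ζ → 0ℚ ≤ κ → 0ℚ ≤ 1ℚ - ζ → κ * (ι (length trials) - ∑ trials none) ≤ ∑ trials gain →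
        ∑ trials none ≤ (1ℚ - ζ) * ι (length trials) → 
        ∀ N → κ * (1ℚ - pw (1ℚ - ζ) N) * pw (ι (length trials)) N ≤ total N
      total-≥ κ ζ 0≤κ 0≤τ hg hn zero    = ≡≤ (identity-82 κ) (0≤total 0)
      total-≥ κ ζ 0≤κ 0≤τ hg hn (suc N) = ≤-trans (-≤0⇒≤ (subst (0ℚ ≤_) (identity-83 κ ℓ nn (∑ trials gain) (1ℚ - ζ) t P)
          (0≤+ (0≤* (0≤- hg) (pw-0≤ (0≤ι (length trials)) N)) (0≤* (0≤* 0≤κ (0≤* (pw-0≤ 0≤τ N) (pw-0≤ (0≤ι (length trials)) N))) (0≤- hn)))))
        (≤-trans (+-monoʳ-≤ (∑ trials gain * P) (*ˡ nn (∑-0≤ trials λ c → 0≤ind ((accA c ∨ accB c) BoolP.≟ false)) (total-≥ κ ζ 0≤κ 0≤τ hg hn N))) (total-suc N))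
        where
        ℓ nn t P : ℚ
        ℓ = ι (length trials)
        nn = ∑ trials none
        t = pw (1ℚ - ζ) N
        P = pw ℓ N

 -- Simulation of the transcript at one coordinate

 module BitSimulation where

  open import Data.List.Base using ([]; _∷_)
  open import Data.List.Properties using (≡-dec)
  open import Data.Nat.Base as ℕ using (zero; suc)
  open import Defs using (run)
  open Sums
  open Logarithms
  open Classes
  open CoordinateChoice
  open NoisySearch
  open Dithering

  -- The threshold for predicting the bit b on the elements of Q satisfying P, in units of 1 / length Q !
  module Threshold {Ω : Set} (Q : List Ω) {P : Ω → Set} (P? : ∀ ω → Dec (P ω)) (b : Ω → Bool) where

    F : ℕ
    F = fact (length Q)

    with-bit : Bool → ℕ
    with-bit v = count (λ ω → P? ω ×-dec (b ω BoolP.≟ v)) Q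

    τ : ℕ
    τ = share (length Q) (count P? Q) ℕ.* with-bit true

    split : ι (with-bit true) + ι (with-bit false) ≡ ι (count P? Q)
    split = trans (cong₂ _+_ (ι-count _ Q) (ι-count _ Q)) (trans (sym (∑-+ Q _ _)) (trans (∑-cong Q λ ω → one (P? ω) (b ω)) (sym (ι-count P? Q))))
      where
      one : ∀ {A : Set} (p : Dec A) v → ind (p ×-dec (v BoolP.≟ true)) + ind (p ×-dec (v BoolP.≟ false)) ≡ ind p
      one (yes _) true  = +-identityʳ 1ℚ
      one (yes _) false = +-identityˡ 1ℚ
      one (no _)  true  = +-identityʳ 0ℚ
      one (no _)  false = +-identityʳ 0ℚ

    module _ (pos : 1 ℕ.≤ count P? Q) where

      with-bit≤ : with-bit true ℕ.≤ count P? Q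
      with-bit≤ = count-mono _ P? Q λ _ → proj₁

      τ≤F : τ ℕ.≤ F
      τ≤F = ℕP.≤-trans (ℕP.*-monoʳ-≤ (share (length Q) (count P? Q)) with-bit≤) (ℕP.≤-reflexive (share-* (length Q) (count P? Q) pos (count≤length P? Q)))

      ιτ : ι τ ≡ ι F * (ι (with-bit true) * inv (count P? Q))
      ιτ = trans (ι-* (share (length Q) (count P? Q)) (with-bit true)) (trans (cong (_* ι (with-bit true)) (ι-share (length Q) (count P? Q) (count≤length P? Q)))
        (trans (*-assoc (ι F) _ _) (cong (ι F *_) (*-comm _ _))))

      hits-τ : ∀ v → hits F v τ ≡ ι F * (ι (with-bit v) * inv (count P? Q))
      hits-τ true  = trans (hits-true F τ τ≤F) ιτ
      hits-τ false = trans (trans (identity-89 (hits F true τ) (hits F false τ)) (cong₂ _-_ (hits-both F τ) (trans (hits-true F τ τ≤F) ιτ)))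
        (trans (cong (_- ι F * (ι (with-bit true) * inv (count P? Q))) (trans (sym (*-identityʳ (ι F))) (cong (ι F *_) (trans (sym (ι*inv pos)) (cong (_* inv (count P? Q)) (sym split))))))
          (identity-90 (ι F) (ι (with-bit true)) (ι (with-bit false)) (inv (count P? Q))))

  prefix : {Ω : Set} → (ℕ → Ω → Bool) → ℕ → Ω → List Bool
  prefix bits zero    ω = []
  prefix bits (suc k) ω = bits k ω ∷ prefix bits k ω

  length-prefix : ∀ {Ω : Set} (bits : ℕ → Ω → Bool) k ω → length (prefix bits k ω) ≡ k
  length-prefix bits zero    ω = refl
  length-prefix bits (suc k) ω = cong suc (length-prefix bits k ω)

  prefix-bits : ∀ {Ω : Set} (bits : ℕ → Ω → Bool) k {ω ω′} → prefix bits k ω ≡ prefix bits k ω′ → ∀ i → i ℕ.< k → bits i ω ≡ bits i ω′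
  prefix-bits bits (suc k) e i i<k with ∷-injective e | ℕP.m≤n⇒m<n∨m≡n (ℕP.≤-pred i<k)
  ... | _ , e₂ | inj₁ p    = prefix-bits bits k e₂ i p
  ... | e₁ , _ | inj₂ refl = e₁

  bits-prefix : ∀ {Ω : Set} (bits : ℕ → Ω → Bool) k {ω ω′} → (∀ i → i ℕ.< k → bits i ω ≡ bits i ω′) → prefix bits k ω ≡ prefix bits k ω′
  bits-prefix bits zero    h = refl
  bits-prefix bits (suc k) h = cong₂ _∷_ (h k ℕP.≤-refl) (bits-prefix bits k λ i p → h i (ℕP.m≤n⇒m≤1+n p))

  _≟L_ : DecidableEquality (List Bool)
  _≟L_ = ≡-dec BoolP._≟_

  nth : List ℕ → ℕ → ℕ
  nth []       k       = 0
  nth (u ∷ us) zero    = u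
  nth (u ∷ us) (suc k) = nth us k

  -- the conditional probability of one player's view given the other's, against the posterior
  excess : ∀ {p p′ t} → 0ℚ ≤ p → 0ℚ ≤ p′ → 0ℚ ≤ t → plus (p - p′) ≤ p * (plus (1ℚ - p′ * t) + plus (p * t - 1ℚ))
  excess {p} {p′} {t} 0≤p 0≤p′ 0≤t = plus-lub 0≤rhs (go (≤-total 1ℚ (p * t)) (≤-total p p′))
    where
    0≤rhs : 0ℚ ≤ p * (plus (1ℚ - p′ * t) + plus (p * t - 1ℚ))
    0≤rhs = 0≤* 0≤p (0≤+ (0≤plus _) (0≤plus _))
    go : 1ℚ ≤ p * t ⊎ p * t ≤ 1ℚ → p ≤ p′ ⊎ p′ ≤ p → p - p′ ≤ p * (plus (1ℚ - p′ * t) + plus (p * t - 1ℚ))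
    go _        (inj₁ h) = ≤-trans (≤≡ (+-monoˡ-≤ (- p′) h) (+-inverseʳ p′)) 0≤rhs
    go (inj₁ q) (inj₂ h) = ≤-trans (≡≤ (sym (*-identityˡ _)) (*ʳ (p - p′) (0≤- h) q))
        (≡≤ (identity-93 p p′ t) (*ˡ p 0≤p (+-mono-≤ (≤plus _) (≤plus _))))
    go (inj₂ q) (inj₂ h) = ≤-trans (+-monoʳ-≤ p (neg-≤ (≤≡ (*ʳ p′ 0≤p′ q) (*-identityˡ p′))))
        (≡≤ (identity-94 p p′ t) (*ˡ p 0≤p (≤-trans (≤plus _) (gap _ (0≤plus _) refl))))

  plus-* : ∀ {f a} → 0ℚ ≤ f → plus (f * a) ≤ f * plus a
  plus-* {f} {a} 0≤f = plus-lub (0≤* 0≤f (0≤plus a)) (*ˡ f 0≤f (≤plus a))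

  length-∈ : ∀ {A : Set} {xs : List A} k {us} → us ∈ tuples xs k → length us ≡ k
  length-∈ zero (here refl) = refl
  length-∈ {xs = xs} (suc k) {us} us∈ = go xs us∈
    where
    go : ∀ ys → us ∈ concatMap (λ y → map (y ∷_) (tuples xs k)) ys → length us ≡ suc k
    go (y ∷ ys) m with ∈-++⁻ (map (y ∷_) (tuples xs k)) m
    ... | inj₂ r = go ys r
    ... | inj₁ r with ∈-map⁻ (y ∷_) r
    ... | vs , vs∈ , refl = cong suc (length-∈ k vs∈)

  ind-≢ : ∀ r {t b : Bool} → t ≡ b → ind (¬? (r BoolP.≟ t)) ≡ 1ℚ - ind (r BoolP.≟ b)
  ind-≢ r {t} refl with r BoolP.≟ t
  ... | yes _ = sym (+-inverseʳ 1ℚ)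
  ... | no _  = sym (trans (cong (1ℚ +_) neg-0) (+-identityʳ 1ℚ))

  bools-pos : ∀ k → 1 ℕ.≤ length (bools k)
  bools-pos zero    = s≤s z≤n
  bools-pos (suc k) = ℕP.≤-trans (bools-pos k) (ℕP.≤-trans (ℕP.≤-reflexive (sym (length-map (false ∷_) (bools k)))) (ℕP.≤-trans (ℕP.m≤m+n _ _) (ℕP.≤-reflexive (sym (length-++ (map (false ∷_) (bools k)))))))

  -- A class of R is drawn with its probability given P, by accepting ω′ with probability a ω′.
  module Accept {Ω : Set} (Q : List Ω) (full : ∀ ω → ω ∈ Q) (R : Eqv Ω) {P : Ω → Set} (P? : ∀ ω → Dec (P ω)) where

    open Counting Q full

    F #P : ℕ
    F = fact (length Q)
    #P = count P? Q

    #PR : Ω → ℕ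
    #PR ω′ = count (λ ω → P? ω ×-dec (R ∋ ω′ ≈? ω)) Q

    -- The acceptance threshold over the denominator `F * F`, with one factorial for each of the two
    -- inverses in `a`.
    α : Ω → ℕ
    α ω′ = share (length Q) #P ℕ.* (share (length Q) (cnt R ω′) ℕ.* #PR ω′)

    FF : ℚ
    FF = ι (F ℕ.* F)

    a : Ω → ℚ
    a ω′ = inv #P * (i R ω′ * ι (#PR ω′))

    ια : ∀ ω′ → ι (α ω′) ≡ FF * a ω′
    ια ω′ = trans (ι-* (share (length Q) #P) _) (trans (cong₂ _*_ (ι-share (length Q) #P (count≤length P? Q))
        (trans (ι-* (share (length Q) (cnt R ω′)) (#PR ω′)) (cong (_* ι (#PR ω′)) (ι-share (length Q) (cnt R ω′) (cnt≤ R ω′)))))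
      (trans (identity-132 (ι F) (inv #P) (i R ω′) (ι (#PR ω′))) (cong (_* a ω′) (sym (ι-* F F)))))

    share≤ : ∀ c → c ℕ.≤ length Q → share (length Q) c ℕ.≤ F
    share≤ zero    h = subst (ℕ._≤ F) (sym (share-0 (length Q))) z≤n
      where
      share-0 : ∀ n → share n 0 ≡ 0
      share-0 zero    = refl
      share-0 (suc n) = refl
    share≤ (suc c) h = ℕP.≤-trans (ℕP.m≤m*n (share (length Q) (suc c)) (suc c)) (ℕP.≤-reflexive (share-* (length Q) (suc c) (s≤s z≤n) h))

    α≤ : ∀ ω′ → α ω′ ℕ.≤ F ℕ.* F
    α≤ ω′ = ℕP.*-mono-≤ (share≤ #P (count≤length P? Q)) (ℕP.≤-trans (ℕP.*-monoʳ-≤ (share (length Q) (cnt R ω′)) (count-mono _ (R ∋ ω′ ≈?_) Q λ _ → proj₂))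
      (ℕP.≤-reflexive (share-* (length Q) (cnt R ω′) (cnt-pos R ω′) (cnt≤ R ω′))))

    ∑a : ∑ Q a ≡ inv #P * ι #P
    ∑a = trans (∑-*ˡ Q (inv #P) _) (cong (inv #P *_) (trans (∑-cong Q spread) (trans (∑-swap Q Q _)
        (trans (∑-cong Q λ ω → trans (∑-*ˡ Q (ind (P? ω)) (λ ω′ → ind (R ∋ ω ≈? ω′) * i R ω′)) (trans (cong (ind (P? ω) *_) (unit= R ω)) (*-identityʳ _))) (sym (ι-count P? Q))))))
      where
      spread : ∀ ω′ → i R ω′ * ι (#PR ω′) ≡ ∑ Q (λ ω → ind (P? ω) * (ind (R ∋ ω ≈? ω′) * i R ω′))
      spread ω′ = trans (cong (i R ω′ *_) (ι-count _ Q)) (trans (sym (∑-*ˡ Q (i R ω′) _)) (∑-cong Q λ ω → trans (cong (i R ω′ *_) (prodInd (P? ω) (R ∋ ω′ ≈? ω)))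
          (trans (cong (λ u → i R ω′ * (ind (P? ω) * u)) (ind-cong (R ∋ ω′ ≈? ω) (R ∋ ω ≈? ω′) (symmetric R) (symmetric R))) (identity-112 (i R ω′) (ind (P? ω)) (ind (R ∋ ω ≈? ω′))))))
        where
        prodInd : ∀ {A B : Set} (p : Dec A) (r : Dec B) → ind (p ×-dec r) ≡ ind p * ind r
        prodInd (yes _) r = sym (*-identityˡ (ind r))
        prodInd (no _)  r = sym (*-zeroˡ (ind r))

    ∑a≤1 : ∑ Q a ≤ 1ℚ
    ∑a≤1 = subst (_≤ 1ℚ) (sym ∑a) (go #P)
      where
      go : ∀ c → inv c * ι c ≤ 1ℚ
      go zero    = subst (_≤ 1ℚ) (sym (trans (cong (_* ι 0) inv0) (*-zeroˡ _))) 0≤1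
      go (suc c) = ≤-reflexive (inv*ι (s≤s z≤n))

    ∑a≡1 : 1 ℕ.≤ #P → ∑ Q a ≡ 1ℚ
    ∑a≡1 h = trans ∑a (inv*ι h)

    accepts : Ω × ℕ → Bool
    accepts (ω′ , u) = below (α ω′) u

    ∑accepts : ∀ ω′ → ∑ (range (F ℕ.* F)) (λ u → ind (accepts (ω′ , u) BoolP.≟ true)) ≡ FF * a ω′
    ∑accepts ω′ = trans (hits-true (F ℕ.* F) (α ω′) (α≤ ω′)) (ια ω′)

  module Simulation {Ω X Y : Set} (Q : List Ω) (full : ∀ ω → ω ∈ Q) (1≤#Q : 1 ℕ.≤ length Q)
    (E : List (X × Y)) (_≟X_ : DecidableEquality X) (_≟Y_ : DecidableEquality Y)
    (n : ℕ) (x : ℕ → Ω → X) (y : ℕ → Ω → Y) (bits : ℕ → Ω → Bool) (own : ℕ → Bool)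
    (pt∈E : ∀ {j} → j ℕ.< n → ∀ ω → (x j ω , y j ω) ∈ E) (1≤#E : 1 ℕ.≤ length E)
    (T J d : ℕ) (1≤d : 1 ℕ.≤ d) (1≤J : 1 ℕ.≤ J) (T<2^J : T ℕ.< 2 ℕ.^ J) (z : List Bool → Bool) (f : X × Y → Bool) (j : ℕ) (j<n : j ℕ.< n)
    (win : ∀ ω → z (prefix bits T ω) ≡ f (x j ω , y j ω)) where

    open Coordinates Q full 1≤#Q E _≟X_ _≟Y_ n x y bits own pt∈E 1≤#E

    mp : ℕ → Ω → List Bool
    mp = prefix bits

    -- `RY` fixes the public part alone, `XR` adds Alice's coordinate `j`, and `YR` adds Bob's.
    RY XR YR : Eqv Ω
    RY = Rel j (suc j) 0
    XR = Rel (suc j) (suc j) 0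
    YR = Rel j j 0

    PX? : ∀ a ω′ v ω → Dec (x j ω ≡ a × RY ∋ ω′ ≈ ω × mp (length v) ω ≡ v)
    PX? a ω′ v ω = (x j ω ≟X a) ×-dec (RY ∋ ω′ ≈? ω) ×-dec (mp (length v) ω ≟L v)

    PY? : ∀ b ω′ v ω → Dec (y j ω ≡ b × RY ∋ ω′ ≈ ω × mp (length v) ω ≡ v)
    PY? b ω′ v ω = (y j ω ≟Y b) ×-dec (RY ∋ ω′ ≈? ω) ×-dec (mp (length v) ω ≟L v)

    module TX a ω′ v = Threshold Q (PX? a ω′ v) (bits (length v))
    module TY b ω′ v = Threshold Q (PY? b ω′ v) (bits (length v))

    F : ℕ
    F = fact (length Q)

    predX : Maybe Ω → List ℕ → X → List Bool → Bool
    predX nothing   us a v = false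
    predX (just ω′) us a v = below (TX.τ a ω′ v) (nth us (length v))

    predY : Maybe Ω → List ℕ → Y → List Bool → Bool
    predY nothing   us b v = false
    predY (just ω′) us b v = below (TY.τ b ω′ v) (nth us (length v))

    qX qY : ℕ → Ω → ℚ
    qX k ω = c (Rel (suc j) (suc j) (suc k)) ω * i (Rel (suc j) (suc j) k) ω
    qY k ω = c (Rel j j (suc k)) ω * i (Rel j j k) ω

    -- `1 / t` is the probability of the true bit given both views, and `p` is the owner's
    -- probability. `err` adds how far the other player falls short of `1 / t` and how far the owner
    -- exceeds it, each relative to `1 / t`.
    t p err : Ω → ℕ → ℚ
    t ω k = c (Rel (suc j) j k) ω * i (Rel (suc j) j (suc k)) ω
    p ω k = if own k then qX k ω else qY k ω
    err ω k = if own k then plus (1ℚ - qY k ω * t ω k) + plus (qX k ω * t ω k - 1ℚ) else plus (1ℚ - qX k ω * t ω k) + plus (qY k ω * t ω k - 1ℚ)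

    -- If the sampled public part is that of `ω`, the players count in exactly the classes of `ω` in
    -- their own views, so their thresholds are the conditional probabilities `qX` and `qY`.
    module Matched (ω ω′ : Ω) (same : RY ∋ ω′ ≈ ω) where

      a : X
      a = x j ω
      b : Y
      b = y j ω

      up : ∀ {s t k ω₁} → (∀ i → i ℕ.< k → bits i ω ≡ bits i ω₁) → Rel s t 0 ∋ ω ≈ ω₁ → Rel s t k ∋ ω ≈ ω₁
      up h (p , q , _) = p , q , h

      down : ∀ {s t k ω₁} → Rel s t k ∋ ω ≈ ω₁ → Rel s t 0 ∋ ω ≈ ω₁
      down (p , q , _) = p , q , λ _ ()

      toX : ∀ {k ω₁} → x j ω₁ ≡ a × RY ∋ ω′ ≈ ω₁ × mp (length (mp k ω)) ω₁ ≡ mp k ω → Rel (suc j) (suc j) k ∋ ω ≈ ω₁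
      toX {k} {ω₁} (e , r , m) = up (λ i h → sym (prefix-bits bits k (subst (λ l → mp l ω₁ ≡ mp k ω) (length-prefix bits k ω) m) i h))
        (add-x {j} {suc j} (sym e) (transitive RY (symmetric RY same) r))

      fromX : ∀ {k ω₁} → Rel (suc j) (suc j) k ∋ ω ≈ ω₁ → x j ω₁ ≡ a × RY ∋ ω′ ≈ ω₁ × mp (length (mp k ω)) ω₁ ≡ mp k ω
      fromX {k} {ω₁} r@(p , q , m) = sym (p j ℕP.≤-refl) , transitive RY same (Rel-mono {suc j} {j} {suc j} {suc j} {k} {0} (ℕP.n≤1+n j) ℕP.≤-refl z≤n r) ,
        subst (λ l → mp l ω₁ ≡ mp k ω) (sym (length-prefix bits k ω)) (sym (bits-prefix bits k m))

      toY : ∀ {k ω₁} → y j ω₁ ≡ b × RY ∋ ω′ ≈ ω₁ × mp (length (mp k ω)) ω₁ ≡ mp k ω → Rel j j k ∋ ω ≈ ω₁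
      toY {k} {ω₁} (e , r , m) = up (λ i h → sym (prefix-bits bits k (subst (λ l → mp l ω₁ ≡ mp k ω) (length-prefix bits k ω) m) i h))
        (add-y {j} {j} (sym e) (transitive RY (symmetric RY same) r))

      fromY : ∀ {k ω₁} → Rel j j k ∋ ω ≈ ω₁ → y j ω₁ ≡ b × RY ∋ ω′ ≈ ω₁ × mp (length (mp k ω)) ω₁ ≡ mp k ω
      fromY {k} {ω₁} r@(p , q , m) = sym (q j j<n ℕP.≤-refl) , transitive RY same (Rel-mono {j} {j} {j} {suc j} {k} {0} ℕP.≤-refl (ℕP.n≤1+n j) z≤n r) ,
        subst (λ l → mp l ω₁ ≡ mp k ω) (sym (length-prefix bits k ω)) (sym (bits-prefix bits k m))

      countX : ∀ k → count (PX? a ω′ (mp k ω)) Q ≡ cnt (Rel (suc j) (suc j) k) ω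
      countX k = count-cong (PX? a ω′ (mp k ω)) (Rel (suc j) (suc j) k ∋ ω ≈?_) Q (λ _ → toX) (λ _ → fromX)

      countY : ∀ k → count (PY? b ω′ (mp k ω)) Q ≡ cnt (Rel j j k) ω
      countY k = count-cong (PY? b ω′ (mp k ω)) (Rel j j k ∋ ω ≈?_) Q (λ _ → toY) (λ _ → fromY)

      bit-eq : ∀ k {ω₁} → bits (length (mp k ω)) ω₁ ≡ bits k ω → bits k ω ≡ bits k ω₁
      bit-eq k {ω₁} e = sym (subst (λ l → bits l ω₁ ≡ bits k ω) (length-prefix bits k ω) e)

      eq-bit : ∀ k {ω₁} → bits k ω ≡ bits k ω₁ → bits (length (mp k ω)) ω₁ ≡ bits k ω
      eq-bit k {ω₁} e = subst (λ l → bits l ω₁ ≡ bits k ω) (sym (length-prefix bits k ω)) (sym e)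

      withX : ∀ k → TX.with-bit a ω′ (mp k ω) (bits k ω) ≡ cnt (Rel (suc j) (suc j) (suc k)) ω
      withX k = count-cong _ (Rel (suc j) (suc j) (suc k) ∋ ω ≈?_) Q (λ ω₁ (p , e) → add-m {suc j} {suc j} (bit-eq k e) (toX p))
        (λ ω₁ r → fromX (Rel-mono {suc j} {suc j} {suc j} {suc j} {suc k} {k} ℕP.≤-refl ℕP.≤-refl (ℕP.n≤1+n k) r) , eq-bit k (last-m {suc j} {suc j} r))

      withY : ∀ k → TY.with-bit b ω′ (mp k ω) (bits k ω) ≡ cnt (Rel j j (suc k)) ω
      withY k = count-cong _ (Rel j j (suc k) ∋ ω ≈?_) Q (λ ω₁ (p , e) → add-m {j} {j} (bit-eq k e) (toY p))
        (λ ω₁ r → fromY (Rel-mono {j} {j} {j} {j} {suc k} {k} ℕP.≤-refl ℕP.≤-refl (ℕP.n≤1+n k) r) , eq-bit k (last-m {j} {j} r))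

      hitsX : ∀ k → hits F (bits k ω) (TX.τ a ω′ (mp k ω)) ≡ ι F * qX k ω
      hitsX k = trans (TX.hits-τ a ω′ (mp k ω) (subst (1 ℕ.≤_) (sym (countX k)) (cnt-pos (Rel (suc j) (suc j) k) ω)) (bits k ω))
        (cong₂ (λ p q → ι F * (ι p * inv q)) (withX k) (countX k))

      hitsY : ∀ k → hits F (bits k ω) (TY.τ b ω′ (mp k ω)) ≡ ι F * qY k ω
      hitsY k = trans (TY.hits-τ b ω′ (mp k ω) (subst (1 ℕ.≤_) (sym (countY k)) (cnt-pos (Rel j j k) ω)) (bits k ω))
        (cong₂ (λ p q → ι F * (ι p * inv q)) (withY k) (countY k))

      τo τt : ℕ → ℕ
      τo k = if own k then TX.τ a ω′ (mp k ω) else TY.τ b ω′ (mp k ω)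
      τt k = if own k then TY.τ b ω′ (mp k ω) else TX.τ a ω′ (mp k ω)

      S X′ : ℕ → ℕ → ℚ
      S k u = ind (below (τo k) u BoolP.≟ bits k ω)
      X′ k u = S k u * (1ℚ - ind (below (τt k) u BoolP.≟ bits k ω))

      0≤qX : ∀ k → 0ℚ ≤ qX k ω
      0≤qX k = 0≤* (0≤c (Rel (suc j) (suc j) (suc k)) ω) (0≤i (Rel (suc j) (suc j) k) ω)

      0≤qY : ∀ k → 0ℚ ≤ qY k ω
      0≤qY k = 0≤* (0≤c (Rel j j (suc k)) ω) (0≤i (Rel j j k) ω)

      0≤t : ∀ k → 0ℚ ≤ t ω k
      0≤t k = 0≤* (0≤c (Rel (suc j) j k) ω) (0≤i (Rel (suc j) j (suc k)) ω)

      0≤p : ∀ k → 0ℚ ≤ p ω k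
      0≤p k with own k
      ... | true  = 0≤qX k
      ... | false = 0≤qY k

      0≤err : ∀ k → 0ℚ ≤ err ω k
      0≤err k with own k
      ... | true  = 0≤+ (0≤plus _) (0≤plus _)
      ... | false = 0≤+ (0≤plus _) (0≤plus _)

      0≤X′ : ∀ k u → 0ℚ ≤ X′ k u
      0≤X′ k u = 0≤* (0≤ind (below (τo k) u BoolP.≟ bits k ω)) (0≤- (ind≤1 (below (τt k) u BoolP.≟ bits k ω)))

      ∑S : ∀ k → ∑ (range F) (S k) ≡ ι F * p ω k
      ∑S k with own k
      ... | true  = hitsX k
      ... | false = hitsY k

      ∑X′ : ∀ k → ∑ (range F) (X′ k) ≤ ι F * (p ω k * err ω k)
      ∑X′ k with own k
      ... | true  = ≤-trans (misses F (bits k ω) (TX.τ a ω′ (mp k ω)) (TY.τ b ω′ (mp k ω))) (≡≤ (cong plus (trans (cong₂ _-_ (hitsX k) (hitsY k)) (identity-91 (ι F) (qX k ω) (qY k ω))))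
          (≤-trans (plus-* (0≤ι F)) (*ˡ (ι F) (0≤ι F) (excess (0≤qX k) (0≤qY k) (0≤t k)))))
      ... | false = ≤-trans (misses F (bits k ω) (TY.τ b ω′ (mp k ω)) (TX.τ a ω′ (mp k ω))) (≡≤ (cong plus (trans (cong₂ _-_ (hitsY k) (hitsX k)) (identity-91 (ι F) (qY k ω) (qX k ω))))
          (≤-trans (plus-* (0≤ι F)) (*ˡ (ι F) (0≤ι F) (excess (0≤qY k) (0≤qX k) (0≤t k)))))

      open Levels F S X′ (p ω) (err ω) (λ k u → 0≤ind (below (τo k) u BoolP.≟ bits k ω)) 0≤X′ 0≤p 0≤err ∑S ∑X′ public

      module Path (us : List ℕ) where

        pX pY : List Bool → Bool
        pX = predX (just ω′) us a
        pY = predY (just ω′) us b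

        open Walk {List Bool → Bool} {List Bool → Bool} own id id T J z

        predX≡ : ∀ k → tp pX pY k ≡ mp k ω → pX (tp pX pY k) ≡ below (TX.τ a ω′ (mp k ω)) (nth us k)
        predX≡ k e = trans (cong pX e) (cong (λ l → below (TX.τ a ω′ (mp k ω)) (nth us l)) (length-prefix bits k ω))

        predY≡ : ∀ k → tp pX pY k ≡ mp k ω → pY (tp pX pY k) ≡ below (TY.τ b ω′ (mp k ω)) (nth us k)
        predY≡ k e = trans (cong pY e) (cong (λ l → below (TY.τ b ω′ (mp k ω)) (nth us l)) (length-prefix bits k ω))

        level : ∀ k → tp pX pY k ≡ mp k ω →
          (if own k then pX (tp pX pY k) else pY (tp pX pY k)) ≡ below (τo k) (nth us k) ×
          mist pX pY k ≡ below (τo k) (nth us k) xor below (τt k) (nth us k)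
        level k e = trans (cong₂ (λ u v → if own k then u else v) (predX≡ k e) (predY≡ k e)) (pull (own k) _ _ (nth us k)) ,
            trans (cong₂ _xor_ (predX≡ k e) (predY≡ k e)) (order (own k) _ _ (nth us k))
          where
          pull : ∀ o tx ty w → (if o then below tx w else below ty w) ≡ below (if o then tx else ty) w
          pull true  tx ty w = refl
          pull false tx ty w = refl
          order : ∀ o tx ty w → below tx w xor below ty w ≡ below (if o then tx else ty) w xor below (if o then ty else tx) w
          order true  tx ty w = refl
          order false tx ty w = BoolP.xor-comm (below tx w) (below ty w)

        Outcome : ℕ → List ℕ → Set
        Outcome k us′ = (allS k us′ ≡ 0ℚ × someX k us′ ≡ 0ℚ) ⊎
          (allS k us′ ≡ 1ℚ × tp pX pY (k ℕ.+ length us′) ≡ mp (k ℕ.+ length us′) ω × someX k us′ ≡ ι (ones (mist pX pY) (length us′) k))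

        -- As long as the owners' predictions are the bits of `ω`, the path of the walk is the
        -- transcript of `ω`, and the failures counted by `someX` are the disagreements that the
        -- search meets. One wrong bit makes both quantities vanish.
        follow : ∀ k us′ → (∀ i → nth us (k ℕ.+ i) ≡ nth us′ i) → tp pX pY k ≡ mp k ω → Outcome k us′
        follow k [] h e = inj₂ (refl , trans (cong (tp pX pY) (ℕP.+-identityʳ k)) (trans e (cong (λ l → mp l ω) (sym (ℕP.+-identityʳ k)))) , sym ι0)
        follow k (u ∷ us′) h e = go (below (τo k) u BoolP.≟ bits k ω) refl
          where
          u≡ : nth us k ≡ u
          u≡ = trans (cong (nth us) (sym (ℕP.+-identityʳ k))) (h 0)
          shift : ∀ i → nth us (suc k ℕ.+ i) ≡ nth us′ i
          shift i = trans (cong (nth us) (sym (ℕP.+-suc k i))) (h (suc i))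
          go : (dd : Dec (below (τo k) u ≡ bits k ω)) → S k u ≡ ind dd → Outcome k (u ∷ us′)
          go (no _) es = inj₁ (trans (cong (_* allS (suc k) us′) es) (*-zeroˡ _) ,
            trans (cong₂ (λ v w → v * (1ℚ - ind (below (τt k) u BoolP.≟ bits k ω)) * allS (suc k) us′ + w * someX (suc k) us′) es es) (identity-87 _ _ _))
          go (yes es) eS = next (follow (suc k) us′ shift tp-suc)
            where
            tp-suc : tp pX pY (suc k) ≡ mp (suc k) ω
            tp-suc = cong₂ _∷_ (trans (proj₁ (level k e)) (trans (cong (below (τo k)) u≡) es)) e
            miss : 1ℚ - ind (below (τt k) u BoolP.≟ bits k ω) ≡ ι (if mist pX pY k then 1 else 0)
            miss = trans (table (bits k ω) (below (τt k) u)) (cong (λ v → ι (if v then 1 else 0)) (sym (trans (proj₂ (level k e)) (trans (cong (λ w → below (τo k) w xor below (τt k) w) u≡) (cong (_xor below (τt k) u) es)))))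
              where
              table : ∀ v w → 1ℚ - ind (w BoolP.≟ v) ≡ ι (if v xor w then 1 else 0)
              table true  true  = trans (+-inverseʳ 1ℚ) (sym ι0)
              table true  false = trans (cong (1ℚ +_) neg-0) (trans (+-identityʳ 1ℚ) (sym ι1))
              table false true  = trans (cong (1ℚ +_) neg-0) (trans (+-identityʳ 1ℚ) (sym ι1))
              table false false = trans (+-inverseʳ 1ℚ) (sym ι0)
            next : Outcome (suc k) us′ → Outcome k (u ∷ us′)
            next (inj₁ (e₁ , e₂)) = inj₁ (trans (cong (S k u *_) e₁) (*-zeroʳ _) , trans (cong₂ (λ v w → X′ k u * v + S k u * w) e₁ e₂) (trans (cong₂ _+_ (*-zeroʳ _) (*-zeroʳ _)) (+-identityʳ 0ℚ)))
            next (inj₂ (e₁ , e₂ , e₃)) = inj₂ (trans (cong₂ _*_ eS e₁) (*-identityˡ 1ℚ) ,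
              trans (cong (tp pX pY) (ℕP.+-suc k (length us′))) (trans e₂ (cong (λ l → mp l ω) (sym (ℕP.+-suc k (length us′))))) ,
              trans (cong₂ _+_ (cong₂ _*_ (cong₂ _*_ eS miss) e₁) (cong₂ _*_ eS e₃)) (trans (identity-86 _ _) (sym (ι-+ (if mist pX pY k then 1 else 0) _))))

        Good? : Dec (tp pX pY T ≡ mp T ω × ones (mist pX pY) T 0 ℕ.≤ d)
        Good? = (tp pX pY T ≟L mp T ω) ×-dec (ones (mist pX pY) T 0 ℕP.≤? d)

        -- Markov's inequality before averaging: `1 - m / d` is at most the indicator of `m ≤ d`.
        good-≥ : length us ≡ T → allS 0 us - inv d * someX 0 us ≤ ind Good?
        good-≥ len = go (follow 0 us (λ i → refl) refl)
          where
          few : ∀ m → Dec (m ℕ.≤ d) → (m ℕ.≤ d → 1ℚ ≤ ind Good?) → 1ℚ - inv d * ι m ≤ ind Good?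
          few m (yes h) k = ≤-trans (≤≡ (+-monoʳ-≤ 1ℚ (≤≡ (neg-≤ (0≤* (0≤inv d) (0≤ι m))) neg-0)) (+-identityʳ 1ℚ)) (k h)
          few m (no h)  k = ≤-trans (≤≡ (+-monoʳ-≤ 1ℚ (neg-≤ (≡≤ (sym (inv*ι 1≤d)) (*ˡ (inv d) (0≤inv d) (ι-mono (ℕP.<⇒≤ (ℕP.≰⇒> h))))))) (+-inverseʳ 1ℚ)) (0≤ind Good?)
          go : Outcome 0 us → allS 0 us - inv d * someX 0 us ≤ ind Good?
          go (inj₁ (e₁ , e₂)) = ≡≤ (trans (cong₂ (λ v w → v - inv d * w) e₁ e₂) (identity-88 (inv d))) (0≤ind Good?)
          go (inj₂ (e₁ , e₂ , e₃)) = ≡≤ (cong₂ (λ v w → v - inv d * w) e₁ e₃) (few (ones (mist pX pY) (length us) 0) (_ ℕP.≤? d)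
            λ h → ≤-reflexive (sym (ind-yes Good? (subst (λ l → tp pX pY l ≡ mp l ω) len e₂ , subst (λ l → ones (mist pX pY) l 0 ℕ.≤ d) len h))))

      mass-≤ : (good : List ℕ → ℚ) → (∀ us → length us ≡ T → allS 0 us - inv d * someX 0 us ≤ good us) →
        pw (ι F) T * (prodFrom (p ω) 0 T * (1ℚ - inv d * sumFrom (err ω) 0 T)) ≤ ∑ (seqs T) good
      mass-≤ good h = ≤-trans (≤≡ (-≤0⇒≤ (subst (0ℚ ≤_) (identity-92 (pw (ι F) T) (prod 0 T) (inv d) (from 0 T) (∑ (seqs T) (someX 0)))
          (0≤* (0≤inv d) (0≤- (∑-someX 0 T))))) (sym (trans (∑-- (seqs T) (allS 0) (λ us → inv d * someX 0 us)) (cong₂ _-_ (∑-allS 0 T) (∑-*ˡ (seqs T) (inv d) (someX 0))))))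
        (∑-mono∈ (seqs T) λ {us} us∈ → h us (length-∈ T us∈))

    open Walk {List Bool → Bool} {List Bool → Bool} own id id T J z using (tp; ones; mist; walk; st; Coin)

    module AX (a : X) = Accept Q full RY (λ ω → x j ω ≟X a)
    module AY (b : Y) = Accept Q full RY (λ ω → y j ω ≟Y b)

    FF : ℚ
    FF = ι (F ℕ.* F)

    0≤FF : 0ℚ ≤ FF
    0≤FF = 0≤ι (F ℕ.* F)

    trials : List (Ω × ℕ)
    trials = pairs Q (range (F ℕ.* F))

    start : Walk.State {List Bool → Bool} {List Bool → Bool} own id id T J z
    start = st (λ _ → false) 0 J

    hashes : List (List (Coin × Coin))
    hashes = tuples (pairs (tuples (bools T) 4) (tuples (bools T) 4)) (8 ℕ.+ ((J ℕ.+ J ℕ.* d) ℕ.+ (J ℕ.+ J ℕ.* d)))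

    seqs : List (List ℕ)
    seqs = tuples (range F) T

    guess : Maybe Ω → Maybe Ω → List ℕ → List (Coin × Coin) → X → Y → Bool
    guess r r′ us hc a b = run (walk hc start []) (predX r us a) (predY r′ us b)

    module Input (a : X) (b : Y) where

      succ : Maybe Ω → Maybe Ω → ℚ
      succ r r′ = ∑ seqs (λ us → ∑ hashes (λ hc → ind (guess r r′ us hc a b BoolP.≟ f (a , b))))

      0≤succ : ∀ r r′ → 0ℚ ≤ succ r r′
      0≤succ r r′ = ∑-0≤ seqs λ us → ∑-0≤ hashes λ hc → 0≤ind (guess r r′ us hc a b BoolP.≟ f (a , b))

      path : Ω → List ℕ → List Bool
      path ω′ us = tp (predX (just ω′) us a) (predY (just ω′) us b) T

      errors : Ω → List ℕ → ℕ
      errors ω′ us = ones (mist (predX (just ω′) us a) (predY (just ω′) us b)) T 0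

      fine? : ∀ ω′ us → Dec (z (path ω′ us) ≡ f (a , b) × errors ω′ us ℕ.≤ d)
      fine? ω′ us = (z (path ω′ us) BoolP.≟ f (a , b)) ×-dec (errors ω′ us ℕP.≤? d)

      ∣H∣ : ℚ
      ∣H∣ = ι (length hashes)

      fine : Ω → ℚ
      fine ω′ = ∑ seqs (λ us → ind (fine? ω′ us))

      -- For predictions with at most `d` disagreements, `walk-correct` leaves at most a sixteenth
      -- of the hash coins with a wrong answer.
      fine-succ : ∀ ω′ → ι 15 * (∣H∣ * fine ω′) ≤ ι 16 * succ (just ω′) (just ω′)
      fine-succ ω′ = ≡≤ (trans (sym (*-assoc (ι 15) ∣H∣ (fine ω′))) (sym (∑-*ˡ seqs (ι 15 * ∣H∣) _))) (≤≡ (∑-mono seqs pointwise) (∑-*ˡ seqs (ι 16) _))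
        where
        pointwise : ∀ us → (ι 15 * ∣H∣) * ind (fine? ω′ us) ≤ ι 16 * ∑ hashes (λ hc → ind (guess (just ω′) (just ω′) us hc a b BoolP.≟ f (a , b)))
        pointwise us = go (fine? ω′ us)
          where
          S : ℚ
          S = ∑ hashes (λ hc → ind (guess (just ω′) (just ω′) us hc a b BoolP.≟ f (a , b)))
          pX pY : List Bool → Bool
          pX = predX (just ω′) us a
          pY = predY (just ω′) us b
          open WalkCorrect {List Bool → Bool} {List Bool → Bool} own id id T J z 1≤J T<2^J pX pY using (walk-correct; W)
          go : (dd : Dec (z (path ω′ us) ≡ f (a , b) × errors ω′ us ℕ.≤ d)) → (ι 15 * ∣H∣) * ind dd ≤ ι 16 * S
          go (no _) = ≡≤ (*-zeroʳ _) (0≤* (0≤ι 16) (∑-0≤ hashes λ hc → 0≤ind (guess (just ω′) (just ω′) us hc a b BoolP.≟ f (a , b))))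
          go (yes (e , few)) = -≤0⇒≤ (subst (0ℚ ≤_) (trans (cong (λ u → ∣H∣ - ι 16 * u) W≡) (trans (cong (λ u → ∣H∣ - u * (∣H∣ - S)) (ι-suc 15)) (trans (identity-101 ∣H∣ S (ι 15)) (cong (λ u → u * S - (ι 15 * ∣H∣) * 1ℚ) (sym (ι-suc 15))))))
              (0≤- (walk-correct (J ℕ.+ J ℕ.* d) (ℕP.+-monoʳ-≤ J (ℕP.*-monoʳ-≤ J few)))))
            where
            W≡ : W (8 ℕ.+ ((J ℕ.+ J ℕ.* d) ℕ.+ (J ℕ.+ J ℕ.* d))) start [] ≡ ∣H∣ - S
            W≡ = trans (∑-cong hashes λ hc → ind-≢ (run (walk hc start []) pX pY) e) (trans (∑-- hashes (λ _ → 1ℚ) _) (cong (_- S) (trans (∑-const hashes 1ℚ) (*-identityʳ _))))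

      accA accB : Ω × ℕ → Bool
      accA = AX.accepts a
      accB = AY.accepts b

      open Correlated trials accA accB proj₁ public

      aX aY : Ω → ℚ
      aX = AX.a a
      aY = AY.a b

      Bs : Ω → ℚ
      Bs ω′ = ∑ (range (F ℕ.* F)) (λ u → both (ω′ , u))

      0≤both : ∀ t → 0ℚ ≤ both t
      0≤both t = 0≤ind ((accA t ∧ accB t) BoolP.≟ true)

      0≤Bs : ∀ ω′ → 0ℚ ≤ Bs ω′
      0≤Bs ω′ = ∑-0≤ (range (F ℕ.* F)) λ u → 0≤both (ω′ , u)

      FT : ℚ
      FT = pw (ι F) T

      0≤FT : 0ℚ ≤ FT
      0≤FT = pw-0≤ (0≤ι F) T

      fine≤ : ∀ ω′ → fine ω′ ≤ FT
      fine≤ ω′ = ≤≡ (∑-mono seqs λ us → ind≤1 (fine? ω′ us)) (trans (∑-const seqs 1ℚ) (trans (*-identityʳ _)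
        (trans (length-tuples (range F) T) (cong (λ l → pw (ι l) T) (length-range F)))))

      and-≤ : ∀ p q → ind ((p ∧ q) BoolP.≟ true) ≤ ind (p BoolP.≟ true)
      and-≤ true  q = ind≤1 (q BoolP.≟ true)
      and-≤ false q = ≤-refl

      Bs≤ : ∀ ω′ → Bs ω′ ≤ FF * aX ω′
      Bs≤ ω′ = ≤≡ (∑-mono (range (F ℕ.* F)) λ u → and-≤ (accA (ω′ , u)) (accB (ω′ , u))) (AX.∑accepts a ω′)

      -- Both players compare the same number `u` with their thresholds, so joint acceptance is
      -- acceptance at the smaller one.
      Bs≥ : ∀ ω′ v → v ≤ aX ω′ → v ≤ aY ω′ → FF * v ≤ Bs ω′
      Bs≥ ω′ v hX hY = go (ℕP.≤-total (AX.α a ω′) (AY.α b ω′))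
        where
        mono : ∀ {τ τ′ u} → τ ℕ.≤ τ′ → below τ u ≡ true → below τ′ u ≡ true
        mono h e = below-yes (ℕP.≤-trans (ℕP.≰⇒> λ q → contradiction (trans (sym e) (below-no q)) λ ()) h)
        table₁ : ∀ p q → (p ≡ true → q ≡ true) → ind (p BoolP.≟ true) ≤ ind ((p ∧ q) BoolP.≟ true)
        table₁ true  q h = ≤-reflexive (sym (ind-yes (q BoolP.≟ true) (h refl)))
        table₁ false q h = ≤-refl
        table₂ : ∀ p q → (q ≡ true → p ≡ true) → ind (q BoolP.≟ true) ≤ ind ((p ∧ q) BoolP.≟ true)
        table₂ true  q h = ≤-refl
        table₂ false true h = contradiction (h refl) λ ()
        table₂ false false h = ≤-refl
        go : AX.α a ω′ ℕ.≤ AY.α b ω′ ⊎ AY.α b ω′ ℕ.≤ AX.α a ω′ → FF * v ≤ Bs ω′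
        go (inj₁ h) = ≤-trans (*ˡ FF 0≤FF hX) (≡≤ (sym (AX.∑accepts a ω′)) (∑-mono (range (F ℕ.* F)) λ u → table₁ (accA (ω′ , u)) (accB (ω′ , u)) (mono h)))
        go (inj₂ h) = ≤-trans (*ˡ FF 0≤FF hY) (≡≤ (sym (AY.∑accepts b ω′)) (∑-mono (range (F ℕ.* F)) λ u → table₂ (accA (ω′ , u)) (accB (ω′ , u)) (mono h)))

      hit : ℚ
      hit = ∑ Q (λ ω′ → Bs ω′ * fine ω′)

      ∑gain : ∑ trials (gain succ 0≤succ) ≡ ∑ Q (λ ω′ → Bs ω′ * succ (just ω′) (just ω′))
      ∑gain = trans (∑-pairs Q (range (F ℕ.* F)) _) (∑-cong Q λ ω′ → ∑-*ʳ (range (F ℕ.* F)) _ (λ u → both (ω′ , u)))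

      gain≥ : ι 15 * (∣H∣ * hit) ≤ ι 16 * ∑ trials (gain succ 0≤succ)
      gain≥ = ≡≤ (trans (trans (sym (*-assoc (ι 15) ∣H∣ hit)) (sym (∑-*ˡ Q (ι 15 * ∣H∣) _))) (∑-cong Q λ ω′ → identity-123 (ι 15) ∣H∣ (Bs ω′) (fine ω′)))
        (≤≡ (∑-mono Q λ ω′ → *ˡ (Bs ω′) (0≤Bs ω′) (fine-succ ω′)) (trans (∑-cong Q λ ω′ → identity-22 (Bs ω′) (ι 16) (succ (just ω′) (just ω′)))
          (trans (∑-*ˡ Q (ι 16) _) (cong (ι 16 *_) (sym ∑gain)))))

      ∣C∣ : ℚ
      ∣C∣ = ι (length trials)

      ∣C∣≡ : ∣C∣ ≡ ∣Q∣ * FF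
      ∣C∣≡ = trans (sym (trans (∑-const trials 1ℚ) (*-identityʳ _))) (trans (∑-pairs Q (range (F ℕ.* F)) (λ _ → 1ℚ)) (trans (∑-cong Q λ _ → ∑-range (F ℕ.* F)) (∑-const Q FF)))

      ∑none : ∑ trials none ≡ ∣Q∣ * FF - FF * ∑ Q aX - FF * ∑ Q aY + ∑ Q Bs
      ∑none = trans (∑-pairs Q (range (F ℕ.* F)) none) (trans (∑-cong Q per) (trans (∑-+ Q _ Bs) (cong (_+ ∑ Q Bs)
          (trans (∑-- Q _ (λ ω′ → FF * aY ω′)) (cong₂ _-_ (trans (∑-- Q (λ _ → FF) (λ ω′ → FF * aX ω′)) (cong₂ _-_ (∑-const Q FF) (∑-*ˡ Q FF aX))) (∑-*ˡ Q FF aY))))))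
        where
        table : ∀ p q → ind ((p ∨ q) BoolP.≟ false) ≡ 1ℚ - ind (p BoolP.≟ true) - ind (q BoolP.≟ true) + ind ((p ∧ q) BoolP.≟ true)
        table true  true  = lem
          where
          lem : 0ℚ ≡ 1ℚ - 1ℚ - 1ℚ + 1ℚ
          lem = identity-107 1ℚ
        table true  false = identity-108 1ℚ
        table false true  = identity-109 1ℚ
        table false false = identity-110 1ℚ
        per : ∀ ω′ → ∑ (range (F ℕ.* F)) (λ u → none (ω′ , u)) ≡ FF - FF * aX ω′ - FF * aY ω′ + Bs ω′
        per ω′ = trans (∑-cong (range (F ℕ.* F)) λ u → table (accA (ω′ , u)) (accB (ω′ , u))) (trans (∑-+ (range (F ℕ.* F)) _ _) (cong (_+ Bs ω′)
          (trans (∑-- (range (F ℕ.* F)) _ _) (cong₂ _-_ (trans (∑-- (range (F ℕ.* F)) _ _) (cong₂ _-_ (∑-range (F ℕ.* F)) (AX.∑accepts a ω′))) (AY.∑accepts b ω′)))))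

      -- If `a` occurs in the sample, Alice accepts one trial in `length Q` on average. Hence all
      -- `16` times `length Q` trials are rejected with probability at most `1/17`, by Bernoulli's
      -- inequality.
      N : ℕ
      N = 16 ℕ.* length Q

      τ tail : ℚ
      τ = 1ℚ - inv (length Q)
      tail = pw τ N

      0≤τ : 0ℚ ≤ τ
      0≤τ = 0≤- (≡≤ (sym (*-identityʳ _)) (≤≡ (*ˡ (inv (length Q)) (0≤inv _) (1≤ι 1≤#Q)) (inv*ι 1≤#Q)))

      t-small : ι 17 * tail ≤ 1ℚ
      t-small = ≤-trans (*ʳ tail (pw-0≤ 0≤τ N) (≡≤ seventeen (bernoulli (0≤inv (length Q)) N)))
        (≡≤ (sym (pw-* (1ℚ + inv (length Q)) τ N)) (pw≤1 (≤-trans (gap (inv (length Q) * inv (length Q)) (0≤* (0≤inv _) (0≤inv _)) (identity-124 (inv (length Q)))) ≤-refl) N))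
        where
        seventeen : ι 17 ≡ 1ℚ + ι N * inv (length Q)
        seventeen = trans (ι-suc 16) (cong (1ℚ +_) (sym (trans (cong (_* inv (length Q)) (ι-* 16 (length Q))) (trans (*-assoc (ι 16) _ _) (trans (cong (ι 16 *_) (ι*inv 1≤#Q)) (*-identityʳ _))))))
        pw≤1 : (1ℚ + inv (length Q)) * τ ≤ 1ℚ → ∀ n → pw ((1ℚ + inv (length Q)) * τ) n ≤ 1ℚ
        pw≤1 h zero    = ≤-refl
        pw≤1 h (suc n) = ≤≡ (*-mono (0≤* (0≤+ 0≤1 (0≤inv _)) 0≤τ) 0≤1 h (pw≤1 h n)) (*-identityˡ 1ℚ)

      0≤1-t : 0ℚ ≤ 1ℚ - tail
      0≤1-t = 0≤- (≤-trans (≡≤ (sym (*-identityˡ tail)) (*ʳ tail (pw-0≤ 0≤τ N) (1≤ι {17} (s≤s z≤n)))) t-small)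

      module _ (η : ℚ) (hη : hit ≡ η * (FF * FT)) (1≤FF : 1ℚ ≤ FF) (1≤FT : 1ℚ ≤ FT) where

        bulk : ℚ
        bulk = (ι 15 * (∣H∣ * FT)) * (1ℚ - tail) * pw ∣C∣ N

        0≤bulk : 0ℚ ≤ bulk
        0≤bulk = 0≤* (0≤* (0≤* (0≤ι 15) (0≤* (0≤ι (length hashes)) 0≤FT)) 0≤1-t) (pw-0≤ (0≤ι (length trials)) N)

        ∑Bs≥ : FF * η ≤ ∑ Q Bs
        ∑Bs≥ = *-cancelʳ-≤ FT (<-≤-trans 0<1 1≤FT) (≡≤ (trans (identity-111 FF η FT) (sym hη)) (≤≡ (∑-mono Q λ ω′ → *ˡ (Bs ω′) (0≤Bs ω′) (fine≤ ω′)) (∑-*ʳ Q FT Bs)))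

        -- Acceptance by some player has mass at most `2 - η`, since joint acceptance has mass at
        -- least `η`. So the deciding trial is joint and fine with probability at least
        -- `η / (2 - η)`, which exceeds `2 η - 1` by `2 (1 - η)² / (2 - η)`. A bound linear in `η`
        -- can be averaged over `E`.
        input-bound : bulk * (η + η - 1ℚ) ≤ ι 16 * total succ 0≤succ N
        input-bound = go (≤-total 0ℚ (η + η - 1ℚ))
          where
          go : 0ℚ ≤ η + η - 1ℚ ⊎ η + η - 1ℚ ≤ 0ℚ → bulk * (η + η - 1ℚ) ≤ ι 16 * total succ 0≤succ N
          go (inj₂ h) = ≤-trans (≤≡ (*ˡ bulk 0≤bulk h) (*-zeroʳ bulk)) (0≤* (0≤ι 16) (0≤total succ 0≤succ N))
          go (inj₁ h) = ≡≤ (trans (identity-102 (ι 15) ∣H∣ FT (1ℚ - tail) (pw ∣C∣ N) (η + η - 1ℚ)) (trans (cong (λ u → u * (m * (1ℚ - tail) * pw ∣C∣ N)) (sym (ι*inv {16} (s≤s z≤n))))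
              (identity-103 (ι 16) (inv 16) m (1ℚ - tail) (pw ∣C∣ N))))
            (*ˡ (ι 16) (0≤ι 16) (subst (λ u → κ * (1ℚ - pw u N) * pw ∣C∣ N ≤ total succ 0≤succ N) τ≡ (total-≥ succ 0≤succ κ (inv (length Q)) 0≤κ 0≤τ accept few N)))
            where
            m κ : ℚ
            m = ι 15 * (∣H∣ * FT) * (η + η - 1ℚ)
            κ = inv 16 * m
            τ≡ : 1ℚ - inv (length Q) ≡ τ
            τ≡ = refl
            0≤m : 0ℚ ≤ m
            0≤m = 0≤* (0≤* (0≤ι 15) (0≤* (0≤ι (length hashes)) 0≤FT)) h
            0≤κ : 0ℚ ≤ κ
            0≤κ = 0≤* (0≤inv 16) 0≤m
            outside : ∣C∣ - ∑ trials none ≤ FF * (1ℚ + 1ℚ - η)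
            outside = -≤0⇒≤ (subst (0ℚ ≤_) (sym (trans (cong₂ (λ u v → FF * (1ℚ + 1ℚ - η) - (u - v)) ∣C∣≡ ∑none) (identity-96 FF η ∣Q∣ (∑ Q aX) (∑ Q aY) (∑ Q Bs))))
                (0≤+ (0≤+ (0≤* 0≤FF (0≤- (AX.∑a≤1 a))) (0≤* 0≤FF (0≤- (AY.∑a≤1 b)))) (0≤- ∑Bs≥)))
            accept : κ * (∣C∣ - ∑ trials none) ≤ ∑ trials (gain succ 0≤succ)
            accept = ι-cancelˡ {16} (s≤s z≤n) (≡≤ (trans (identity-98 (ι 16) (inv 16) m (∣C∣ - ∑ trials none)) (trans (cong (λ u → u * (m * (∣C∣ - ∑ trials none))) (ι*inv {16} (s≤s z≤n))) (*-identityˡ _)))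
                (≤-trans (*ˡ m 0≤m outside) (≤-trans bound gain≥)))
              where
              bound : m * (FF * (1ℚ + 1ℚ - η)) ≤ ι 15 * (∣H∣ * hit)
              bound = gap ((ι 15 * (∣H∣ * (FT * FF))) * ((1ℚ - η) * (1ℚ - η) + (1ℚ - η) * (1ℚ - η)))
                (0≤* (0≤* (0≤ι 15) (0≤* (0≤ι (length hashes)) (0≤* 0≤FT 0≤FF))) (0≤+ (square-0≤ (1ℚ - η)) (square-0≤ (1ℚ - η))))
                (trans (cong (λ u → ι 15 * (∣H∣ * u)) hη) (identity-95 (ι 15) ∣H∣ FT FF η))
            ∑aX : ∑ Q aX ≡ 1ℚ
            ∑aX = valid (AX.#P a) refl
              where
              valid : ∀ c → AX.#P a ≡ c → ∑ Q aX ≡ 1ℚ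
              valid (suc c) e = AX.∑a≡1 a (subst (1 ℕ.≤_) (sym e) (s≤s z≤n))
              -- Without a sample of value `a` Alice would never accept, which forces `η ≤ 0`,
              -- contrary to `2 η ≥ 1` in this case.
              valid zero    e = contradiction (≤-trans h η≤) λ q → <-irrefl refl (<-≤-trans neg q)
                where
                ∑aX0 : ∑ Q aX ≡ 0ℚ
                ∑aX0 = trans (AX.∑a a) (trans (cong (λ c → inv c * ι c) e) (trans (cong (_* ι 0) inv0) (*-zeroˡ _)))
                FFη≤0 : η * FF ≤ 0ℚ * FF
                FFη≤0 = ≡≤ (*-comm η FF) (≤-trans ∑Bs≥ (≤≡ (∑-mono Q Bs≤) (trans (∑-*ˡ Q FF aX) (trans (cong (FF *_) ∑aX0) (trans (*-zeroʳ FF) (sym (*-zeroˡ FF)))))))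
                η≤0 : η ≤ 0ℚ
                η≤0 = *-cancelʳ-≤ FF (<-≤-trans 0<1 1≤FF) FFη≤0
                η≤ : η + η - 1ℚ ≤ 0ℚ - 1ℚ
                η≤ = +-monoˡ-≤ (- 1ℚ) (≤≡ (+-mono-≤ η≤0 η≤0) (+-identityˡ 0ℚ))
                neg : 0ℚ - 1ℚ < 0ℚ
                neg = subst₂ _<_ (trans (+-identityʳ _) (sym (+-identityˡ _))) (trans (+-comm (- 1ℚ) 1ℚ) (+-inverseʳ 1ℚ)) (+-monoʳ-< (- 1ℚ) 0<1)
            few : ∑ trials none ≤ (1ℚ - inv (length Q)) * ∣C∣
            few = ≡≤ ∑none (≤≡ (-≤0⇒≤ (subst (0ℚ ≤_) (identity-99 ∣Q∣ FF (∑ Q aX) (∑ Q aY) (∑ Q Bs)) (0≤- ∑Bs≤)))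
                (trans (cong (λ u → ∣Q∣ * FF - FF * u) ∑aX) (trans (cong (λ u → ∣Q∣ * FF - FF * u) (sym (inv*ι 1≤#Q))) (trans (identity-100 ∣Q∣ FF (inv (length Q))) (cong (τ *_) (sym ∣C∣≡))))))
              where
              ∑Bs≤ : ∑ Q Bs ≤ FF * ∑ Q aY
              ∑Bs≤ = ≤≡ (∑-mono Q λ ω′ → ≤≡ (∑-mono (range (F ℕ.* F)) λ u → and-≤′ (accA (ω′ , u)) (accB (ω′ , u))) (AY.∑accepts b ω′)) (∑-*ˡ Q FF aY)
                where
                and-≤′ : ∀ p q → ind ((p ∧ q) BoolP.≟ true) ≤ ind (q BoolP.≟ true)
                and-≤′ true  q = ≤-refl
                and-≤′ false q = 0≤ind (q BoolP.≟ true)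

    ptD : DecidableEquality (X × Y)
    ptD = ×P.≡-dec _≟X_ _≟Y_

    R₀ : Eqv Ω
    R₀ = Rel (suc j) j T

    hitE : X × Y → ℚ
    hitE (a , b) = Input.hit a b

    rX rY s : Ω → ℚ
    rX ω = c XR ω * i (xk j) ω
    rY ω = c YR ω * i (yk j) ω
    s ω = inv d * sumFrom (err ω) 0 T

    FT K : ℚ
    FT = pw (ι F) T
    K = FF * FT

    -- The contribution of `ω` to the hits. `v` lies below both players' densities for the public
    -- part. Summing over the trials equivalent to `ω` removes the factor `i RY`, and summing over
    -- `E` yields the multiplicity of the input.
    module PerSample (ω : Ω) (v : ℚ) (0≤v : 0ℚ ≤ v) (vX : v ≤ rX ω) (vY : v ≤ rY ω) where

      a : X
      a = x j ω
      b : Y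
      b = y j ω

      open Input a b hiding (FT; 0≤FT)

      match? : ∀ (e : X × Y) ω′ us → Dec (pt j ω ≡ e × RY ∋ ω′ ≈ ω × Input.path (proj₁ e) (proj₂ e) ω′ us ≡ mp T ω)
      match? e ω′ us = ptD (pt j ω) e ×-dec (RY ∋ ω′ ≈? ω) ×-dec (Input.path (proj₁ e) (proj₂ e) ω′ us ≟L mp T ω)

      term : X × Y → Ω → List ℕ → ℚ
      term e ω′ us = Input.Bs (proj₁ e) (proj₂ e) ω′ * (ind (Input.fine? (proj₁ e) (proj₂ e) ω′ us) * (ind (match? e ω′ us) * i R₀ ω))

      0≤term : ∀ e ω′ us → 0ℚ ≤ term e ω′ us
      0≤term e ω′ us = 0≤* (Input.0≤Bs (proj₁ e) (proj₂ e) ω′) (0≤* (0≤ind (Input.fine? (proj₁ e) (proj₂ e) ω′ us)) (0≤* (0≤ind (match? e ω′ us)) (0≤i R₀ ω)))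

      pm : ℚ
      pm = prodFrom (p ω) 0 T * plus (1ℚ - s ω)

      module _ (ω′ : Ω) (same : RY ∋ ω′ ≈ ω) where

        open Matched ω ω′ same using (mass-≤; module Path; allS; someX)

        aX≡ : aX ω′ ≡ i RY ω′ * rX ω
        aX≡ = trans (cong₂ (λ u w → inv u * (i RY ω′ * ι w))
            (count-cong (λ ω₁ → x j ω₁ ≟X a) (xk j ∋ ω ≈?_) Q (λ _ → sym) (λ _ → sym))
            (count-cong _ (XR ∋ ω ≈?_) Q (λ ω₁ (e , r) → add-x {j} {suc j} (sym e) (transitive RY (symmetric RY same) r))
              (λ ω₁ r → sym (proj₁ r j ℕP.≤-refl) , transitive RY same (Rel-mono {suc j} {j} {suc j} {suc j} {0} {0} (ℕP.n≤1+n j) ℕP.≤-refl z≤n r))))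
          (identity-112 (i (xk j) ω) (i RY ω′) (c XR ω))

        aY≡ : aY ω′ ≡ i RY ω′ * rY ω
        aY≡ = trans (cong₂ (λ u w → inv u * (i RY ω′ * ι w))
            (count-cong (λ ω₁ → y j ω₁ ≟Y b) (yk j ∋ ω ≈?_) Q (λ _ → sym) (λ _ → sym))
            (count-cong _ (YR ∋ ω ≈?_) Q (λ ω₁ (e , r) → add-y {j} {j} (sym e) (transitive RY (symmetric RY same) r))
              (λ ω₁ r → sym (proj₁ (proj₂ r) j j<n ℕP.≤-refl) , transitive RY same (Rel-mono {j} {j} {j} {suc j} {0} {0} ℕP.≤-refl (ℕP.n≤1+n j) z≤n r))))
          (identity-112 (i (yk j) ω) (i RY ω′) (c YR ω))

        few-mistakes : FT * pm ≤ ∑ seqs (λ us → ind (fine? ω′ us) * ind (match? (a , b) ω′ us))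
        few-mistakes = go (≤-total 0ℚ (1ℚ - s ω))
          where
          S : ℚ
          S = ∑ seqs (λ us → ind (fine? ω′ us) * ind (match? (a , b) ω′ us))
          0≤S : 0ℚ ≤ S
          0≤S = ∑-0≤ seqs λ us → 0≤* (0≤ind (fine? ω′ us)) (0≤ind (match? (a , b) ω′ us))
          good : ∀ us → length us ≡ T → allS 0 us - inv d * someX 0 us ≤ ind (fine? ω′ us) * ind (match? (a , b) ω′ us)
          good us len = ≤-trans (Path.good-≥ us len) (both′ (Path.Good? us))
            where
            both′ : (g : Dec (path ω′ us ≡ mp T ω × errors ω′ us ℕ.≤ d)) → ind g ≤ ind (fine? ω′ us) * ind (match? (a , b) ω′ us)
            both′ (no _)        = 0≤* (0≤ind (fine? ω′ us)) (0≤ind (match? (a , b) ω′ us))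
            both′ (yes (e , h)) = ≤-reflexive (sym (trans (cong₂ _*_ (ind-yes (fine? ω′ us) (trans (cong z e) (win ω) , h)) (ind-yes (match? (a , b) ω′ us) (refl , same , e))) (*-identityˡ 1ℚ)))
          go : 0ℚ ≤ 1ℚ - s ω ⊎ 1ℚ - s ω ≤ 0ℚ → FT * pm ≤ S
          go (inj₁ h) = ≡≤ (cong (λ u → FT * (prodFrom (p ω) 0 T * u)) (plus≡ h)) (mass-≤ _ good)
          go (inj₂ h) = ≡≤ (trans (cong (λ u → FT * (prodFrom (p ω) 0 T * u)) (plus-0 h)) (trans (cong (FT *_) (*-zeroʳ _)) (*-zeroʳ FT))) 0≤S

        one-ω′ : (FF * (i RY ω′ * v)) * (i R₀ ω * (FT * pm)) ≤ ∑ seqs (term (a , b) ω′)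
        one-ω′ = ≤≡ (*-mono (0≤* 0≤FF (0≤* (0≤i RY ω′) 0≤v)) (0≤* (0≤i R₀ ω) (∑-0≤ seqs λ us → 0≤* (0≤ind (fine? ω′ us)) (0≤ind (match? (a , b) ω′ us))))
            (Bs≥ ω′ (i RY ω′ * v) (≤≡ (*ˡ (i RY ω′) (0≤i RY ω′) vX) (sym aX≡)) (≤≡ (*ˡ (i RY ω′) (0≤i RY ω′) vY) (sym aY≡)))
            (*ˡ (i R₀ ω) (0≤i R₀ ω) few-mistakes))
          (trans (sym (*-assoc (Bs ω′) (i R₀ ω) _)) (trans (sym (∑-*ˡ seqs (Bs ω′ * i R₀ ω) _)) (∑-cong seqs λ us → identity-113 (Bs ω′) (i R₀ ω) (ind (fine? ω′ us)) (ind (match? (a , b) ω′ us)))))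

      W : ℚ
      W = (FF * v) * (i R₀ ω * (FT * pm))

      all-ω′ : W ≤ ∑ Q (λ ω′ → ∑ seqs (term (a , b) ω′))
      all-ω′ = ≡≤ (sym (trans (cong (_* W) (unit= RY ω)) (*-identityˡ W))) (≡≤ (sym (∑-*ʳ Q W _))
        (∑-mono Q λ ω′ → go ω′ (RY ∋ ω ≈? ω′)))
        where
        go : ∀ ω′ (dd : Dec (RY ∋ ω ≈ ω′)) → (ind dd * i RY ω′) * W ≤ ∑ seqs (term (a , b) ω′)
        go ω′ (no _)  = ≡≤ (trans (cong (_* W) (*-zeroˡ _)) (*-zeroˡ W)) (∑-0≤ seqs (0≤term (a , b) ω′))
        go ω′ (yes q) = ≡≤ (identity-114 (i RY ω′) FF v (i R₀ ω * (FT * pm))) (one-ω′ ω′ (symmetric RY q))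

      all-e : ι (μ j ω) * W ≤ ∑ E (λ e → ∑ Q (λ ω′ → ∑ seqs (term e ω′)))
      all-e = ≡≤ (trans (cong (_* W) (ι-count (ptD (pt j ω)) E)) (sym (∑-*ʳ E W _))) (∑-mono E λ e → go e (ptD (pt j ω) e))
        where
        go : ∀ e (dd : Dec (pt j ω ≡ e)) → ind dd * W ≤ ∑ Q (λ ω′ → ∑ seqs (term e ω′))
        go e (no _)     = ≡≤ (*-zeroˡ W) (∑-0≤ Q λ ω′ → ∑-0≤ seqs (0≤term e ω′))
        go e (yes refl) = ≡≤ (*-identityˡ W) all-ω′

    -- every simulated outcome is matched by at most one class of samples
    hit-≥ : (v : Ω → ℚ) (0≤v : ∀ ω → 0ℚ ≤ v ω) (vX : ∀ ω → v ω ≤ rX ω) (vY : ∀ ω → v ω ≤ rY ω) →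
      ∑ Q (λ ω → ι (μ j ω) * PerSample.W ω (v ω) (0≤v ω) (vX ω) (vY ω)) ≤ ∑ E hitE
    hit-≥ v 0≤v vX vY = ≤-trans (∑-mono Q λ ω → PerSample.all-e ω (v ω) (0≤v ω) (vX ω) (vY ω)) (≡≤ (trans (∑-swap Q E _)
        (∑-cong E λ e → trans (∑-swap Q Q _) (∑-cong Q λ ω′ → ∑-swap Q seqs _)))
      (∑-mono E λ e → ∑-mono Q λ ω′ → ≤≡ (∑-mono seqs λ us → inner e ω′ us) (∑-*ˡ seqs (Input.Bs (proj₁ e) (proj₂ e) ω′) _)))
      where
      term : Ω → X × Y → Ω → List ℕ → ℚ
      term ω = PerSample.term ω (v ω) (0≤v ω) (vX ω) (vY ω)
      inner : ∀ e ω′ us → ∑ Q (λ ω → term ω e ω′ us) ≤ Input.Bs (proj₁ e) (proj₂ e) ω′ * ind (Input.fine? (proj₁ e) (proj₂ e) ω′ us)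
      inner e ω′ us = ≡≤ (trans (∑-*ˡ Q B _) (cong (B *_) (∑-*ˡ Q I _))) (*ˡ B (Input.0≤Bs (proj₁ e) (proj₂ e) ω′)
          (≤≡ (*ˡ I (0≤ind (Input.fine? (proj₁ e) (proj₂ e) ω′ us)) (unit R₀ M? same)) (*-identityʳ I)))
        where
        B I : ℚ
        B = Input.Bs (proj₁ e) (proj₂ e) ω′
        I = ind (Input.fine? (proj₁ e) (proj₂ e) ω′ us)
        M? : ∀ ω → Dec (pt j ω ≡ e × RY ∋ ω′ ≈ ω × Input.path (proj₁ e) (proj₂ e) ω′ us ≡ mp T ω)
        M? ω = ptD (pt j ω) e ×-dec (RY ∋ ω′ ≈? ω) ×-dec (Input.path (proj₁ e) (proj₂ e) ω′ us ≟L mp T ω)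
        same : ∀ {ω₁ ω₂} → (pt j ω₁ ≡ e × RY ∋ ω′ ≈ ω₁ × Input.path (proj₁ e) (proj₂ e) ω′ us ≡ mp T ω₁) →
          (pt j ω₂ ≡ e × RY ∋ ω′ ≈ ω₂ × Input.path (proj₁ e) (proj₂ e) ω′ us ≡ mp T ω₂) → R₀ ∋ ω₁ ≈ ω₂
        same {ω₁} {ω₂} (e₁ , r₁ , m₁) (e₂ , r₂ , m₂) = proj₁ level , proj₁ (proj₂ level) , prefix-bits bits T (trans (sym m₁) m₂)
          where
          level : Rel (suc j) j 0 ∋ ω₁ ≈ ω₂
          level = add-x {j} {j} (cong proj₁ (trans e₁ (sym e₂))) (add-y {j} {j} (cong proj₂ (trans e₁ (sym e₂))) (transitive RY (symmetric RY r₁) r₂))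

    -- The loss of a product is at most the sum of the losses of its factors; truncation at zero
    -- keeps this true when a loss exceeds one.
    discount : ∀ {w s} → 0ℚ ≤ w → 0ℚ ≤ s → 1ℚ - plus (1ℚ - w) - s ≤ w * plus (1ℚ - s)
    discount {w} {s} 0≤w 0≤s = go (≤-total 0ℚ g)
      where
      g : ℚ
      g = 1ℚ - plus (1ℚ - w)
      g≤w : g ≤ w
      g≤w = ≤≡ (+-monoʳ-≤ 1ℚ (neg-≤ (≤plus (1ℚ - w)))) (identity-125 w)
      go : 0ℚ ≤ g ⊎ g ≤ 0ℚ → g - s ≤ w * plus (1ℚ - s)
      go (inj₁ h) = ≤-trans (gap (plus (1ℚ - w) * s) (0≤* (0≤plus (1ℚ - w)) 0≤s) (identity-126 (plus (1ℚ - w)) s)) (*-mono h (0≤plus (1ℚ - s)) g≤w (≤plus (1ℚ - s)))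
      go (inj₂ h) = ≤-trans (+-mono-≤ h (≤≡ (neg-≤ 0≤s) neg-0)) (≡≤ (+-identityʳ 0ℚ) (0≤* 0≤w (0≤plus (1ℚ - s))))

    1≤F : 1 ℕ.≤ F
    1≤F = fact-pos (length Q)

    pw-1 : ∀ n → pw 1ℚ n ≡ 1ℚ
    pw-1 zero    = refl
    pw-1 (suc n) = trans (*-identityˡ _) (pw-1 n)

    tuples-pos : ∀ {A : Set} (xs : List A) k → 1 ℕ.≤ length xs → 1 ℕ.≤ length (tuples xs k)
    tuples-pos xs k h = ι-cancel (≡≤ ι1 (≤≡ (pw-1≤ (1≤ι h) k) (sym (length-tuples xs k))))

    pairs-length : ∀ {A B : Set} (xs : List A) (ys : List B) → ι (length (pairs xs ys)) ≡ ι (length xs) * ι (length ys)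
    pairs-length xs ys = trans (sym (trans (∑-const (pairs xs ys) 1ℚ) (*-identityʳ _))) (trans (∑-pairs xs ys (λ _ → 1ℚ))
      (trans (∑-cong xs λ _ → trans (∑-const ys 1ℚ) (*-identityʳ _)) (∑-const xs (ι (length ys)))))

    pairs-pos : ∀ {A B : Set} (xs : List A) (ys : List B) → 1 ℕ.≤ length xs → 1 ℕ.≤ length ys → 1 ℕ.≤ length (pairs xs ys)
    pairs-pos xs ys h k = ι-cancel (≡≤ (trans ι1 (sym (*-identityˡ 1ℚ))) (≤≡ (*-mono 0≤1 (0≤ι (length ys)) (1≤ι h) (1≤ι k)) (sym (pairs-length xs ys))))

    module Conclude (wX wY : Ω → ℚ)
      (wX≡ : ∀ ω → wX ω ≡ (ι (μ j ω) * inv (length E)) * rX ω * prodFrom (p ω) 0 T * (∣Q∣ * i R₀ ω))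
      (wY≡ : ∀ ω → wY ω ≡ (ι (μ j ω) * inv (length E)) * rY ω * prodFrom (p ω) 0 T * (∣Q∣ * i R₀ ω))
      (small : ∑ Q (λ ω → plus (1ℚ - wX ω) + plus (1ℚ - wY ω)) + ∑ Q s ≤ ∣Q∣ * inv 16) where

      #E : ℚ
      #E = ι (length E)

      v : Ω → ℚ
      v ω = rX ω ⊓ rY ω

      0≤v : ∀ ω → 0ℚ ≤ v ω
      0≤v ω = ⊓-glb (0≤* (0≤c XR ω) (0≤i (xk j) ω)) (0≤* (0≤c YR ω) (0≤i (yk j) ω))

      vX : ∀ ω → v ω ≤ rX ω
      vX ω = ⊓-≤ˡ (rX ω) (rY ω)

      vY : ∀ ω → v ω ≤ rY ω
      vY ω = ⊓-≤ʳ (rX ω) (rY ω)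

      0≤K : 0ℚ ≤ K
      0≤K = 0≤* 0≤FF (pw-0≤ (0≤ι F) T)

      0≤s : ∀ ω → 0ℚ ≤ s ω
      0≤s ω = 0≤* (0≤inv d) (go 0 T)
        where
        go : ∀ k m → 0ℚ ≤ sumFrom (err ω) k m
        go k zero    = ≤-refl
        go k (suc m) = 0≤+ (Matched.0≤err ω ω (reflexive RY ω) k) (go (suc k) m)

      -- The smaller of the two densities belongs to one of the players, so the loss of the joint
      -- sampling is at most the sum of both losses.
      sample-≥ : ∀ ω → (#E * K) * (1ℚ - (plus (1ℚ - wX ω) + plus (1ℚ - wY ω)) - s ω) ≤ ∣Q∣ * (ι (μ j ω) * PerSample.W ω (v ω) (0≤v ω) (vX ω) (vY ω))
      sample-≥ ω = go (≤-total (rX ω) (rY ω))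
        where
        P L A : ℚ
        P = prodFrom (p ω) 0 T
        L = plus (1ℚ - s ω)
        A = ι (μ j ω) * P * (∣Q∣ * i R₀ ω)
        0≤P : 0ℚ ≤ P
        0≤P = prod≥ 0 T
          where
          prod≥ : ∀ k m → 0ℚ ≤ prodFrom (p ω) k m
          prod≥ k zero    = 0≤1
          prod≥ k (suc m) = 0≤* (Matched.0≤p ω ω (reflexive RY ω) k) (prod≥ (suc k) m)
        0≤A : 0ℚ ≤ A
        0≤A = 0≤* (0≤* (0≤ι (μ j ω)) 0≤P) (0≤* (0≤ι (length Q)) (0≤i R₀ ω))
        #E*w : ∀ r w → w ≡ (ι (μ j ω) * inv (length E)) * r * P * (∣Q∣ * i R₀ ω) → #E * w ≡ r * A
        #E*w r w e = trans (cong (#E *_) e) (trans (identity-115 #E (ι (μ j ω)) (inv (length E)) r P (∣Q∣ * i R₀ ω)) (trans (cong (_* (r * A)) (ι*inv 1≤#E)) (*-identityˡ _)))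
        W≡ : ∣Q∣ * (ι (μ j ω) * PerSample.W ω (v ω) (0≤v ω) (vX ω) (vY ω)) ≡ K * ((v ω * A) * L)
        W≡ = identity-116 ∣Q∣ (ι (μ j ω)) FF (v ω) (i R₀ ω) FT P L
        use : ∀ r w o → w ≡ (ι (μ j ω) * inv (length E)) * r * P * (∣Q∣ * i R₀ ω) → 0ℚ ≤ r → r ≤ v ω → 0ℚ ≤ o →
          (#E * K) * (1ℚ - (plus (1ℚ - w) + o) - s ω) ≤ ∣Q∣ * (ι (μ j ω) * PerSample.W ω (v ω) (0≤v ω) (vX ω) (vY ω))
        use r w o e 0≤r h 0≤o = ≤-trans (*ˡ (#E * K) (0≤* (0≤ι (length E)) 0≤K) (≤-trans (gap o 0≤o (identity-117 (plus (1ℚ - w)) o (s ω))) (discount 0≤w (0≤s ω))))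
            (≡≤ (trans (identity-118 #E K w L) (cong (λ u → K * (u * L)) (#E*w r w e))) (≤≡ (*ˡ K 0≤K (*ʳ L (0≤plus _) (*ʳ A 0≤A h))) (sym W≡)))
          where
          0≤w : 0ℚ ≤ w
          0≤w = subst (0ℚ ≤_) (sym e) (0≤* (0≤* (0≤* (0≤* (0≤ι (μ j ω)) (0≤inv (length E))) 0≤r) 0≤P) (0≤* (0≤ι (length Q)) (0≤i R₀ ω)))
        go : rX ω ≤ rY ω ⊎ rY ω ≤ rX ω → _
        go (inj₁ h) = use (rX ω) (wX ω) (plus (1ℚ - wY ω)) (wX≡ ω) (0≤* (0≤c XR ω) (0≤i (xk j) ω)) (⊓-glb ≤-refl h) (0≤plus _)
        go (inj₂ h) = subst (λ u → (#E * K) * (1ℚ - u - s ω) ≤ ∣Q∣ * (ι (μ j ω) * PerSample.W ω (v ω) (0≤v ω) (vX ω) (vY ω))) (+-comm (plus (1ℚ - wY ω)) (plus (1ℚ - wX ω)))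
          (use (rY ω) (wY ω) (plus (1ℚ - wX ω)) (wY≡ ω) (0≤* (0≤c YR ω) (0≤i (yk j) ω)) (⊓-glb h ≤-refl) (0≤plus _))

      ∑hit : (#E * K) * (ι 15 * inv 16) ≤ ∑ E hitE
      ∑hit = ι-cancelˡ {length Q} 1≤#Q (≡≤ (identity-22 ∣Q∣ (#E * K) (ι 15 * inv 16)) (≤-trans (*ˡ (#E * K) (0≤* (0≤ι (length E)) 0≤K) most)
          (≡≤ (sym (∑-*ˡ Q (#E * K) _)) (≤-trans (∑-mono Q sample-≥) (≡≤ (∑-*ˡ Q ∣Q∣ _) (*ˡ ∣Q∣ (0≤ι (length Q)) (hit-≥ v 0≤v vX vY)))))))
        where
        losses : Ω → ℚ
        losses ω = plus (1ℚ - wX ω) + plus (1ℚ - wY ω)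
        most : ∣Q∣ * (ι 15 * inv 16) ≤ ∑ Q (λ ω → 1ℚ - losses ω - s ω)
        most = -≤0⇒≤ (subst (0ℚ ≤_) (sym (trans (cong (_- ∣Q∣ * (ι 15 * inv 16)) (trans (∑-- Q _ s) (cong (_- ∑ Q s) (trans (∑-- Q (λ _ → 1ℚ) losses) (cong (_- ∑ Q losses) ∑1)))))
            (trans (cong (λ u → ∣Q∣ - ∑ Q losses - ∑ Q s - ∣Q∣ * u) fifteen) (identity-119 ∣Q∣ (∑ Q losses) (∑ Q s) (inv 16))))) (0≤- small))
          where
          fifteen : ι 15 * inv 16 ≡ 1ℚ - inv 16
          fifteen = trans (identity-104 (ι 15) (inv 16)) (cong (_- inv 16) (trans (cong (_* inv 16) (sym (ι-suc 15))) (ι*inv {16} (s≤s z≤n))))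

      CS : List (List (Ω × ℕ))
      CS = tuples trials (16 ℕ.* length Q)

      coins : List (List (Ω × ℕ) × (List ℕ × List (Coin × Coin)))
      coins = pairs CS (pairs seqs hashes)

      answer : List (Ω × ℕ) × (List ℕ × List (Coin × Coin)) → X → Y → Bool
      answer (cs , us , hc) a b = guess (Input.first a b (AX.accepts a) cs) (Input.first a b (AY.accepts b) cs) us hc a b

      correct? : ∀ coin (e : X × Y) → Dec (answer coin (proj₁ e) (proj₂ e) ≡ f e)
      correct? coin e = answer coin (proj₁ e) (proj₂ e) BoolP.≟ f e

      totalE : X × Y → ℚ
      totalE (a , b) = Input.total a b (Input.succ a b) (Input.0≤succ a b) (16 ℕ.* length Q)

      ∑correct : ∑ coins (λ coin → ∑ E (λ e → ind (correct? coin e))) ≡ ∑ E totalE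
      ∑correct = trans (∑-swap coins E _) (∑-cong E λ e → trans (∑-pairs CS (pairs seqs hashes) _) (∑-cong CS λ cs → ∑-pairs seqs hashes _))

      1≤FF : 1ℚ ≤ FF
      1≤FF = 1≤ι (ℕP.*-mono-≤ 1≤F 1≤F)

      1≤FT : 1ℚ ≤ FT
      1≤FT = pw-1≤ (1≤ι 1≤F) T

      invK : ℚ
      invK = inv (F ℕ.* F) * pw (inv F) T

      K*invK : K * invK ≡ 1ℚ
      K*invK = trans (identity-84 FF FT (inv (F ℕ.* F)) (pw (inv F) T)) (trans (cong₂ _*_ (ι*inv (ℕP.*-mono-≤ 1≤F 1≤F)) (trans (sym (pw-* (ι F) (inv F) T)) (trans (cong (λ u → pw u T) (ι*inv 1≤F)) (pw-1 T)))) (*-identityˡ 1ℚ))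

      0≤invK : 0ℚ ≤ invK
      0≤invK = 0≤* (0≤inv (F ℕ.* F)) (pw-0≤ (0≤inv F) T)

      η : X × Y → ℚ
      η e = hitE e * invK

      Θ : ℚ
      Θ = ι (length hashes) * FT * pw (ι (length trials)) (16 ℕ.* length Q)

      0≤Θ : 0ℚ ≤ Θ
      0≤Θ = 0≤* (0≤* (0≤ι (length hashes)) (pw-0≤ (0≤ι F) T)) (pw-0≤ (0≤ι (length trials)) (16 ℕ.* length Q))

      coins-length : ι (length coins) ≡ Θ
      coins-length = trans (pairs-length CS (pairs seqs hashes)) (trans (cong₂ _*_ (length-tuples trials (16 ℕ.* length Q)) (trans (pairs-length seqs hashes)
          (cong (_* ι (length hashes)) (trans (length-tuples (range F) T) (cong (λ l → pw (ι l) T) (length-range F))))))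
        (identity-127 (pw (ι (length trials)) (16 ℕ.* length Q)) FT (ι (length hashes))))

      tail : ℚ
      tail = pw (1ℚ - inv (length Q)) (16 ℕ.* length Q)

      per-input : ∀ e → (ι 15 * (1ℚ - tail) * Θ) * (η e + η e - 1ℚ) ≤ ι 16 * totalE e
      per-input e@(a , b) = ≡≤ (cong (_* (η e + η e - 1ℚ)) (identity-128 (ι 15) (1ℚ - tail) (ι (length hashes)) FT (pw (ι (length trials)) (16 ℕ.* length Q))))
          (Input.input-bound a b (η e) (sym (trans (*-assoc (hitE e) invK K) (trans (cong (hitE e *_) (trans (*-comm invK K) K*invK)) (*-identityʳ _)))) 1≤FF 1≤FT)

      -- The constant is `15/16 · 16/17 · 7/8 = 105/136`: the errors of the search, the exhaustion
      -- of the trials, and `2 · 15/16 - 1` from the average of `2 η - 1`.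
      ∑total : ι 105 * (#E * Θ) ≤ ι 136 * ∑ E totalE
      ∑total = ι-cancelˡ {16} (s≤s z≤n) (≤-trans (≡≤ (trans (cong (λ u → ι 16 * (u * (#E * Θ))) (ι-* 15 7)) (identity-129 (ι 16) (ι 15) (ι 7) #E Θ))
          (*ʳ (ι 15 * ι 7 * (#E * Θ)) (0≤* (0≤* (0≤ι 15) (0≤ι 7)) (0≤* (0≤ι (length E)) 0≤Θ)) tail≤))
        (≡≤ (identity-130 (ι 17) (1ℚ - tail) (ι 15) (ι 7) #E Θ)
        (≤-trans (*ˡ (ι 17 * (ι 15 * (1ℚ - tail) * Θ)) (0≤* (0≤ι 17) 0≤B) seven) (≡≤ (identity-84 (ι 17) (ι 15 * (1ℚ - tail) * Θ) (ι 8) S₂)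
        (≤≡ (*ˡ (ι 17 * ι 8) (0≤* (0≤ι 17) (0≤ι 8)) summed) (trans (identity-22 (ι 17 * ι 8) (ι 16) (∑ E totalE)) (cong (λ u → ι 16 * (u * ∑ E totalE)) (sym (ι-* 17 8))))))))) 
        where
        S₂ : ℚ
        S₂ = ∑ E (λ e → η e + η e - 1ℚ)
        tail≤ : ι 16 ≤ ι 17 * (1ℚ - tail)
        tail≤ = -≤0⇒≤ (subst (0ℚ ≤_) (trans (cong (λ u → 1ℚ - u * tail) (ι-suc 16)) (trans (identity-120 (ι 16) tail) (cong (λ u → u * (1ℚ - tail) - ι 16) (sym (ι-suc 16))))) (0≤- (tail-small E 1≤#E)))
          where
          tail-small : ∀ (E′ : List (X × Y)) → 1 ℕ.≤ length E′ → ι 17 * tail ≤ 1ℚ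
          tail-small (e ∷ _) _ = Input.t-small (proj₁ e) (proj₂ e)
        0≤B : 0ℚ ≤ ι 15 * (1ℚ - tail) * Θ
        0≤B = 0≤* (0≤* (0≤ι 15) (one E 1≤#E)) 0≤Θ
          where
          one : ∀ (E′ : List (X × Y)) → 1 ℕ.≤ length E′ → 0ℚ ≤ 1ℚ - tail
          one (e ∷ _) _ = Input.0≤1-t (proj₁ e) (proj₂ e)
        summed : (ι 15 * (1ℚ - tail) * Θ) * S₂ ≤ ι 16 * ∑ E totalE
        summed = ≡≤ (sym (∑-*ˡ E _ _)) (≤≡ (∑-mono E per-input) (∑-*ˡ E (ι 16) totalE))
        ∑η : #E * (ι 15 * inv 16) ≤ ∑ E η
        ∑η = ≡≤ (sym (trans (identity-121 #E K (ι 15 * inv 16) invK) (trans (cong (_* (#E * (ι 15 * inv 16))) K*invK) (*-identityˡ _))))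
            (≤≡ (*ʳ invK 0≤invK ∑hit) (sym (∑-*ʳ E invK hitE)))
        seven : ι 7 * #E ≤ ι 8 * S₂
        seven = ≡≤ (trans (cong (_* #E) seven≡) (identity-122 #E (ι 15 * inv 16) (ι 8))) (*ˡ (ι 8) (0≤ι 8) (≤≡ (+-monoˡ-≤ (- #E) (+-mono-≤ ∑η ∑η))
            (sym (trans (∑-- E _ (λ _ → 1ℚ)) (cong₂ _-_ (∑-+ E η η) (trans (∑-const E 1ℚ) (*-identityʳ _)))))))
          where
          seven≡ : ι 7 ≡ ι 8 * (ι 15 * inv 16 + ι 15 * inv 16) - ι 8
          seven≡ = sym (trans (cong (_- ι 8) (trans (identity-105 (ι 8) (ι 15) (inv 16)) (trans (cong (λ u → u * inv 16 * ι 15) (sym (ι-+ 8 8))) (trans (cong (_* ι 15) (ι*inv {16} (s≤s z≤n))) (*-identityˡ _)))))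
              (trans (cong (_- ι 8) (ι-+ 7 8)) (identity-106 (ι 7) (ι 8))))

      -- `105/136` exceeds `102/136 = 3/4`, and some coins do at least as well as the average.
      good-coins : Σ[ coin ∈ _ ] coin ∈ coins × ι 3 * #E ≤ ι 4 * ∑ E (λ e → ind (correct? coin e))
      good-coins = ∑-exists coins (λ _ → ι 3 * #E) (λ coin → ι 4 * ∑ E (λ e → ind (correct? coin e)))
          (pairs-pos CS (pairs seqs hashes) (tuples-pos trials (16 ℕ.* length Q) (pairs-pos Q (range (F ℕ.* F)) 1≤#Q (subst (1 ℕ.≤_) (sym (length-range _)) (ℕP.*-mono-≤ 1≤F 1≤F))))
            (pairs-pos seqs hashes (tuples-pos (range F) T (subst (1 ℕ.≤_) (sym (length-range F)) 1≤F)) (tuples-pos (pairs (tuples (bools T) 4) (tuples (bools T) 4)) (8 ℕ.+ ((J ℕ.+ J ℕ.* d) ℕ.+ (J ℕ.+ J ℕ.* d))) (pairs-pos (tuples (bools T) 4) (tuples (bools T) 4) hash-pos hash-pos))))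
          (≡≤ (trans (∑-const coins (ι 3 * #E)) (cong (_* (ι 3 * #E)) coins-length))
            (≤≡ (ι-cancelˡ {34} (s≤s z≤n) (≡≤ (trans (identity-131 (ι 34) Θ (ι 3) #E) (cong (_* (#E * Θ)) (sym (ι-* 34 3))))
              (≤-trans (*ʳ (#E * Θ) (0≤* (0≤ι (length E)) 0≤Θ) (ι-mono {102} {105} (ℕP.m≤m+n 102 3))) (≤≡ ∑total (trans (cong (_* ∑ E totalE) (ι-* 34 4)) (*-assoc (ι 34) (ι 4) _))))))
              (sym (trans (∑-*ˡ coins (ι 4) _) (cong (ι 4 *_) ∑correct)))))
        where
        hash-pos : 1 ℕ.≤ length (tuples (bools T) 4)
        hash-pos = tuples-pos (bools T) 4 (bools-pos T)

 -- Padded transcripts, product inputs and relabelled trees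

 module TreeTranscripts where

  open import Data.List.Base using ([]; _∷_)
  open import Data.List.Properties using (≡-dec)
  open import Data.Nat.Base as ℕ using (zero; suc)
  open import Data.Vec.Base as Vec using ([]; _∷_)
  open import Defs using (Tree; output; alice; bob; run; depth)
  open Sums
  open Logarithms
  open CoordinateChoice using (prodTo)
  open NoisySearch using (pairs; tuples)
  open BitSimulation using (prefix)

  alternate : ℕ → Bool
  alternate zero    = true
  alternate (suc k) = not (alternate k)

  -- The transcript of a tree, padded so that Alice speaks at even and Bob at odd levels.
  module Transcript {A B O : Set} where

    advance : Bool → Tree A B O → Bool → Tree A B O
    advance true  (alice g next) b = next b
    advance false (bob g next)   b = next b
    advance _     t              b = t

    say : Bool → Tree A B O → A → B → Bool
    say true  (alice g next) x y = g x
    say false (bob g next)   x y = g y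
    say _     _              x y = false

    run-advance : ∀ o t x y → run (advance o t (say o t x y)) x y ≡ run t x y
    run-advance true  (output _)   x y = refl
    run-advance true  (alice _ _)  x y = refl
    run-advance true  (bob _ _)    x y = refl
    run-advance false (output _)   x y = refl
    run-advance false (alice _ _)  x y = refl
    run-advance false (bob _ _)    x y = refl

    next≤ : ∀ (next : Bool → Tree A B O) b → depth (next b) ℕ.≤ depth (next false) ℕ.⊔ depth (next true)
    next≤ next false = ℕP.m≤m⊔n _ _
    next≤ next true  = ℕP.m≤n⊔m (depth (next false)) _

    depth-advance : ∀ o t b → depth (advance o t b) ℕ.≤ depth t
    depth-advance true  (output _)     b = ℕP.≤-refl
    depth-advance true  (alice _ next) b = ℕP.m≤n⇒m≤1+n (next≤ next b)
    depth-advance true  (bob _ _)      b = ℕP.≤-refl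
    depth-advance false (output _)     b = ℕP.≤-refl
    depth-advance false (alice _ _)    b = ℕP.≤-refl
    depth-advance false (bob _ next)   b = ℕP.m≤n⇒m≤1+n (next≤ next b)

    -- One of two consecutive levels belongs to the player who speaks at the root, so a pair of
    -- levels always consumes a bit of the tree.
    depth-twice : ∀ o t b c → depth (advance (not o) (advance o t b) c) ℕ.≤ ℕ.pred (depth t)
    depth-twice true  (output _)     b c = z≤n
    depth-twice true  (alice _ next) b c = ℕP.≤-trans (depth-advance false (next b) c) (next≤ next b)
    depth-twice true  (bob _ next)   b c = next≤ next c
    depth-twice false (output _)     b c = z≤n
    depth-twice false (alice _ next) b c = next≤ next c
    depth-twice false (bob _ next)   b c = ℕP.≤-trans (depth-advance true (next b) c) (next≤ next b)

    module _ (t : Tree A B O) where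

      node : List Bool → Tree A B O
      node []      = t
      node (b ∷ v) = advance (alternate (length v)) (node v) b

      transcript : ℕ → A → B → List Bool
      transcript zero    x y = []
      transcript (suc k) x y = say (alternate k) (node (transcript k x y)) x y ∷ transcript k x y

      length-transcript : ∀ k x y → length (transcript k x y) ≡ k
      length-transcript zero    x y = refl
      length-transcript (suc k) x y = cong suc (length-transcript k x y)

      run-node : ∀ k x y → run (node (transcript k x y)) x y ≡ run t x y
      run-node zero    x y = refl
      run-node (suc k) x y rewrite length-transcript k x y = trans (run-advance (alternate k) (node (transcript k x y)) x y) (run-node k x y)

      depth-node : ∀ m v → length v ≡ m ℕ.+ m → depth (node v) ℕ.≤ depth t ℕ.∸ m
      depth-node zero    []          e = ℕP.≤-refl
      depth-node (suc m) (c ∷ [])    e = contradiction (trans (ℕP.suc-injective e) (ℕP.+-suc m m)) λ ()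
      depth-node (suc m) (c ∷ b ∷ v) e = ℕP.≤-trans (depth-twice (alternate (length v)) (node v) b c)
        (ℕP.≤-trans (ℕP.pred-mono-≤ (depth-node m v (ℕP.suc-injective (trans (ℕP.suc-injective e) (ℕP.+-suc m m))))) (ℕP.≤-reflexive (ℕP.pred[m∸n]≡m∸[1+n] (depth t) m)))

      leaf : O → Tree A B O → O
      leaf o (output o′) = o′
      leaf o _           = o

      leaf-run : ∀ o t′ x y → depth t′ ≡ 0 → leaf o t′ ≡ run t′ x y
      leaf-run o (output _) x y e = refl

      label-run : ∀ o m x y → depth t ℕ.≤ m → leaf o (node (transcript (m ℕ.+ m) x y)) ≡ run t x y
      label-run o m x y h = trans (leaf-run o (node (transcript (m ℕ.+ m) x y)) x y (ℕP.n≤0⇒n≡0 (ℕP.≤-trans (depth-node m (transcript (m ℕ.+ m) x y) (length-transcript (m ℕ.+ m) x y)) (ℕP.≤-reflexive (ℕP.m≤n⇒m∸n≡0 h)))))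
        (run-node (m ℕ.+ m) x y)

  allVecs : {A : Set} → List A → ∀ n → List (Vec A n)
  allVecs xs zero    = [] ∷ []
  allVecs xs (suc n) = concatMap (λ x → map (x ∷_) (allVecs xs n)) xs

  ∑-allVecs : ∀ {A : Set} (xs : List A) n (f : Vec A (suc n) → ℚ) → ∑ (allVecs xs (suc n)) f ≡ ∑ xs (λ x → ∑ (allVecs xs n) (λ v → f (x ∷ v)))
  ∑-allVecs xs n f = trans (∑-concatMap (λ x → map (x ∷_) (allVecs xs n)) xs f) (∑-cong xs λ x → ∑-map (x ∷_) (allVecs xs n) f)

  length-allVecs : ∀ {A : Set} (xs : List A) n → ι (length (allVecs xs n)) ≡ pw (ι (length xs)) n
  length-allVecs xs zero    = ι1
  length-allVecs xs (suc n) = trans (sym (trans (∑-const (allVecs xs (suc n)) 1ℚ) (*-identityʳ _)))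
    (trans (∑-allVecs xs n (λ _ → 1ℚ)) (trans (∑-const xs _) (cong (ι (length xs) *_) (trans (trans (∑-const (allVecs xs n) 1ℚ) (*-identityʳ _)) (length-allVecs xs n)))))

  vnth : ∀ {A : Set} {n} → A → Vec A n → ℕ → A
  vnth a []       i       = a
  vnth a (x ∷ xs) zero    = x
  vnth a (x ∷ xs) (suc i) = vnth a xs i

  vnth-ext : ∀ {A : Set} {n} a (u v : Vec A n) → (∀ i → i ℕ.< n → vnth a u i ≡ vnth a v i) → u ≡ v
  vnth-ext a []      []      h = refl
  vnth-ext a (x ∷ u) (y ∷ v) h = cong₂ _∷_ (h 0 (s≤s z≤n)) (vnth-ext a u v λ i p → h (suc i) (s≤s p))

  vnth-map : ∀ {A B : Set} {n} (g : A → B) a b (v : Vec A n) i → i ℕ.< n → vnth b (Vec.map g v) i ≡ g (vnth a v i)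
  vnth-map g a b (x ∷ v) zero    h       = refl
  vnth-map g a b (x ∷ v) (suc i) (s≤s h) = vnth-map g a b v i h

  vnth-zipWith : ∀ {A B C : Set} {n} (g : A → B → C) a b c (u : Vec A n) (v : Vec B n) i → i ℕ.< n → vnth c (Vec.zipWith g u v) i ≡ g (vnth a u i) (vnth b v i)
  vnth-zipWith g a b c (x ∷ u) (y ∷ v) zero    h       = refl
  vnth-zipWith g a b c (x ∷ u) (y ∷ v) (suc i) (s≤s h) = vnth-zipWith g a b c u v i h

  ∈-allVecs : ∀ {A : Set} {xs : List A} {n} {v : Vec A n} a → v ∈ allVecs xs n → ∀ i → i ℕ.< n → vnth a v i ∈ xs
  ∈-allVecs {A} {xs = xs} {suc n} {v} a v∈ i i< = go xs v∈ id
    where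
    entry : ∀ {y} {u : Vec A n} → y ∈ xs → u ∈ allVecs xs n → ∀ i → i ℕ.< suc n → vnth a (y ∷ u) i ∈ xs
    entry y∈ u∈ zero    _       = y∈
    entry y∈ u∈ (suc i) (s≤s p) = ∈-allVecs a u∈ i p
    go : ∀ ys → v ∈ concatMap (λ x → map (x ∷_) (allVecs xs n)) ys → (∀ {y} → y ∈ ys → y ∈ xs) → vnth a v i ∈ xs
    go (y ∷ ys) m sub with ∈-++⁻ (map (y ∷_) (allVecs xs n)) m
    ... | inj₂ r = go ys r (sub ∘ there)
    ... | inj₁ r with ∈-map⁻ (y ∷_) r
    ... | u , u∈ , refl = entry (sub (here refl)) u∈ i i<

  ind-∷ : ∀ {A : Set} (_≟_ : DecidableEquality A) {n} x y (v u : Vec A n) →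
    ind (VecP.≡-dec _≟_ (x ∷ v) (y ∷ u)) ≡ ind (x ≟ y) * ind (VecP.≡-dec _≟_ v u)
  ind-∷ _≟_ x y v u with x ≟ y | VecP.≡-dec _≟_ v u
  ... | yes _ | yes _ = sym (*-identityˡ 1ℚ)
  ... | yes _ | no _  = sym (*-identityˡ 0ℚ)
  ... | no _  | yes _ = sym (*-zeroˡ 1ℚ)
  ... | no _  | no _  = sym (*-zeroˡ 0ℚ)

  count-vec : ∀ {A : Set} (_≟_ : DecidableEquality A) (xs : List A) a {n} (v : Vec A n) →
    ∑ (allVecs xs n) (λ u → ind (VecP.≡-dec _≟_ v u)) ≡ prodTo (λ i → ι (count (vnth a v i ≟_) xs)) n
  count-vec {A} _≟_ xs a v = trans (go v) (shape v)
    where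
    prodL : ∀ {n} → Vec A n → ℚ
    prodL []      = 1ℚ
    prodL (x ∷ v) = ι (count (x ≟_) xs) * prodL v
    go : ∀ {n} (v : Vec A n) → ∑ (allVecs xs n) (λ u → ind (VecP.≡-dec _≟_ v u)) ≡ prodL v
    go []      = +-identityʳ 1ℚ
    go {suc n} (x ∷ v) = trans (∑-allVecs xs n _) (trans (∑-cong xs λ y → trans (∑-cong (allVecs xs n) λ u → ind-∷ _≟_ x y v u) (∑-*ˡ (allVecs xs n) (ind (x ≟ y)) _))
      (trans (∑-*ʳ xs _ (λ y → ind (x ≟ y))) (cong₂ _*_ (sym (ι-count (x ≟_) xs)) (go v))))
    prodTo-shift : ∀ (g : ℕ → ℚ) n → prodTo g (suc n) ≡ g 0 * prodTo (g ∘ suc) n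
    prodTo-shift g zero    = trans (*-identityˡ _) (sym (*-identityʳ _))
    prodTo-shift g (suc n) = trans (cong (_* g (suc n)) (prodTo-shift g n)) (*-assoc (g 0) _ _)
    shape : ∀ {n} (v : Vec A n) → prodL v ≡ prodTo (λ i → ι (count (vnth a v i ≟_) xs)) n
    shape []      = refl
    shape {suc n} (x ∷ v) = trans (cong (ι (count (x ≟_) xs) *_) (shape v)) (sym (prodTo-shift (λ i → ι (count (vnth a (x ∷ v) i ≟_) xs)) n))

  mapTree : ∀ {A A′ B B′ O : Set} → (A → A′) → (B → B′) → Tree A′ B′ O → Tree A B O
  mapTree g h (output o)     = output o
  mapTree g h (alice k next) = alice (k ∘ g) (λ b → mapTree g h (next b))
  mapTree g h (bob k next)   = bob (k ∘ h) (λ b → mapTree g h (next b))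

  run-mapTree : ∀ {A A′ B B′ O : Set} (g : A → A′) (h : B → B′) (t : Tree A′ B′ O) a b → run (mapTree g h t) a b ≡ run t (g a) (h b)
  run-mapTree g h (output o)     a b = refl
  run-mapTree g h (alice k next) a b = run-mapTree g h (next (k (g a))) a b
  run-mapTree g h (bob k next)   a b = run-mapTree g h (next (k (h b))) a b

  depth-mapTree : ∀ {A A′ B B′ O : Set} (g : A → A′) (h : B → B′) (t : Tree A′ B′ O) → depth (mapTree g h t) ≡ depth t
  depth-mapTree g h (output o)     = refl
  depth-mapTree g h (alice k next) = cong suc (cong₂ ℕ._⊔_ (depth-mapTree g h (next false)) (depth-mapTree g h (next true)))
  depth-mapTree g h (bob k next)   = cong suc (cong₂ ℕ._⊔_ (depth-mapTree g h (next false)) (depth-mapTree g h (next true)))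

  ∈-pairs : ∀ {A B : Set} (xs : List A) (ys : List B) {a b} → (a , b) ∈ pairs xs ys → a ∈ xs × b ∈ ys
  ∈-pairs (x ∷ xs) ys m with ∈-++⁻ (map (x ,_) ys) m
  ... | inj₂ r = there (proj₁ (∈-pairs xs ys r)) , proj₂ (∈-pairs xs ys r)
  ... | inj₁ r with ∈-map⁻ (x ,_) r
  ... | y , y∈ , refl = here refl , y∈

 -- From small losses to a deterministic protocol for one coordinate

 module SimulatedCoordinate where

  open import Data.List.Base using ([]; _∷_)
  open import Data.Nat.Base as ℕ using (zero; suc)
  open import Defs using (Tree; run; depth)
  open Sums
  open Logarithms
  open Classes
  open Likelihoods
  open CoordinateChoice
  open NoisySearch
  open Dithering
  open BitSimulation
  open TreeTranscripts

  prodFrom-snoc : ∀ g k m → prodFrom g k (suc m) ≡ prodFrom g k m * g (k ℕ.+ m)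
  prodFrom-snoc g k zero    = trans (*-identityʳ (g k)) (sym (trans (*-identityˡ _) (cong g (ℕP.+-identityʳ k))))
  prodFrom-snoc g k (suc m) = trans (cong (g k *_) (prodFrom-snoc g (suc k) m)) (trans (sym (*-assoc (g k) _ _)) (cong (λ l → g k * prodFrom g (suc k) m * g l) (sym (ℕP.+-suc k m))))

  sumFrom-snoc : ∀ g k m → sumFrom g k (suc m) ≡ sumFrom g k m + g (k ℕ.+ m)
  sumFrom-snoc g k zero    = trans (+-identityʳ (g k)) (sym (trans (+-identityˡ _) (cong g (ℕP.+-identityʳ k))))
  sumFrom-snoc g k (suc m) = trans (cong (g k +_) (sumFrom-snoc g (suc k) m)) (trans (sym (+-assoc (g k) _ _)) (cong (λ l → g k + sumFrom g (suc k) m + g l) (sym (ℕP.+-suc k m))))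

  sumFrom≡sumTo : ∀ g m → sumFrom g 0 m ≡ sumTo g m
  sumFrom≡sumTo g zero    = refl
  sumFrom≡sumTo g (suc m) = trans (sumFrom-snoc g 0 m) (cong (_+ g m) (sumFrom≡sumTo g m))

  ∈-tuples-∷ : ∀ {A : Set} {xs : List A} k {a as} → (a ∷ as) ∈ tuples xs (suc k) → a ∈ xs × as ∈ tuples xs k
  ∈-tuples-∷ {A} {xs} k {a} {as} m = go xs m id
    where
    go : ∀ ys → (a ∷ as) ∈ concatMap (λ y → map (y ∷_) (tuples xs k)) ys → (∀ {y} → y ∈ ys → y ∈ xs) → a ∈ xs × as ∈ tuples xs k
    go (y ∷ ys) m sub with ∈-++⁻ (map (y ∷_) (tuples xs k)) m
    ... | inj₂ r = go ys r (sub ∘ there)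
    ... | inj₁ r with ∈-map⁻ (y ∷_) r
    ... | vs , vs∈ , refl = sub (here refl) , vs∈

  short : ∀ {xs : List (List Bool)} w k {hc} → hc ∈ tuples (pairs (tuples xs w) (tuples xs w)) k →
    ∀ own T J z → Walk.Short {List Bool → Bool} {List Bool → Bool} own id id T J z w hc
  short w k       {[]}            m own T J z = tt
  short w zero    {_ ∷ _} (here ()) own T J z
  short w zero    {_ ∷ _} (there ()) own T J z
  short w (suc k) {(h , h′) ∷ hc} m own T J z = length-∈ w (proj₁ both) , length-∈ w (proj₂ both) , short w k (proj₂ split) own T J z
    where
    split : _
    split = ∈-tuples-∷ k m
    both : _
    both = ∈-pairs _ _ (proj₁ split)

  module Combine {Ω X Y : Set} (Q : List Ω) (full : ∀ ω → ω ∈ Q) (1≤#Q : 1 ℕ.≤ length Q)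
    (E : List (X × Y)) (_≟X_ : DecidableEquality X) (_≟Y_ : DecidableEquality Y)
    (n : ℕ) (x : ℕ → Ω → X) (y : ℕ → Ω → Y) (bits : ℕ → Ω → Bool) (own : ℕ → Bool)
    (pt∈E : ∀ {j} → j ℕ.< n → ∀ ω → (x j ω , y j ω) ∈ E) (1≤#E : 1 ℕ.≤ length E)
    (f : X × Y → Bool) (T J d N N₁ : ℕ) (1≤N : 1 ℕ.≤ N) (1≤d : 1 ℕ.≤ d) (1≤J : 1 ℕ.≤ J) (T<2^J : T ℕ.< 2 ℕ.^ J)
    (z : ℕ → List Bool → Bool) (win : ∀ {j} → j ℕ.< n → ∀ ω → z j (prefix bits T ω) ≡ f (x j ω , y j ω)) where

    open Totals Q full 1≤#Q E _≟X_ _≟Y_ n x y bits own pt∈E 1≤#E N 1≤N T N₁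

    module _
      (detA : ∀ k {ω ω′} → own k ≡ true → Rel n n k ∋ ω ≈ ω′ → bits k ω ≡ bits k ω′)
      (detB : ∀ k {ω ω′} → own k ≡ false → Rel 0 0 k ∋ ω ≈ ω′ → bits k ω ≡ bits k ω′)
      (hprod : ∀ ω → c (Rel n 0 0) ω ≤ prodTo (λ j → ι (μ j ω)) n) where

      open Determined detA detB hprod
      open Sizes

      module _ (hsize : ι n * ι (lg (length E)) ≤ ι (lg (length Q)) + 1ℚ + ι n * ι N₁) {j : ℕ} (j<n : j ℕ.< n)
        (small : ∑ Q (loss hsize j<n) + inv d * ∑ Q (λ ω → sumTo (mistakes hsize j ω) T) ≤ ∣Q∣ * inv 16) where

        open Simulation Q full 1≤#Q E _≟X_ _≟Y_ n x y bits own pt∈E 1≤#E T J d 1≤d 1≤J T<2^J (z j) f j j<n (win j<n)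

        private
          module PX = LX j<n N 1≤N
          module PY = LY j<n N 1≤N

          p-step : ∀ k ω → c (Own 1 j k) ω * i (Own 0 j k) ω ≡ p ω k
          p-step k ω = go (own k)
            where
            go : ∀ o → c (if o then Rel (suc j) (suc j) (suc k) else Rel j j (suc k)) ω * i (if o then Rel (suc j) (suc j) k else Rel j j k) ω
              ≡ (if o then qX k ω else qY k ω)
            go true  = refl
            go false = refl

          vX≡ : ∀ K ω → PX.v 1≤#E 1≤#Q K ω ≡ (ι (μ j ω) * inv (length E)) * rX ω * prodFrom (p ω) 0 K
          vX≡ zero    ω = sym (*-identityʳ _)
          vX≡ (suc K) ω = trans (cong₂ _*_ (vX≡ K ω) (p-step K ω)) (trans (*-assoc _ _ _) (cong ((ι (μ j ω) * inv (length E)) * rX ω *_) (sym (prodFrom-snoc (p ω) 0 K))))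

          vY≡ : ∀ K ω → PY.v 1≤#E 1≤#Q K ω ≡ (ι (μ j ω) * inv (length E)) * rY ω * prodFrom (p ω) 0 K
          vY≡ zero    ω = sym (*-identityʳ _)
          vY≡ (suc K) ω = trans (cong₂ _*_ (vY≡ K ω) (p-step K ω)) (trans (*-assoc _ _ _) (cong ((ι (μ j ω) * inv (length E)) * rY ω *_) (sym (prodFrom-snoc (p ω) 0 K))))

          -- The excesses over one minus the shortfalls below one add up to `Σ w - ∣Q∣`, which is
          -- not positive. This is how the two-sided `err` is bounded by the one-sided `mistakes`.
          excess≤ : ∀ (w : Ω → ℚ) → ∑ Q w ≤ ∣Q∣ → ∑ Q (λ ω → plus (w ω - 1ℚ)) ≤ ∑ Q (λ ω → plus (1ℚ - w ω))
          excess≤ w h = ≡≤ (trans (∑-cong Q λ ω → trans (plus-split (w ω - 1ℚ)) (cong (w ω - 1ℚ +_) (cong plus (identity-133 (w ω))))) (trans (∑-+ Q _ _) (cong (_+ ∑ Q (λ ω → plus (1ℚ - w ω))) (trans (∑-- Q w (λ _ → 1ℚ)) (cong (λ u → ∑ Q w - u) ∑1)))))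
            (≤≡ (+-monoˡ-≤ _ (≤≡ (+-monoˡ-≤ (- ∣Q∣) h) (+-inverseʳ ∣Q∣))) (+-identityˡ _))

          ∑w₁ : ∀ k → ∑ Q (w₁ hsize j k) ≤ ∣Q∣
          ∑w₁ k = ∑-ratio (Rel j j (suc k)) (Rel (suc j) j k) (Rel (suc j) j (suc k)) (Rel j j k)
            (Rel-mono ℕP.≤-refl ℕP.≤-refl (ℕP.n≤1+n k)) (Rel-mono (ℕP.n≤1+n j) ℕP.≤-refl ℕP.≤-refl) (λ p → add-m (last-m {j} {j} p))

          ∑w₂ : ∀ k → ∑ Q (w₂ hsize j k) ≤ ∣Q∣
          ∑w₂ k = ∑-ratio (Rel (suc j) (suc j) (suc k)) (Rel (suc j) j k) (Rel (suc j) j (suc k)) (Rel (suc j) (suc j) k)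
            (Rel-mono ℕP.≤-refl ℕP.≤-refl (ℕP.n≤1+n k)) (Rel-mono ℕP.≤-refl (ℕP.n≤1+n j) ℕP.≤-refl) (λ p → add-m (last-m {suc j} {suc j} p))

          err≤ : ∀ k → ∑ Q (λ ω → err ω k) ≤ ∑ Q (λ ω → mistakes hsize j ω k)
          err≤ k = go (own k)
            where
            a b : Ω → ℚ
            a = w₁ hsize j k
            b = w₂ hsize j k
            go : ∀ o → ∑ Q (λ ω → if o then plus (1ℚ - a ω) + plus (b ω - 1ℚ) else plus (1ℚ - b ω) + plus (a ω - 1ℚ)) ≤ ∑ Q (λ ω → plus (1ℚ - a ω) + plus (1ℚ - b ω))
            go true  = ≡≤ (∑-+ Q _ _) (≤≡ (+-monoʳ-≤ _ (excess≤ b (∑w₂ k))) (sym (∑-+ Q _ _)))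
            go false = ≡≤ (∑-+ Q _ _) (≤≡ (+-monoʳ-≤ _ (excess≤ a (∑w₁ k))) (trans (+-comm _ _) (sym (∑-+ Q _ _))))

          ∑s≤ : ∑ Q s ≤ inv d * ∑ Q (λ ω → sumTo (mistakes hsize j ω) T)
          ∑s≤ = ≡≤ (∑-*ˡ Q (inv d) _) (*ˡ (inv d) (0≤inv d)
            (≡≤ (trans (∑-cong Q λ ω → sumFrom≡sumTo (err ω) T) (∑-sumTo Q (λ k ω → err ω k) T))
            (≤≡ (sumTo-mono T λ k _ → err≤ k) (sym (∑-sumTo Q (λ k ω → mistakes hsize j ω k) T)))))

          module Coin′ = Conclude (wX hsize j<n T) (wY hsize j<n T) (λ ω → cong (_* (∣Q∣ * i R₀ ω)) (vX≡ T ω)) (λ ω → cong (_* (∣Q∣ * i R₀ ω)) (vY≡ T ω))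
            (≤-trans (+-monoʳ-≤ _ ∑s≤) small)

        simulated : Σ[ t ∈ Tree X Y Bool ] depth t ℕ.≤ (8 ℕ.+ ((J ℕ.+ J ℕ.* d) ℕ.+ (J ℕ.+ J ℕ.* d))) ℕ.* 16 ℕ.+ 1 ×
          ι 3 * ι (length E) ≤ ι 4 * ∑ E (λ e → ind (run t (proj₁ e) (proj₂ e) BoolP.≟ f e))
        simulated = go Coin′.good-coins
          where
          open Walk {List Bool → Bool} {List Bool → Bool} own id id T J (z j) using (walk; walk-depth)
          go : Σ[ coin ∈ _ ] coin ∈ Coin′.coins × ι 3 * ι (length E) ≤ ι 4 * ∑ E (λ e → ind (Coin′.correct? coin e)) → _
          go ((cs , us , hc) , coin∈ , good) = mapTree gX gY (walk hc start []) ,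
              subst (ℕ._≤ _) (sym (depth-mapTree gX gY (walk hc start [])))
                (subst (λ l → depth (walk hc start []) ℕ.≤ l ℕ.* 16 ℕ.+ 1) (length-∈ {xs = pairs (tuples (bools T) 4) (tuples (bools T) 4)} L hc∈) (walk-depth 4 hc (short {bools T} 4 L hc∈ own T J (z j)) start [])) ,
              ≤≡ good (cong (ι 4 *_) (∑-cong E λ e → cong (λ o → ind (o BoolP.≟ f e)) (sym (run-mapTree gX gY (walk hc start []) (proj₁ e) (proj₂ e)))))
            where
            L : ℕ
            L = 8 ℕ.+ ((J ℕ.+ J ℕ.* d) ℕ.+ (J ℕ.+ J ℕ.* d))
            hc∈ : hc ∈ hashes
            hc∈ = proj₂ (∈-pairs seqs hashes (proj₂ (∈-pairs Coin′.CS (pairs seqs hashes) coin∈)))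
            gX : X → List Bool → Bool
            gX a = predX (firstAccepted proj₁ (AX.accepts a) cs) us a
            gY : Y → List Bool → Bool
            gY b = predY (firstAccepted proj₁ (AY.accepts b) cs) us b

      simulation : (hsize : ι n * ι (lg (length E)) ≤ ι (lg (length Q)) + 1ℚ + ι n * ι N₁) (1≤n : 1 ℕ.≤ n) (h s N₂ : ℕ)
        (eq₁ : N ≡ suc h ℕ.* suc h ℕ.* N₁) (eq₂ : N ≡ suc s ℕ.* suc s ℕ.* N₂)
        (hA : (ι T + ι 9) * inv N ≤ inv (suc h) * inv (suc h))
        (hB : (ι n * (ι T + ι T + (ι T + ι T)) + ι n * ι 16 + (1ℚ + 1ℚ) + (ι T + ι T) * (1ℚ + 1ℚ)) * inv N ≤ ι T)
        (hC : (ι n + ι n) * (inv (suc h) * inv (suc h)) ≤ ι T)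
        (hs : ι (suc s) ≤ ι n * inv (suc s))
        (hd : (ι T * ι 6) * (inv (suc s) * inv d) ≤ inv 32)
        (small : ι 6 * inv (suc h) + inv 32 ≤ inv 16) →
        Σ[ t ∈ Tree X Y Bool ] depth t ℕ.≤ (8 ℕ.+ ((J ℕ.+ J ℕ.* d) ℕ.+ (J ℕ.+ J ℕ.* d))) ℕ.* 16 ℕ.+ 1 ×
          ι 3 * ι (length E) ≤ ι 4 * ∑ E (λ e → ind (run t (proj₁ e) (proj₂ e) BoolP.≟ f e))
      simulation hsize 1≤n h s N₂ eq₁ eq₂ hA hB hC hs hd small = simulated hsize (proj₁ (proj₂ picked)) (≤-trans (proj₂ (proj₂ picked)) (*ˡ ∣Q∣ (0≤ι (length Q)) small))
        where
        picked : Σ[ j ∈ ℕ ] Σ[ j<n ∈ j ℕ.< n ] ∑ Q (loss hsize j<n) + inv d * ∑ Q (λ ω → sumTo (mistakes hsize j ω) T) ≤ ∣Q∣ * (ι 6 * inv (suc h) + inv 32)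
        picked = Pick.pick-coordinate hsize 1≤n h s N₂ d eq₁ eq₂ hA hB hC hs hd

 -- The two cases, very short and longer protocols for the power of `f`

 module Reduction where

  open import Data.List.Base using ([]; _∷_; lookup)
  open import Data.Nat.Base as ℕ using (zero; suc)
  open import Data.Vec.Base as Vec using ([]; _∷_)
  open import Defs using (Tree; output; alice; bob; run; depth)
  open Sums
  open Logarithms
  open Classes
  open CoordinateChoice
  open BitSimulation
  open TreeTranscripts
  open SimulatedCoordinate

  ≤*inv : ∀ {c a b} → 1 ℕ.≤ c → a * ι c ≤ b → a ≤ b * inv c
  ≤*inv {c} {a} {b} h p = ≡≤ (sym (trans (*-assoc a (ι c) (inv c)) (trans (cong (a *_) (ι*inv h)) (*-identityʳ a)))) (*ʳ (inv c) (0≤inv c) p)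

  *inv≤ : ∀ {c a b} → 1 ℕ.≤ c → a ≤ b * ι c → a * inv c ≤ b
  *inv≤ {c} {a} {b} h p = ≤≡ (*ʳ (inv c) (0≤inv c) p) (trans (*-assoc b (ι c) (inv c)) (trans (cong (b *_) (ι*inv h)) (*-identityʳ b)))

  ∑-filter : ∀ {A : Set} {P : A → Set} (P? : ∀ a → Dec (P a)) xs g → ∑ (filter P? xs) g ≡ ∑ xs (λ a → ind (P? a) * g a)
  ∑-filter P? []       g = refl
  ∑-filter P? (x ∷ xs) g with P? x
  ... | yes _ = cong₂ _+_ (sym (*-identityˡ (g x))) (∑-filter P? xs g)
  ... | no _  = trans (∑-filter P? xs g) (sym (trans (cong (_+ ∑ xs (λ a → ind (P? a) * g a)) (*-zeroˡ (g x))) (+-identityˡ _)))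

  ∑-lookup : ∀ {A : Set} (xs : List A) g → ∑ (allFin (length xs)) (g ∘ lookup xs) ≡ ∑ xs g
  ∑-lookup xs g = trans (sym (∑-map (lookup xs) (allFin (length xs)) g)) (cong (λ l → ∑ l g) (trans (map-tabulate id (lookup xs)) (tabulate-lookup xs)))

  nonempty : ∀ {A : Set} {a : A} {as} → a ∈ as → 1 ℕ.≤ length as
  nonempty (here _)  = s≤s z≤n
  nonempty (there _) = s≤s z≤n

  module Wins {X Y : Set} (_≟X_ : DecidableEquality X) (_≟Y_ : DecidableEquality Y) (f : X × Y → Bool) (E : List (X × Y)) (n : ℕ)
    (tr : Tree (Vec X n) (Vec Y n) (Vec Bool n)) where

    xs : Vec (X × Y) n → Vec X n
    xs = Vec.map proj₁
    ys : Vec (X × Y) n → Vec Y n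
    ys = Vec.map proj₂

    win? : ∀ v → Dec (run tr (xs v) (ys v) ≡ Vec.zipWith (λ a b → f (a , b)) (xs v) (ys v))
    win? v = VecP.≡-dec BoolP._≟_ _ _

    wins : List (Vec (X × Y) n)
    wins = filter win? (allVecs E n)

    #wins : ι (length wins) ≡ ∑ (allVecs E n) (λ v → ind (win? v))
    #wins = trans (sym (trans (∑-const wins 1ℚ) (*-identityʳ _))) (trans (∑-filter win? (allVecs E n) (λ _ → 1ℚ)) (∑-cong (allVecs E n) λ v → *-identityʳ _))

    Good : Tree X Y Bool → Set
    Good t = ι 5 * ι (length E) ≤ ι 8 * ∑ E (λ e → ind (run t (proj₁ e) (proj₂ e) BoolP.≟ f e))

    -- A short protocol reaches few outputs, and a given output is correct with probability at most a power of the bias of f.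
    module Small (e₀ : X × Y) (e₀∈ : e₀ ∈ E) (1≤n : 1 ℕ.≤ n) (Td : ℕ) (depth≤ : depth tr ℕ.≤ Td) (Td<n : 4 ℕ.* Td ℕ.≤ n) (θ : ℚ) (0≤θ : 0ℚ ≤ θ) (θ≤ : θ ≤ inv 32)
      (many : pw (ι (length E)) n ≤ ι (length wins) * pw (1ℚ + θ) n) where

      ε m : ℚ
      ε = ι (length E)
      m = ι 5 * inv 8 * ε

      0≤m : 0ℚ ≤ m
      0≤m = 0≤* (0≤* (0≤ι 5) (0≤inv 8)) (0≤ι (length E))

      module _ (biased : ∀ b → ∑ E (λ e → ind (b BoolP.≟ f e)) ≤ m) where

        leaf≤ : ∀ {k} (o : Vec Bool k) → ∑ (allVecs E k) (λ v → ind (VecP.≡-dec BoolP._≟_ o (Vec.zipWith (λ a b → f (a , b)) (Vec.map proj₁ v) (Vec.map proj₂ v)))) ≤ pw m k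
        leaf≤ []      = ≤-reflexive (+-identityʳ 1ℚ)
        leaf≤ {suc k} (b ∷ o) = ≡≤ (trans (∑-allVecs E k _) (trans (∑-cong E λ e → trans (∑-cong (allVecs E k) λ v → ind-∷ BoolP._≟_ b _ o _) (∑-*ˡ (allVecs E k) (ind (b BoolP.≟ f e)) _))
          (∑-*ʳ E _ (λ e → ind (b BoolP.≟ f e))))) (*-mono (∑-0≤ E λ e → 0≤ind (b BoolP.≟ f e)) (pw-0≤ 0≤m k) (biased b) (leaf≤ o))

        tree≤ : ∀ (t : Tree (Vec X n) (Vec Y n) (Vec Bool n)) k → depth t ℕ.≤ k →
          ∑ (allVecs E n) (λ v → ind (VecP.≡-dec BoolP._≟_ (run t (xs v) (ys v)) (Vec.zipWith (λ a b → f (a , b)) (xs v) (ys v)))) ≤ pw (1ℚ + 1ℚ) k * pw m n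
        branch≤ : ∀ (next : Bool → Tree (Vec X n) (Vec Y n) (Vec Bool n)) (g : Vec (X × Y) n → Bool) k → depth (next false) ℕ.⊔ depth (next true) ℕ.≤ k →
          ∑ (allVecs E n) (λ v → ind (VecP.≡-dec BoolP._≟_ (run (next (g v)) (xs v) (ys v)) (Vec.zipWith (λ a b → f (a , b)) (xs v) (ys v)))) ≤ pw (1ℚ + 1ℚ) (suc k) * pw m n

        tree≤ (output o) k h = ≤-trans (leaf≤ o) (≡≤ (sym (*-identityˡ _)) (*ʳ _ (pw-0≤ 0≤m n) (pw-1≤ (gap 1ℚ 0≤1 refl) k)))
        tree≤ (alice g next) (suc k) (s≤s h) = branch≤ next (g ∘ xs) k h
        tree≤ (bob g next)   (suc k) (s≤s h) = branch≤ next (g ∘ ys) k h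

        branch≤ next g k h = ≤-trans (∑-mono (allVecs E n) λ v → go (g v) {_} {λ b → run (next b) (xs v) (ys v)}) (≡≤ (∑-+ (allVecs E n) _ _)
            (≤≡ (+-mono-≤ (tree≤ (next false) k (ℕP.≤-trans (ℕP.m≤m⊔n _ _) h)) (tree≤ (next true) k (ℕP.≤-trans (ℕP.m≤n⊔m (depth (next false)) _) h)))
            (identity-136 (pw (1ℚ + 1ℚ) k) (pw m n))))
          where
          go : ∀ b {u : Vec Bool n} {w : Bool → Vec Bool n} → ind (VecP.≡-dec BoolP._≟_ (w b) u) ≤ ind (VecP.≡-dec BoolP._≟_ (w false) u) + ind (VecP.≡-dec BoolP._≟_ (w true) u)
          go false {u} {w} = gap _ (0≤ind (VecP.≡-dec BoolP._≟_ (w true) u)) refl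
          go true  {u} {w} = gap _ (0≤ind (VecP.≡-dec BoolP._≟_ (w false) u)) (+-comm (ind (VecP.≡-dec BoolP._≟_ (w false) u)) _)

        -- Falsity is expressed as the negation of a truth. There are at most `2 ^ Td ≤ (5/4) ^ n`
        -- leaves because `4 Td ≤ n` and `2 ≤ (5/4) ^ 4`, and each is right on at most `(5/8) ^ n`
        -- of the inputs. With the density of the wins this gives `1 ≤ c ^ n` for
        -- `c = 5/4 · 5/8 · 33/32 < 1`.
        impossible : ¬ (0ℚ ≤ 1ℚ)
        impossible _ = <-irrefl refl (<-≤-trans c<1 1≤c)
          where
          a c : ℚ
          a = 1ℚ + inv 4
          c = a * (ι 5 * inv 8) * (1ℚ + inv 32)
          0≤a : 0ℚ ≤ a
          0≤a = 0≤+ 0≤1 (0≤inv 4)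
          opaque
            unfolding _+_
            c<1 : c < 1ℚ
            c<1 = toWitness {a? = QP._<?_ c 1ℚ} tt
          0≤c : 0ℚ ≤ c
          0≤c = 0≤* (0≤* 0≤a (0≤* (0≤ι 5) (0≤inv 8))) (0≤+ 0≤1 (0≤inv 32))
          2≤a⁴ : 1ℚ + 1ℚ ≤ pw a 4
          2≤a⁴ = ≡≤ (cong (1ℚ +_) (sym (ι*inv {4} (s≤s z≤n)))) (bernoulli (0≤inv 4) 4)
          2^≤ : pw (1ℚ + 1ℚ) Td ≤ pw a n
          2^≤ = ≤-trans (pw-mono (0≤+ 0≤1 0≤1) 2≤a⁴ Td) (≡≤ (sym (pw-∸ a Td 4))
            (≡≤ (sym (*-identityʳ _)) (≤≡ (*ˡ _ (pw-0≤ 0≤a (Td ℕ.* 4)) (pw-1≤ (gap (inv 4) (0≤inv 4) refl) (n ℕ.∸ Td ℕ.* 4)))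
            (trans (sym (pw-+ a (Td ℕ.* 4) _)) (cong (pw a) (ℕP.m+[n∸m]≡n (subst (ℕ._≤ n) (ℕP.*-comm 4 Td) Td<n)))))))
          bound : pw ε n * 1ℚ ≤ pw ε n * pw c n
          bound = ≡≤ (*-identityʳ _) (≤-trans many (≤-trans (*ʳ _ (pw-0≤ (0≤+ 0≤1 0≤θ) n) (≡≤ #wins (≤-trans (tree≤ tr Td depth≤) (*ʳ (pw m n) (pw-0≤ 0≤m n) 2^≤))))
            (≤≡ (*ˡ (pw a n * pw m n) (0≤* (pw-0≤ 0≤a n) (pw-0≤ 0≤m n)) (pw-mono (0≤+ 0≤1 0≤θ) (+-monoʳ-≤ 1ℚ θ≤) n))
            (trans (sym (trans (pw-* (a * m) (1ℚ + inv 32) n) (cong (_* pw (1ℚ + inv 32) n) (pw-* a m n)))) (trans (cong (λ u → pw u n) (identity-134 a (ι 5 * inv 8) ε (1ℚ + inv 32))) (pw-* ε c n))))))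
          1≤ε^ : 1ℚ ≤ pw ε n
          1≤ε^ = pw-1≤ (1≤ι (nonempty e₀∈)) n
          1≤cⁿ : 1ℚ ≤ pw c n
          1≤cⁿ = *-cancel-pos (pw ε n) 1≤ε^ (subst₂ _≤_ (*-comm (pw ε n) 1ℚ) (*-comm (pw ε n) (pw c n)) bound)
          1≤c : 1ℚ ≤ c
          1≤c = first n 1≤n 1≤cⁿ
            where
            first : ∀ n → 1 ℕ.≤ n → 1ℚ ≤ pw c n → 1ℚ ≤ c
            first (suc k) _ h = ≤-trans h (≤≡ (*ˡ c 0≤c (pw≤1 k)) (*-identityʳ c))
              where
              pw≤1 : ∀ k → pw c k ≤ 1ℚ
              pw≤1 zero    = ≤-refl
              pw≤1 (suc k) = ≤≡ (*-mono 0≤c 0≤1 (<⇒≤ c<1) (pw≤1 k)) (*-identityʳ 1ℚ)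

      constant : Σ[ b ∈ Bool ] Good (output b)
      constant = go (≤-total (ι 5 * ε) (ι 8 * M true)) (≤-total (ι 5 * ε) (ι 8 * M false))
        where
        M : Bool → ℚ
        M b = ∑ E (λ e → ind (b BoolP.≟ f e))
        go : ι 5 * ε ≤ ι 8 * M true ⊎ ι 8 * M true ≤ ι 5 * ε → ι 5 * ε ≤ ι 8 * M false ⊎ ι 8 * M false ≤ ι 5 * ε → Σ[ b ∈ Bool ] Good (output b)
        go (inj₁ p) _        = true , p
        go (inj₂ _) (inj₁ p) = false , p
        go (inj₂ p) (inj₂ q) = contradiction 0≤1 (impossible λ { true → scale p ; false → scale q })
          where
          scale : ∀ {u} → ι 8 * u ≤ ι 5 * ε → u ≤ m
          scale {u} h = ≤≡ (≤*inv {8} (s≤s z≤n) (≡≤ (*-comm u (ι 8)) h)) (identity-135 (ι 5) ε (inv 8))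

    module Large (e₀ : X × Y) (e₀∈ : e₀ ∈ E) (1≤n : 1 ℕ.≤ n) (Td : ℕ) (depth≤ : depth tr ℕ.≤ Td) (1≤Td : 1 ℕ.≤ Td)
      (h s J d : ℕ) (1≤J : 1 ℕ.≤ J) (T<2^J : Td ℕ.+ Td ℕ.< 2 ℕ.^ J) (hH : ι 6 * inv (suc h) ≤ inv 32)
      (hC : (ι n + ι n) * (inv (suc h) * inv (suc h)) ≤ ι (Td ℕ.+ Td)) (S²≤n : suc s ℕ.* suc s ℕ.≤ n)
      (hd : 192 ℕ.* (Td ℕ.+ Td) ℕ.≤ suc s ℕ.* d)
      (many : pw (ι (length E)) n ≤ ι (length wins) * pw (1ℚ + inv (suc h) * inv (suc h)) n) where

      -- `T` is twice `Td` because of the padding. `A` and `T + 9` are the rounding terms of `hB`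
      -- and `hA`, and `Wn` exceeds both. `N` is a common multiple of `H²` and `S²`, as the two
      -- tangents require, and `N₁ / N = θ²` is the allowance for the density of the wins.
      T S H A Wn N₁ N₂ N : ℕ
      T = Td ℕ.+ Td
      S = suc s
      H = suc h
      A = n ℕ.* (T ℕ.+ T ℕ.+ (T ℕ.+ T)) ℕ.+ n ℕ.* 16 ℕ.+ 2 ℕ.+ (T ℕ.+ T) ℕ.* 2
      Wn = A ℕ.+ (T ℕ.+ 9)
      N₁ = S ℕ.* S ℕ.* Wn
      N₂ = H ℕ.* H ℕ.* Wn
      N = H ℕ.* H ℕ.* N₁

      1≤#E : 1 ℕ.≤ length E
      1≤#E = nonempty e₀∈

      1≤T : 1 ℕ.≤ T
      1≤T = ℕP.≤-trans 1≤Td (ℕP.m≤m+n Td Td)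

      1≤d : 1 ℕ.≤ d
      1≤d = pos d hd
        where
        pos : ∀ d → 192 ℕ.* T ℕ.≤ S ℕ.* d → 1 ℕ.≤ d
        pos (suc d) _ = s≤s z≤n
        pos zero    p = contradiction (ℕP.≤-trans (ℕP.≤-trans (ℕP.*-mono-≤ {1} {192} (s≤s z≤n) 1≤T) p) (ℕP.≤-reflexive (ℕP.*-zeroʳ S))) λ ()

      1≤Wn : 1 ℕ.≤ Wn
      1≤Wn = ℕP.≤-trans (ℕP.≤-trans 1≤T (ℕP.m≤m+n T 9)) (ℕP.m≤n+m (T ℕ.+ 9) A)

      Wn≤N₁ : Wn ℕ.≤ N₁
      Wn≤N₁ = ℕP.m≤n*m Wn (S ℕ.* S)

      N₁≤N : N₁ ℕ.≤ N
      N₁≤N = ℕP.m≤n*m N₁ (H ℕ.* H)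

      1≤N : 1 ℕ.≤ N
      1≤N = ℕP.≤-trans 1≤Wn (ℕP.≤-trans Wn≤N₁ N₁≤N)

      eq₂ : N ≡ S ℕ.* S ℕ.* N₂
      eq₂ = swap (H ℕ.* H) (S ℕ.* S) Wn
        where
        swap : ∀ a b c → a ℕ.* (b ℕ.* c) ≡ b ℕ.* (a ℕ.* c)
        swap a b c = trans (sym (ℕP.*-assoc a b c)) (trans (cong (ℕ._* c) (ℕP.*-comm a b)) (ℕP.*-assoc b a c))

      θ : ℚ
      θ = inv H

      one-H : inv H * ι H ≡ 1ℚ
      one-H = inv*ι (s≤s z≤n)

      θθN : θ * θ * ι N ≡ ι N₁
      θθN = trans (cong (θ * θ *_) (trans (ι-* (H ℕ.* H) N₁) (cong (_* ι N₁) (ι-* H H)))) (trans (identity-137 θ (ι H) (ι N₁)) (trans (cong₂ (λ a b → a * b * ι N₁) one-H one-H) (trans (cong (_* ι N₁) (*-identityʳ 1ℚ)) (*-identityˡ _))))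

      hA : (ι T + ι 9) * inv N ≤ θ * θ
      hA = *inv≤ 1≤N (≡≤ (sym (ι-+ T 9)) (≤≡ (ι-mono (ℕP.≤-trans (ℕP.m≤n+m (T ℕ.+ 9) A) Wn≤N₁)) (sym θθN)))

      hB : (ι n * (ι T + ι T + (ι T + ι T)) + ι n * ι 16 + (1ℚ + 1ℚ) + (ι T + ι T) * (1ℚ + 1ℚ)) * inv N ≤ ι T
      hB = *inv≤ 1≤N (≡≤ (sym number) (≤-trans (ι-mono (ℕP.≤-trans (ℕP.m≤m+n A (T ℕ.+ 9)) (ℕP.≤-trans Wn≤N₁ N₁≤N)))
        (≡≤ (sym (*-identityˡ (ι N))) (*ʳ (ι N) (0≤ι N) (1≤ι 1≤T)))))
        where
        two : ι 2 ≡ 1ℚ + 1ℚ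
        two = trans (ι-suc 1) (cong (1ℚ +_) ι1)
        number : ι (n ℕ.* (T ℕ.+ T ℕ.+ (T ℕ.+ T)) ℕ.+ n ℕ.* 16 ℕ.+ 2 ℕ.+ (T ℕ.+ T) ℕ.* 2) ≡ ι n * (ι T + ι T + (ι T + ι T)) + ι n * ι 16 + (1ℚ + 1ℚ) + (ι T + ι T) * (1ℚ + 1ℚ)
        number = trans (ι-+ _ ((T ℕ.+ T) ℕ.* 2)) (cong₂ _+_ (trans (ι-+ _ 2) (cong₂ _+_ (trans (ι-+ _ (n ℕ.* 16))
          (cong₂ _+_ (trans (ι-* n _) (cong (ι n *_) (trans (ι-+ (T ℕ.+ T) (T ℕ.+ T)) (cong₂ _+_ (ι-+ T T) (ι-+ T T))))) (ι-* n 16))) two))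
          (trans (ι-* (T ℕ.+ T) 2) (cong₂ _*_ (ι-+ T T) two)))

      hs : ι S ≤ ι n * inv S
      hs = ≤*inv (s≤s z≤n) (≡≤ (sym (ι-* S S)) (ι-mono S²≤n))

      hd′ : (ι T * ι 6) * (inv S * inv d) ≤ inv 32
      hd′ = ≡≤ (sym (*-assoc _ (inv S) (inv d))) (*inv≤ 1≤d (*inv≤ {S} (s≤s z≤n)
        (≤≡ (ι-cancelˡ {32} (s≤s z≤n) (≡≤ (trans (trans (identity-138 (ι 32) (ι T) (ι 6)) (cong (_* ι T) (sym (ι-* 32 6)))) (sym (ι-* 192 T)))
          (≤≡ (ι-mono hd) (trans (trans (ι-* S d) (*-comm (ι S) (ι d))) (sym (trans (sym (*-assoc (ι 32) (inv 32) _)) (trans (cong (_* (ι d * ι S)) (ι*inv {32} (s≤s z≤n))) (*-identityˡ _))))))))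
          (sym (*-assoc (inv 32) (ι d) (ι S))))))

      thresholds : ι 6 * θ + inv 32 ≤ inv 16
      thresholds = ≤≡ (+-monoˡ-≤ (inv 32) hH) (trans (sym (trans (cong (_* (inv 32 + inv 32)) (inv*ι {16} (s≤s z≤n))) (*-identityˡ _)))
        (trans (identity-139 (inv 16) (ι 16) (inv 32)) (trans (cong (λ u → inv 16 * (u * inv 32)) (sym (ι-+ 16 16))) (trans (cong (inv 16 *_) (ι*inv {32} (s≤s z≤n))) (*-identityʳ _)))))

      1≤#wins : 1 ℕ.≤ length wins
      1≤#wins = pos (length wins) many
        where
        pos : ∀ l → pw (ι (length E)) n ≤ ι l * pw (1ℚ + θ * θ) n → 1 ℕ.≤ l
        pos (suc l) _ = s≤s z≤n
        pos zero    p = contradiction (≤-trans (pw-1≤ (1≤ι 1≤#E) n) (≤≡ p (trans (cong (_* pw (1ℚ + θ * θ) n) ι0) (*-zeroˡ _)))) λ q → <-irrefl refl (<-≤-trans 0<1 q)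

      Ω : Set
      Ω = Fin (length wins)

      Q : List Ω
      Q = allFin (length wins)

      #Q≡ : length Q ≡ length wins
      #Q≡ = length-tabulate id

      1≤#Q : 1 ℕ.≤ length Q
      1≤#Q = subst (1 ℕ.≤_) (sym #Q≡) 1≤#wins

      v : Ω → Vec (X × Y) n
      v = lookup wins

      x : ℕ → Ω → X
      x i ω = proj₁ (vnth e₀ (v ω) i)

      y : ℕ → Ω → Y
      y i ω = proj₂ (vnth e₀ (v ω) i)

      open Transcript

      bits : ℕ → Ω → Bool
      bits k ω = say (alternate k) (node tr (transcript tr k (xs (v ω)) (ys (v ω)))) (xs (v ω)) (ys (v ω))

      prefix≡ : ∀ k ω → prefix bits k ω ≡ transcript tr k (xs (v ω)) (ys (v ω))
      prefix≡ zero    ω = refl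
      prefix≡ (suc k) ω = cong (bits k ω ∷_) (prefix≡ k ω)

      v∈ : ∀ ω → v ω ∈ allVecs E n × (run tr (xs (v ω)) (ys (v ω)) ≡ Vec.zipWith (λ a b → f (a , b)) (xs (v ω)) (ys (v ω)))
      v∈ ω = ∈-filter⁻ win? {xs = allVecs E n} (∈-lookup {xs = wins} ω)

      pt∈E : ∀ {j} → j ℕ.< n → ∀ ω → (x j ω , y j ω) ∈ E
      pt∈E j<n ω = ∈-allVecs e₀ (proj₁ (v∈ ω)) _ j<n

      full : ∀ ω → ω ∈ Q
      full = ∈-allFin

      z : ℕ → List Bool → Bool
      z j u = vnth false (leaf tr (Vec.replicate n false) (node tr u)) j

      win : ∀ {j} → j ℕ.< n → ∀ ω → z j (prefix bits T ω) ≡ f (x j ω , y j ω)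
      win {j} j<n ω = trans (cong (z j) (prefix≡ T ω)) (trans (cong (λ o → vnth false o j) (trans (label-run tr _ Td (xs (v ω)) (ys (v ω)) depth≤) (proj₂ (v∈ ω))))
        (trans (vnth-zipWith (λ a b → f (a , b)) (proj₁ e₀) (proj₂ e₀) false (xs (v ω)) (ys (v ω)) j j<n)
          (cong₂ (λ a b → f (a , b)) (vnth-map proj₁ e₀ (proj₁ e₀) (v ω) j j<n) (vnth-map proj₂ e₀ (proj₂ e₀) (v ω) j j<n))))

      open Coordinates Q full 1≤#Q E _≟X_ _≟Y_ n x y bits alternate pt∈E 1≤#E
      open Log N 1≤N

      same-xs : ∀ {ω ω′} → (∀ i → i ℕ.< n → x i ω ≡ x i ω′) → xs (v ω) ≡ xs (v ω′)
      same-xs {ω} {ω′} e = vnth-ext (proj₁ e₀) _ _ λ i p → trans (vnth-map proj₁ e₀ _ (v ω) i p) (trans (e i p) (sym (vnth-map proj₁ e₀ _ (v ω′) i p)))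

      same-ys : ∀ {ω ω′} → (∀ i → i ℕ.< n → y i ω ≡ y i ω′) → ys (v ω) ≡ ys (v ω′)
      same-ys {ω} {ω′} e = vnth-ext (proj₂ e₀) _ _ λ i p → trans (vnth-map proj₂ e₀ _ (v ω) i p) (trans (e i p) (sym (vnth-map proj₂ e₀ _ (v ω′) i p)))

      same-transcript : ∀ {k ω ω′} → (∀ i → i ℕ.< k → bits i ω ≡ bits i ω′) → transcript tr k (xs (v ω)) (ys (v ω)) ≡ transcript tr k (xs (v ω′)) (ys (v ω′))
      same-transcript {k} {ω} {ω′} e = trans (sym (prefix≡ k ω)) (trans (bits-prefix bits k e) (prefix≡ k ω′))

      say-x : ∀ (t : Tree (Vec X n) (Vec Y n) (Vec Bool n)) a b b′ → say true t a b ≡ say true t a b′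
      say-x (output _)  a b b′ = refl
      say-x (alice _ _) a b b′ = refl
      say-x (bob _ _)   a b b′ = refl

      say-y : ∀ (t : Tree (Vec X n) (Vec Y n) (Vec Bool n)) a a′ b → say false t a b ≡ say false t a′ b
      say-y (output _)  a a′ b = refl
      say-y (alice _ _) a a′ b = refl
      say-y (bob _ _)   a a′ b = refl

      detA : ∀ k {ω ω′} → alternate k ≡ true → Rel n n k ∋ ω ≈ ω′ → bits k ω ≡ bits k ω′
      detA k {ω} {ω′} o (p , _ , r) = trans (cong₂ (λ t a → say (alternate k) (node tr t) a (ys (v ω))) (same-transcript r) (same-xs p))
        (subst (λ w → say w t′ (xs (v ω′)) (ys (v ω)) ≡ say w t′ (xs (v ω′)) (ys (v ω′))) (sym o) (say-x t′ _ _ _))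
        where
        t′ : Tree (Vec X n) (Vec Y n) (Vec Bool n)
        t′ = node tr (transcript tr k (xs (v ω′)) (ys (v ω′)))

      detB : ∀ k {ω ω′} → alternate k ≡ false → Rel 0 0 k ∋ ω ≈ ω′ → bits k ω ≡ bits k ω′
      detB k {ω} {ω′} o (_ , q , r) = trans (cong₂ (λ t b → say (alternate k) (node tr t) (xs (v ω)) b) (same-transcript r) (same-ys λ i p → q i p z≤n))
        (subst (λ w → say w t′ (xs (v ω)) (ys (v ω′)) ≡ say w t′ (xs (v ω′)) (ys (v ω′))) (sym o) (say-y t′ _ _ _))
        where
        t′ : Tree (Vec X n) (Vec Y n) (Vec Bool n)
        t′ = node tr (transcript tr k (xs (v ω′)) (ys (v ω′)))

      _≟V_ : DecidableEquality (Vec (X × Y) n)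
      _≟V_ = VecP.≡-dec (×P.≡-dec _≟X_ _≟Y_)

      hprod : ∀ ω → c (Rel n 0 0) ω ≤ prodTo (λ j → ι (μ j ω)) n
      hprod ω = ≡≤ (c-∑ (Rel n 0 0) ω) (≤-trans (∑-mono Q λ ω′ → ind-mono (Rel n 0 0 ∋ ω ≈? ω′) (v ω ≟V v ω′) same)
        (≡≤ (trans (∑-lookup wins (λ u → ind (v ω ≟V u))) (∑-filter win? (allVecs E n) _))
        (≤≡ (∑-mono (allVecs E n) λ u → ≤≡ (*ʳ _ (0≤ind (v ω ≟V u)) (ind≤1 (win? u))) (*-identityˡ _))
          (count-vec (×P.≡-dec _≟X_ _≟Y_) E e₀ (v ω)))))
        where
        same : ∀ {ω′} → Rel n 0 0 ∋ ω ≈ ω′ → v ω ≡ v ω′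
        same (p , q , _) = vnth-ext e₀ _ _ λ i h → cong₂ _,_ (p i h) (q i h z≤n)

      1+θθ≤ : 1ℚ + θ * θ ≤ pw β N₁
      1+θθ≤ = ≡≤ (cong (1ℚ +_) (sym (trans (cong (_* inv N) (sym θθN)) (trans (*-assoc _ (ι N) (inv N)) (trans (cong (θ * θ *_) (ι*inv 1≤N)) (*-identityʳ _)))))) (β^≥ N₁)

      -- The hypothesis `many` in logarithms, with `1 + θ² ≤ β ^ N₁` for the density.
      hsize : ι n * ι (lg (length E)) ≤ ι (lg (length Q)) + 1ℚ + ι n * ι N₁
      hsize = ≡≤ (sym (ι-* n _)) (≤≡ (ι-mono (β^-cancel powers))
          (trans (ι-+ (suc (lg (length Q))) (n ℕ.* N₁)) (cong₂ _+_ (trans (ι-suc _) (+-comm 1ℚ _)) (ι-* n N₁))))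
        where
        powers : pw β (n ℕ.* lg (length E)) ≤ pw β (suc (lg (length Q)) ℕ.+ n ℕ.* N₁)
        powers = ≡≤ (pw-∸ β n (lg (length E))) (≤-trans (pw-mono (pw-0≤ 0≤β (lg (length E))) (lg-≤ 1≤#E) n) (≤-trans many
          (≤≡ (*-mono (0≤ι _) (pw-0≤ (pw-0≤ 0≤β N₁) n)
            (≡≤ (cong ι (sym #Q≡)) (lg-≥ (length Q))) (pw-mono (0≤+ 0≤1 (0≤* (0≤inv H) (0≤inv H))) 1+θθ≤ n))
          (trans (cong (pw β (suc (lg (length Q))) *_) (sym (pw-∸ β n N₁))) (sym (pw-+ β (suc (lg (length Q))) (n ℕ.* N₁)))))))

      simulation : Σ[ t ∈ Tree X Y Bool ] depth t ℕ.≤ (8 ℕ.+ ((J ℕ.+ J ℕ.* d) ℕ.+ (J ℕ.+ J ℕ.* d))) ℕ.* 16 ℕ.+ 1 ×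
        ι 3 * ι (length E) ≤ ι 4 * ∑ E (λ e → ind (run t (proj₁ e) (proj₂ e) BoolP.≟ f e))
      simulation = Combine.simulation Q full 1≤#Q E _≟X_ _≟Y_ n x y bits alternate pt∈E 1≤#E f T J d N N₁ 1≤N 1≤d 1≤J T<2^J z win
        detA detB hprod hsize 1≤n h s N₂ refl eq₂ hA hB hC hs hd′ thresholds

 -- Regret matching

 module RegretMatching where

  open import Data.List.Base using ([]; _∷_)
  open import Data.List.Relation.Unary.All using ([]; _∷_)
  open import Data.Nat.Base as ℕ using (zero; suc)
  open import Defs using (Tree; run; depth)
  open Sums
  open Logarithms

  ι-∸ : ∀ m n → ι (m ℕ.∸ n) ≡ plus (ι m - ι n)
  ι-∸ m n with ℕP.≤-total m n
  ... | inj₁ p = trans (cong ι (ℕP.m≤n⇒m∸n≡0 p)) (trans ι0 (sym (plus-0 (≤≡ (+-monoˡ-≤ (- ι n) (ι-mono p)) (+-inverseʳ (ι n))))))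
  ... | inj₂ p = trans (identity-148 (ι (m ℕ.∸ n)) (ι n)) (trans (cong (_- ι n) (trans (sym (ι-+ (m ℕ.∸ n) n)) (cong ι (ℕP.m∸n+n≡m p)))) (sym (plus≡ (0≤- (ι-mono p)))))

  square-step : ∀ a δ → δ * δ ≤ ι 25 → plus (a + δ) * plus (a + δ) ≤ plus a * plus a + (1ℚ + 1ℚ) * (plus a * δ) + ι 25
  square-step a δ h = go (≤-total 0ℚ (a + δ))
    where
    u : ℚ
    u = plus a
    rest : (u + δ) * (u + δ) ≤ u * u + (1ℚ + 1ℚ) * (u * δ) + ι 25
    rest = ≡≤ (identity-149 u δ) (+-monoʳ-≤ _ h)
    go : 0ℚ ≤ a + δ ⊎ a + δ ≤ 0ℚ → plus (a + δ) * plus (a + δ) ≤ u * u + (1ℚ + 1ℚ) * (u * δ) + ι 25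
    go (inj₁ p) = ≡≤ (cong (λ w → w * w) (plus≡ p)) (≤-trans (*-mono p (≤-trans p (+-monoˡ-≤ δ (≤plus a))) (+-monoˡ-≤ δ (≤plus a)) (+-monoˡ-≤ δ (≤plus a))) rest)
    go (inj₂ p) = ≡≤ (trans (cong (λ w → w * w) (plus-0 p)) (*-zeroˡ 0ℚ)) (≤-trans (square-0≤ (u + δ)) rest)

  square-cancel : ∀ {a b} → 0ℚ ≤ a → 0ℚ ≤ b → a * a ≤ b * b → a ≤ b
  square-cancel {a} {b} 0≤a 0≤b h with ≤-total a b
  ... | inj₁ p = p
  ... | inj₂ p = decide (a ≤? b)
    where
    decide : Dec (a ≤ b) → a ≤ b
    decide (yes q) = q
    decide (no ¬q) = contradiction (<-≤-trans (*ˡ-< a (≤-<-trans 0≤b (≰⇒> ¬q)) (≰⇒> ¬q)) h′) (<-irrefl refl)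
      where
      h′ : a * a ≤ a * b
      h′ = ≤-trans h (*ʳ b 0≤b p)

  -- Regret matching: the next tree is chosen against the positive parts of the deficits of the points.
  module Minimax {X Y : Set} (f : X × Y → Bool) (P : List (X × Y)) (1≤#P : 1 ℕ.≤ length P) (D : ℕ)
    (respond : ∀ E → (∀ {e} → e ∈ E → e ∈ P) → Σ[ t ∈ Tree X Y Bool ] depth t ℕ.≤ D ×
      ι 5 * ι (length E) ≤ ι 8 * ∑ E (λ e → ind (run t (proj₁ e) (proj₂ e) BoolP.≟ f e))) where

    right? : ∀ (e : X × Y) (t : Tree X Y Bool) → Dec (run t (proj₁ e) (proj₂ e) ≡ f e)
    right? e t = run t (proj₁ e) (proj₂ e) BoolP.≟ f e

    weight : List (Tree X Y Bool) → X × Y → ℕ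
    weight ts e = 5 ℕ.* length ts ℕ.∸ 8 ℕ.* count (right? e) ts

    deficit : List (Tree X Y Bool) → X × Y → ℚ
    deficit ts e = ι 5 * ι (length ts) - ι 8 * ι (count (right? e) ts)

    ι-weight : ∀ ts e → ι (weight ts e) ≡ plus (deficit ts e)
    ι-weight ts e = trans (ι-∸ (5 ℕ.* length ts) (8 ℕ.* count (right? e) ts)) (cong plus (cong₂ _-_ (ι-* 5 (length ts)) (ι-* 8 _)))

    -- The positive parts of the deficits are natural numbers and serve as multiplicities, so a
    -- weighting of the points becomes a list to which `respond` applies.
    sample : List (Tree X Y Bool) → List (X × Y) → List (X × Y)
    sample ts = concatMap (λ e → replicate (weight ts e) e)

    ∑-replicate : ∀ k (e : X × Y) g → ∑ (replicate k e) g ≡ ι k * g e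
    ∑-replicate zero    e g = sym (trans (cong (_* g e) ι0) (*-zeroˡ (g e)))
    ∑-replicate (suc k) e g = trans (cong (g e +_) (∑-replicate k e g)) (trans (identity-2 (g e) (ι k)) (cong (_* g e) (sym (ι-suc k))))

    ∑-sample : ∀ ts P g → ∑ (sample ts P) g ≡ ∑ P (λ e → plus (deficit ts e) * g e)
    ∑-sample ts P g = trans (∑-concatMap (λ e → replicate (weight ts e) e) P g) (∑-cong P λ e → trans (∑-replicate (weight ts e) e g) (cong (_* g e) (ι-weight ts e)))

    sample⊆ : ∀ ts P′ {e} → e ∈ sample ts P′ → e ∈ P′
    sample⊆ ts (p ∷ P′) m with ∈-++⁻ (replicate (weight ts p) p) m
    ... | inj₁ r = here (∈-replicate (weight ts p) r)
      where
      ∈-replicate : ∀ k {e} → e ∈ replicate k p → e ≡ p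
      ∈-replicate (suc k) (here q)  = q
      ∈-replicate (suc k) (there q) = ∈-replicate k q
    ... | inj₂ r = there (sample⊆ ts P′ r)

    Φ : List (Tree X Y Bool) → ℚ
    Φ ts = ∑ P (λ e → plus (deficit ts e) * plus (deficit ts e))

    δ : Tree X Y Bool → X × Y → ℚ
    δ t e = ι 5 - ι 8 * ind (right? e t)

    deficit-∷ : ∀ t ts e → deficit (t ∷ ts) e ≡ deficit ts e + δ t e
    deficit-∷ t ts e = trans (cong₂ (λ a b → ι 5 * a - ι 8 * b) (ι-suc (length ts)) (trans (ι-+ (if does (right? e t) then 1 else 0) _) (cong (_+ ι (count (right? e) ts)) (ι-ind (right? e t)))))
        (identity-147 (ι 5) (ι 8) (ι (length ts)) (ind (right? e t)) (ι (count (right? e) ts)))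
      where
      ι-ind : ∀ {A : Set} (d : Dec A) → ι (if does d then 1 else 0) ≡ ind d
      ι-ind (yes _) = ι1
      ι-ind (no _)  = ι0

    δ²≤ : ∀ t e → δ t e * δ t e ≤ ι 25
    δ²≤ t e = go (right? e t)
      where
      opaque
        unfolding _+_
        yes≤ : (ι 5 - ι 8 * 1ℚ) * (ι 5 - ι 8 * 1ℚ) ≤ ι 25
        yes≤ = toWitness {a? = (ι 5 - ι 8 * 1ℚ) * (ι 5 - ι 8 * 1ℚ) ≤? ι 25} tt
        no≤ : (ι 5 - ι 8 * 0ℚ) * (ι 5 - ι 8 * 0ℚ) ≤ ι 25
        no≤ = toWitness {a? = (ι 5 - ι 8 * 0ℚ) * (ι 5 - ι 8 * 0ℚ) ≤? ι 25} tt
      go : ∀ {A : Set} (d : Dec A) → (ι 5 - ι 8 * ind d) * (ι 5 - ι 8 * ind d) ≤ ι 25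
      go (yes _) = yes≤
      go (no _)  = no≤

    -- That the response is right on five eighths of the weighted points means exactly that the
    -- cross term in the expanded square is not positive. Only the squares of `δ`, which is `5` or
    -- `-3`, accumulate.
    Φ-step : ∀ t ts → ι 5 * ι (length (sample ts P)) ≤ ι 8 * ∑ (sample ts P) (λ e → ind (right? e t)) → Φ (t ∷ ts) ≤ Φ ts + ι (length P) * ι 25
    Φ-step t ts good = ≤-trans (∑-mono P λ e → ≡≤ (cong (λ u → plus u * plus u) (deficit-∷ t ts e)) (square-step (deficit ts e) (δ t e) (δ²≤ t e)))
      (≡≤ (trans (∑-+ P _ _) (cong₂ _+_ (trans (∑-+ P _ _) (cong (Φ ts +_) (∑-*ˡ P (1ℚ + 1ℚ) _))) (∑-const P (ι 25))))
      (+-monoˡ-≤ _ (≤≡ (+-monoʳ-≤ (Φ ts) (≤≡ (*ˡ (1ℚ + 1ℚ) (0≤+ 0≤1 0≤1) gain) (*-zeroʳ (1ℚ + 1ℚ)))) (+-identityʳ (Φ ts)))))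
      where
      gain : ∑ P (λ e → plus (deficit ts e) * δ t e) ≤ 0ℚ
      gain = ≡≤ (trans (sym (∑-sample ts P (δ t))) (trans (∑-- (sample ts P) _ _) (cong₂ _-_ (trans (∑-const (sample ts P) (ι 5)) (*-comm _ (ι 5))) (∑-*ˡ (sample ts P) (ι 8) _))))
        (≤≡ (+-monoˡ-≤ _ good) (+-inverseʳ _))

    play : ∀ k → Σ[ ts ∈ List (Tree X Y Bool) ] length ts ≡ k × All (λ t → depth t ℕ.≤ D) ts × Φ ts ≤ ι k * (ι (length P) * ι 25)
    play zero = [] , refl , [] , ≤-reflexive (trans (trans (∑-cong P λ e → trans (cong (λ u → u * u) (trans (cong plus (zero-deficit e)) (plus-0 ≤-refl))) (*-zeroˡ 0ℚ)) (∑-0 P)) (sym (trans (cong (_* (ι (length P) * ι 25)) ι0) (*-zeroˡ _))))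
      where
      zero-deficit : ∀ e → deficit [] e ≡ 0ℚ
      zero-deficit e = trans (cong (λ u → ι 5 * u - ι 8 * u) ι0) (identity-146 (ι 5) (ι 8))
    play (suc k) = step (play k)
      where
      step : _ → _
      step (ts , len , ds , bd) = extend (respond (sample ts P) (sample⊆ ts P))
        where
        extend : _ → _
        extend (t , dt , good) = t ∷ ts , cong suc len , dt ∷ ds , ≤-trans (Φ-step t ts good) (≤≡ (+-monoˡ-≤ _ bd)
            (trans (identity-145 (ι k) (ι (length P) * ι 25)) (cong (_* (ι (length P) * ι 25)) (sym (ι-suc k)))))

    rounds : ℕ
    rounds = 100 ℕ.* length P

    -- After `R = 100 ∣P∣` rounds a squared deficit is at most `25 R ∣P∣ = (50 ∣P∣)²`. With `c`
    -- right answers this says `5 R - 8 c ≤ R / 2`, that is `16 c ≥ 9 R`.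
    strategy : Σ[ ts ∈ List (Tree X Y Bool) ] length ts ≡ rounds × All (λ t → depth t ℕ.≤ D) ts ×
      (∀ {e} → e ∈ P → ι 9 * ι rounds ≤ ι 16 * ι (count (right? e) ts))
    strategy = finish (play rounds)
      where
      finish : _ → _
      finish (ts , len , ds , bd) = ts , len , ds , λ {e} e∈ → result e e∈
        where
        half : ℚ
        half = ι 50 * ι (length P)
        result : ∀ e → e ∈ P → ι 9 * ι rounds ≤ ι 16 * ι (count (right? e) ts)
        result e e∈ = -≤0⇒≤ (subst (0ℚ ≤_) shape (0≤+ (0≤- small) (0≤- small)))
          where
          squared : plus (deficit ts e) * plus (deficit ts e) ≤ half * half
          squared = ≤-trans (∑-≤∈ {f = λ e → plus (deficit ts e) * plus (deficit ts e)} (λ e → square-0≤ _) e∈) (≤-trans bd (≤-reflexive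
            (trans (cong (_* (ι (length P) * ι 25)) (ι-* 100 (length P))) (trans (identity-142 (ι 100) (ι (length P)) (ι 25)) (trans (cong (_* (ι (length P) * ι (length P))) (trans (sym (ι-* 100 25)) (ι-* 50 50))) (trans (sym (identity-142 (ι 50) (ι (length P)) (ι 50))) (identity-143 (ι 50) (ι (length P)))))))))
          small : deficit ts e ≤ half
          small = ≤-trans (≤plus _) (square-cancel (0≤plus _) (0≤* (0≤ι 50) (0≤ι (length P))) squared)
          shape : (half - deficit ts e) + (half - deficit ts e) ≡ ι 16 * ι (count (right? e) ts) - ι 9 * ι rounds
          shape = trans (cong (λ l → (half - (ι 5 * ι l - ι 8 * ι (count (right? e) ts))) + (half - (ι 5 * ι l - ι 8 * ι (count (right? e) ts)))) len)
            (trans (identity-144 half (ι 5) (ι rounds) (ι 8) (ι (count (right? e) ts))) (cong₂ (λ a b → a * ι (count (right? e) ts) - b) (sym (ι-+ 8 8)) nine))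
            where
            nine : (ι 5 + ι 5) * ι rounds - (half + half) ≡ ι 9 * ι rounds
            nine = trans (cong₂ _-_ (cong (_* ι rounds) (trans (sym (ι-+ 5 5)) (ι-suc 9))) (trans (sym (trans (cong (_* ι (length P)) (ι-+ 50 50)) (identity-140 (ι 50) (ι (length P))))) (sym (ι-* 100 (length P))))) (identity-141 (ι 9) (ι rounds))

 -- Partial sums of the exponential series and the addition theorem

 module ExponentialSeries where

  open import Data.Nat.Base as ℕ using (zero; suc)
  open Sums
  open Logarithms

  open Defs using (expTerm; expSum)

  opaque
    unfolding _+_

    expTerm-suc : ∀ q k → expTerm q (suc k) ≡ expTerm q k * q * inv (suc k)
    expTerm-suc q k = refl

    expSum-suc : ∀ q k → expSum q (suc k) ≡ expSum q k + expTerm q (suc k)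
    expSum-suc q k = refl

    expSum-tail : ∀ B → 0ℚ ≤ B → ∀ ε → 0ℚ < ε → Σ[ N ∈ ℕ ] (∀ m n → N ℕ.≤ m → m ℕ.≤ n → expSum B n - expSum B m ≤ ε)
    expSum-tail B 0≤B ε 0<ε = N₀ ℕ.⊔ N₁ , λ m n h m≤n → ≤-trans (Defs.Exp.S-tail B 0≤B (ℕP.≤-trans (ℕP.m≤m⊔n N₀ N₁) h) m≤n)
        (proj₂ (Defs.Exp.T-small B 0≤B ε 0<ε) m (ℕP.≤-trans (ℕP.m≤n⊔m N₀ N₁) h))
      where
      N₀ N₁ : ℕ
      N₀ = Defs.Exp.N₀ B 0≤B
      N₁ = proj₁ (Defs.Exp.T-small B 0≤B ε 0<ε)

  module _ where

    term-suc : ∀ q k → ι (suc k) * expTerm q (suc k) ≡ q * expTerm q k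
    term-suc q k = trans (cong (ι (suc k) *_) (expTerm-suc q k)) (trans (identity-165 (ι (suc k)) (expTerm q k) q (inv (suc k))) (trans (cong (_* (q * expTerm q k)) (inv*ι {suc k} (s≤s z≤n))) (*-identityˡ _)))

    0≤term : ∀ {q} → 0ℚ ≤ q → ∀ k → 0ℚ ≤ expTerm q k
    0≤term h zero    = 0≤1
    0≤term {q} h (suc k) = subst (0ℚ ≤_) (sym (expTerm-suc q k)) (0≤* (0≤* (0≤term h k) h) (0≤inv (suc k)))

    expSum-mono-index : ∀ {q} → 0ℚ ≤ q → ∀ {m n} → m ℕ.≤ n → expSum q m ≤ expSum q n
    expSum-mono-index {q} h {m} p = go (ℕP.≤⇒≤′ p)
      where
      go : ∀ {n} → m ℕ.≤′ n → expSum q m ≤ expSum q n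
      go ℕ.≤′-refl = ≤-refl
      go (ℕ.≤′-step {n} p) = ≤-trans (go p) (gap _ (0≤term h (suc n)) (expSum-suc q n))

    1≤expSum : ∀ {q} → 0ℚ ≤ q → ∀ m → 1ℚ ≤ expSum q m
    1≤expSum h m = expSum-mono-index h {0} {m} z≤n

    term-mono : ∀ {p q} → 0ℚ ≤ p → p ≤ q → ∀ k → expTerm p k ≤ expTerm q k
    term-mono h p≤q zero    = ≤-refl
    term-mono {p} {q} h p≤q (suc k) = subst₂ _≤_ (sym (expTerm-suc p k)) (sym (expTerm-suc q k))
      (*ʳ (inv (suc k)) (0≤inv (suc k)) (*-mono (0≤term h k) (≤-trans h p≤q) (term-mono h p≤q k) p≤q))

    expSum-mono : ∀ {p q} → 0ℚ ≤ p → p ≤ q → ∀ m → expSum p m ≤ expSum q m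
    expSum-mono h p≤q zero    = ≤-refl
    expSum-mono {p} {q} h p≤q (suc m) = subst₂ _≤_ (sym (expSum-suc p m)) (sym (expSum-suc q m)) (+-mono-≤ (expSum-mono h p≤q m) (term-mono h p≤q (suc m)))

    -- The inequality `exp q ≤ 1 / (1 - q)`. Carrying the remainder `q * expTerm q m` along makes
    -- the induction close, as each term is at most `q` times the preceding one.
    expSum-geometric : ∀ {q} → 0ℚ ≤ q → ∀ m → (1ℚ - q) * expSum q m ≤ 1ℚ
    expSum-geometric {q} h m = ≤-trans (gap _ (0≤* h (0≤term h m)) refl) (go m)
      where
      go : ∀ m → (1ℚ - q) * expSum q m + q * expTerm q m ≤ 1ℚ
      go zero    = ≤-reflexive (identity-150 q)
      go (suc m) = ≡≤ (trans (cong (λ u → (1ℚ - q) * u + q * t′) (expSum-suc q m)) (identity-151 q (expSum q m) t′)) (≤-trans (+-monoʳ-≤ _ smaller) (go m))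
        where
        t′ : ℚ
        t′ = expTerm q (suc m)
        smaller : t′ ≤ q * expTerm q m
        smaller = ≤≡ (≡≤ (sym (*-identityˡ t′)) (*ʳ t′ (0≤term h (suc m)) (1≤ι {suc m} (s≤s z≤n)))) (term-suc q m)

  infix 4 ∣_∣≤_
  ∣_∣≤_ : ℚ → ℚ → Set
  ∣ a ∣≤ b = a ≤ b × - a ≤ b

  module _ where

    abs-* : ∀ {a A b B} → ∣ a ∣≤ A → ∣ b ∣≤ B → ∣ a * b ∣≤ A * B
    abs-* {a} {A} {b} {B} (p , p′) (q , q′) =
        -≤0⇒≤ (≤-half (subst (0ℚ ≤_) (identity-166 a A b B) (0≤+ (0≤* (0≤- p) (0≤- q′)) (0≤* (0≤- p′) (0≤- q))))) ,
        -≤0⇒≤ (≤-half (subst (0ℚ ≤_) (identity-167 a A b B) (0≤+ (0≤* (0≤- p) (0≤- q)) (0≤* (0≤- p′) (0≤- q′)))))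

    abs-+ : ∀ {a A b B} → ∣ a ∣≤ A → ∣ b ∣≤ B → ∣ a + b ∣≤ A + B
    abs-+ {a} {A} {b} {B} (p , p′) (q , q′) = +-mono-≤ p q , ≡≤ (neg-distrib-+ a b) (+-mono-≤ p′ q′)

    abs-nonneg : ∀ {a} → 0ℚ ≤ a → ∣ a ∣≤ a
    abs-nonneg {a} h = ≤-refl , ≤-trans (≤≡ (neg-≤ h) neg-0) h

    abs-0≤ : ∀ {a A} → ∣ a ∣≤ A → 0ℚ ≤ A
    abs-0≤ {a} {A} (p , p′) = ≤-half (≡≤ (sym (+-inverseʳ a)) (+-mono-≤ p p′))

    abs-term : ∀ {a A} → ∣ a ∣≤ A → ∀ k → ∣ expTerm a k ∣≤ expTerm A k
    abs-term h zero    = abs-nonneg 0≤1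
    abs-term {a} {A} h (suc k) = subst₂ ∣_∣≤_ (sym (expTerm-suc a k)) (sym (expTerm-suc A k)) (abs-* (abs-* (abs-term h k) h) (abs-nonneg (0≤inv (suc k))))

    abs-tail : ∀ {a A} → ∣ a ∣≤ A → ∀ {j m} → j ℕ.≤ m → ∣ expSum a m - expSum a j ∣≤ expSum A m - expSum A j
    abs-tail {a} {A} h {j} p = go (ℕP.≤⇒≤′ p)
      where
      go : ∀ {m} → j ℕ.≤′ m → ∣ expSum a m - expSum a j ∣≤ expSum A m - expSum A j
      go ℕ.≤′-refl = subst₂ ∣_∣≤_ (sym (+-inverseʳ _)) (sym (+-inverseʳ _)) (abs-nonneg ≤-refl)
      go (ℕ.≤′-step {m} p) = subst₂ ∣_∣≤_ (trans (identity-152 (expSum a m) (expSum a j) (expTerm a (suc m))) (cong (_- expSum a j) (sym (expSum-suc a m))))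
        (trans (identity-152 (expSum A m) (expSum A j) (expTerm A (suc m))) (cong (_- expSum A j) (sym (expSum-suc A m)))) (abs-+ (go p) (abs-term h (suc m)))

  -- Σ_{r ≤ i} u r * f (j + (i - r))
  convolve : (ℕ → ℚ) → (ℕ → ℚ) → ℕ → ℕ → ℚ
  convolve u f zero    j = u 0 * f j
  convolve u f (suc i) j = convolve u f i (suc j) + u (suc i) * f j

  module _ (a b : ℚ) where

    private
      u v V : ℕ → ℚ
      u = expTerm a
      v = expTerm b
      V = expSum b
      W : ℕ → ℕ → ℚ
      W = convolve u v

      product-rule : ∀ i j → ι (suc i ℕ.+ suc j) * (u (suc i) * v (suc j)) ≡ a * (u i * v (suc j)) + b * (u (suc i) * v j)
      product-rule i j = trans (cong (_* (u (suc i) * v (suc j))) (ι-+ (suc i) (suc j))) (trans (identity-153 (ι (suc i)) (ι (suc j)) (u (suc i)) (v (suc j)))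
          (trans (cong₂ (λ p q → p * v (suc j) + u (suc i) * q) (term-suc a i) (term-suc b j)) (identity-154 a (u i) (v (suc j)) b (u (suc i)) (v j))))

      -- the derivation rule for Σ aʳ bˢ / (r! s!)
      W-suc : ∀ i j → ι (suc i ℕ.+ suc j) * W (suc i) (suc j) ≡ a * W i (suc j) + b * W (suc i) j
      W-zero : ∀ j → ι (suc j) * W 0 (suc j) ≡ b * W 0 j
      W-zero j = trans (identity-155 (ι (suc j)) (v (suc j))) (trans (term-suc b j) (identity-156 b (v j)))
      W-suc zero j = trans (*-distribˡ-+ (ι (suc (suc j))) (W 0 (suc (suc j))) (u 1 * v (suc j))) (trans (cong₂ _+_ (W-zero (suc j)) (product-rule 0 j))
          (identity-157 b (W 0 (suc j)) (a * W 0 (suc j)) (u 1 * v j)))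
      W-suc (suc i) j = trans (*-distribˡ-+ (ι (suc (suc i) ℕ.+ suc j)) (W (suc i) (suc (suc j))) (u (suc (suc i)) * v (suc j)))
          (trans (cong₂ _+_ (trans (cong (λ k → ι k * W (suc i) (suc (suc j))) (sym (ℕP.+-suc (suc i) (suc j)))) (W-suc i (suc j))) (product-rule (suc i) j))
          (identity-158 a (W i (suc (suc j))) (u (suc i) * v (suc j)) b (W (suc i) (suc j)) (u (suc (suc i)) * v j)))

      W-diagonal : ∀ i → ι (suc i) * W (suc i) 0 ≡ (a + b) * W i 0
      W-diagonal zero    = trans (*-distribˡ-+ (ι 1) (W 0 1) (u 1 * v 0)) (trans (cong₂ _+_ (W-zero 0) (trans (identity-159 (ι 1) (u 1)) (term-suc a 0))) (identity-160 a b))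
      W-diagonal (suc i) = trans (*-distribˡ-+ (ι (suc (suc i))) (W (suc i) 1) (u (suc (suc i)) * v 0))
          (trans (cong₂ _+_ (trans (cong (λ k → ι k * W (suc i) 1) (sym (trans (ℕP.+-suc (suc i) 0) (cong suc (ℕP.+-identityʳ (suc i)))))) (W-suc i 0)) (trans (identity-159 (ι (suc (suc i))) (u (suc (suc i)))) (term-suc a (suc i))))
          (identity-161 a b (W i 1) (u (suc i))))

      -- Both sides satisfy the recursion `(k + 1) u (k + 1) = (a + b) u k`, which avoids binomial
      -- coefficients.
      binomial : ∀ k → W k 0 ≡ expTerm (a + b) k
      binomial zero    = *-identityˡ 1ℚ
      binomial (suc k) = ≤-antisym (ι-cancelˡ {suc k} (s≤s z≤n) (≤-reflexive same)) (ι-cancelˡ {suc k} (s≤s z≤n) (≤-reflexive (sym same)))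
        where
        same : ι (suc k) * W (suc k) 0 ≡ ι (suc k) * expTerm (a + b) (suc k)
        same = trans (W-diagonal k) (trans (cong ((a + b) *_) (binomial k)) (sym (term-suc (a + b) k)))

      partial : ∀ i j → convolve u V i (suc j) ≡ convolve u V i j + W i (suc j)
      partial zero    j = trans (cong (u 0 *_) (expSum-suc b j)) (*-distribˡ-+ (u 0) (V j) (v (suc j)))
      partial (suc i) j = trans (cong₂ (λ p q → p + u (suc i) * q) (partial i (suc j)) (expSum-suc b j)) (identity-162 (convolve u V i (suc j)) (W i (suc (suc j))) (u (suc i)) (V j) (v (suc j)))

    convolve-expSum : ∀ m → convolve u V m 0 ≡ expSum (a + b) m
    convolve-expSum zero    = *-identityˡ 1ℚ
    convolve-expSum (suc m) = trans (cong (_+ u (suc m) * 1ℚ) (partial m 0)) (trans (+-assoc (convolve u V m 0) _ _) (trans (cong₂ _+_ (convolve-expSum m) (binomial (suc m))) (sym (expSum-suc (a + b) m))))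

    module _ {A B : ℚ} (a≤ : ∣ a ∣≤ A) (b≤ : ∣ b ∣≤ B) where

      -- A product of partial sums extends over a square of index pairs, the corresponding partial
      -- sum of the convolution over a triangle. The surplus terms are dominated by those for `A`
      -- and `B`.
      square-minus-triangle : ∀ M i j → i ℕ.+ j ℕ.≤ M →
        ∣ expSum a i * V M - convolve u V i j ∣≤ expSum A i * expSum B M - convolve (expTerm A) (expSum B) i j
      square-minus-triangle M zero    j h = subst₂ ∣_∣≤_ (identity-163 1ℚ (V M) (V j)) (identity-163 1ℚ (expSum B M) (expSum B j)) (abs-* (abs-term a≤ 0) (abs-tail b≤ h))
      square-minus-triangle M (suc i) j h = subst₂ ∣_∣≤_
          (trans (identity-164 (expSum a i) (V M) (convolve u V i (suc j)) (u (suc i)) (V j)) (cong (λ s → s * V M - convolve u V (suc i) j) (sym (expSum-suc a i))))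
          (trans (identity-164 (expSum A i) (expSum B M) (convolve (expTerm A) (expSum B) i (suc j)) (expTerm A (suc i)) (expSum B j)) (cong (λ s → s * expSum B M - convolve (expTerm A) (expSum B) (suc i) j) (sym (expSum-suc A i))))
          (abs-+ (square-minus-triangle M i (suc j) (subst (ℕ._≤ M) (sym (ℕP.+-suc i j)) h)) (abs-* (abs-term a≤ (suc i)) (abs-tail b≤ (ℕP.≤-trans (ℕP.m≤n+m j (suc i)) h))))

      exp-product : ∀ m → ∣ expSum a m * expSum b m - expSum (a + b) m ∣≤ expSum A m * expSum B m - convolve (expTerm A) (expSum B) m 0
      exp-product m = subst (λ r → ∣ expSum a m * expSum b m - r ∣≤ expSum A m * expSum B m - convolve (expTerm A) (expSum B) m 0) (convolve-expSum m)
        (square-minus-triangle m m 0 (ℕP.≤-reflexive (ℕP.+-identityʳ m)))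

  expSum-+≤ : ∀ {a b} → 0ℚ ≤ a → 0ℚ ≤ b → ∀ m → expSum (a + b) m ≤ expSum a m * expSum b m
  expSum-+≤ {a} {b} 0≤a 0≤b m = -≤0⇒≤ (subst (λ r → 0ℚ ≤ expSum a m * expSum b m - r) (convolve-expSum a b m) (abs-0≤ (exp-product a b (abs-nonneg 0≤a) (abs-nonneg 0≤b) m)))

  expSum-ι* : ∀ {a} → 0ℚ ≤ a → ∀ n m → expSum (ι n * a) m ≤ pw (expSum a m) n
  expSum-ι* {a} h zero    m = ≤≡ (expSum-mono (0≤* (0≤ι 0) h) (≤-reflexive (trans (cong (_* a) ι0) (*-zeroˡ a))) m) (at-0 m)
    where
    term-0 : ∀ k → expTerm 0ℚ (suc k) ≡ 0ℚ
    term-0 k = trans (expTerm-suc 0ℚ k) (trans (cong (_* inv (suc k)) (*-zeroʳ _)) (*-zeroˡ _))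
    at-0 : ∀ m → expSum 0ℚ m ≡ 1ℚ
    at-0 zero    = refl
    at-0 (suc m) = trans (expSum-suc 0ℚ m) (trans (cong₂ _+_ (at-0 m) (term-0 m)) (+-identityʳ 1ℚ))
  expSum-ι* {a} h (suc n) m = ≡≤ (cong (λ q → expSum q m) (trans (cong (_* a) (ι-suc n)) (identity-169 a (ι n)))) (≤-trans (expSum-+≤ h (0≤* (0≤ι n) h) m)
    (*ˡ (expSum a m) (≤-trans 0≤1 (1≤expSum h m)) (expSum-ι* h n m)))

  -- for arguments in [-B, B], the error of the addition theorem is at most the tail of the series at 2 B
  exp-additive : ∀ B → 0ℚ ≤ B → ∀ ε → 0ℚ < ε → Σ[ N ∈ ℕ ] (∀ m a b → N ℕ.≤ m → ∣ a ∣≤ B → ∣ b ∣≤ B → ∣ expSum a m * expSum b m - expSum (a + b) m ∣≤ ε)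
  exp-additive B 0≤B ε 0<ε = N , λ m a b h a≤ b≤ → bound m h (exp-product a b a≤ b≤ m)
    where
    N : ℕ
    N = proj₁ (expSum-tail (B + B) (0≤+ 0≤B 0≤B) ε 0<ε)
    S t : ℕ → ℚ
    S = expSum B
    t = expTerm B
    R : ℕ → ℕ → ℚ
    R = convolve t S
    R-shift : ∀ i k j → R i (k ℕ.+ j) ≤ R (k ℕ.+ i) j
    R-shift i zero    j = ≤-refl
    R-shift i (suc k) j = ≤-trans (subst (λ l → R i (suc (k ℕ.+ j)) ≤ R i l) (sym (ℕP.+-suc k j)) ≤-refl) (≤-trans (R-shift i k (suc j)) (gap _ (0≤* (0≤term 0≤B (suc (k ℕ.+ i))) (≤-trans 0≤1 (1≤expSum 0≤B j))) refl))
    S*S≤R : ∀ i j → S i * S j ≤ R i j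
    S*S≤R zero    j = ≤-refl
    S*S≤R (suc i) j = ≡≤ (trans (cong (_* S j) (expSum-suc B i)) (identity-168 (S i) (t (suc i)) (S j))) (+-monoˡ-≤ _ (≤-trans (*ˡ (S i) (≤-trans 0≤1 (1≤expSum 0≤B i)) (expSum-mono-index 0≤B (ℕP.n≤1+n j))) (S*S≤R i (suc j))))
    -- The square of side `m` fits into the triangle of side `2 m`.
    close : ∀ m → N ℕ.≤ m → S m * S m - R m 0 ≤ ε
    close m h = ≤-trans (+-mono-≤ (≤-trans (S*S≤R m m) (≤-trans (subst (λ l → R m m ≤ R m l) (sym (ℕP.+-identityʳ m)) ≤-refl) (≤≡ (R-shift m m 0) (convolve-expSum B B (m ℕ.+ m))))) (≤-reflexive (cong -_ (convolve-expSum B B m))))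
      (proj₂ (expSum-tail (B + B) (0≤+ 0≤B 0≤B) ε 0<ε) m (m ℕ.+ m) h (ℕP.m≤m+n m m))
    bound : ∀ m → N ℕ.≤ m → ∀ {e} → ∣ e ∣≤ S m * S m - R m 0 → ∣ e ∣≤ ε
    bound m h (p , q) = ≤-trans p (close m h) , ≤-trans q (close m h)

  exp-inverse : ∀ B → 0ℚ ≤ B → ∀ ε → 0ℚ < ε → Σ[ N ∈ ℕ ] (∀ m q → N ℕ.≤ m → ∣ q ∣≤ B → ∣ expSum q m * expSum (- q) m - 1ℚ ∣≤ ε)
  exp-inverse B 0≤B ε 0<ε = N , λ m q h (p , p′) → subst (λ s → ∣ expSum q m * expSum (- q) m - s ∣≤ ε) (trans (cong (λ r → expSum r m) (+-inverseʳ q)) (at-0 m)) (proj₂ add m q (- q) h (p , p′) (p′ , ≡≤ (identity-170 q) p))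
    where
    add : _
    add = exp-additive B 0≤B ε 0<ε
    N : ℕ
    N = proj₁ add
    at-0 : ∀ m → expSum 0ℚ m ≡ 1ℚ
    at-0 m = ≤-antisym (≤-trans (expSum-mono ≤-refl (≤-reflexive (sym (trans (cong (_* 0ℚ) ι0) (*-zeroˡ 0ℚ)))) m) (expSum-ι* ≤-refl 0 m)) (1≤expSum ≤-refl m)

 -- Inequalities between Cauchy reals in terms of their sequences

 module Limits where

  open import Data.Fin.Base using (zero; suc)
  open import Data.Nat.Base as ℕ using (zero; suc)
  open Sums
  open Logarithms

  open D using (ℝ; seq; FiniteProbabilitySpace; size; prob; nonneg; total; expectation; Protocol; public-coins; alice-coins; bob-coins; tree; run)

  0<inv : ∀ {c} → 1 ℕ.≤ c → 0ℚ < inv c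
  0<inv {c} h = *-cancelʳ-< (ι c) (0≤ι c) (subst₂ _<_ (sym (*-zeroˡ (ι c))) (sym (inv*ι h)) 0<1)

  0<⊓ : ∀ {a b} → 0ℚ < a → 0ℚ < b → 0ℚ < a ⊓ b
  0<⊓ {a} {b} p q with ≤-total a b
  ... | inj₁ h = <-≤-trans p (⊓-glb ≤-refl h)
  ... | inj₂ h = <-≤-trans q (⊓-glb h ≤-refl)

  neg-neg : ∀ q → - (- q) ≡ q
  neg-neg = identity-170

  opaque
    unfolding _+_

    seq-+ : ∀ x y m → seq (x D.+ y) m ≡ seq x m + seq y m
    seq-+ x y m = refl

    seq-* : ∀ x y m → seq (x D.* y) m ≡ seq x m * seq y m
    seq-* x y m = refl

    seq-neg : ∀ x m → seq (D.- x) m ≡ - seq x m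
    seq-neg x m = refl

    seq-fromℕ : ∀ n m → seq (D.fromℕ n) m ≡ ι n
    seq-fromℕ n m = refl

    archimedean : ∀ p → Σ[ n ∈ ℕ ] p ≤ ι n
    archimedean = D.Rational.archimedean

    cauchy-≤ : ∀ x δ → 0ℚ < δ → Σ[ N ∈ ℕ ] (∀ m n → N ℕ.≤ m → N ℕ.≤ n → seq x m ≤ seq x n + δ)
    cauchy-≤ x δ 0<δ = proj₁ (D.cauchy x δ 0<δ) , λ m n hm hn → -≤0⇒≤ (subst (0ℚ ≤_) (identity-179 (seq x m) (seq x n) δ) (0≤- (≤-trans (p≤∣p∣ _) (proj₂ (D.cauchy x δ 0<δ) m n hm hn))))
      where
      p≤∣p∣ : ∀ p → p ≤ Q.∣ p ∣
      p≤∣p∣ p with QP.≤-total 0ℚ p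
      ... | inj₁ h = QP.≤-reflexive (sym (QP.0≤p⇒∣p∣≡p h))
      ... | inj₂ h = QP.≤-trans h (QP.0≤∣p∣ p)

    lower-bound : ∀ x → Σ[ B ∈ ℚ ] (∀ m → 0ℚ ≤ B + seq x m) × (∀ m → seq x m ≤ B) × 0ℚ ≤ B
    lower-bound x with D.Bounds.bound x
    ... | B , 0≤B , b = B , (λ m → ≡≤ (sym (QP.+-inverseʳ B)) (QP.+-monoʳ-≤ B (≤-trans (QP.neg-antimono-≤ (b m)) (neg∣∣ (seq x m))))) ,
        (λ m → ≤-trans (QP.≤-trans (≤-reflexive (sym (neg-neg (seq x m)))) (QP.≤-trans (QP.neg-antimono-≤ (neg∣∣ (Q.- seq x m))) (≤-reflexive (trans (neg-neg _) (QP.∣-p∣≡∣p∣ (seq x m)))))) (b m)) , 0≤B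
      where
      neg∣∣ : ∀ p → Q.- Q.∣ p ∣ ≤ p
      neg∣∣ p with QP.≤-total 0ℚ p
      ... | inj₁ h = QP.≤-trans (QP.neg-antimono-≤ (QP.0≤∣p∣ p)) h
      ... | inj₂ h = QP.≤-reflexive (trans (cong Q.-_ (trans (sym (QP.∣-p∣≡∣p∣ p)) (QP.0≤p⇒∣p∣≡p (QP.neg-antimono-≤ h)))) (neg-neg p))

  Eventually : (ℕ → Set) → Set
  Eventually P = Σ[ N ∈ ℕ ] (∀ m → N ℕ.≤ m → P m)

  module _ where

    infixr 4 _&_
    _&_ : ∀ {P R : ℕ → Set} → Eventually P → Eventually R → Eventually (λ m → P m × R m)
    (N , p) & (M , r) = N ℕ.⊔ M , λ m h → p m (ℕP.≤-trans (ℕP.m≤m⊔n N M) h) , r m (ℕP.≤-trans (ℕP.m≤n⊔m N M) h)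

    always : ∀ {P : ℕ → Set} → (∀ m → P m) → Eventually P
    always p = 0 , λ m _ → p m

    infixl 1 _⇒_
    _⇒_ : ∀ {P R : ℕ → Set} → Eventually P → (∀ {m} → P m → R m) → Eventually R
    (N , p) ⇒ f = N , λ m h → f (p m h)

    all-Fin : ∀ n {P : Fin n → ℕ → Set} → (∀ i → Eventually (P i)) → Eventually (λ m → ∀ i → P i m)
    all-Fin zero    h = always λ _ ()
    all-Fin (suc n) h = h zero & all-Fin n (h ∘ suc) ⇒ λ { (p , q) zero → p ; (p , q) (suc i) → q i }

    opaque
      unfolding _+_

      <⇒ : ∀ x y → x D.< y → Σ[ ε ∈ ℚ ] 0ℚ < ε × Eventually (λ m → seq x m + ε ≤ seq y m)
      <⇒ x y h = h

      ⇒< : ∀ x y ε → 0ℚ < ε → Eventually (λ m → seq x m + ε ≤ seq y m) → x D.< y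
      ⇒< x y ε 0<ε h = ε , 0<ε , h

    -- `x ≤ y` is only a negation, but rational terms can be compared. At an index past both moduli
    -- the terms either satisfy the inequality up to `3 δ`, or their distance is a witness of
    -- `y < x`.
    ≤⇒ : ∀ x y → x D.≤ y → ∀ ε → 0ℚ < ε → Eventually (λ m → seq x m ≤ seq y m + ε)
    ≤⇒ x y x≤y ε 0<ε = go (seq x N ≤? seq y N + (δ + δ + δ))
      where
      δ : ℚ
      δ = ε * inv 5
      0<δ : 0ℚ < δ
      0<δ = 0<* 0<ε (0<inv (s≤s z≤n))
      cx : Σ[ N ∈ ℕ ] (∀ m n → N ℕ.≤ m → N ℕ.≤ n → seq x m ≤ seq x n + δ)
      cx = cauchy-≤ x δ 0<δ
      cy : Σ[ N ∈ ℕ ] (∀ m n → N ℕ.≤ m → N ℕ.≤ n → seq y m ≤ seq y n + δ)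
      cy = cauchy-≤ y δ 0<δ
      N : ℕ
      N = proj₁ cx ℕ.⊔ proj₁ cy
      N₁ : proj₁ cx ℕ.≤ N
      N₁ = ℕP.m≤m⊔n _ _
      N₂ : proj₁ cy ℕ.≤ N
      N₂ = ℕP.m≤n⊔m (proj₁ cx) _
      five : (δ + δ + δ) + δ + δ ≡ ε
      five = trans (identity-176 δ) (trans (cong (δ *_) (sym ι5)) (trans (*-assoc ε (inv 5) (ι 5)) (trans (cong (ε *_) (inv*ι {5} (s≤s z≤n))) (*-identityʳ ε))))
        where
        ι5 : ι 5 ≡ 1ℚ + (1ℚ + (1ℚ + (1ℚ + 1ℚ)))
        ι5 = trans (ι-suc 4) (cong (1ℚ +_) (trans (ι-suc 3) (cong (1ℚ +_) (trans (ι-suc 2) (cong (1ℚ +_) (trans (ι-suc 1) (cong (1ℚ +_) ι1)))))))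
      go : Dec (seq x N ≤ seq y N + (δ + δ + δ)) → Eventually (λ m → seq x m ≤ seq y m + ε)
      go (yes p) = N , λ m h → ≤-trans (proj₂ cx m N (ℕP.≤-trans N₁ h) N₁) (≤≡ (+-monoˡ-≤ δ (≤-trans p (+-monoˡ-≤ _ (proj₂ cy N m N₂ (ℕP.≤-trans N₂ h)))))
        (trans (identity-177 (seq y m) δ) (cong (seq y m +_) five)))
      go (no ¬p) = contradiction (⇒< y x δ 0<δ (N , λ m h → -≤0⇒≤ (subst (0ℚ ≤_) (identity-178 (seq x m) (seq y m) (seq x N) (seq y N) δ)
          (0≤+ (0≤- (<⇒≤ (≰⇒> ¬p))) (0≤+ (0≤- (proj₂ cx N m N₁ (ℕP.≤-trans N₁ h))) (0≤- (proj₂ cy m N (ℕP.≤-trans N₂ h) N₂))))))) x≤y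

    -- A term of `x` past the modulus for `ε / 4` is compared with `c + ε / 2`, where `ε` is a gap
    -- between `c` and `d`; either outcome leaves a margin of `ε / 4`.
    cotransitive : ∀ c d x → (∀ m → seq c m ≡ seq c 0) → c D.< d → x D.< d ⊎ c D.< x
    cotransitive c d x const c<d = go (<⇒ c d c<d)
      where
      go : Σ[ ε ∈ ℚ ] 0ℚ < ε × Eventually (λ m → seq c m + ε ≤ seq d m) → x D.< d ⊎ c D.< x
      go (ε , 0<ε , ev) = decide (seq x N ≤? seq c 0 + (δ + δ))
        where
        δ : ℚ
        δ = ε * inv 4
        0<δ : 0ℚ < δ
        0<δ = 0<* 0<ε (0<inv (s≤s z≤n))
        four : δ + δ + (δ + δ) ≡ ε
        four = trans (identity-172 δ) (trans (cong (δ *_) (sym ι4)) (trans (*-assoc ε (inv 4) (ι 4)) (trans (cong (ε *_) (inv*ι {4} (s≤s z≤n))) (*-identityʳ ε))))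
          where
          ι4 : ι 4 ≡ 1ℚ + (1ℚ + (1ℚ + 1ℚ))
          ι4 = trans (ι-suc 3) (cong (1ℚ +_) (trans (ι-suc 2) (cong (1ℚ +_) (trans (ι-suc 1) (cong (1ℚ +_) ι1)))))
        cx : Σ[ N ∈ ℕ ] (∀ m n → N ℕ.≤ m → N ℕ.≤ n → seq x m ≤ seq x n + δ)
        cx = cauchy-≤ x δ 0<δ
        N : ℕ
        N = proj₁ cx
        decide : Dec (seq x N ≤ seq c 0 + (δ + δ)) → x D.< d ⊎ c D.< x
        decide (yes p) = inj₁ (⇒< x d δ 0<δ ((N , λ m h → proj₂ cx m N h ℕP.≤-refl) & ev ⇒ λ {m} (h , k) → -≤0⇒≤ (subst (0ℚ ≤_)
            (trans (cong (λ e → (seq c 0 + (δ + δ) - seq x N) + ((seq x N + δ - seq x m) + (seq d m - (seq c m + e)))) (sym four))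
              (trans (cong (λ u → (seq c 0 + (δ + δ) - seq x N) + ((seq x N + δ - seq x m) + (seq d m - (u + (δ + δ + (δ + δ)))))) (const m)) (identity-173 (seq c 0) δ (seq x N) (seq x m) (seq d m))))
            (0≤+ (0≤- p) (0≤+ (0≤- h) (0≤- k))))))
        decide (no ¬p) = inj₂ (⇒< c x δ 0<δ (N , λ m h → -≤0⇒≤ (subst (0ℚ ≤_) (trans (identity-174 (seq c 0) δ (seq x N) (seq x m)) (cong (λ u → seq x m - (u + δ)) (sym (const m))))
            (0≤+ (0≤- (<⇒≤ (≰⇒> ¬p))) (0≤- (proj₂ cx N m ℕP.≤-refl h))))))

  seq-∑ : ∀ {I : Set} n (g : Fin n → I) (u : I → ℝ) m → seq (D.∑ (u ∘ g)) m ≡ ∑ (tabulate g) (λ i → seq (u i) m)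
  seq-∑ zero    g u m = trans (seq-fromℕ 0 m) ι0
  seq-∑ (suc n) g u m = trans (seq-+ (u (g zero)) (D.∑ (u ∘ g ∘ suc)) m) (cong (seq (u (g zero)) m +_) (seq-∑ n (g ∘ suc) u m))

  shrink : ∀ K ε → 0ℚ < ε → Σ[ δ ∈ ℚ ] 0ℚ < δ × δ ≤ 1ℚ × δ * K ≤ ε
  shrink K ε 0<ε = δ , 0<δ , ≤-trans δ≤ (⊓-≤ʳ ε 1ℚ) ,
      ≤-trans (*ˡ δ (<⇒≤ 0<δ) (≤-trans (proj₂ (archimedean K)) (ι-mono (ℕP.n≤1+n k)))) (≡≤ (trans (*-assoc (ε ⊓ 1ℚ) (inv (suc k)) (ι (suc k))) (trans (cong ((ε ⊓ 1ℚ) *_) (inv*ι {suc k} (s≤s z≤n))) (*-identityʳ _))) (⊓-≤ˡ ε 1ℚ))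
    where
    k : ℕ
    k = proj₁ (archimedean K)
    δ : ℚ
    δ = (ε ⊓ 1ℚ) * inv (suc k)
    0<δ : 0ℚ < δ
    0<δ = 0<* (0<⊓ 0<ε 0<1) (0<inv (s≤s z≤n))
    δ≤ : δ ≤ ε ⊓ 1ℚ
    δ≤ = ≤≡ (*ˡ (ε ⊓ 1ℚ) (<⇒≤ (0<⊓ 0<ε 0<1)) inv≤1) (*-identityʳ _)
      where
      inv≤1 : inv (suc k) ≤ 1ℚ
      inv≤1 = ≤≡ (≡≤ (sym (*-identityʳ _)) (*ˡ (inv (suc k)) (0≤inv (suc k)) (1≤ι {suc k} (s≤s z≤n)))) (inv*ι {suc k} (s≤s z≤n))

  module Expectation (S : FiniteProbabilitySpace) where

    coins : List (Fin (size S))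
    coins = allFin (size S)

    p : ℕ → Fin (size S) → ℚ
    p m ω = seq (prob S ω) m

    seq-expectation : ∀ u m → seq (expectation S u) m ≡ ∑ coins (λ ω → p m ω * seq (u ω) m)
    seq-expectation u m = trans (seq-∑ (size S) id (λ ω → prob S ω D.* u ω) m) (∑-cong coins λ ω → seq-* (prob S ω) (u ω) m)

    ∑-seq-expectation : ∀ {E : Set} (L : List E) (u : E → Fin (size S) → ℝ) m →
      ∑ L (λ e → seq (expectation S (u e)) m) ≡ ∑ coins (λ ω → p m ω * ∑ L (λ e → seq (u e ω) m))
    ∑-seq-expectation L u m = trans (∑-cong L λ e → seq-expectation (u e) m) (trans (∑-swap L coins _) (∑-cong coins λ ω → ∑-*ˡ L (p m ω) _))

    -- The approximations of the probabilities are only known to be at least `- δ`, with sum at most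
    -- `1 + δ`. Each product is therefore bounded by means of `(p + δ) (v + δ - u) ≥ 0`, where `B`
    -- controls the stray term `δ u`, and `δ` is chosen against the constant `K`.
    expectation-≤ : ∀ (u : Fin (size S) → ℝ) v → 0ℚ ≤ v → (∀ ω ε → 0ℚ < ε → Eventually (λ m → seq (u ω) m ≤ v + ε)) →
      ∀ ε → 0ℚ < ε → Eventually (λ m → seq (expectation S u) m ≤ v + ε)
    expectation-≤ u v 0≤v below ε 0<ε = go (shrink K ε 0<ε)
      where
      B : Fin (size S) → ℚ
      B ω = proj₁ (lower-bound (u ω))
      K : ℚ
      K = v + (1ℚ + 1ℚ) + ∑ coins (λ ω → v + B ω + 1ℚ)
      go : Σ[ δ ∈ ℚ ] 0ℚ < δ × δ ≤ 1ℚ × δ * K ≤ ε → Eventually (λ m → seq (expectation S u) m ≤ v + ε)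
      go (δ , 0<δ , δ≤1 , small) = all-Fin (size S) (λ ω → ≤⇒ D.0ℝ (prob S ω) (nonneg S ω) δ 0<δ) & all-Fin (size S) (λ ω → below ω δ 0<δ) & ≤⇒ (D.∑ (prob S)) D.1ℝ (proj₁ (total S)) δ 0<δ ⇒
          λ {m} (pos , u≤ , tot) → estimate m (λ ω → ≡≤ (sym (trans (seq-fromℕ 0 m) ι0)) (pos ω)) u≤
            (≡≤ (sym (seq-∑ (size S) id (prob S) m)) (≤≡ tot (cong (_+ δ) (trans (seq-fromℕ 1 m) ι1))))
        where
        0≤δ : 0ℚ ≤ δ
        0≤δ = <⇒≤ 0<δ
        estimate : ∀ m → (∀ ω → 0ℚ ≤ p m ω + δ) → (∀ ω → seq (u ω) m ≤ v + δ) → ∑ coins (p m) ≤ 1ℚ + δ → seq (expectation S u) m ≤ v + ε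
        estimate m pos u≤ tot = ≡≤ (seq-expectation u m) (≤-trans (∑-mono coins each)
            (≡≤ (trans (∑-+ coins _ _) (cong₂ _+_ (∑-*ˡ coins (v + δ) (p m)) (∑-*ˡ coins δ _)))
            (≤-trans (+-mono-≤ (*ˡ (v + δ) (0≤+ 0≤v 0≤δ) tot) (*ˡ δ 0≤δ (∑-mono coins λ ω → +-monoʳ-≤ (v + B ω) δ≤1)))
            (≡≤ (identity-175 v δ (∑ coins (λ ω → v + B ω + 1ℚ))) (+-monoʳ-≤ v (≤-trans (*ˡ δ 0≤δ (+-monoˡ-≤ _ (+-monoʳ-≤ v (+-monoʳ-≤ 1ℚ δ≤1)))) small))))))
          where
          each : ∀ ω → p m ω * seq (u ω) m ≤ (v + δ) * p m ω + δ * (v + B ω + δ)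
          each ω = -≤0⇒≤ (subst (0ℚ ≤_) (identity-171 (p m ω) δ v (seq (u ω) m) (B ω)) (0≤+ (0≤* (pos ω) (0≤- (u≤ ω))) (0≤* 0≤δ (proj₁ (proj₂ (lower-bound (u ω))) m))))

 -- Fixing the coins of a protocol, and the numerical constants

 module Derandomization where

  open import Data.Fin.Base using (zero; suc)
  open import Data.Fin.Properties using (any?)
  open import Data.List.Base using ([]; _∷_)
  open import Data.Nat.Base as ℕ using (zero; suc)
  open Sums
  open Logarithms
  open ExponentialSeries
  open Limits

  open D using (ℝ; seq; FiniteProbabilitySpace; size; prob; expectation; Protocol; public-coins; alice-coins; bob-coins; tree; run; expSum)

  module Average {A B O : Set} (_≟_ : DecidableEquality O) (g : A × B → O) (π : Protocol A B O) where

    private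
      module P = Expectation (public-coins π)
      module S = Expectation (alice-coins π)
      module R = Expectation (bob-coins π)

    success : A × B → ℝ
    success e = D.𝔼[ (λ o → if ⌊ o ≟ g e ⌋ then D.1ℝ else D.0ℝ) ] π e

    correct? : ∀ ω α β (e : A × B) → Dec (run (tree π ω) (proj₁ e , α) (proj₂ e , β) ≡ g e)
    correct? ω α β e = run (tree π ω) (proj₁ e , α) (proj₂ e , β) ≟ g e

    score : List (A × B) → Fin (size (public-coins π)) → Fin (size (alice-coins π)) → Fin (size (bob-coins π)) → ℚ
    score L ω α β = ∑ L (λ e → ind (correct? ω α β e))

    ∑-success : ∀ L m → ∑ L (λ e → seq (success e) m) ≡
      seq (expectation (public-coins π) λ ω → expectation (alice-coins π) λ α → expectation (bob-coins π) λ β → D.fromℚ (score L ω α β)) m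
    ∑-success L m = trans (P.∑-seq-expectation L _ m) (trans (∑-cong P.coins λ ω → cong (P.p m ω *_)
        (trans (S.∑-seq-expectation L _ m) (trans (∑-cong S.coins λ α → cong (S.p m α *_)
          (trans (R.∑-seq-expectation L _ m) (trans (∑-cong R.coins λ β → cong (R.p m β *_) (∑-cong L λ e → seq-if (correct? ω α β e)))
          (sym (R.seq-expectation _ m)))))
        (sym (S.seq-expectation _ m)))))
      (sym (P.seq-expectation _ m)))
      where
      seq-if : ∀ {Z : Set} (d : Dec Z) → seq (if ⌊ d ⌋ then D.1ℝ else D.0ℝ) m ≡ ind d
      seq-if (yes _) = trans (seq-fromℕ 1 m) ι1
      seq-if (no _)  = trans (seq-fromℕ 0 m) ι0

    ∑-success-≤ : ∀ L M → 0ℚ ≤ M → (∀ ω α β → score L ω α β ≤ M) → ∀ ε → 0ℚ < ε → Eventually (λ m → ∑ L (λ e → seq (success e) m) ≤ M + ε)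
    ∑-success-≤ L M 0≤M h ε 0<ε = P.expectation-≤ _ M 0≤M (λ ω → S.expectation-≤ _ M 0≤M λ α → R.expectation-≤ _ M 0≤M λ β ε 0<ε → always λ m → ≤-trans (h ω α β) (gap ε (<⇒≤ 0<ε) refl)) ε 0<ε
      ⇒ λ {m} p → ≡≤ (∑-success L m) p

    ∑-success-≥ : ∀ c L → (∀ e → e ∈ L → D.fromℚ c D.< success e) →
      Σ[ ε ∈ ℚ ] 0ℚ ≤ ε × (1 ℕ.≤ length L → 0ℚ < ε) × Eventually (λ m → ι (length L) * c + ε ≤ ∑ L (λ e → seq (success e) m))
    ∑-success-≥ c []      h = 0ℚ , ≤-refl , (λ ()) , always λ m → ≤-reflexive (trans (+-identityʳ _) (trans (cong (_* c) ι0) (*-zeroˡ c)))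
    ∑-success-≥ c (e ∷ L) h = add (∑-success-≥ c L λ e′ e∈ → h e′ (there e∈)) (<⇒ (D.fromℚ c) (success e) (h e (here refl)))
      where
      add : _ → _ → _
      add (ε , 0≤ε , _ , ev) (ε′ , 0<ε′ , ev′) = ε + ε′ , 0≤+ 0≤ε (<⇒≤ 0<ε′) , (λ _ → <-≤-trans 0<ε′ (gap ε 0≤ε (+-comm ε ε′))) ,
          (ev & ev′ ⇒ λ (p , p′) → ≡≤ (trans (cong (λ k → k * c + (ε + ε′)) (ι-suc (length L))) (identity-181 (ι (length L)) c ε ε′)) (+-mono-≤ p′ p))

    -- Otherwise every choice of coins, and hence the expectation, stays below the bound, whereas
    -- strict success on finitely many inputs leaves a positive gap above it. Only finitely many
    -- coins have to be inspected.
    find : ∀ c L → 0ℚ ≤ c → 1 ℕ.≤ length L → (∀ e → e ∈ L → D.fromℚ c D.< success e) → Σ[ ω ∈ _ ] Σ[ α ∈ _ ] Σ[ β ∈ _ ] ι (length L) * c ≤ score L ω α β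
    find c L 0≤c 1≤#L h = go (any? λ ω → any? λ α → any? λ β → ι (length L) * c ≤? score L ω α β)
      where
      go : Dec (∃ λ ω → ∃ λ α → ∃ λ β → ι (length L) * c ≤ score L ω α β) → Σ[ ω ∈ _ ] Σ[ α ∈ _ ] Σ[ β ∈ _ ] ι (length L) * c ≤ score L ω α β
      go (yes found) = found
      go (no none)   = clash (∑-success-≥ c L h)
        where
        clash : _ → _
        clash (ε , 0≤ε , pos , ev) = conflict (ev & ∑-success-≤ L (ι (length L) * c) (0≤* (0≤ι (length L)) 0≤c)
            (λ ω α β → <⇒≤ (≰⇒> λ p → none (ω , α , β , p))) (ε * inv 2) (0<* (pos 1≤#L) (0<inv {2} (s≤s z≤n))))
          where
          conflict : _ → _
          conflict (N , both) = contradiction ε≤0 λ p → <-irrefl refl (<-≤-trans (pos 1≤#L) p)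
            where
            half≥ : ε ≤ ε * inv 2
            half≥ = cancel-≤ (ι (length L) * c) (ι (length L) * c) ε (ε * inv 2) (≤-trans (proj₁ (both N ℕP.≤-refl)) (proj₂ (both N ℕP.≤-refl))) ≤-refl
            ε≤0 : ε ≤ 0ℚ
            ε≤0 = cancel-≤ ε ε ε 0ℚ (≤≡ (+-mono-≤ half≥ half≥) (trans (identity-180 ε (inv 2)) (trans (cong (ε *_) two) (trans (*-identityʳ ε) (sym (+-identityʳ ε)))))) ≤-refl
              where
              two : (1ℚ + 1ℚ) * inv 2 ≡ 1ℚ
              two = trans (cong (_* inv 2) (sym (trans (ι-suc 1) (cong (1ℚ +_) ι1)))) (ι*inv {2} (s≤s z≤n))

  -- `2 ^ 20`, four times the constant `2 ^ 14 · 2 · 8` that collects the length of the simulation,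
  -- the rounding of the square root and the estimate of the logarithm.
  K₀ : ℕ
  K₀ = 1048576

  -- the success probability that the protocol for f ^ n is assumed to exceed is ρ ^ n
  θ ρ κ : ℚ
  θ = inv 256
  ρ = ι 65536 * inv 65537
  κ = inv K₀

  module _ where

    opaque
      unfolding _+_

      ρ-θ : ρ * (1ℚ + θ * θ) ≡ 1ℚ
      ρ-θ = refl

      6θ≤ : ι 6 * θ ≤ inv 32
      6θ≤ = toWitness {a? = ι 6 * θ ≤? inv 32} tt

      θθ≤ : θ * θ ≤ inv 32
      θθ≤ = toWitness {a? = θ * θ ≤? inv 32} tt

      margin : 1ℚ + κ ≤ (1ℚ - κ) * (1ℚ + θ * θ)
      margin = toWitness {a? = 1ℚ + κ ≤? (1ℚ - κ) * (1ℚ + θ * θ)} tt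

      margin′ : 1ℚ + κ * inv 2 ≤ (1ℚ - κ * inv 4) * (1ℚ + κ)
      margin′ = toWitness {a? = 1ℚ + κ * inv 2 ≤? (1ℚ - κ * inv 4) * (1ℚ + κ)} tt

      κ/4≤1 : κ * inv 4 ≤ 1ℚ
      κ/4≤1 = toWitness {a? = κ * inv 4 ≤? 1ℚ} tt

      κ≤1 : κ ≤ 1ℚ
      κ≤1 = toWitness {a? = κ ≤? 1ℚ} tt

    0≤ρ : 0ℚ ≤ ρ
    0≤ρ = 0≤* (0≤ι 65536) (0≤inv 65537)

    0<κ : 0ℚ < κ
    0<κ = 0<inv (s≤s z≤n)

  -- ρ ^ n < exp (- κ n), since exp (- x) exp x = 1 and exp κ ≤ 1 / (1 - κ)
  ρⁿ<exp : ∀ n → 1 ℕ.≤ n → D.fromℚ (pw ρ n) D.< D.exp (D.- (D.fromℚ κ D.* D.fromℕ n))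
  ρⁿ<exp n 1≤n = ⇒< (D.fromℚ (pw ρ n)) (D.exp (D.- (D.fromℚ κ D.* D.fromℕ n))) (pw ρ n * (κ * inv 2)) 0<gain (proj₁ ev , λ m h → subst (λ q → pw ρ n + pw ρ n * (κ * inv 2) ≤ expSum q m) (sym (arg m)) (bound m (proj₂ ev m (- x) h abs)))
    where
    x η : ℚ
    x = ι n * κ
    η = κ * inv 4
    0≤x : 0ℚ ≤ x
    0≤x = 0≤* (0≤ι n) (0≤inv K₀)
    arg : ∀ m → seq (D.- (D.fromℚ κ D.* D.fromℕ n)) m ≡ - x
    arg m = trans (seq-neg (D.fromℚ κ D.* D.fromℕ n) m) (cong -_ (trans (seq-* (D.fromℚ κ) (D.fromℕ n) m) (trans (*-comm κ _) (cong (_* κ) (seq-fromℕ n m)))))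
    abs : ∣ - x ∣≤ x
    abs = ≤-trans (≤≡ (neg-≤ 0≤x) neg-0) 0≤x , ≤-reflexive (neg-neg x)
    ev : _
    ev = exp-inverse x 0≤x η (0<* 0<κ (0<inv {4} (s≤s z≤n)))
    0<ρⁿ : 0ℚ < pw ρ n
    0<ρⁿ = go n
      where
      go : ∀ n → 0ℚ < pw ρ n
      go zero    = 0<1
      go (suc n) = 0<* (0<* (<-≤-trans 0<1 (1≤ι {65536} (s≤s z≤n))) (0<inv {65537} (s≤s z≤n))) (go n)
    0<gain : 0ℚ < pw ρ n * (κ * inv 2)
    0<gain = 0<* 0<ρⁿ (0<* 0<κ (0<inv {2} (s≤s z≤n)))
    pw-one : ∀ n → pw 1ℚ n ≡ 1ℚ
    pw-one zero    = refl
    pw-one (suc n) = trans (*-identityˡ _) (pw-one n)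
    -- The surplus `κ` pays for the error `η` of the truncated series and still makes the inequality
    -- strict.
    growth : 1ℚ + κ ≤ pw (1ℚ - κ) n * pw (1ℚ + θ * θ) n
    growth = ≤-trans (≤-trans (gap _ (0≤- first) (identity-1 (1ℚ + κ) (1ℚ + ι n * κ))) (bernoulli (0≤inv K₀) n)) (≤≡ (pw-mono (0≤+ 0≤1 (0≤inv K₀)) margin n) (pw-* (1ℚ - κ) (1ℚ + θ * θ) n))
      where
      first : 1ℚ + κ ≤ 1ℚ + ι n * κ
      first = +-monoʳ-≤ 1ℚ (≡≤ (sym (*-identityˡ κ)) (*ʳ κ (0≤inv K₀) (1≤ι 1≤n)))
    bound : ∀ m → ∣ expSum (- x) m * expSum (- (- x)) m - 1ℚ ∣≤ η → pw ρ n + pw ρ n * (κ * inv 2) ≤ expSum (- x) m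
    bound m (_ , q) = ≤-trans (≡≤ (identity-182 (pw ρ n) (κ * inv 2)) (≤≡ (*ˡ (pw ρ n) (<⇒≤ 0<ρⁿ) (≤-trans margin′ (*ˡ (1ℚ - η) (0≤- κ/4≤1) growth)))
        (trans (identity-183 (pw ρ n) (1ℚ - η) (pw (1ℚ - κ) n) (pw (1ℚ + θ * θ) n)) (trans (cong (_* ((1ℚ - η) * pw (1ℚ - κ) n)) (trans (sym (pw-* ρ (1ℚ + θ * θ) n)) (trans (cong (λ u → pw u n) ρ-θ) (pw-one n)))) (*-identityˡ _)))))
        (*-cancel-pos (expSum x m) 1≤E (≤-trans (≡≤ (*-assoc (1ℚ - η) _ _) (≤≡ (*ˡ (1ℚ - η) (0≤- κ/4≤1) small) (*-identityʳ _))) (≤≡ (-≤0⇒≤ (subst (0ℚ ≤_) (identity-184 η (expSum (- x) m * expSum (- (- x)) m)) (0≤- q))) (cong (λ u → expSum (- x) m * expSum u m) (neg-neg x)))))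
      where
      1≤E : 1ℚ ≤ expSum x m
      1≤E = 1≤expSum 0≤x m
      small : pw (1ℚ - κ) n * expSum x m ≤ 1ℚ
      small = ≤-trans (*ˡ _ (pw-0≤ (0≤- κ≤1) n) (expSum-ι* (0≤inv K₀) n m)) (≡≤ (sym (pw-* (1ℚ - κ) (expSum κ m) n)) (≤≡ (pw-mono (0≤* (0≤- κ≤1) (≤-trans 0≤1 (1≤expSum (0≤inv K₀) m))) (expSum-geometric (0≤inv K₀) m) n) (pw-one n)))

 -- Choice of the parameters and the length of the simulation

 module Parameters where

  open import Data.Nat.Base as ℕ using (zero; suc)
  open import Data.Nat.DivMod using (_/_)
  open Sums
  open Logarithms
  open ExponentialSeries
  open Limits
  open Derandomization

  open D using (ℝ; seq; expSum)

  isqrt : ∀ n → 1 ℕ.≤ n → Σ[ s ∈ ℕ ] suc s ℕ.* suc s ℕ.≤ n × n ℕ.< suc (suc s) ℕ.* suc (suc s)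
  isqrt (suc zero)    _ = 0 , s≤s z≤n , s≤s (s≤s z≤n)
  isqrt (suc (suc n)) _ = go (isqrt (suc n) (s≤s z≤n))
    where
    go : _ → _
    go (s , lo , hi) = decide (suc (suc s) ℕ.* suc (suc s) ℕP.≤? suc (suc n))
      where
      decide : Dec (suc (suc s) ℕ.* suc (suc s) ℕ.≤ suc (suc n)) → _
      decide (yes p) = suc s , p , ℕP.≤-<-trans hi (ℕP.*-mono-< (ℕP.n<1+n (suc (suc s))) (ℕP.n<1+n (suc (suc s))))
      decide (no ¬p) = s , ℕP.m≤n⇒m≤1+n lo , ℕP.≰⇒> ¬p

  ilog : ∀ n → 1 ℕ.≤ n → Σ[ K ∈ ℕ ] 2 ℕ.^ K ℕ.≤ n × n ℕ.< 2 ℕ.^ suc K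
  ilog (suc zero)    _ = 0 , s≤s z≤n , s≤s (s≤s z≤n)
  ilog (suc (suc n)) _ = go (ilog (suc n) (s≤s z≤n))
    where
    go : _ → _
    go (K , lo , hi) = decide (2 ℕ.^ suc K ℕP.≤? suc (suc n))
      where
      decide : Dec (2 ℕ.^ suc K ℕ.≤ suc (suc n)) → _
      decide (yes p) = suc K , p , ℕP.≤-<-trans hi (ℕP.^-monoʳ-< 2 (s≤s (s≤s z≤n)) (ℕP.n<1+n (suc K)))
      decide (no ¬p) = K , ℕP.m≤n⇒m≤1+n lo , ℕP.≰⇒> ¬p

  -- The condition `6 T / ((s + 1) d) ≤ 1/32` with `T = 2 Td`, solved for `d` and rounded up.
  mistake-bound : ℕ → ℕ → ℕ
  mistake-bound s Td = suc (384 ℕ.* Td / suc s)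

  -- `8 + 2 p` rounds for the initial potential `p = J + J d`, and one bit for the answer. A round
  -- has two tests, each with four hash bits from Alice and a reply from Bob to each of them.
  protocol-length : ℕ → ℕ → ℕ
  protocol-length J d = (8 ℕ.+ ((J ℕ.+ J ℕ.* d) ℕ.+ (J ℕ.+ J ℕ.* d))) ℕ.* 16 ℕ.+ 1

  mistake-bound-≥ : ∀ s Td → 192 ℕ.* (Td ℕ.+ Td) ℕ.≤ suc s ℕ.* mistake-bound s Td
  mistake-bound-≥ s Td = ℕP.≤-trans (ℕP.≤-reflexive (trans (lem Td) (m≡m%n+[m/n]*n (384 ℕ.* Td) (suc s))))
    (ℕP.≤-trans (ℕP.+-monoˡ-≤ _ (ℕP.<⇒≤ (m%n<n (384 ℕ.* Td) (suc s)))) (ℕP.≤-reflexive (ℕP.*-comm (mistake-bound s Td) (suc s))))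
    where
    lem : ∀ t → 192 ℕ.* (t ℕ.+ t) ≡ 384 ℕ.* t
    lem t = trans (cong (192 ℕ.*_) (cong (t ℕ.+_) (sym (ℕP.+-identityʳ t)))) (sym (ℕP.*-assoc 192 2 t))

  protocol-length-≤ : ∀ s n J Td → suc s ℕ.* suc s ℕ.≤ n → n ℕ.≤ 4 ℕ.* Td → 1 ℕ.≤ J →
    suc s ℕ.* protocol-length J (mistake-bound s Td) ℕ.≤ 16384 ℕ.* (J ℕ.* Td)
  protocol-length-≤ s n J Td S²≤n n≤ 1≤J = ι-cancel (≡≤ expand (≤-trans (+-mono-≤ (+-mono-≤ S≤ (*ˡ (ι 32) (0≤ι 32) (*ˡ (ι J) (0≤ι J) S≤4T))) (*ˡ (ι 32) (0≤ι 32) (*ˡ (ι J) (0≤ι J) (≤-trans Sd≤ (+-monoˡ-≤ (ι 384 * t) S≤4T)))))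
      (≡≤ (identity-197 (ι 129) (ι 4) (ι 32) (ι 384) (ι J) t) (≤≡ (*ʳ (ι J * t) (0≤* (0≤ι J) (0≤ι Td)) number) (sym (trans (ι-* 16384 (J ℕ.* Td)) (cong (ι 16384 *_) (ι-* J Td))))))))
    where
    d S : ℕ
    d = mistake-bound s Td
    S = suc s
    t : ℚ
    t = ι Td
    S≤4T : ι S ≤ ι 4 * t
    S≤4T = ≤≡ (ι-mono (ℕP.≤-trans (ℕP.m≤m*n S S) (ℕP.≤-trans S²≤n n≤))) (ι-* 4 Td)
    S≤ : ι 129 * ι S ≤ ι 129 * (ι J * (ι 4 * t))
    S≤ = *ˡ (ι 129) (0≤ι 129) (≤-trans S≤4T (≡≤ (sym (*-identityˡ _)) (*ʳ (ι 4 * t) (0≤* (0≤ι 4) (0≤ι Td)) (1≤ι 1≤J))))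
    Sd≤ : ι S * ι d ≤ ι S + ι 384 * t
    Sd≤ = ≡≤ (sym (ι-* S d)) (≤≡ (ι-mono (ℕP.≤-trans (ℕP.≤-reflexive (ℕP.*-comm S d)) (ℕP.+-monoʳ-≤ S (m/n*n≤m (384 ℕ.* Td) S)))) (trans (ι-+ S (384 ℕ.* Td)) (cong (ι S +_) (ι-* 384 Td))))
    expand : ι (S ℕ.* protocol-length J d) ≡ ι 129 * ι S + ι 32 * (ι J * ι S) + ι 32 * (ι J * (ι S * ι d))
    expand = trans (ι-* S _) (trans (cong (ι S *_) (trans (ι-+ _ 1) (cong₂ _+_ (trans (ι-* _ 16) (cong (_* ι 16) (trans (ι-+ 8 _) (cong (ι 8 +_) (trans (ι-+ (J ℕ.+ J ℕ.* d) (J ℕ.+ J ℕ.* d)) (cong₂ _+_ Jd Jd)))))) ι1)))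
      (trans (identity-196 (ι S) (ι 8) (ι 16) (ι J) (ι d)) (cong₂ (λ a b → a * ι S + b * (ι J * ι S) + b * (ι J * (ι S * ι d))) (trans (cong₂ _+_ (sym (ι-* 8 16)) (sym ι1)) (sym (ι-+ 128 1))) (sym (ι-+ 16 16)))))
      where
      Jd : ι (J ℕ.+ J ℕ.* d) ≡ ι J + ι J * ι d
      Jd = trans (ι-+ J (J ℕ.* d)) (cong (ι J +_) (ι-* J d))
    opaque
      unfolding _+_
      number : ι 129 * ι 4 + (ι 32 * ι 4 + ι 32 * (ι 4 + ι 384)) ≤ ι 16384
      number = toWitness {a? = ι 129 * ι 4 + (ι 32 * ι 4 + ι 32 * (ι 4 + ι 384)) ≤? ι 16384} tt

  module _ where

    -- only ln 2 ≤ 1 and e ^ (1/4) ≤ 4/3 are used of the logarithm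
    log-lower : ∀ C n l → D.IsLog₂ (C D.* D.fromℕ n) l → D.0ℝ D.< l → ∀ K → 1 ℕ.≤ K →
      Eventually (λ m → ι (2 ℕ.^ K) ≤ seq C m * ι n) → Eventually (λ m → ι K * inv 4 ≤ seq l m)
    log-lower C n l (ln2 , exp-ln2 , exp-l) 0<l K 1≤K big =
        positive (<⇒ D.0ℝ l 0<l) & big & ≤⇒ (D.exp ln2) D.2ℝ (proj₁ exp-ln2) (inv 4) (0<inv {4} (s≤s z≤n)) & ≤⇒ (C D.* D.fromℕ n) (D.exp (l D.* ln2)) (proj₂ exp-l) (inv 8) (0<inv {8} (s≤s z≤n)) & inverses & (2 , λ m h → h)
        ⇒ λ {m} (0≤l , large , e₂ , eₗ , e⁻ , 2≤m) → pointwise m 0≤l large (≤≡ e₂ (cong (_+ inv 4) (seq-fromℕ 2 m)))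
            (≡≤ (sym (trans (seq-* C (D.fromℕ n) m) (cong (seq C m *_) (seq-fromℕ n m)))) (≤≡ eₗ (cong (λ q → expSum q m + inv 8) (seq-* l ln2 m))))
            (≡≤ (cong (λ q → expSum q m * expSum (- q) m - 1ℚ) (sym (seq-* l ln2 m))) (proj₁ e⁻)) 2≤m
      where
      positive : Σ[ ε ∈ ℚ ] 0ℚ < ε × Eventually (λ m → seq D.0ℝ m + ε ≤ seq l m) → Eventually (λ m → 0ℚ ≤ seq l m)
      positive (ε , 0<ε , ev) = ev ⇒ λ {m} h → ≤-trans (<⇒≤ 0<ε) (≡≤ (sym (trans (cong (_+ ε) (trans (seq-fromℕ 0 m) ι0)) (+-identityˡ ε))) h)
      bd : _
      bd = lower-bound (l D.* ln2)
      inverses : Eventually (λ m → ∣ expSum (seq (l D.* ln2) m) m * expSum (- seq (l D.* ln2) m) m - 1ℚ ∣≤ inv 2)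
      inverses = proj₁ ev , λ m h → proj₂ ev m (seq (l D.* ln2) m) h (proj₁ (proj₂ (proj₂ bd)) m , -≤0⇒≤ (subst (0ℚ ≤_) (identity-195 (proj₁ bd) (seq (l D.* ln2) m)) (proj₁ (proj₂ bd) m)))
        where
        ev : _
        ev = exp-inverse (proj₁ bd) (proj₂ (proj₂ (proj₂ bd))) (inv 2) (0<inv {2} (s≤s z≤n))
      t : ℚ
      t = ι 4 * inv 3
      opaque
        unfolding _+_
        e-large : ι 2 + inv 4 < expSum 1ℚ 2
        e-large = toWitness {a? = ι 2 + inv 4 QP.<? expSum 1ℚ 2} tt
        t-inverse : t * (1ℚ - inv 4) ≡ 1ℚ
        t-inverse = refl
        0≤¾ : 0ℚ ≤ 1ℚ - inv 4
        0≤¾ = toWitness {a? = 0ℚ ≤? (1ℚ - inv 4)} tt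
        t≤ : t ≤ ι 2 * (1ℚ - inv 4)
        t≤ = toWitness {a? = t ≤? ι 2 * (1ℚ - inv 4)} tt
        t≤2 : t ≤ ι 2
        t≤2 = toWitness {a? = t ≤? ι 2} tt
        eighth : inv 8 < ι 2 * inv 4
        eighth = toWitness {a? = inv 8 QP.<? ι 2 * inv 4} tt
        3/2≤ : 1ℚ + inv 2 ≤ ι 2 * (1ℚ - inv 4)
        3/2≤ = toWitness {a? = 1ℚ + inv 2 ≤? ι 2 * (1ℚ - inv 4)} tt
      0≤t : 0ℚ ≤ t
      0≤t = 0≤* (0≤ι 4) (0≤inv 3)
      P : ℚ
      P = pw (ι 2) K
      2≤P : ι 2 ≤ P
      2≤P = first K 1≤K
        where
        first : ∀ K → 1 ℕ.≤ K → ι 2 ≤ pw (ι 2) K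
        first (suc k) _ = ≡≤ (sym (*-identityʳ _)) (*ˡ (ι 2) (0≤ι 2) (pw-1≤ (1≤ι {2} (s≤s z≤n)) k))
      quarter : ∀ m → expSum (inv 4) m ≤ t
      quarter m = ≡≤ (sym (trans (sym (*-assoc t (1ℚ - inv 4) _)) (trans (cong (_* expSum (inv 4) m) t-inverse) (*-identityˡ _)))) (≤≡ (*ˡ t 0≤t (expSum-geometric (0≤inv 4) m)) (*-identityʳ t))
      power : pw t K ≤ P * (1ℚ - inv 4)
      power = first K 1≤K
        where
        first : ∀ K → 1 ℕ.≤ K → pw t K ≤ pw (ι 2) K * (1ℚ - inv 4)
        first (suc k) _ = ≤≡ (*-mono 0≤t (pw-0≤ (0≤ι 2) k) t≤ (pw-mono 0≤t t≤2 k)) (identity-135 (ι 2) (1ℚ - inv 4) (pw (ι 2) k))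
      pointwise : ∀ m → 0ℚ ≤ seq l m → ι (2 ℕ.^ K) ≤ seq C m * ι n → expSum (seq ln2 m) m ≤ ι 2 + inv 4 → seq C m * ι n ≤ expSum (seq l m * seq ln2 m) m + inv 8 →
        expSum (seq l m * seq ln2 m) m * expSum (- (seq l m * seq ln2 m)) m - 1ℚ ≤ inv 2 → 2 ℕ.≤ m → ι K * inv 4 ≤ seq l m
      pointwise m 0≤l large e₂ eₗ e⁻ 2≤m = go (≤-total (ι K * inv 4) (seq l m))
        where
        q p : ℚ
        q = seq ln2 m
        p = seq l m * q
        -- Already `1 + 1 + 1/2` exceeds `2 + 1/4`, so the series at an argument above one would be
        -- too large.
        q≤1 : q ≤ 1ℚ
        q≤1 = case (≤-total q 1ℚ)
          where
          case : q ≤ 1ℚ ⊎ 1ℚ ≤ q → q ≤ 1ℚ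
          case (inj₁ h) = h
          case (inj₂ h) = contradiction (<-≤-trans e-large (≤-trans (expSum-mono-index 0≤1 2≤m) (≤-trans (expSum-mono 0≤1 h m) e₂))) (<-irrefl refl)
        go : ι K * inv 4 ≤ seq l m ⊎ seq l m ≤ ι K * inv 4 → ι K * inv 4 ≤ seq l m
        go (inj₁ h) = h
        go (inj₂ h) = contradiction absurd (<-irrefl refl)
          where
          E≤ : expSum p m ≤ P * (1ℚ - inv 4)
          E≤ = case (≤-total 0ℚ p)
            where
            case : 0ℚ ≤ p ⊎ p ≤ 0ℚ → expSum p m ≤ P * (1ℚ - inv 4)
            case (inj₁ 0≤p) = ≤-trans (expSum-mono 0≤p (≤-trans (≤≡ (*ˡ (seq l m) 0≤l q≤1) (*-identityʳ _)) h) m)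
              (≤-trans (expSum-ι* (0≤inv 4) K m) (≤-trans (pw-mono (≤-trans 0≤1 (1≤expSum (0≤inv 4) m)) (quarter m) K) power))
            -- For a nonpositive argument the monotonicity of the partial sums is not at hand;
            -- `exp p · exp (- p) ≤ 3/2` and `exp (- p) ≥ 1` replace it.
            case (inj₂ p≤0) = ≤-trans (sign (≤-total 0ℚ (expSum p m))) (≤-trans 3/2≤ (*ʳ (1ℚ - inv 4) 0≤¾ 2≤P))
              where
              0≤-p : 0ℚ ≤ - p
              0≤-p = subst (_≤ - p) neg-0 (neg-≤ p≤0)
              sign : 0ℚ ≤ expSum p m ⊎ expSum p m ≤ 0ℚ → expSum p m ≤ 1ℚ + inv 2
              sign (inj₁ 0≤e) = ≤-trans (≡≤ (sym (*-identityʳ _)) (*ˡ (expSum p m) 0≤e (1≤expSum 0≤-p m))) (-≤0⇒≤ (subst (0ℚ ≤_) (identity-185 (inv 2) (expSum p m * expSum (- p) m)) (0≤- e⁻)))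
              sign (inj₂ e≤0) = ≤-trans e≤0 (0≤+ 0≤1 (0≤inv 2))
          absurd : inv 8 < inv 8
          absurd = <-≤-trans eighth (≤-trans (*ʳ (inv 4) (0≤inv 4) 2≤P) (-≤0⇒≤ (subst (0ℚ ≤_) (identity-186 (inv 8) P (inv 4)) (0≤- (≤-trans (≡≤ (pw-ι 2 K) large) (≤-trans eₗ (+-monoˡ-≤ (inv 8) E≤)))))))

  -- The length C of the simulation would satisfy 2 Td ≤ C n, so log (C n) is at least a multiple of log Td.
  module TooShort (C r l lam : ℝ) (n s Td K : ℕ) (1≤n : 1 ℕ.≤ n) (S²≤n : suc s ℕ.* suc s ℕ.≤ n) (n≤4Td : n ℕ.≤ 4 ℕ.* Td) (1≤Td : 1 ℕ.≤ Td)
    (2^K≤ : 2 ℕ.^ K ℕ.≤ Td ℕ.+ Td) (1≤K : 1 ℕ.≤ K)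
    (log : ∀ K → 1 ℕ.≤ K → Eventually (λ m → ι (2 ℕ.^ K) ≤ seq C m * ι n) → Eventually (λ m → ι K * inv 4 ≤ seq l m))
    (C-large : Eventually (λ m → ι K₀ ≤ seq C m))
    (lam-inverse : Eventually (λ m → seq lam m * seq l m ≡ 1ℚ × 0ℚ ≤ seq lam m))
    (root : Eventually (λ m → seq r m ≤ ι (suc (suc s))))
    (short : Eventually (λ m → ι Td ≤ κ * seq C m * seq r m * seq lam m + inv 2)) where

    private
      S J : ℕ
      S = suc s
      J = suc K

      opaque
        unfolding _+_
        16≤ : ι 16 ≤ ι K₀
        16≤ = toWitness {a? = ι 16 ≤? ι K₀} tt
        4κ≤ : κ + κ + (κ + κ) ≤ inv 2
        4κ≤ = toWitness {a? = κ + κ + (κ + κ) ≤? inv 2} tt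
        halves : inv 2 + inv 2 ≡ 1ℚ
        halves = refl
        κ-final : κ * (ι 16384 * (1ℚ + 1ℚ) * ι 8) ≡ inv 4
        κ-final = refl
        ¾<1 : inv 4 + inv 2 < 1ℚ
        ¾<1 = toWitness {a? = inv 4 + inv 2 QP.<? 1ℚ} tt
        1≤½16 : 1ℚ ≤ inv 2 * ι 16
        1≤½16 = toWitness {a? = 1ℚ ≤? inv 2 * ι 16} tt

      root≤ : ∀ {m} → seq r m ≤ ι (suc (suc s)) → seq r m ≤ ι S + ι S
      root≤ h = ≤-trans h (≤≡ (ι-mono (s≤s (ℕP.≤-trans (ℕP.≤-reflexive (sym (ℕP.+-comm s 1))) (ℕP.+-monoʳ-≤ s (s≤s z≤n))))) (ι-+ S S))

      Cn≥ : ∀ {m} → ι K₀ ≤ seq C m → ι 16 ≤ seq C m * ι n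
      Cn≥ {m} h = ≤-trans 16≤ (≤-trans h (≡≤ (sym (*-identityʳ _)) (*ˡ (seq C m) (≤-trans (0≤ι K₀) h) (1≤ι 1≤n))))

      -- `C n ≥ 16 = 2 ^ 4`, so `log-lower` makes the logarithm at least one.
      lam≤1 : Eventually (λ m → seq lam m ≤ 1ℚ)
      lam≤1 = log 4 (s≤s z≤n) (C-large ⇒ Cn≥) & lam-inverse ⇒ λ {m} (h , e , 0≤λ) → ≤≡ (≡≤ (sym (trans (cong (seq lam m *_) (ι*inv {4} (s≤s z≤n))) (*-identityʳ _))) (*ˡ (seq lam m) 0≤λ h)) e

      -- A bootstrap: the weak bound `1` for the inverse logarithm already shows `2 Td ≤ C n`, and
      -- this is what lets `log-lower` be applied at `K`.
      2^K≤Cn : Eventually (λ m → ι (2 ℕ.^ K) ≤ seq C m * ι n)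
      2^K≤Cn = lam≤1 & lam-inverse & root & short & C-large ⇒ λ {m} (h , (_ , 0≤λ) , r≤ , sh , big) → ≤-trans (ι-mono 2^K≤) (≡≤ (ι-+ Td Td) (bound (seq C m) (seq r m) (seq lam m) h 0≤λ (root≤ {m} r≤) sh (≤-trans (0≤ι K₀) big) (Cn≥ {m} big)))
        where
        bound : ∀ c r λ′ → λ′ ≤ 1ℚ → 0ℚ ≤ λ′ → r ≤ ι S + ι S → ι Td ≤ κ * c * r * λ′ + inv 2 → 0ℚ ≤ c → ι 16 ≤ c * ι n → ι Td + ι Td ≤ c * ι n
        bound c r λ′ λ≤1 0≤λ r≤ sh 0≤c big = ≤-trans (+-mono-≤ sh′ sh′) (≡≤ (identity-192 κ c (ι n) (inv 2)) (≤≡ (+-mono-≤ (*ʳ (c * ι n) (0≤* 0≤c (0≤ι n)) 4κ≤) (≡≤ halves (≤-trans 1≤½16 (*ˡ (inv 2) (0≤inv 2) big))))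
            (trans (identity-193 (inv 2) (c * ι n)) (trans (cong (_* (c * ι n)) halves) (*-identityˡ _)))))
          where
          S≤n : ι S ≤ ι n
          S≤n = ι-mono (ℕP.≤-trans (ℕP.m≤m*n S S) S²≤n)
          0≤κc : 0ℚ ≤ κ * c
          0≤κc = 0≤* (0≤inv K₀) 0≤c
          sh′ : ι Td ≤ κ * c * (ι n + ι n) + inv 2
          sh′ = ≤-trans sh (+-monoˡ-≤ (inv 2) (≤-trans (*ʳ λ′ 0≤λ (*ˡ (κ * c) 0≤κc (≤-trans r≤ (+-mono-≤ S≤n S≤n)))) (≤≡ (*ˡ _ (0≤* 0≤κc (0≤+ (0≤ι n) (0≤ι n))) λ≤1) (*-identityʳ _))))

      lamJ≤8 : Eventually (λ m → seq lam m * ι J ≤ ι 8)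
      lamJ≤8 = log K 1≤K 2^K≤Cn & lam-inverse ⇒ λ {m} (h , e , 0≤λ) → bound (seq lam m) 0≤λ (≤≡ (*ˡ (seq lam m) 0≤λ h) e)
        where
        bound : ∀ λ′ → 0ℚ ≤ λ′ → λ′ * (ι K * inv 4) ≤ 1ℚ → λ′ * ι J ≤ ι 8
        bound λ′ 0≤λ h = ≤-trans (*ˡ λ′ 0≤λ (≤≡ (ι-mono J≤2K) (ι-+ K K))) (≡≤ (trans (sym (trans (cong (_* (λ′ * (ι K + ι K))) (ι*inv {4} (s≤s z≤n))) (*-identityˡ _))) (identity-194 λ′ (ι K) (ι 4) (inv 4))) (≤≡ (*ˡ (ι 4 + ι 4) (0≤+ (0≤ι 4) (0≤ι 4)) h) (trans (*-identityʳ _) (sym (ι-+ 4 4)))))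
          where
          J≤2K : J ℕ.≤ K ℕ.+ K
          J≤2K = ℕP.+-monoˡ-≤ K 1≤K

    -- Multiply the bound for `Td` by `J` and insert the length for `C`, `2 S` for the root and `8`
    -- for `J` over the logarithm. The result is `J Td ≤ (1/4 + 1/2) J Td`.
    contradictory : ¬ Eventually (λ m → seq C m ≤ ι (protocol-length J (mistake-bound s Td)))
    contradictory C≤ = finish (lamJ≤8 & lam-inverse & root & short & C-large & C≤)
      where
      D′ : ℕ
      D′ = protocol-length J (mistake-bound s Td)
      finish : _ → _
      finish (N , ev) = bound (seq C N) (seq r N) (seq lam N) (ev N ℕP.≤-refl)
        where
        bound : ∀ c r′ λ′ → λ′ * ι J ≤ ι 8 × (λ′ * seq l N ≡ 1ℚ × 0ℚ ≤ λ′) × r′ ≤ ι (suc (suc s)) × ι Td ≤ κ * c * r′ * λ′ + inv 2 × ι K₀ ≤ c × c ≤ ι D′ → _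
        bound c r′ λ′ (λJ≤ , (_ , 0≤λ) , r≤ , sh , big , c≤) = <-irrefl refl (<-≤-trans (*ˡ-< Z 0<Z ¾<1) (≡≤ (*-identityʳ Z) total))
          where
          Z : ℚ
          Z = ι J * ι Td
          1≤Z : 1ℚ ≤ Z
          1≤Z = ≤≡ (1≤ι (ℕP.*-mono-≤ {1} {J} (s≤s z≤n) 1≤Td)) (ι-* J Td)
          0<Z : 0ℚ < Z
          0<Z = <-≤-trans 0<1 1≤Z
          0≤c : 0ℚ ≤ c
          0≤c = ≤-trans (0≤ι K₀) big
          r≤2S : r′ ≤ ι S + ι S
          r≤2S = ≤-trans r≤ (≤≡ (ι-mono (s≤s (ℕP.≤-trans (ℕP.≤-reflexive (sym (ℕP.+-comm s 1))) (ℕP.+-monoʳ-≤ s (s≤s z≤n))))) (ι-+ S S))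
          DS : ι D′ * (ι S + ι S) ≤ ι 16384 * (1ℚ + 1ℚ) * Z
          DS = ≡≤ (identity-187 (ι D′) (ι S)) (≤≡ (*ˡ (1ℚ + 1ℚ) (0≤+ 0≤1 0≤1) (≡≤ (sym (ι-* S D′)) (≤≡ (ι-mono (protocol-length-≤ s n J Td S²≤n n≤4Td (s≤s z≤n))) (trans (ι-* 16384 (J ℕ.* Td)) (cong (ι 16384 *_) (ι-* J Td)))))) (identity-188 (ι 16384) Z))
          main : ι J * (κ * c * r′ * λ′) ≤ inv 4 * Z
          main = ≡≤ (identity-189 (ι J) κ c r′ λ′) (≤≡ (*ˡ κ (0≤inv K₀) (≤-trans (*ʳ (λ′ * ι J) (0≤* 0≤λ (0≤ι J)) (≤-trans (*ˡ c 0≤c r≤2S) (≤-trans (*ʳ (ι S + ι S) (0≤+ (0≤ι S) (0≤ι S)) c≤) DS)))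
              (*ˡ (ι 16384 * (1ℚ + 1ℚ) * Z) (0≤* (0≤* (0≤ι 16384) (0≤+ 0≤1 0≤1)) (<⇒≤ 0<Z)) λJ≤))) (trans (identity-190 κ (ι 16384 * (1ℚ + 1ℚ)) Z (ι 8)) (cong (_* Z) κ-final)))
          total : Z ≤ Z * (inv 4 + inv 2)
          total = ≤-trans (*ˡ (ι J) (0≤ι J) sh) (≡≤ (*-distribˡ-+ (ι J) _ (inv 2)) (≤≡ (+-mono-≤ main (*ʳ (inv 2) (0≤inv 2) (≡≤ (sym (*-identityʳ (ι J))) (*ˡ (ι J) (0≤ι J) (1≤ι 1≤Td))))) (identity-191 Z (inv 4) (inv 2))))

 -- Assembly: mixtures of trees and the contradiction

 module Assembly where

  open import Data.Fin.Base using (zero; suc)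
  open import Data.List.Base using ([]; _∷_; lookup)
  open import Data.List.Relation.Unary.All using ([]; _∷_)
  open import Data.Nat.Base as ℕ using (zero; suc)
  open import Data.Vec.Base as Vec using ([]; _∷_)
  open Sums
  open Logarithms
  open TreeTranscripts
  open Reduction
  open RegretMatching
  open ExponentialSeries
  open Limits
  open Derandomization
  open Parameters

  open D using (ℝ; seq; FiniteProbabilitySpace; size; prob; expectation; Protocol; public-coins; alice-coins; bob-coins; tree; run; depth; Tree; output)

  ≤-seq : ∀ x y → (∀ m → seq x m ≤ seq y m) → x D.≤ y
  ≤-seq x y h y<x = go (<⇒ y x y<x)
    where
    go : ¬ (Σ[ ε ∈ ℚ ] 0ℚ < ε × Eventually (λ m → seq y m + ε ≤ seq x m))
    go (ε , 0<ε , N , ev) = <-irrefl refl (<-≤-trans (+-monoʳ-< (seq x N) 0<ε) (≤-trans (+-monoˡ-≤ ε (h N)) (≤≡ (ev N ℕP.≤-refl) (sym (+-identityʳ _)))))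

  ≤-refute : ∀ x y → ¬ Eventually (λ m → seq y m ≤ seq x m) → x D.≤ y
  ≤-refute x y h y<x = go (<⇒ y x y<x)
    where
    go : ¬ (Σ[ ε ∈ ℚ ] 0ℚ < ε × Eventually (λ m → seq y m + ε ≤ seq x m))
    go (ε , 0<ε , ev) = h (ev ⇒ λ p → ≤-trans (gap ε (<⇒≤ 0<ε) refl) p)

  opaque
    unfolding _+_

    inverse-spec : ∀ y (h : D.0ℝ D.< y) → Eventually (λ m → seq (D.inverse y h) m * seq y m ≡ 1ℚ × 0ℚ ≤ seq (D.inverse y h) m)
    inverse-spec y (ε , 0<ε , N , ε≤y) = N , λ m h → spec (seq y m) (subst (λ z → z ≤ seq y m) (QP.+-identityˡ ε) (ε≤y m h))
      where
      spec : ∀ q → ε ≤ q → D.Bounds.clamped-inverse 0<ε q * q ≡ 1ℚ × 0ℚ ≤ D.Bounds.clamped-inverse 0<ε q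
      spec q ε≤q = trans (cong (D.Bounds.clamped-inverse 0<ε q *_) (sym (QP.p≤q⇒p⊔q≡q ε≤q))) (QP.*-inverseˡ (ε Q.⊔ q) {{QP.pos⇒nonZero (ε Q.⊔ q) {{D.Bounds.clamped-pos 0<ε q}}}}) ,
        <⇒≤ (QP.positive⁻¹ _ {{QP.1/pos⇒pos (ε Q.⊔ q) {{D.Bounds.clamped-pos 0<ε q}}}})

    sign-seq : ∀ o g m → seq ((D.- D.1ℝ) D.^ (D.bit o ℕ.+ D.bit g)) m ≡ ι 2 * ind (o BoolP.≟ g) - 1ℚ
    sign-seq false false m = refl
    sign-seq false true  m = refl
    sign-seq true  false m = refl
    sign-seq true  true  m = refl

  foldr-⊔-≤ : ∀ {n} (u : Fin n → ℕ) {b} → (∀ i → u i ℕ.≤ b) → Tuple.foldr ℕ._⊔_ 0 u ℕ.≤ b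
  foldr-⊔-≤ {zero}  u h = z≤n
  foldr-⊔-≤ {suc n} u h = ℕP.⊔-lub (h zero) (foldr-⊔-≤ (u ∘ suc) (h ∘ suc))

  ≤-foldr-⊔ : ∀ {n} (u : Fin n → ℕ) i → u i ℕ.≤ Tuple.foldr ℕ._⊔_ 0 u
  ≤-foldr-⊔ u zero    = ℕP.m≤m⊔n (u zero) _
  ≤-foldr-⊔ u (suc i) = ℕP.≤-trans (≤-foldr-⊔ (u ∘ suc) i) (ℕP.m≤n⊔m (u zero) _)

  point : FiniteProbabilitySpace
  point = record
    { size = 1 ; prob = λ _ → D.1ℝ
    ; nonneg = λ _ → ≤-seq D.0ℝ D.1ℝ λ m → ≡≤ (seq-fromℕ 0 m) (≤≡ (ι-mono {0} {1} z≤n) (sym (seq-fromℕ 1 m)))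
    ; total = ≤-seq (D.∑ {1} (λ _ → D.1ℝ)) D.1ℝ (≤-reflexive ∘ same) , ≤-seq D.1ℝ (D.∑ {1} (λ _ → D.1ℝ)) (≤-reflexive ∘ sym ∘ same) }
    where
    same : ∀ m → seq (D.∑ {1} (λ _ → D.1ℝ)) m ≡ seq D.1ℝ m
    same m = trans (seq-+ D.1ℝ D.0ℝ m) (trans (cong (seq D.1ℝ m +_) (trans (seq-fromℕ 0 m) ι0)) (+-identityʳ _))

  seq-point : ∀ u m → seq (expectation point u) m ≡ seq (u zero) m
  seq-point u m = trans (Expectation.seq-expectation point u m) (trans (+-identityʳ _) (trans (cong (_* seq (u zero) m) (trans (seq-fromℕ 1 m) ι1)) (*-identityˡ _)))

  uniform : ∀ n → 1 ℕ.≤ n → FiniteProbabilitySpace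
  uniform n 1≤n = record
    { size = n ; prob = λ _ → D.fromℚ (inv n)
    ; nonneg = λ _ → ≤-seq D.0ℝ (D.fromℚ (inv n)) λ m → ≡≤ (trans (seq-fromℕ 0 m) ι0) (0≤inv n)
    ; total = ≤-seq (D.∑ {n} (λ _ → D.fromℚ (inv n))) D.1ℝ (≤-reflexive ∘ same) , ≤-seq D.1ℝ (D.∑ {n} (λ _ → D.fromℚ (inv n))) (≤-reflexive ∘ sym ∘ same) }
    where
    same : ∀ m → seq (D.∑ {n} (λ _ → D.fromℚ (inv n))) m ≡ seq D.1ℝ m
    same m = trans (seq-∑ n id (λ _ → D.fromℚ (inv n)) m) (trans (∑-const (allFin n) (inv n)) (trans (cong (λ l → ι l * inv n) (length-tabulate id)) (trans (ι*inv 1≤n) (sym (trans (seq-fromℕ 1 m) ι1)))))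
      where open import Data.List.Properties using (length-tabulate)

  module Mixture {X Y : Set} (f : X × Y → Bool) (ts : List (Tree X Y Bool)) (1≤#ts : 1 ℕ.≤ length ts) where

    mixture : Protocol X Y Bool
    mixture = record { public-coins = uniform (length ts) 1≤#ts ; alice-coins = point ; bob-coins = point ; tree = λ ω → mapTree proj₁ proj₁ (lookup ts ω) }

    length-≤ : ∀ {b} → All (λ t → depth t ℕ.≤ b) ts → D.‖ mixture ‖ ℕ.≤ b
    length-≤ h = foldr-⊔-≤ (λ ω → depth (tree mixture ω)) λ ω → ℕP.≤-trans (ℕP.≤-reflexive (depth-mapTree proj₁ proj₁ (lookup ts ω))) (All.lookup h (∈-lookup {xs = ts} ω))

    advantage : X × Y → ℝ
    advantage e = D.𝔼[ (λ o → (D.- D.1ℝ) D.^ (D.bit o ℕ.+ D.bit (f e))) ] mixture e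

    signs : ∀ (e : X × Y) (ω : Fin (length ts)) → Fin 1 → Fin 1 → ℝ
    signs e ω α β = (D.- D.1ℝ) D.^ (D.bit (run (tree mixture ω) (proj₁ e , α) (proj₂ e , β)) ℕ.+ D.bit (f e))

    seq-advantage : ∀ e m → seq (advantage e) m ≡ inv (length ts) * (ι 2 * ι (count (λ t → run t (proj₁ e) (proj₂ e) BoolP.≟ f e) ts) - ι (length ts))
    seq-advantage e m = trans (Expectation.seq-expectation (uniform (length ts) 1≤#ts) (λ ω → expectation point λ α → expectation point (signs e ω α)) m) (trans (∑-*ˡ (allFin (length ts)) (inv (length ts)) _)
      (cong (inv (length ts) *_) (trans (∑-cong (allFin (length ts)) λ ω → trans (seq-point (λ α → expectation point (signs e ω α)) m) (trans (seq-point (signs e ω zero) m) (trans (sign-seq (run (tree mixture ω) (proj₁ e , zero) (proj₂ e , zero)) (f e) m)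
        (cong (λ o → ι 2 * ind (o BoolP.≟ f e) - 1ℚ) (run-mapTree proj₁ proj₁ (lookup ts ω) (proj₁ e , zero) (proj₂ e , zero))))))
      (trans (∑-lookup ts (λ t → ι 2 * ind (run t (proj₁ e) (proj₂ e) BoolP.≟ f e) - 1ℚ))
      (trans (∑-- ts _ _) (cong₂ _-_ (trans (∑-*ˡ ts (ι 2) _) (cong (ι 2 *_) (sym (ι-count _ ts)))) (trans (∑-const ts 1ℚ) (*-identityʳ _))))))))

    opaque
      unfolding _+_
      8κ<1 : ι 8 * κ < 1ℚ
      8κ<1 = toWitness {a? = ι 8 * κ QP.<? 1ℚ} tt

    -- A success rate of `9/16` is an advantage of `2 · 9/16 - 1 = 1/8`, and `8 κ < 1`.
    advantage-large : ∀ e → ι 9 * ι (length ts) ≤ ι 16 * ι (count (λ t → run t (proj₁ e) (proj₂ e) BoolP.≟ f e) ts) → ¬ (advantage e D.< D.fromℚ κ)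
    advantage-large e h lt = go (<⇒ (advantage e) (D.fromℚ κ) lt)
      where
      k r : ℚ
      k = ι (count (λ t → run t (proj₁ e) (proj₂ e) BoolP.≟ f e) ts)
      r = ι (length ts)
      1≤8a : 1ℚ ≤ ι 8 * (inv (length ts) * (ι 2 * k - r))
      1≤8a = ≡≤ (sym (inv*ι 1≤#ts)) (≤≡ (*ˡ (inv (length ts)) (0≤inv (length ts)) (-≤0⇒≤ (subst (0ℚ ≤_) shape (0≤- h)))) (identity-22 (inv (length ts)) (ι 8) (ι 2 * k - r)))
        where
        shape : ι 16 * k - ι 9 * r ≡ ι 8 * (ι 2 * k - r) - r
        shape = trans (cong₂ (λ a b → a * k - b * r) (ι-* 8 2) (ι-suc 8)) (identity-199 (ι 8) (ι 2) k r)
      go : ¬ (Σ[ ε ∈ ℚ ] 0ℚ < ε × Eventually (λ m → seq (advantage e) m + ε ≤ κ))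
      go (ε , 0<ε , N , ev) = <-irrefl refl (≤-<-trans (≤-trans 1≤8a (*ˡ (ι 8) (0≤ι 8) (≡≤ (sym (seq-advantage e N)) (≤-trans (gap ε (<⇒≤ 0<ε) refl) (ev N ℕP.≤-refl))))) 8κ<1)

  allVecs-∈ : ∀ {A : Set} {xs : List A} a {n} (v : Vec A n) → (∀ i → i ℕ.< n → vnth a v i ∈ xs) → v ∈ allVecs xs n
  allVecs-∈ a []      h = here refl
  allVecs-∈ {A} {xs} a {suc n} (x ∷ v) h = go xs (h 0 (s≤s z≤n))
    where
    go : ∀ ys → x ∈ ys → (x ∷ v) ∈ concatMap (λ y → map (y ∷_) (allVecs xs n)) ys
    go (y ∷ ys) (here refl) = ∈-++⁺ˡ (∈-map⁺ (x ∷_) (allVecs-∈ a v λ i p → h (suc i) (s≤s p)))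
    go (y ∷ ys) (there p)   = ∈-++⁺ʳ (map (y ∷_) (allVecs xs n)) (go ys p)

  search : ∀ {A : Set} {P R : A → Set} (L : List A) → (∀ a → P a ⊎ R a) → (∃ P) ⊎ (∀ a → a ∈ L → R a)
  search []      h = inj₂ λ _ ()
  search (a ∷ L) h with h a | search L h
  ... | inj₁ p | _      = inj₁ (a , p)
  ... | inj₂ _ | inj₁ q = inj₁ q
  ... | inj₂ r | inj₂ s = inj₂ λ { _ (here refl) → r ; b (there m) → s b m }

  module Main {X Y : Set} {a b : ℕ} (iX : X ↔ Fin a) (iY : Y ↔ Fin b) (f : X × Y → Bool) (n : ℕ) (1≤n : 1 ℕ.≤ n)
    (C : ℝ) (C-large : Eventually (λ m → ι K₀ ≤ seq C m))
    (weak : ∀ (π : Protocol X Y Bool) → D.fromℕ D.‖ π ‖ D.≤ C → Σ[ e ∈ X × Y ] D.𝔼[ (λ o → (D.- D.1ℝ) D.^ (D.bit o ℕ.+ D.bit (f e))) ] π e D.< D.fromℚ κ)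
    (√n l : ℝ) (isSqrt : D.IsSqrt (D.fromℕ n) √n) (isLog : D.IsLog₂ (C D.* D.fromℕ n) l) (0<l : D.0ℝ D.< l)
    (π : Protocol (Vec X n) (Vec Y n) (Vec Bool n)) (short : D.fromℕ D.‖ π ‖ D.≤ (D.fromℚ κ D.* C D.* √n D./ l [ 0<l ])) where

    _≟X_ : DecidableEquality X
    x ≟X x′ = map′ (λ e → trans (sym (Inverse.strictlyInverseʳ iX x)) (trans (cong (Inverse.from iX) e) (Inverse.strictlyInverseʳ iX x′))) (cong (Inverse.to iX)) (Inverse.to iX x FinP.≟ Inverse.to iX x′)

    _≟Y_ : DecidableEquality Y
    y ≟Y y′ = map′ (λ e → trans (sym (Inverse.strictlyInverseʳ iY y)) (trans (cong (Inverse.from iY) e) (Inverse.strictlyInverseʳ iY y′))) (cong (Inverse.to iY)) (Inverse.to iY y FinP.≟ Inverse.to iY y′)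

    points : List (X × Y)
    points = cartesianProduct (tabulate (Inverse.from iX)) (tabulate (Inverse.from iY))

    ∈-points : ∀ e → e ∈ points
    ∈-points (x , y) = ∈-cartesianProduct⁺ (subst (_∈ tabulate (Inverse.from iX)) (Inverse.strictlyInverseʳ iX x) (∈-tabulate⁺ {f = Inverse.from iX} (Inverse.to iX x))) (subst (_∈ tabulate (Inverse.from iY)) (Inverse.strictlyInverseʳ iY y) (∈-tabulate⁺ {f = Inverse.from iY} (Inverse.to iY y)))

    -- Comparing the real number `C` with a length is undecidable, but admissibility is itself a
    -- negation and follows once `C ≤ k` is refuted.
    allowed : ∀ (ρ : Protocol X Y Bool) {k} → D.‖ ρ ‖ ℕ.≤ k → ¬ Eventually (λ m → seq C m ≤ ι k) → D.fromℕ D.‖ ρ ‖ D.≤ C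
    allowed ρ {k} h ¬le = ≤-refute (D.fromℕ D.‖ ρ ‖) C λ ev → ¬le (ev ⇒ λ {m} p → ≤-trans p (≡≤ (seq-fromℕ D.‖ ρ ‖ m) (ι-mono h)))

    opaque
      unfolding _+_
      0<K₀ : ι 0 < ι K₀
      0<K₀ = toWitness {a? = ι 0 QP.<? ι K₀} tt

    positive : ¬ Eventually (λ m → seq C m ≤ ι 0)
    positive ev = go (ev & C-large)
      where
      go : ¬ Eventually (λ m → seq C m ≤ ι 0 × ι K₀ ≤ seq C m)
      go (N , both) = <-irrefl refl (<-≤-trans 0<K₀ (≤-trans (proj₂ (both N ℕP.≤-refl)) (proj₁ (both N ℕP.≤-refl))))

    -- An infimum below `κ` comes with a witness; the constant protocol of length zero thus shows
    -- that there is an input.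
    e₀ : X × Y
    e₀ = proj₁ (weak M.mixture (allowed M.mixture (M.length-≤ (z≤n ∷ [])) positive))
      where module M = Mixture f (output true ∷ []) (s≤s z≤n)

    Td : ℕ
    Td = D.‖ π ‖

    module A = Average D._≟ⁿ_ (f D.^⊗ n) π

    inputs : List (X × Y) → List (Vec X n × Vec Y n)
    inputs E = map (λ v → Vec.map proj₁ v , Vec.map proj₂ v) (allVecs E n)

    module _ (strong : ∀ e → e ∈ inputs points → D.fromℚ (pw ρ n) D.< A.success e) where

      derandomize : ∀ e E → Σ[ tr ∈ Tree (Vec X n) (Vec Y n) (Vec Bool n) ] depth tr ℕ.≤ Td ×
        pw (ι (length (e ∷ E))) n ≤ ι (length (Wins.wins _≟X_ _≟Y_ f (e ∷ E) n tr)) * pw (1ℚ + θ * θ) n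
      derandomize e E = go (A.find (pw ρ n) (inputs E′) (pw-0≤ 0≤ρ n) nonempty-inputs λ u u∈ → strong u (included u∈))
        where
        E′ : List (X × Y)
        E′ = e ∷ E
        #inputs : ι (length (inputs E′)) ≡ pw (ι (length E′)) n
        #inputs = trans (cong ι (length-map _ (allVecs E′ n))) (length-allVecs E′ n)
        nonempty-inputs : 1 ℕ.≤ length (inputs E′)
        nonempty-inputs = ι-cancel (≡≤ ι1 (≤≡ (pw-1≤ (1≤ι {length E′} (s≤s z≤n)) n) (sym #inputs)))
        included : ∀ {u} → u ∈ inputs E′ → u ∈ inputs points
        included u∈ with ∈-map⁻ _ u∈
        ... | v , v∈ , refl = ∈-map⁺ _ (allVecs-∈ e v λ i _ → ∈-points _)
        go : Σ[ ω ∈ _ ] Σ[ α ∈ _ ] Σ[ β ∈ _ ] ι (length (inputs E′)) * pw ρ n ≤ A.score (inputs E′) ω α β → _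
        go (ω , α , β , h) = tr , ℕP.≤-trans (ℕP.≤-reflexive (depth-mapTree (_, α) (_, β) (tree π ω))) (≤-foldr-⊔ (λ ω → depth (tree π ω)) ω) ,
            ≡≤ (trans (sym (*-identityʳ _)) (trans (cong₂ _*_ (sym #inputs) (sym (trans (sym (pw-* ρ (1ℚ + θ * θ) n)) (trans (cong (λ u → pw u n) ρ-θ) (pw-one n))))) (sym (*-assoc _ (pw ρ n) _))))
              (*ʳ (pw (1ℚ + θ * θ) n) (pw-0≤ (0≤+ 0≤1 (0≤* (0≤inv 256) (0≤inv 256))) n) (≤≡ h same))
          where
          tr : Tree (Vec X n) (Vec Y n) (Vec Bool n)
          tr = mapTree (_, α) (_, β) (tree π ω)
          pw-one : ∀ n → pw 1ℚ n ≡ 1ℚ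
          pw-one zero    = refl
          pw-one (suc n) = trans (*-identityˡ _) (pw-one n)
          same : A.score (inputs E′) ω α β ≡ ι (length (Wins.wins _≟X_ _≟Y_ f E′ n tr))
          same = trans (∑-map _ (allVecs E′ n) _) (trans (∑-cong (allVecs E′ n) λ v → cong (λ o → ind (o D.≟ⁿ _)) (sym (run-mapTree (_, α) (_, β) (tree π ω) _ _))) (sym (Wins.#wins _≟X_ _≟Y_ f E′ n tr)))

      -- Good trees for all lists of points combine by regret matching into a mixture of length at
      -- most `k` with advantage at least `1/8` everywhere. It is admissible, so `weak` produces an
      -- input where its advantage is below `κ`.
      refuted : ∀ k → ¬ Eventually (λ m → seq C m ≤ ι k) → ¬ (∀ e E → Σ[ t ∈ Tree X Y Bool ] depth t ℕ.≤ k ×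
        ι 5 * ι (length (e ∷ E)) ≤ ι 8 * ∑ (e ∷ E) (λ e → ind (run t (proj₁ e) (proj₂ e) BoolP.≟ f e)))
      refuted k ¬le simulate = go (MM.strategy)
        where
        respond : ∀ E → (∀ {e} → e ∈ E → e ∈ points) → Σ[ t ∈ Tree X Y Bool ] depth t ℕ.≤ k ×
          ι 5 * ι (length E) ≤ ι 8 * ∑ E (λ e → ind (run t (proj₁ e) (proj₂ e) BoolP.≟ f e))
        respond []      _ = output true , z≤n , ≤-reflexive (trans (cong (ι 5 *_) ι0) (trans (*-zeroʳ _) (sym (*-zeroʳ _))))
        respond (e ∷ E) _ = simulate e E
        module MM = Minimax f points (nonempty (∈-points e₀)) k respond
        go : _ → _
        go (ts , len , depths , good) = M.advantage-large e (subst (λ r → ι 9 * ι r ≤ ι 16 * ι (count (MM.right? e) ts)) (sym len) (good (∈-points e))) (proj₂ found)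
          where
          1≤#ts : 1 ℕ.≤ length ts
          1≤#ts = subst (1 ℕ.≤_) (sym len) (ℕP.*-mono-≤ {1} {100} (s≤s z≤n) (nonempty (∈-points e₀)))
          module M = Mixture f ts 1≤#ts
          found : _
          found = weak M.mixture (allowed M.mixture (M.length-≤ depths) ¬le)
          e : X × Y
          e = proj₁ found

      -- Falsity from `strong`, written as the negation of a truth. In the second case `n < 4 Td`
      -- makes `Td` positive and bounds the price of conditioning by the length of the transcript,
      -- as `hC` demands.
      impossible : ¬ (0 ℕ.≤ 0)
      impossible _ = split (4 ℕ.* Td ℕP.≤? n)
        where
        split : ¬ Dec (4 ℕ.* Td ℕ.≤ n)
        split (yes 4Td≤n) = refuted 0 positive λ e E → guess e E (derandomize e E)
          where
          guess : ∀ e E → _ → _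
          guess e E (tr , d≤ , many) = output (proj₁ c) , z≤n , proj₂ c
            where
            c : Σ[ b ∈ Bool ] Wins.Good _≟X_ _≟Y_ f (e ∷ E) n tr (output b)
            c = Wins.Small.constant _≟X_ _≟Y_ f (e ∷ E) n tr e (here refl) 1≤n Td d≤ 4Td≤n (θ * θ) (0≤* (0≤inv 256) (0≤inv 256)) θθ≤ many
        split (no 4Td≰n) = go (isqrt n 1≤n) (ilog (Td ℕ.+ Td) (ℕP.≤-trans 1≤Td (ℕP.m≤m+n Td Td)))
          where
          n≤4Td : n ℕ.≤ 4 ℕ.* Td
          n≤4Td = ℕP.<⇒≤ (ℕP.≰⇒> 4Td≰n)
          1≤Td : 1 ℕ.≤ Td
          1≤Td = pos Td n≤4Td
            where
            pos : ∀ t → n ℕ.≤ 4 ℕ.* t → 1 ℕ.≤ t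
            pos zero    h = contradiction (ℕP.≤-trans 1≤n h) λ ()
            pos (suc t) _ = s≤s z≤n
          go : Σ[ s ∈ ℕ ] suc s ℕ.* suc s ℕ.≤ n × n ℕ.< suc (suc s) ℕ.* suc (suc s) → Σ[ K ∈ ℕ ] 2 ℕ.^ K ℕ.≤ Td ℕ.+ Td × Td ℕ.+ Td ℕ.< 2 ℕ.^ suc K → _
          go (s , S²≤n , n<) (K , 2^K≤ , <2^J) = refuted (protocol-length (suc K) d) (TooShort.contradictory C √n l (D.inverse l 0<l) n s Td K 1≤n S²≤n n≤4Td 1≤Td 2^K≤ 1≤K
              (log-lower C n l isLog 0<l) C-large (inverse-spec l 0<l) root few)
              λ e E → simulate e E (derandomize e E)
            where
            d : ℕ
            d = mistake-bound s Td
            1≤K : 1 ℕ.≤ K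
            1≤K = pos K <2^J
              where
              pos : ∀ K → Td ℕ.+ Td ℕ.< 2 ℕ.^ suc K → 1 ℕ.≤ K
              pos zero    h = contradiction (ℕP.≤-trans (s≤s (ℕP.+-mono-≤ 1≤Td 1≤Td)) h) λ { (s≤s (s≤s ())) }
              pos (suc K) _ = s≤s z≤n
            opaque
              unfolding _+_
              ½<1 : inv 2 < 1ℚ
              ½<1 = toWitness {a? = inv 2 QP.<? 1ℚ} tt
              θθ≤½ : ι 4 * (θ * θ) ≤ 1ℚ
              θθ≤½ = toWitness {a? = ι 4 * (θ * θ) ≤? 1ℚ} tt
            root : Eventually (λ m → seq √n m ≤ ι (suc (suc s)))
            root = ≤⇒ (√n D.* √n) (D.fromℕ n) (proj₁ (proj₂ isSqrt)) (inv 2) (0<inv {2} (s≤s z≤n)) ⇒ λ {m} h → bound (seq √n m) (≤-total (seq √n m) (ι (suc (suc s))))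
                (≡≤ (sym (seq-* √n √n m)) (≤≡ h (cong (_+ inv 2) (seq-fromℕ n m))))
              where
              bound : ∀ r → r ≤ ι (suc (suc s)) ⊎ ι (suc (suc s)) ≤ r → r * r ≤ ι n + inv 2 → r ≤ ι (suc (suc s))
              bound r (inj₁ p) h = p
              bound r (inj₂ p) h = contradiction (<-≤-trans (+-monoʳ-< (ι n) ½<1) (≡≤ (trans (+-comm (ι n) 1ℚ) (sym (ι-suc n))) (≤-trans (ι-mono n<) (≡≤ (ι-* (suc (suc s)) (suc (suc s))) (≤-trans (*-mono (0≤ι (suc (suc s))) (≤-trans (0≤ι (suc (suc s))) p) p p) h))))) (<-irrefl refl)
            few : Eventually (λ m → ι Td ≤ κ * seq C m * seq √n m * seq (D.inverse l 0<l) m + inv 2)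
            few = ≤⇒ (D.fromℕ Td) (D.fromℚ κ D.* C D.* √n D./ l [ 0<l ]) short (inv 2) (0<inv {2} (s≤s z≤n)) ⇒ λ {m} h → ≡≤ (sym (seq-fromℕ Td m)) (≤≡ h (cong (_+ inv 2)
              (trans (seq-* (D.fromℚ κ D.* C D.* √n) (D.inverse l 0<l) m) (cong (_* seq (D.inverse l 0<l) m) (trans (seq-* (D.fromℚ κ D.* C) √n m) (cong (_* seq √n m) (seq-* (D.fromℚ κ) C m)))))))
            hC : (ι n + ι n) * (inv 256 * inv 256) ≤ ι (Td ℕ.+ Td)
            hC = ≤-trans (*ʳ (θ * θ) (0≤* (0≤inv 256) (0≤inv 256)) (+-mono-≤ n≤ n≤)) (≡≤ (identity-198 (ι 4) (ι Td) (θ * θ)) (≤≡ (*ˡ (ι Td + ι Td) (0≤+ (0≤ι Td) (0≤ι Td)) θθ≤½) (trans (*-identityʳ _) (sym (ι-+ Td Td)))))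
              where
              n≤ : ι n ≤ ι 4 * ι Td
              n≤ = ≤≡ (ι-mono n≤4Td) (ι-* 4 Td)
            simulate : ∀ e E → _ → _
            -- The argument `255` is `h`, whose successor is the denominator of `θ`.
            simulate e E (tr , d≤ , many) = result (Wins.Large.simulation _≟X_ _≟Y_ f (e ∷ E) n tr e (here refl) 1≤n Td d≤ 1≤Td 255 s (suc K) d (s≤s z≤n) <2^J 6θ≤ hC S²≤n (mistake-bound-≥ s Td) many)
              where
              result : _ → _
              result (t , t≤ , good) = t , t≤ , ≤-trans (*ʳ _ (0≤ι (length (e ∷ E))) (ι-mono {5} {6} (ℕP.n≤1+n 5))) (≡≤ (twice 3 _) (≤≡ (+-mono-≤ good good) (sym (twice 4 _))))
                where
                twice : ∀ k x → ι (k ℕ.+ k) * x ≡ ι k * x + ι k * x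
                twice k x = trans (cong (_* x) (ι-+ k k)) (identity-140 (ι k) x)

    -- Each of the finitely many inputs has success below `d` or above `ρ ^ n`, by cotransitivity.
    -- One of the first kind is the witness sought; if all are of the second kind, `strong` holds
    -- and is refuted.
    conclusion : ∀ d → D.fromℚ (pw ρ n) D.< d → Σ[ e ∈ Vec X n × Vec Y n ] A.success e D.< d
    conclusion d c<d = go (search (inputs points) λ e → cotransitive (D.fromℚ (pw ρ n)) d (A.success e) (λ _ → refl) c<d)
      where
      go : (∃ λ e → A.success e D.< d) ⊎ (∀ e → e ∈ inputs points → D.fromℚ (pw ρ n) D.< A.success e) → _
      go (inj₁ found)  = found
      go (inj₂ strong) = contradiction z≤n (impossible strong)

  0<κℝ : D.0ℝ D.< D.fromℚ κ
  0<κℝ = ⇒< D.0ℝ (D.fromℚ κ) κ 0<κ (always λ m → ≤-reflexive (trans (cong (_+ κ) (trans (seq-fromℕ 0 m) ι0)) (+-identityˡ κ)))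

  large : ∀ C → D.1ℝ D./ D.fromℚ κ [ 0<κℝ ] D.< C → Eventually (λ m → ι K₀ ≤ seq C m)
  large C lt = go (<⇒ (D.1ℝ D./ D.fromℚ κ [ 0<κℝ ]) C lt)
    where
    go : _ → _
    go (ε , 0<ε , ev) = ev & inverse-spec (D.fromℚ κ) 0<κℝ ⇒ λ {m} (h , e , _) → ≡≤ (value (seq (D.inverse (D.fromℚ κ) 0<κℝ) m) e) (≡≤ (sym (trans (seq-* D.1ℝ (D.inverse (D.fromℚ κ) 0<κℝ) m) (trans (cong (_* seq (D.inverse (D.fromℚ κ) 0<κℝ) m) (trans (seq-fromℕ 1 m) ι1)) (*-identityˡ _)))) (≤-trans (gap ε (<⇒≤ 0<ε) refl) h))
      where
      value : ∀ q → q * κ ≡ 1ℚ → ι K₀ ≡ q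
      value q e = trans (sym (*-identityˡ _)) (trans (cong (_* ι K₀) (sym e)) (trans (*-assoc q κ (ι K₀)) (trans (cong (q *_) (inv*ι {K₀} (s≤s z≤n))) (*-identityʳ q))))

open import Defs
open import Data.Bool.Base using (Bool)
open import Data.Fin.Base using (Fin)
open import Data.Nat.Base as ℕ using (ℕ)
open import Data.Product.Base using (Σ-syntax; _×_)
open import Function.Bundles using (_↔_)

corollary12 : Σ[ κ ∈ ℝ ] Σ[ 0<κ ∈ 0ℝ < κ ]
    (∀ {X Y : Set} {a b : ℕ} → X ↔ Fin a → Y ↔ Fin b →
    (f : X × Y → Bool) (n : ℕ) → 1 ℕ.≤ n →
    (C : ℝ) → 1ℝ / κ [ 0<κ ] < C →
    adv C f <̄ κ →
    ∀ √n log[Cn] → IsSqrt (fromℕ n) √n → IsLog₂ (C * fromℕ n) log[Cn] →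
    (0<log : 0ℝ < log[Cn]) →
    suc-prob _≟ⁿ_ (κ * C * √n / log[Cn] [ 0<log ]) (f ^⊗ n) <̄ exp (- (κ * fromℕ n)))
corollary12 = fromℚ Derandomization.κ , Assembly.0<κℝ ,
  λ {X} {Y} iX iY f n 1≤n C 1/κ<C (c , c<κ , bounded) √n log[Cn] isSqrt isLog 0<log →
    -- A supremum is below a number if some smaller number bounds every protocol; here that number
    -- is `ρ ^ n`.
    fromℚ (Logarithms.pw Derandomization.ρ n) , Derandomization.ρⁿ<exp n 1≤n ,
    λ (π , short) → Assembly.Main.conclusion iX iY f n 1≤n C (Assembly.large C 1/κ<C)
      (λ π′ allowed → bounded (π′ , allowed) (fromℚ Derandomization.κ) c<κ) √n log[Cn] isSqrt isLog 0<log π short
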